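{- For every $\alpha\ge1$ there exist integers $a_{j,i},b_{j,i},c_{j,i}$ such that $$L_{2\alpha-1}=7^{\alpha+1}a_{2\alpha-1,1}u+7^{\alpha+1}a_{2\alpha-1,2}u^2+7^{\alpha+1}\sum_{i=3}^{(7^{2\alpha}-1)/6}7^{\lceil\frac{7i-24}{26}\rceil}a_{2\alpha-1,i}u^i+7^{\alpha}b_{2\alpha-1,1}ut+7^{\alpha}b_{2\alpha-1,2}u^2t$$ $$\quad+7^{\alpha+1}\sum_{i=3}^{(7^{2\alpha}-1)/6}7^{\lceil\frac{7i-24}{26}\rceil}b_{2\alpha-1,i}u^it+7^{\alpha}c_{2\alpha-1,2}u^2t^2+7^{\alpha+1}\sum_{i=3}^{(7^{2\alpha}-1)/6}7^{\lceil\frac{7i-24}{26}\rceil}c_{2\alpha-1,i}u^it^2,$$ and $$L_{2\alpha}=7^{\alpha+1}a_{2\alpha,1}u+7^{\alpha+1}a_{2\alpha,2}u^2+7^{\alpha+1}\sum_{i=3}^{(7^{2\alpha+1}-7)/6}7^{\lceil\frac{7i+3}{26}\rceil}a_{2\alpha,i}u^i+7^{\alpha+1}b_{2\alpha,1}ut+7^{\alpha+1}b_{2\alpha,2}u^2t$$ $$\quad+7^{\alpha+1}\sum_{i=3}^{(7^{2\alpha+1}-7)/6}7^{\lceil\frac{7i+3}{26}\rceil}b_{2\alpha,i}u^it+7^{\alpha+1}c_{2\alpha,2}u^2t^2+7^{\alpha+1}\sum_{i=3}^{(7^{2\alpha+1}-7)/6}7^{\lceil\frac{7i+3}{26}\r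ceil}c_{2\alpha,i}u^it^2.$$
   Context: Notation: - $\tau\in\mathbb{H}$ (the upper half-plane) and $q=e^{2\pi i\tau}$. - $\eta(\tau)=q^{1/24}\prod_{n\ge1}(1-q^n)$ is the Dedekind eta function. - $t=\dfrac{\eta(2\tau)\eta^7(7\tau)}{\eta(\tau)\eta^7(14\tau)}$, $u=\dfrac{\eta^7(14\tau)}{\eta^3(\tau)\eta(2\tau)\eta^3(7\tau)}$ and $A=\dfrac{\eta^2(2\tau)\eta^5(49\tau)}{\eta^5(\tau)\eta^2(98\tau)}$. - For $f:\mathbb{H}\to\mathbb{C}$, the Atkin operator is $U_7(f)(\tau)=\frac17\sum_{\lambda=0}^{6}f\big(\frac{\tau+\lambda}{7}\big)$. On $q$-expansions, $U_7(\sum a(n)q^n)=\sum a(7n)q^n$. - Set $L_0=1$, and for $\alpha\ge1$ set $L_{2\alpha-1}=U_7(AL_{2\alpha-2})$ and $L_{2\alpha}=U_7(L_{2\alpha-1})$. Equalities are identities of functions on $\mathbb{H}$. -}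

module Defs where

open import Data.Nat as ℕ using (ℕ; zero; suc)
open import Data.Nat.Divisibility using (_∣?_)
open import Data.Integer as ℤ using (ℤ; +_; -[1+_])
open import Data.List using (List; []; _∷_; foldr; map; upTo)
open import Data.Bool using (Bool; true; false; if_then_else_; not)
open import Relation.Nullary using (does)
open import Relation.Binary.PropositionalEquality using (_≡_)

-- Formal power series with integer coefficients: n ↦ coefficient of q^n

Series : Set
Series = ℕ → ℤ

sumℤ : List ℤ → ℤ
sumℤ = foldr ℤ._+_ (+ 0)

infixl 7 _⊛_
_⊛_ : Series → Series → Series
(f ⊛ g) n = sumℤ (map (λ k → f k ℤ.* g (n ℕ.∸ k)) (upTo (suc n)))

oneS : Series
oneS zero    = + 1
oneS (suc _) = + 0

powS : Series → ℕ → Series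
powS f zero    = oneS
powS f (suc e) = f ⊛ powS f e

-- the polynomial 1 - q^j   (used with j ≥ 1)
factor : ℕ → Series
factor j zero    = + 1
factor j (suc n) = if does (suc n ℕ.≟ j) then ℤ.- (+ 1) else + 0

-- the geometric series 1/(1 - q^j) = Σ_r q^(j r)   (used with j ≥ 1)
geom : ℕ → Series
geom j n = if does (j ∣? n) then + 1 else + 0

prodOver : (ℕ → Series) → ℕ → Series
prodOver F zero    = oneS
prodOver F (suc N) = F (suc N) ⊛ prodOver F N

-- euler k = Π_{n≥1} (1 - q^{k n}); coefficient n only depends on the
-- factors with m ≤ n.
euler : ℕ → Series
euler k n = prodOver (λ m → factor (k ℕ.* m)) n n

eulerInv : ℕ → Series
eulerInv k n = prodOver (λ m → geom (k ℕ.* m)) n n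

-- Formal Laurent series  q^val · Σ_n ser n q^n

record Laurent : Set where
  constructor mkL
  field
    val : ℤ
    ser : Series
open Laurent public

coeff : Laurent → ℤ → ℤ
coeff f m with m ℤ.- val f
... | + n      = ser f n
... | -[1+ _ ] = + 0

_≈_ : Laurent → Laurent → Set
f ≈ g = ∀ m → coeff f m ≡ coeff g m

infix 4 _≈_
infixl 6 _+L_
infixl 7 _*L_

_+L_ : Laurent → Laurent → Laurent
f +L g = mkL v (λ n → coeff f (v ℤ.+ + n) ℤ.+ coeff g (v ℤ.+ + n))
  where v = val f ℤ.⊓ val g

_*L_ : Laurent → Laurent → Laurent
f *L g = mkL (val f ℤ.+ val g) (ser f ⊛ ser g)

scale : ℤ → Laurent → Laurent
scale z f = mkL (val f) (λ n → z ℤ.* ser f n)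

zeroL : Laurent
zeroL = mkL (+ 0) (λ _ → + 0)

oneL : Laurent
oneL = mkL (+ 0) oneS

powL : Laurent → ℕ → Laurent
powL f zero    = oneL
powL f (suc e) = f *L powL f e

-- Atkin operator: U₇ (Σ a(n) qⁿ) = Σ a(7n) qⁿ
-- (the chosen valuation v' satisfies 7 v' ≤ val f, so nothing is lost)
U7 : Laurent → Laurent
U7 f = mkL v' (λ n → coeff f (+ 7 ℤ.* (v' ℤ.+ + n)))
  where v' = ℤ.- (+ ℤ.∣ val f ∣)

-- The eta quotients as q-expansions.  η(kτ) = q^{k/24} euler k; the
-- q^{1/24}-powers combine to an integral power of q in each case.

-- t = η(2τ)η⁷(7τ) / (η(τ)η⁷(14τ)),  order (2+49-1-98)/24 = -2
t : Laurent
t = mkL (ℤ.- (+ 2))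
        (euler 2 ⊛ powS (euler 7) 7 ⊛ eulerInv 1 ⊛ powS (eulerInv 14) 7)

-- u = η⁷(14τ) / (η³(τ)η(2τ)η³(7τ)),  order (98-3-2-21)/24 = 3
u : Laurent
u = mkL (+ 3)
        (powS (euler 14) 7 ⊛ powS (eulerInv 1) 3 ⊛ eulerInv 2 ⊛ powS (eulerInv 7) 3)

-- A = η²(2τ)η⁵(49τ) / (η⁵(τ)η²(98τ)),  order (4+245-5-196)/24 = 2
A : Laurent
A = mkL (+ 2)
        (powS (euler 2) 2 ⊛ powS (euler 49) 5 ⊛ powS (eulerInv 1) 5 ⊛ powS (eulerInv 98) 2)

isEven : ℕ → Bool
isEven zero    = true
isEven (suc n) = not (isEven n)

L : ℕ → Laurent
L zero    = oneL
L (suc n) = if isEven n then U7 (A *L L n) else U7 (L n)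

p7 : ℕ → ℤ
p7 e = + (7 ℕ.^ e)

sum3 : ℕ → (ℕ → Laurent) → Laurent
sum3 N F = foldr _+L_ zeroL (map (λ k → F (3 ℕ.+ k)) (upTo (N ℕ.∸ 2)))

-- ⌈(7i-24)/26⌉ for i ≥ 3 (for i = 3 it is ⌈-3/26⌉ = 0)
e1 : ℕ → ℕ
e1 i = ((7 ℕ.* i ℕ.∸ 24) ℕ.+ 25) ℕ./ 26

e2 : ℕ → ℕ
e2 i = ((7 ℕ.* i ℕ.+ 3) ℕ.+ 25) ℕ./ 26

N1 : ℕ → ℕ
N1 α = (7 ℕ.^ (2 ℕ.* α) ℕ.∸ 1) ℕ./ 6

N2 : ℕ → ℕ
N2 α = (7 ℕ.^ (2 ℕ.* α ℕ.+ 1) ℕ.∸ 7) ℕ./ 6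

t² : Laurent
t² = t *L t

RHSodd : ℕ → (a b c : ℕ → ℤ) → Laurent
RHSodd α a b c =
     scale (p7 (suc α) ℤ.* a 1) u
  +L scale (p7 (suc α) ℤ.* a 2) (powL u 2)
  +L scale (p7 (suc α)) (sum3 (N1 α) (λ i → scale (p7 (e1 i) ℤ.* a i) (powL u i)))
  +L scale (p7 α ℤ.* b 1) (u *L t)
  +L scale (p7 α ℤ.* b 2) (powL u 2 *L t)
  +L scale (p7 (suc α)) (sum3 (N1 α) (λ i → scale (p7 (e1 i) ℤ.* b i) (powL u i *L t)))
  +L scale (p7 α ℤ.* c 2) (powL u 2 *L t²)
  +L scale (p7 (suc α)) (sum3 (N1 α) (λ i → scale (p7 (e1 i) ℤ.* c i) (powL u i *L t²)))

RHSeven : ℕ → (a b c : ℕ → ℤ) → Laurent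
RHSeven α a b c =
     scale (p7 (suc α) ℤ.* a 1) u
  +L scale (p7 (suc α) ℤ.* a 2) (powL u 2)
  +L scale (p7 (suc α)) (sum3 (N2 α) (λ i → scale (p7 (e2 i) ℤ.* a i) (powL u i)))
  +L scale (p7 (suc α) ℤ.* b 1) (u *L t)
  +L scale (p7 (suc α) ℤ.* b 2) (powL u 2 *L t)
  +L scale (p7 (suc α)) (sum3 (N2 α) (λ i → scale (p7 (e2 i) ℤ.* b i) (powL u i *L t)))
  +L scale (p7 (suc α) ℤ.* c 2) (powL u 2 *L t²)
  +L scale (p7 (suc α)) (sum3 (N2 α) (λ i → scale (p7 (e2 i) ℤ.* c i) (powL u i *L t²)))

{-# OPTIONS --safe #-}

-- Put z = η(τ)/η(49τ) and y(τ) = z(2τ).  The pentagonal number theorem dissects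
-- them as z = a + b + c − 1 and y = a′ + b′ + c′ − 1 by exponents modulo 7.
-- Jacobi's identity (abc = −1) and the dissection of φ(−q) = η(τ)²/η(2τ) show
-- that everything lives in a tower over ℤ[s] (s = a′/c + c′/b + b′/a) in which
-- U₇, the part with exponents divisible by 7, can be computed exactly; the
-- remaining quotient η⁴(7τ)/η⁴(49τ) is identified through Watson's equation for z
-- by comparing logarithmic derivatives.  Hence u satisfies an equation of degree
-- 7 over the functions of q⁷, so U₇(uⁱtʲ) and U₇(A uⁱtʲ) satisfy a recurrence of
-- order 7 in i, whose initial values are computed.  The 7-adic bounds propagate
-- along the recurrence: with G spanned by the 7ⁿuˡtʲ with l ≤ n + 2, and O ⊆ G by
-- requiring a factor 7 at u and u², U₇ maps O to 7G and x ↦ U₇(A x) maps G to O.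
module Submission where

open import Data.Nat using (ℕ; zero; suc)
import Data.Nat.DivMod as ℕ÷
import Data.Nat.Divisibility as ℕ∣
open import Data.Nat.Primality using (Prime; prime?; euclidsLemma)
import Data.Nat.Solver
open import Data.Integer using (ℤ; +_; +0; -[1+_]; _⊖_)
import Data.Integer.DivMod as ℤ÷
import Data.Integer.Divisibility.Signed as ℤ∣
import Data.Bool
open import Data.Bool using (Bool; true; false; not; _∧_; _∨_; if_then_else_)
open import Data.List using (List; []; _∷_; _++_; map; foldr; length; applyUpTo)
open import Data.Vec as Vec using (Vec; []; _∷_)
open import Data.Fin using (Fin; zero; suc)
open import Data.Product using (_×_; _,_; proj₁; proj₂; ∃)
open import Data.Sum using (_⊎_; inj₁; inj₂; [_,_]′)
open import Data.Empty using (⊥; ⊥-elim)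
open import Data.Unit using (⊤; tt)
open import Function using (id)
open import Level using (0ℓ)
open import Relation.Nullary using (¬_; Dec; yes; no; does)
open import Relation.Nullary.Decidable using (dec-true; dec-false; toWitness)
open import Relation.Binary.PropositionalEquality using (_≡_; _≢_; refl; sym; trans; cong; cong₂; subst; subst₂; module ≡-Reasoning)
open import Algebra.Bundles using (CommutativeRing)
open import Algebra.Structures using (IsCommutativeRing)
import Defs

-- The level 14 curve has genus one, so no single parameter describes `u` and `t`; `U` is computed
-- by linear algebra instead. The seven series 1, a, b, c, ab, bc, ca lie in the seven classes of
-- exponents modulo 7, so over coefficients that are functions of q⁷ only the coordinate of 1 is
-- seen by `U`. This settles every polynomial in `z` and `y`. Up to functions of q⁷, w = 1/u is z³y,
-- t is y/z and A is y²/z⁵: positive powers of `w` are within reach, those of `u` are not. Hence the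
-- recurrence starts at negative exponents of `u` and runs upwards to seven consecutive values that
-- are polynomials in u and t with the required powers of 7. Denominators are powers of `w`, removed
-- by working with w³³ times each value. Two facts shape the induction. U(u) and U(u²) are not
-- multiples of 7, which forces the extra factor in `O`; and the functions involved vanish at
-- infinity, which excludes the term ut². The exponents l - 2 provided by `G` grow with slope 1,
-- against 7/26 in the theorem.

module N where
  open import Data.Nat public
  open import Data.Nat.Properties public

module Z where
  open import Data.Integer public
  open import Data.Integer.Properties public

pattern −1 = -[1+ 0 ]
pattern −2 = -[1+ 1 ]
pattern −3 = -[1+ 2 ]
pattern −4 = -[1+ 3 ]
pattern −5 = -[1+ 4 ]
pattern −6 = -[1+ 5 ]
pattern −7 = -[1+ 6 ]
pattern −8 = -[1+ 7 ]
pattern −14 = -[1+ 13 ]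
pattern −16 = -[1+ 15 ]
pattern −80 = -[1+ 79 ]

-- Polynomials in n variables over ℤ: normal forms and a solver for commutative rings

Poly : ℕ → Set
Poly zero = ℤ
Poly (suc n) = List (Poly n)

0P : ∀ n → Poly n
0P zero = + 0
0P (suc n) = []

conP : ∀ n → ℤ → Poly n
conP zero z = z
conP (suc n) z = conP n z ∷ []

varP : ∀ {n} → Fin n → Poly n
varP {suc n} zero = 0P n ∷ conP n (+ 1) ∷ []
varP {suc n} (suc i) = varP i ∷ []

addP : ∀ n → Poly n → Poly n → Poly n
addP zero x y = x Z.+ y
addP (suc n) [] q = q
addP (suc n) (a ∷ p) [] = a ∷ p
addP (suc n) (a ∷ p) (b ∷ q) = addP n a b ∷ addP (suc n) p q

mulP : ∀ n → Poly n → Poly n → Poly n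
scaleP : ∀ n → Poly n → List (Poly n) → List (Poly n)
mulP zero x y = x Z.* y
mulP (suc n) [] q = []
mulP (suc n) (a ∷ p) q = addP (suc n) (scaleP n a q) (0P n ∷ mulP (suc n) p q)
scaleP n a [] = []
scaleP n a (b ∷ q) = mulP n a b ∷ scaleP n a q

-- Normal forms are not unique, since a coefficient list may end in zeros; vanishing is therefore
-- tested coefficient by coefficient.
isZero : ∀ n → Poly n → Bool
isZero zero (+ zero) = true
isZero zero (+ (suc _)) = false
isZero zero -[1+ _ ] = false
isZero (suc n) [] = true
isZero (suc n) (a ∷ p) = isZero n a ∧ isZero (suc n) p

infixl 6 _:+_ _:-_
infixl 7 _:*_
infixr 8 _:^_
infix 9 :-_

data Ex (n : ℕ) : Set where
  var : Fin n → Ex n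
  con : ℤ → Ex n
  𝟘 𝟙 : Ex n
  _:+_ _:*_ _:-_ : Ex n → Ex n → Ex n
  :-_ : Ex n → Ex n
  _:^_ : Ex n → ℕ → Ex n

# : ∀ {n} → ℕ → Ex n
# k = con (+ k)

powP : ∀ n → Poly n → ℕ → Poly n
powP n p zero = conP n (+ 1)
powP n p (suc k) = mulP n p (powP n p k)

nf : ∀ {n} → Ex n → Poly n
nf {n} (var i) = varP i
nf {n} (con z) = conP n z
nf {n} 𝟘 = 0P n
nf {n} 𝟙 = conP n (+ 1)
nf {n} (e :+ f) = addP n (nf e) (nf f)
nf {n} (e :* f) = mulP n (nf e) (nf f)
nf {n} (e :- f) = addP n (nf e) (mulP n (conP n (Z.- + 1)) (nf f))
nf {n} (:- e) = mulP n (conP n (Z.- + 1)) (nf e)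
nf {n} (e :^ k) = powP n (nf e) k

Nary : ℕ → Set → Set → Set
Nary zero A B = B
Nary (suc n) A B = A → Nary n A B

feed : ∀ {n A B} → Nary n A B → Vec A n → B
feed f [] = f
feed f (x ∷ xs) = feed (f x) xs

T⇒≡ : ∀ {b} → Data.Bool.T b → b ≡ true
T⇒≡ {true} _ = refl

vars : ∀ n → Vec (Ex n) n
vars n = Vec.tabulate var

module Ring (R : CommutativeRing 0ℓ 0ℓ) where
  open CommutativeRing R hiding (zero) renaming (refl to ≈-refl; sym to ≈-sym; trans to ≈-trans) public
  open import Algebra.Properties.Ring ring using (-‿distribˡ-*; -0#≈0#; -‿involutive; -‿+-comm; x+x≈x⇒x≈0) public
  open import Algebra.Properties.Semiring.Mult semiring using (×-homo-+) renaming (_×_ to _×#_)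
  open import Algebra.Properties.CommutativeSemigroup +-commutativeSemigroup using () renaming (interchange to +-interchange)
  open import Algebra.Properties.CommutativeSemigroup *-commutativeSemigroup using () renaming (x∙yz≈y∙xz to *-swap)
  open import Relation.Binary.Reasoning.Setoid setoid public

  infixr 5 _⨾_
  _⨾_ : ∀ {x y z} → x ≈ y → y ≈ z → x ≈ z
  p ⨾ q = ≈-trans p q

  infixr 8 _^_
  _^_ : Carrier → ℕ → Carrier
  x ^ zero = 1#
  x ^ suc n = x * x ^ n

  ι₀ : ℤ → Carrier
  ι₀ (+ n) = n ×# 1#
  ι₀ -[1+ n ] = - (suc n ×# 1#)

  cancel-one : ∀ x y → (1# + x) - (1# + y) ≈ x - y
  cancel-one x y = begin
    (1# + x) - (1# + y) ≈⟨ +-congˡ (≈-sym (-‿+-comm 1# y)) ⟩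
    (1# + x) + (- 1# + - y) ≈⟨ +-interchange 1# x (- 1#) (- y) ⟩
    (1# + - 1#) + (x - y) ≈⟨ +-congʳ (-‿inverseʳ 1#) ⟩
    0# + (x - y) ≈⟨ +-identityˡ _ ⟩
    x - y ∎

  ι₀-⊖ : ∀ m n → ι₀ (m ⊖ n) ≈ m ×# 1# - n ×# 1#
  ι₀-⊖ zero zero = ≈-sym (-‿inverseʳ 0#)
  ι₀-⊖ zero (suc n) = ≈-sym (+-identityˡ _)
  ι₀-⊖ (suc m) zero = ≈-sym (+-congˡ -0#≈0# ⨾ +-identityʳ _)
  ι₀-⊖ (suc m) (suc n) = begin
    ι₀ (suc m ⊖ suc n) ≡⟨ cong ι₀ (Z.[1+m]⊖[1+n]≡m⊖n m n) ⟩
    ι₀ (m ⊖ n) ≈⟨ ι₀-⊖ m n ⟩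
    m ×# 1# - n ×# 1# ≈⟨ ≈-sym (cancel-one _ _) ⟩
    suc m ×# 1# - suc n ×# 1# ∎

  ι₀-+ : ∀ x y → ι₀ (x Z.+ y) ≈ ι₀ x + ι₀ y
  ι₀-+ (+ m) (+ n) = ×-homo-+ 1# m n
  ι₀-+ (+ m) -[1+ n ] = ι₀-⊖ m (suc n)
  ι₀-+ -[1+ m ] (+ n) = ι₀-⊖ n (suc m) ⨾ +-comm _ _
  ι₀-+ -[1+ m ] -[1+ n ] = begin
    - (suc (suc (m N.+ n)) ×# 1#) ≈⟨ -‿cong (reflexive (cong (λ k → suc k ×# 1#) (sym (N.+-suc m n)))) ⟩
    - ((suc m N.+ suc n) ×# 1#) ≈⟨ -‿cong (×-homo-+ 1# (suc m) (suc n)) ⟩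
    - (suc m ×# 1# + suc n ×# 1#) ≈⟨ ≈-sym (-‿+-comm _ _) ⟩
    - (suc m ×# 1#) + - (suc n ×# 1#) ∎

  ι₀-neg : ∀ x → ι₀ (Z.- x) ≈ - ι₀ x
  ι₀-neg (+ zero) = ≈-sym -0#≈0#
  ι₀-neg (+ (suc n)) = ≈-refl
  ι₀-neg -[1+ n ] = ≈-sym (-‿involutive _)

  ι₀-*⁺ : ∀ m y → ι₀ (+ m Z.* y) ≈ (m ×# 1#) * ι₀ y
  ι₀-*⁺ zero y = reflexive (cong ι₀ (Z.*-zeroˡ y)) ⨾ ≈-sym (zeroˡ _)
  ι₀-*⁺ (suc m) y = begin
    ι₀ (+ suc m Z.* y) ≡⟨ cong ι₀ (Z.suc-* (+ m) y) ⟩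
    ι₀ (y Z.+ + m Z.* y) ≈⟨ ι₀-+ y (+ m Z.* y) ⟩
    ι₀ y + ι₀ (+ m Z.* y) ≈⟨ +-cong (≈-sym (*-identityˡ _)) (ι₀-*⁺ m y) ⟩
    1# * ι₀ y + (m ×# 1#) * ι₀ y ≈⟨ ≈-sym (distribʳ _ _ _) ⟩
    (suc m ×# 1#) * ι₀ y ∎

  ι₀-* : ∀ x y → ι₀ (x Z.* y) ≈ ι₀ x * ι₀ y
  ι₀-* (+ m) y = ι₀-*⁺ m y
  ι₀-* -[1+ m ] y = begin
    ι₀ (-[1+ m ] Z.* y) ≡⟨ cong ι₀ (sym (Z.neg-distribˡ-* (+ suc m) y)) ⟩
    ι₀ (Z.- (+ suc m Z.* y)) ≈⟨ ι₀-neg (+ suc m Z.* y) ⟩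
    - ι₀ (+ suc m Z.* y) ≈⟨ -‿cong (ι₀-*⁺ (suc m) y) ⟩
    - ((suc m ×# 1#) * ι₀ y) ≈⟨ -‿distribˡ-* _ _ ⟩
    ι₀ -[1+ m ] * ι₀ y ∎

  opaque
    -- Opaque, so that images of large integers are compared by their numerals and never expanded
    -- into sums of `1#`.
    ι : ℤ → Carrier
    ι = ι₀

    ι-+ : ∀ x y → ι (x Z.+ y) ≈ ι x + ι y
    ι-+ = ι₀-+

    ι-* : ∀ x y → ι (x Z.* y) ≈ ι x * ι y
    ι-* = ι₀-*

    ι-neg : ∀ x → ι (Z.- x) ≈ - ι x
    ι-neg = ι₀-neg

    ι-0 : ι +0 ≈ 0#
    ι-0 = ≈-refl

    ι-1 : ι (+ 1) ≈ 1#
    ι-1 = +-identityʳ 1#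

  eval : ∀ n → Poly n → Vec Carrier n → Carrier
  eval zero z ρ = ι z
  eval (suc n) [] ρ = 0#
  eval (suc n) (a ∷ p) (x ∷ ρ) = eval n a ρ + x * eval (suc n) p (x ∷ ρ)

  eval-0 : ∀ n ρ → eval n (0P n) ρ ≈ 0#
  eval-0 zero ρ = ι-0
  eval-0 (suc n) ρ = ≈-refl

  x*0 : ∀ {a x} → a + x * 0# ≈ a
  x*0 = +-congˡ (zeroʳ _) ⨾ +-identityʳ _

  eval-con : ∀ n z ρ → eval n (conP n z) ρ ≈ ι z
  eval-con zero z ρ = ≈-refl
  eval-con (suc n) z (x ∷ ρ) = x*0 ⨾ eval-con n z ρ

  eval-var : ∀ {n} (i : Fin n) ρ → eval n (varP i) ρ ≈ Vec.lookup ρ i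
  eval-var {suc n} zero (x ∷ ρ) = begin
    eval n (0P n) ρ + x * (eval n (conP n (+ 1)) ρ + x * 0#)
      ≈⟨ +-cong (eval-0 n ρ) (*-congˡ (x*0 ⨾ eval-con n (+ 1) ρ ⨾ ι-1)) ⟩
    0# + x * 1# ≈⟨ +-identityˡ _ ⨾ *-identityʳ x ⟩
    x ∎
  eval-var {suc n} (suc i) (x ∷ ρ) = x*0 ⨾ eval-var i ρ

  eval-+ : ∀ n p q ρ → eval n (addP n p q) ρ ≈ eval n p ρ + eval n q ρ
  eval-+ zero p q ρ = ι-+ p q
  eval-+ (suc n) [] q ρ = ≈-sym (+-identityˡ _)
  eval-+ (suc n) (a ∷ p) [] (x ∷ ρ) = ≈-sym (+-identityʳ _)
  eval-+ (suc n) (a ∷ p) (b ∷ q) (x ∷ ρ) = begin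
    eval n (addP n a b) ρ + x * eval (suc n) (addP (suc n) p q) (x ∷ ρ)
      ≈⟨ +-cong (eval-+ n a b ρ) (*-congˡ (eval-+ (suc n) p q (x ∷ ρ)) ⨾ distribˡ _ _ _) ⟩
    (_ + _) + (_ + _) ≈⟨ +-interchange _ _ _ _ ⟩
    (_ + _) + (_ + _) ∎

  eval-* : ∀ n p q ρ → eval n (mulP n p q) ρ ≈ eval n p ρ * eval n q ρ
  eval-scale : ∀ n a q x ρ → eval (suc n) (scaleP n a q) (x ∷ ρ) ≈ eval n a ρ * eval (suc n) q (x ∷ ρ)
  eval-* zero p q ρ = ι-* p q
  eval-* (suc n) [] q ρ = ≈-sym (zeroˡ _)
  eval-* (suc n) (a ∷ p) q (x ∷ ρ) = begin
    eval (suc n) (addP (suc n) (scaleP n a q) (0P n ∷ mulP (suc n) p q)) (x ∷ ρ)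
      ≈⟨ eval-+ (suc n) (scaleP n a q) _ (x ∷ ρ) ⟩
    eval (suc n) (scaleP n a q) (x ∷ ρ) + (eval n (0P n) ρ + x * eval (suc n) (mulP (suc n) p q) (x ∷ ρ))
      ≈⟨ +-cong (eval-scale n a q x ρ) (+-congʳ (eval-0 n ρ) ⨾ +-identityˡ _ ⨾ *-congˡ (eval-* (suc n) p q (x ∷ ρ))) ⟩
    A * Q + x * (P * Q) ≈⟨ +-congˡ (≈-sym (*-assoc x P Q)) ⟩
    A * Q + x * P * Q ≈⟨ ≈-sym (distribʳ Q A (x * P)) ⟩
    (A + x * P) * Q ∎
    where A = eval n a ρ
          P = eval (suc n) p (x ∷ ρ)
          Q = eval (suc n) q (x ∷ ρ)
  eval-scale n a [] x ρ = ≈-sym (zeroʳ _)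
  eval-scale n a (b ∷ q) x ρ = begin
    eval n (mulP n a b) ρ + x * eval (suc n) (scaleP n a q) (x ∷ ρ)
      ≈⟨ +-cong (eval-* n a b ρ) (*-congˡ (eval-scale n a q x ρ)) ⟩
    A * eval n b ρ + x * (A * eval (suc n) q (x ∷ ρ)) ≈⟨ +-congˡ (*-swap x A _) ⟩
    A * eval n b ρ + A * (x * eval (suc n) q (x ∷ ρ)) ≈⟨ ≈-sym (distribˡ A _ _) ⟩
    A * (eval n b ρ + x * eval (suc n) q (x ∷ ρ)) ∎
    where A = eval n a ρ

  eval-isZero : ∀ n p ρ → isZero n p ≡ true → eval n p ρ ≈ 0#
  eval-isZero zero (+ zero) ρ _ = ι-0
  eval-isZero zero (+ (suc _)) ρ ()
  eval-isZero zero -[1+ _ ] ρ ()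
  eval-isZero (suc n) [] ρ _ = ≈-refl
  eval-isZero (suc n) (a ∷ p) (x ∷ ρ) eq with isZero n a in eqₐ
  ... | true = begin
    eval n a ρ + x * eval (suc n) p (x ∷ ρ)
      ≈⟨ +-cong (eval-isZero n a ρ eqₐ) (*-congˡ (eval-isZero (suc n) p (x ∷ ρ) eq)) ⟩
    0# + x * 0# ≈⟨ x*0 ⟩
    0# ∎
  eval-isZero (suc n) (a ∷ p) (x ∷ ρ) () | false

  ⟦_⟧ : ∀ {n} → Ex n → Vec Carrier n → Carrier
  ⟦ var i ⟧ ρ = Vec.lookup ρ i
  ⟦ con z ⟧ ρ = ι z
  ⟦ 𝟘 ⟧ ρ = 0#
  ⟦ 𝟙 ⟧ ρ = 1#
  ⟦ e :+ f ⟧ ρ = ⟦ e ⟧ ρ + ⟦ f ⟧ ρ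
  ⟦ e :* f ⟧ ρ = ⟦ e ⟧ ρ * ⟦ f ⟧ ρ
  ⟦ e :- f ⟧ ρ = ⟦ e ⟧ ρ - ⟦ f ⟧ ρ
  ⟦ :- e ⟧ ρ = - ⟦ e ⟧ ρ
  ⟦ e :^ k ⟧ ρ = ⟦ e ⟧ ρ ^ k

  neg-one* : ∀ x → ι (Z.- + 1) * x ≈ - x
  neg-one* x = begin
    ι (Z.- + 1) * x ≈⟨ *-congʳ (ι-neg (+ 1) ⨾ -‿cong ι-1) ⟩
    - 1# * x ≈⟨ ≈-sym (-‿distribˡ-* 1# x) ⟩
    - (1# * x) ≈⟨ -‿cong (*-identityˡ x) ⟩
    - x ∎

  eval-neg : ∀ n p ρ → eval n (mulP n (conP n (Z.- + 1)) p) ρ ≈ - eval n p ρ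
  eval-neg n p ρ = eval-* n (conP n (Z.- + 1)) p ρ ⨾ *-congʳ (eval-con n _ ρ) ⨾ neg-one* _

  nf-sound : ∀ {n} (e : Ex n) ρ → eval n (nf e) ρ ≈ ⟦ e ⟧ ρ
  nf-sound {n} (var i) ρ = eval-var i ρ
  nf-sound {n} (con z) ρ = eval-con n z ρ
  nf-sound {n} 𝟘 ρ = eval-0 n ρ
  nf-sound {n} 𝟙 ρ = eval-con n (+ 1) ρ ⨾ ι-1
  nf-sound {n} (e :+ f) ρ = eval-+ n (nf e) (nf f) ρ ⨾ +-cong (nf-sound e ρ) (nf-sound f ρ)
  nf-sound {n} (e :* f) ρ = eval-* n (nf e) (nf f) ρ ⨾ *-cong (nf-sound e ρ) (nf-sound f ρ)
  nf-sound {n} (e :- f) ρ = eval-+ n (nf e) _ ρ ⨾ +-cong (nf-sound e ρ) (eval-neg n (nf f) ρ ⨾ -‿cong (nf-sound f ρ))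
  nf-sound {n} (:- e) ρ = eval-neg n (nf e) ρ ⨾ -‿cong (nf-sound e ρ)
  nf-sound {n} (e :^ k) ρ = go k
    where
    go : ∀ k → eval n (powP n (nf e) k) ρ ≈ ⟦ e ⟧ ρ ^ k
    go zero = eval-con n (+ 1) ρ ⨾ ι-1
    go (suc k) = eval-* n (nf e) _ ρ ⨾ *-cong (nf-sound e ρ) (go k)

  sub≈0⇒≈ : ∀ {x y} → x - y ≈ 0# → x ≈ y
  sub≈0⇒≈ {x} {y} eq = begin
    x ≈⟨ ≈-sym (+-identityʳ x) ⟩
    x + 0# ≈⟨ +-congˡ (≈-sym (-‿inverseˡ y)) ⟩
    x + (- y + y) ≈⟨ ≈-sym (+-assoc x (- y) y) ⟩
    x - y + y ≈⟨ +-congʳ eq ⟩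
    0# + y ≈⟨ +-identityˡ y ⟩
    y ∎

  ≈⇒sub≈0 : ∀ {x y} → x ≈ y → x - y ≈ 0#
  ≈⇒sub≈0 eq = +-congʳ eq ⨾ -‿inverseʳ _

  ringᵛ : ∀ {n} (ρ : Vec Carrier n) (f : Nary n (Ex n) (Ex n × Ex n)) →
          {_ : Data.Bool.T (isZero n (nf (proj₁ (feed f (vars n)) :- proj₂ (feed f (vars n)))))} →
          ⟦ proj₁ (feed f (vars n)) ⟧ ρ ≈ ⟦ proj₂ (feed f (vars n)) ⟧ ρ
  ringᵛ {n} ρ f {eq} = sub≈0⇒≈ (≈-sym (nf-sound (l :- r) ρ) ⨾ eval-isZero n _ ρ (T⇒≡ eq))
    where l = proj₁ (feed f (vars n))
          r = proj₂ (feed f (vars n))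

  Hyp : ℕ → Set
  Hyp n = Ex n × Ex n × Ex n

  combination : ∀ {n} → List (Hyp n) → Ex n
  combination [] = 𝟘
  combination ((c , l , r) ∷ hs) = c :* (l :- r) :+ combination hs

  -- The last hypothesis is not paired with `⊤`, so that proofs can be supplied as a plain tuple, or
  -- as a single equation.
  Hold : ∀ {n} → Vec Carrier n → List (Hyp n) → Set
  Hold ρ [] = ⊤
  Hold ρ ((c , l , r) ∷ []) = ⟦ l ⟧ ρ ≈ ⟦ r ⟧ ρ
  Hold ρ ((c , l , r) ∷ hs@(_ ∷ _)) = (⟦ l ⟧ ρ ≈ ⟦ r ⟧ ρ) × Hold ρ hs

  Hold-∷ : ∀ {n} {ρ : Vec Carrier n} c l r hs → Hold ρ ((c , l , r) ∷ hs) → (⟦ l ⟧ ρ ≈ ⟦ r ⟧ ρ) × Hold ρ hs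
  Hold-∷ c l r [] p = p , tt
  Hold-∷ c l r (_ ∷ _) p = p

  combination≈0 : ∀ {n} (ρ : Vec Carrier n) hs → Hold ρ hs → ⟦ combination hs ⟧ ρ ≈ 0#
  combination≈0 ρ [] _ = ≈-refl
  combination≈0 ρ ((c , l , r) ∷ hs) hold = begin
    ⟦ c ⟧ ρ * (⟦ l ⟧ ρ - ⟦ r ⟧ ρ) + ⟦ combination hs ⟧ ρ
      ≈⟨ +-cong (*-congˡ (≈⇒sub≈0 (proj₁ ps)) ⨾ zeroʳ _) (combination≈0 ρ hs (proj₂ ps)) ⟩
    0# + 0# ≈⟨ +-identityˡ 0# ⟩
    0# ∎
    where
    ps : (⟦ l ⟧ ρ ≈ ⟦ r ⟧ ρ) × Hold ρ hs
    ps = Hold-∷ c l r hs hold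

  modᵛ : ∀ {n} (ρ : Vec Carrier n) (f : Nary n (Ex n) ((Ex n × Ex n) × List (Hyp n))) →
         Hold ρ (proj₂ (feed f (vars n))) →
         {_ : Data.Bool.T (isZero n (nf (proj₁ (proj₁ (feed f (vars n))) :- proj₂ (proj₁ (feed f (vars n))) :- combination (proj₂ (feed f (vars n))))))} →
         ⟦ proj₁ (proj₁ (feed f (vars n))) ⟧ ρ ≈ ⟦ proj₂ (proj₁ (feed f (vars n))) ⟧ ρ
  modᵛ {n} ρ f hold {eq} = sub≈0⇒≈ (begin
    ⟦ l ⟧ ρ - ⟦ r ⟧ ρ ≈⟨ sub≈0⇒≈ (≈-sym (nf-sound (l :- r :- combination hs) ρ) ⨾ eval-isZero n _ ρ (T⇒≡ eq)) ⟩
    ⟦ combination hs ⟧ ρ ≈⟨ combination≈0 ρ hs hold ⟩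
    0# ∎)
    where l = proj₁ (proj₁ (feed f (vars n)))
          r = proj₂ (proj₁ (feed f (vars n)))
          hs = proj₂ (feed f (vars n))

  Gather : ∀ n → (Vec Carrier n → Set) → Set
  Gather zero    P = P []
  Gather (suc n) P = (x : Carrier) → Gather n (λ ρ → P (x ∷ ρ))

  gather : ∀ n {P : Vec Carrier n → Set} → (∀ ρ → P ρ) → Gather n P
  gather zero    p   = p []
  gather (suc n) p x = gather n (λ ρ → p (x ∷ ρ))

  ring! : ∀ n → Gather n (λ ρ → (f : Nary n (Ex n) (Ex n × Ex n)) →
          {_ : Data.Bool.T (isZero n (nf (proj₁ (feed f (vars n)) :- proj₂ (feed f (vars n)))))} →
          ⟦ proj₁ (feed f (vars n)) ⟧ ρ ≈ ⟦ proj₂ (feed f (vars n)) ⟧ ρ)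
  ring! n = gather n ringᵛ

  -- l ≈ r follows from l − r = Σ cᵢ (lᵢ − rᵢ) when every lᵢ ≈ rᵢ holds.
  mod! : ∀ n → Gather n (λ ρ → (f : Nary n (Ex n) ((Ex n × Ex n) × List (Hyp n))) →
         Hold ρ (proj₂ (feed f (vars n))) →
         {_ : Data.Bool.T (isZero n (nf (proj₁ (proj₁ (feed f (vars n))) :- proj₂ (proj₁ (feed f (vars n))) :- combination (proj₂ (feed f (vars n))))))} →
         ⟦ proj₁ (proj₁ (feed f (vars n))) ⟧ ρ ≈ ⟦ proj₂ (proj₁ (feed f (vars n))) ⟧ ρ)
  mod! n = gather n modᵛ

module ℤR = Ring Z.+-*-commutativeRing

-- Integer polynomials in one variable, tested for zero by their value at one large integer

-- The integer 2^1024, larger than every bound `size` that `vanishes` meets in the checks below.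
base : ℕ
base = 179769313486231590772930519078902473361797697894230657273430081157732675805500963132708477322407536021120113879871393357658789768814416622492847430639474124377767893424865485276302219601246094119453082952085005768838150682342462881473913110540827237163350510684586298239947245938479716304835356329624224137216

evalℤ : List ℤ → ℤ
evalℤ [] = + 0
evalℤ (c ∷ p) = c Z.+ evalℤ p Z.* + base

norm : List ℤ → ℕ
norm [] = 0
norm (c ∷ p) = Z.∣ c ∣ N.+ norm p

addᶜ : List ℤ → List ℤ → List ℤ
addᶜ = addP 1

scaleᶜ : ℤ → List ℤ → List ℤ
scaleᶜ = scaleP 0

norm-add : ∀ p r → norm (addᶜ p r) N.≤ norm p N.+ norm r
norm-add [] r = N.≤-refl
norm-add (c ∷ p) [] = N.≤-reflexive (sym (N.+-identityʳ _))
norm-add (c ∷ p) (d ∷ r) = N.≤-trans (N.+-mono-≤ (Z.∣i+j∣≤∣i∣+∣j∣ c d) (norm-add p r))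
  (N.≤-reflexive (medial Z.∣ c ∣ Z.∣ d ∣ (norm p) (norm r)))
  where
  open import Algebra.Properties.CommutativeSemigroup N.+-commutativeSemigroup using () renaming (interchange to medial)

norm-scale : ∀ c p → norm (scaleᶜ c p) ≡ Z.∣ c ∣ N.* norm p
norm-scale c [] = sym (N.*-zeroʳ Z.∣ c ∣)
norm-scale c (d ∷ p) = trans (cong₂ N._+_ (Z.abs-* c d) (norm-scale c p)) (sym (N.*-distribˡ-+ Z.∣ c ∣ Z.∣ d ∣ (norm p)))

evalℤ-add : ∀ p r → evalℤ (addᶜ p r) ≡ evalℤ p Z.+ evalℤ r
evalℤ-add [] r = sym (Z.+-identityˡ _)
evalℤ-add (c ∷ p) [] = sym (Z.+-identityʳ _)
evalℤ-add (c ∷ p) (d ∷ r) = trans (cong (λ x → c Z.+ d Z.+ x Z.* + base) (evalℤ-add p r)) (regroup c d (evalℤ p) (evalℤ r) (+ base))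
  where
  regroup : ∀ c d x y b → c Z.+ d Z.+ (x Z.+ y) Z.* b ≡ c Z.+ x Z.* b Z.+ (d Z.+ y Z.* b)
  regroup c d x y b = ℤR.ring! 5 c d x y b (λ c d x y b → c :+ d :+ (x :+ y) :* b , c :+ x :* b :+ (d :+ y :* b))

evalℤ-scale : ∀ c p → evalℤ (scaleᶜ c p) ≡ c Z.* evalℤ p
evalℤ-scale c [] = sym (Z.*-zeroʳ c)
evalℤ-scale c (d ∷ p) = trans (cong (λ x → c Z.* d Z.+ x Z.* + base) (evalℤ-scale c p)) (regroup c d (evalℤ p) (+ base))
  where
  regroup : ∀ c d x b → c Z.* d Z.+ (c Z.* x) Z.* b ≡ c Z.* (d Z.+ x Z.* b)
  regroup c d x b = ℤR.ring! 4 c d x b (λ c d x b → c :* d :+ (c :* x) :* b , c :* (d :+ x :* b))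

-- A polynomial is determined by its value at `base` once `base` exceeds the
-- sum of the absolute values of its coefficients, so computations only ever
-- force the value and the bound; the coefficient list serves the proofs.
record Packed : Set where
  no-eta-equality
  pattern
  constructor packed
  field
    poly : List ℤ
    code : ℤ
    size : ℕ
    code≡ : code ≡ evalℤ poly
    ≤size : norm poly N.≤ size
open Packed public

infixl 6 _⊹_
_⊹_ : Packed → Packed → Packed
packed p v β e l ⊹ packed p′ v′ β′ e′ l′ = packed (addᶜ p p′) (v Z.+ v′) (β N.+ β′)
  (trans (cong₂ Z._+_ e e′) (sym (evalℤ-add p p′))) (N.≤-trans (norm-add p p′) (N.+-mono-≤ l l′))

infixl 7 _◂_
_◂_ : ℤ → Packed → Packed
c ◂ packed p v β e l = packed (scaleᶜ c p) (c Z.* v) (Z.∣ c ∣ N.* β)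
  (trans (cong (Z._*_ c) e) (sym (evalℤ-scale c p))) (N.≤-trans (N.≤-reflexive (norm-scale c p)) (N.*-monoʳ-≤ Z.∣ c ∣ l))

shift : Packed → Packed
shift (packed p v β e l) = packed (+ 0 ∷ p) (v Z.* + base) β
  (trans (cong (Z._* + base) e) (sym (Z.+-identityˡ (evalℤ p Z.* + base)))) l

lit : List ℤ → Packed
lit p = packed p (evalℤ p) (norm p) refl N.≤-refl

isZeroℤ : ℤ → Bool
isZeroℤ (+ zero) = true
isZeroℤ (+ suc _) = false
isZeroℤ -[1+ _ ] = false

vanishes : Packed → Bool
vanishes p = isZeroℤ (code p) ∧ (size p N.<ᵇ base)

-- The lowest coefficient is a multiple of b smaller than b, hence zero, and then so is the
-- remaining value. Repeated along the list, this recovers all coefficients from the value at b.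
small-multiple : ∀ c x b → c Z.+ x Z.* + b ≡ + 0 → Z.∣ c ∣ N.< b → (c ≡ + 0) × (x ≡ + 0)
small-multiple c x b eq c<b = go Z.∣ x ∣ refl
  where
  ∣c∣≡ : Z.∣ c ∣ ≡ Z.∣ x ∣ N.* b
  ∣c∣≡ = trans (cong Z.∣_∣ (ℤR.mod! 2 c (x Z.* + b) (λ c y → (c , :- y) , (𝟙 , c :+ y , 𝟘) ∷ []) eq))
    (trans (Z.∣-i∣≡∣i∣ (x Z.* + b)) (Z.abs-* x (+ b)))
  go : ∀ k → Z.∣ x ∣ ≡ k → (c ≡ + 0) × (x ≡ + 0)
  go zero e = Z.∣i∣≡0⇒i≡0 (trans ∣c∣≡ (cong (N._* b) e)) , Z.∣i∣≡0⇒i≡0 e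
  go (suc k) e = ⊥-elim (N.<⇒≱ c<b (N.≤-trans (N.m≤m+n b (k N.* b)) (N.≤-reflexive (sym (trans ∣c∣≡ (cong (N._* b) e))))))

-- A degree 6 extension of ℤ[s], and vectors of seven coordinates over it

record K₃ : Set where
  no-eta-equality
  pattern
  constructor k₃
  field x₀ x₁ x₂ : Packed
open K₃ public

-- Coordinates on 1 and `r₂` over `K₃`, itself given by coordinates on 1, `r₁`, `r₁`² over ℤ[s].
-- Only multiplications by particular elements are implemented, as linear operators; two general
-- elements are never multiplied.
record K₆ : Set where
  no-eta-equality
  pattern
  constructor k₆
  field lo hi : K₃
open K₆ public

add₃ : K₃ → K₃ → K₃
add₃ (k₃ a b c) (k₃ a′ b′ c′) = k₃ (a ⊹ a′) (b ⊹ b′) (c ⊹ c′)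

scale₃ : ℤ → K₃ → K₃
scale₃ z (k₃ a b c) = k₃ (z ◂ a) (z ◂ b) (z ◂ c)

shift₃ : K₃ → K₃
shift₃ (k₃ a b c) = k₃ (shift a) (shift b) (shift c)

-- Uses r₁³ = s r₁² + (1 + s) r₁ + 1.
ρ₁₃ : K₃ → K₃
ρ₁₃ (k₃ a b c) = k₃ c (a ⊹ (c ⊹ shift c)) (b ⊹ shift c)

infixl 6 _⊹₆_
_⊹₆_ : K₆ → K₆ → K₆
k₆ a b ⊹₆ k₆ a′ b′ = k₆ (add₃ a a′) (add₃ b b′)

scale₆ : ℤ → K₆ → K₆
scale₆ z (k₆ a b) = k₆ (scale₃ z a) (scale₃ z b)

neg₆ : K₆ → K₆
neg₆ = scale₆ −1

shift₆ : K₆ → K₆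
shift₆ (k₆ a b) = k₆ (shift₃ a) (shift₃ b)

ρ₁ ρ₂ ρ₃ ⁺ρ₁ ⁺ρ₂ ⁺ρ₃ ×h ×h⁻¹ ×λ ×[1+h⁻¹] ×T : K₆ → K₆
ρ₁ (k₆ a b) = k₆ (ρ₁₃ a) (ρ₁₃ b)

-- Uses r₂² = (s - r₁) r₂ - (r₁² - s r₁ - (1 + s)), the quotient of the cubic by its linear factor
-- at `r₁`. The third argument is r₁ y, passed in because it is needed several times.
ρ₂-aux : K₃ → K₃ → K₃ → K₆
ρ₂-aux x y ρy = k₆ (add₃ (add₃ y (shift₃ y)) (add₃ (shift₃ ρy) (scale₃ −1 (ρ₁₃ ρy)))) (add₃ x (add₃ (shift₃ y) (scale₃ −1 ρy)))

ρ₂ (k₆ x y) = ρ₂-aux x y (ρ₁₃ y)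
ρ₃ x = shift₆ x ⊹₆ neg₆ (ρ₁ x ⊹₆ ρ₂ x)
⁺ρ₁ x = x ⊹₆ ρ₁ x
⁺ρ₂ x = x ⊹₆ ρ₂ x
⁺ρ₃ x = x ⊹₆ ρ₃ x
×h x = ρ₁ (ρ₃ (⁺ρ₃ x))
×h⁻¹ x = ρ₂ (⁺ρ₁ (⁺ρ₂ x))
×λ x = neg₆ (ρ₁ (ρ₂ (⁺ρ₁ x)))
×[1+h⁻¹] x = x ⊹₆ ×h⁻¹ x

-- Here T = s² + s + r₁² r₂ + r₂² r₃ + r₃² r₁, a cyclic invariant of the three roots, written in the
-- basis. It generates the quadratic subextension: the cubic has discriminant (s² + s - 3)² - 32,
-- which is also the discriminant of T² = (s² + s - 3) T - 8. The arguments are x, r₁ x and r₁² x.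
×T-aux : K₆ → K₆ → K₆ → K₆
×T-aux x y z = shift₆ (x ⊹₆ shift₆ x) ⊹₆ (y ⊹₆ shift₆ (y ⊹₆ shift₆ y)) ⊹₆ neg₆ (shift₆ z)
  ⊹₆ ρ₂ (scale₆ (+ 3) z ⊹₆ neg₆ (x ⊹₆ shift₆ (x ⊹₆ scale₆ (+ 2) y)))
×T x = ×T-aux x (ρ₁ x) (ρ₁ (ρ₁ x))

-- Coordinates on 1, a, b, c, ab, bc, ca, whose exponents lie in the classes 0, 5, 6, 3, 4, 2, 1
-- modulo 7. Thus `eᵒ` is the only coordinate that survives `U`.
record V₇ : Set where
  no-eta-equality
  pattern
  constructor v₇
  field eᵒ eᵃ eᵇ eᶜ eᵃᵇ eᵇᶜ eᶜᵃ : K₆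
open V₇ public

-- Multiplication by αa + βb + γc - 1. The multiplication table is a² = λ⁻ c, b² = -h a, c² = (1 +
-- h⁻¹) b, abc = -1, with the consequences a²c = h⁻¹ b, ab² = -h λ⁻ c and bc² = -(1 + h) a.
×affine : (α β γ : K₆ → K₆) → V₇ → V₇
×affine α β γ (v₇ x a b c ab bc ca) = v₇
  (neg₆ (x ⊹₆ (α bc ⊹₆ (β ca ⊹₆ γ ab))))
  (α x ⊹₆ neg₆ (a ⊹₆ (×h (β b) ⊹₆ (γ bc ⊹₆ ×h (γ bc)))))
  (β x ⊹₆ neg₆ b ⊹₆ (×h⁻¹ (α ca) ⊹₆ ×[1+h⁻¹] (γ c)))
  (γ x ⊹₆ ×λ (α a) ⊹₆ neg₆ (c ⊹₆ ×h (×λ (β ab))))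
  (neg₆ ab ⊹₆ ×[1+h⁻¹] (γ ca) ⊹₆ (α b ⊹₆ β a))
  (neg₆ bc ⊹₆ ×λ (α ab) ⊹₆ (β c ⊹₆ γ b))
  (neg₆ (ca ⊹₆ ×h (β bc)) ⊹₆ (α c ⊹₆ γ a))

idK : K₆ → K₆
idK x = x

×z ×y ×g : V₇ → V₇
×z = ×affine idK idK idK
-- The components of y are a′ = r₁ c, b′ = r₃ a and c′ = r₂ b.
×y = ×affine ρ₃ ρ₂ ρ₁
×g x = ×z (×z (×z (×y x)))

-- The ring ℤ[s] + ℤ[s] t of functions of level 14

record P₂ : Set where
  no-eta-equality
  pattern
  constructor pr
  field part₀ part₁ : Packed
open P₂ public

infixl 6 _⊹₂_
_⊹₂_ : P₂ → P₂ → P₂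
pr a b ⊹₂ pr a′ b′ = pr (a ⊹ a′) (b ⊹ b′)

scale₂ : ℤ → P₂ → P₂
scale₂ z (pr a b) = pr (z ◂ a) (z ◂ b)

shift₂ : P₂ → P₂
shift₂ (pr a b) = pr (shift a) (shift b)

-- Multiplication by t, by w = 1/u, by two functions that turn out to be (η(τ)/η(7τ))⁴ and
-- (η(2τ)/η(14τ))⁴, and by μ = w²/κ₂. The last one makes division by κ₂ possible at the cost of two
-- powers of w.
τ υ κ₁ κ₂ ×μ : P₂ → P₂
τ (pr a b) = pr (−8 ◂ b) (a ⊹ (shift (b ⊹ shift b) ⊹ −3 ◂ b))

υ-aux κ₁-aux κ₂-aux μ-aux : P₂ → P₂ → P₂
υ-aux x τx = scale₂ (+ 8) x ⊹₂ (shift₂ τx ⊹₂ scale₂ −4 τx)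
κ₁-aux x τx = shift₂ (scale₂ (+ 2) x ⊹₂ shift₂ x) ⊹₂ (scale₂ −7 x ⊹₂ scale₂ −1 τx)
κ₂-aux x τx = τx ⊹₂ scale₂ −1 (scale₂ (+ 5) x ⊹₂ shift₂ x)
μ-aux x τx = scale₂ −8 x ⊹₂ (scale₂ (+ 13) τx ⊹₂ shift₂ (scale₂ −7 τx ⊹₂ shift₂ τx))
υ x = υ-aux x (τ x)
κ₁ x = κ₁-aux x (τ x)
κ₂ x = κ₂-aux x (τ x)
×μ x = μ-aux x (τ x)

0ᵖ : Packed
0ᵖ = lit []

0₃ : K₃
0₃ = k₃ 0ᵖ 0ᵖ 0ᵖ

embed : P₂ → K₆
embed (pr a b) = k₆ (k₃ a 0ᵖ 0ᵖ) 0₃ ⊹₆ ×T (k₆ (k₃ b 0ᵖ 0ᵖ) 0₃)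

project-aux : Packed → Packed → P₂
project-aux x y = pr (x ⊹ −1 ◂ shift (y ⊹ shift y)) y

-- Among the coordinates of T, those of r₁² and r₂ are -s and -(1 + s), whose difference 1 isolates
-- the coefficient of T; the constant coordinate s + s² of T is then subtracted. That nothing else
-- is left over is the test `projects`.
project : K₆ → P₂
project k = project-aux (x₀ (lo k)) (x₂ (lo k) ⊹ −1 ◂ x₀ (hi k))

vanishes₃ : K₃ → Bool
vanishes₃ (k₃ a b c) = vanishes a ∧ vanishes b ∧ vanishes c

vanishes₆ : K₆ → Bool
vanishes₆ (k₆ a b) = vanishes₃ a ∧ vanishes₃ b

vanishes₇ : V₇ → Bool
vanishes₇ (v₇ x a b c ab bc ca) = vanishes₆ x ∧ vanishes₆ a ∧ vanishes₆ b ∧ vanishes₆ c ∧ vanishes₆ ab ∧ vanishes₆ bc ∧ vanishes₆ ca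

vanishes₂ : P₂ → Bool
vanishes₂ (pr a b) = vanishes a ∧ vanishes b

projects : K₆ → Bool
projects k = vanishes₆ (k ⊹₆ neg₆ (embed (project k)))

iter : ∀ {A : Set} → (A → A) → ℕ → A → A
iter f zero x = x
iter f (suc n) x = f (iter f n x)

0₆ : K₆
0₆ = k₆ 0₃ 0₃

1₇ : V₇
1₇ = v₇ (k₆ (k₃ (lit (+ 1 ∷ [])) 0ᵖ 0ᵖ) 0₃) 0₆ 0₆ 0₆ 0₆ 0₆ 0₆

addHead : P₂ → V₇ → V₇
addHead c (v₇ x a b d ab bc ca) = v₇ (x ⊹₆ embed c) a b d ab bc ca

-- Signed coefficients (−1)ᵏ cₖ of the equation satisfied by g = z³ y.
S₁ S₂ S₃ S₄ S₅ S₆ S₇ : P₂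
S₁ = pr (lit (-[1+ 97 ] ∷ -[1+ 62 ] ∷ −7 ∷ [])) (lit (+ 7 ∷ []))
S₂ = pr (lit (+ 4291 ∷ + 4851 ∷ + 2240 ∷ + 378 ∷ + 21 ∷ [])) (lit (-[1+ 601 ] ∷ -[1+ 356 ] ∷ -[1+ 20 ] ∷ []))
S₃ = pr (lit (-[1+ 127203 ] ∷ -[1+ 129653 ] ∷ -[1+ 118621 ] ∷ -[1+ 54746 ] ∷ -[1+ 8784 ] ∷ -[1+ 496 ] ∷ -[1+ 34 ] ∷ [])) (lit (+ 13153 ∷ + 30681 ∷ + 8372 ∷ + 462 ∷ + 35 ∷ []))
S₄ = pr (lit (+ 2470594 ∷ + 2284191 ∷ + 1877463 ∷ + 1711178 ∷ + 813953 ∷ + 123130 ∷ + 448 ∷ -[1+ 356 ] ∷ + 35 ∷ [])) (lit (-[1+ 154300 ] ∷ -[1+ 541393 ] ∷ -[1+ 576463 ] ∷ -[1+ 119391 ] ∷ -[1+ 944 ] ∷ + 392 ∷ -[1+ 34 ] ∷ []))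
S₅ = pr (lit (-[1+ 23271198 ] ∷ -[1+ 19745529 ] ∷ -[1+ 23489115 ] ∷ -[1+ 19711467 ] ∷ -[1+ 11130307 ] ∷ -[1+ 5337268 ] ∷ -[1+ 1346176 ] ∷ -[1+ 27362 ] ∷ + 32452 ∷ + 1015 ∷ -[1+ 20 ] ∷ [])) (lit (+ 153188 ∷ + 8221199 ∷ + 6032936 ∷ + 3858015 ∷ + 1180284 ∷ + 55629 ∷ -[1+ 31352 ] ∷ -[1+ 1035 ] ∷ + 21 ∷ []))
S₆ = pr (lit (+ 36241947 ∷ + 84114695 ∷ + 112505785 ∷ + 109457726 ∷ + 72806895 ∷ + 36036280 ∷ + 11196577 ∷ + 2999976 ∷ + 501326 ∷ + 17703 ∷ + 11977 ∷ -[1+ 454 ] ∷ + 7 ∷ [])) (lit (-[1+ 14117949 ] ∷ -[1+ 36576147 ] ∷ -[1+ 39466783 ] ∷ -[1+ 25549971 ] ∷ -[1+ 9587297 ] ∷ -[1+ 2432002 ] ∷ -[1+ 534470 ] ∷ -[1+ 3856 ] ∷ -[1+ 12459 ] ∷ + 462 ∷ −7 ∷ []))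
S₇ = pr (lit (-[1+ 954736 ] ∷ + 3769466 ∷ -[1+ 1034458 ] ∷ -[1+ 2530411 ] ∷ + 505263 ∷ + 835190 ∷ -[1+ 36354 ] ∷ -[1+ 149271 ] ∷ -[1+ 15586 ] ∷ + 12630 ∷ + 3151 ∷ -[1+ 203 ] ∷ -[1+ 162 ] ∷ -[1+ 21 ] ∷ −1 ∷ [])) (lit (-[1+ 917266 ] ∷ + 1262893 ∷ + 145941 ∷ -[1+ 554141 ] ∷ -[1+ 36861 ] ∷ + 105662 ∷ + 17143 ∷ -[1+ 9248 ] ∷ -[1+ 2830 ] ∷ + 122 ∷ + 145 ∷ + 21 ∷ + 1 ∷ []))

coefficient : List P₂
coefficient = S₁ ∷ S₂ ∷ S₃ ∷ S₄ ∷ S₅ ∷ S₆ ∷ S₇ ∷ []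

horner : V₇ → List P₂ → V₇
horner x [] = x
horner x (c ∷ cs) = horner (addHead c (×g x)) cs

-- The coefficients are, up to sign, the elementary symmetric functions of the seven conjugates of g
-- under q ↦ ζq with ζ⁷ = 1; they are functions of q⁷ and lie in ℤ[s] + ℤ[s] T.
equation-check : vanishes₇ (horner 1₇ coefficient) ≡ true
equation-check = refl

orbit : ℕ → V₇ → List K₆
orbit zero x = []
orbit (suc n) x = eᵒ x ∷ orbit n (×g x)

-- Tables of polynomials in u and t, and their verification

Row : Set
Row = ℤ × ℤ × ℤ

-- The row of index l is stored divided by 7 ^ (l ∸ s).
inflate : ℕ → ℕ → List Row → List Row
inflate s l [] = []
inflate s l ((a , b , c) ∷ rows) = (f a , f b , f c) ∷ inflate s (suc l) rows
  where
  f : ℤ → ℤ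
  f x = x Z.* + (7 N.^ (l N.∸ s))

-- Rewrites a + b t + c t² by t² = (s² + s - 3) t - 8. The position of a row in its list is the
-- exponent of `u`.
packRow : Row → P₂
packRow (a , b , c) = pr (lit (a Z.+ −8 Z.* c ∷ [])) (lit (b Z.+ −3 Z.* c ∷ c ∷ c ∷ []))

-- Horner's rule in w = 1/u, since only `w` acts on the ring: n rows with initial value 0 yield
-- w^(n-1) times the polynomial in u that they denote.
evalRows : P₂ → List Row → P₂
evalRows acc [] = acc
evalRows acc (r ∷ rows) = evalRows (υ acc ⊹₂ packRow r) rows

0₂ 1₂ : P₂
0₂ = pr 0ᵖ 0ᵖ
1₂ = pr (lit (+ 1 ∷ [])) 0ᵖ

actRows : P₂ → P₂ → P₂ → P₂ → List Row → P₂
actRows x τx ττx acc [] = acc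
actRows x τx ττx acc ((a , b , c) ∷ rows) = actRows x τx ττx (υ acc ⊹₂ (scale₂ a x ⊹₂ (scale₂ b τx ⊹₂ scale₂ c ττx))) rows

act : List Row → P₂ → P₂
act rows x = actRows x (τ x) (τ (τ x)) 0₂ rows

-- All window entries are multiplied by u ^ (− height).
height : ℕ
height = 33

pack : List Row → P₂
pack rows = iter υ (suc height N.∸ length rows) (evalRows 0₂ rows)

infixr 3 _&_
_&_ : Row → List Row → List Row
r & rows = r ∷ rows

inflate₁ inflate₂ : List Row → List Row
inflate₁ = inflate 1 0
inflate₂ = inflate 2 0

module Tables where
  open import Agda.Builtin.FromNat using (Number; fromNat)
  open import Agda.Builtin.FromNeg using (Negative; fromNeg)
  import Data.Integer.Literals as Literals
  instance
    number : Number ℤ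
    number = Literals.number
    negative : Negative ℤ
    negative = Literals.negative

  ε₁ : List Row
  ε₁ = inflate₁ (0 , 0 , 0 & 1766604 , 434 , 0 & 503499234 , 6268612 , 7329 & 9743830173 , 937940605 , 10488989 & 11602594801 , 14578329717 , 635508342 & -51337120415 , 25598649776 , 5892949916 & 9384452560 , -38497751649 , 10938763920 & 21400016960 , -24625616400 , 3225717089 & [])

  ε₂ : List Row
  ε₂ = inflate₁ (0 , 0 , 0 & -811706 , 21 , 0 & -328015513 , -3314836 , -2261 & -6976003776 , -622530496 , -6257643 & -9080444800 , -10437221088 , -435011465 & 37827335168 , -19257984704 , -4241719104 & -6421925888 , 28049211904 , -8065516032 & -15971221504 , 18380673024 , -2409451520 & [])

  ε₃ : List Row
  ε₃ = inflate₁ (0 , 0 , 0 & 161637 , 0 , 0 & 90141940 , 763952 , 231 & 2080676591 , 173898935 , 1601642 & 2938126240 , 3115308672 , 124818288 & -11605758976 , 6023392816 , 1273473936 & 1820611072 , -8515290560 , 2478139328 & 4966420480 , -5716300800 , 749880320 & [])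

  ε₄ : List Row
  ε₄ = inflate₁ (0 , 0 , 0 & -18648 , 0 , 0 & -13365913 , -99328 , -8 & -331060814 , -26150306 , -225064 & -503718089 , -496306006 , -19207265 & 1897939736 , -1002852424 , -204117928 & -273456064 , 1378752984 , -406125720 & -823639040 , 948106880 , -124467840 & [])

  ε₅ : List Row
  ε₅ = inflate₁ (0 , 0 , 0 & 1344 , 0 , 0 & 1126580 , 7672 , 0 & 29647079 , 2230634 , 18249 & 48306454 , 44516304 , 1670998 & -174496497 , 93761549 , 18421795 & 22923376 , -125576759 , 37442223 & 76832000 , -88452840 , 11620840 & [])

  ε₆ : List Row
  ε₆ = inflate₁ (0 , 0 , 0 & -56 , 0 , 0 & -51114 , -329 , 0 & -1417136 , -102235 , -805 & -2458946 , -2131738 , -77889 & 8552460 , -4668426 , -887586 & -1015280 , 6100255 , -1841224 & -3822392 , 4401033 , -578641 & [])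

  ε₇ : List Row
  ε₇ = inflate₁ (0 , 0 , 0 & 1 , 0 , 0 & 974 , 6 , 0 & 28253 , 1965 , 15 & 51940 , 42581 , 1519 & -174587 , 96726 , 17836 & 18522 , -123480 , 37730 & 79233 , -91238 , 12005 & [])

  -- The coefficients in u⁷ = W(ε₁) u⁶ + ⋯ + W(ε₇). They come from the equation of g through w
  -- κ₂(q⁷)² = g w(q⁷).
  ε : List (List Row)
  ε = ε₁ ∷ ε₂ ∷ ε₃ ∷ ε₄ ∷ ε₅ ∷ ε₆ ∷ ε₇ ∷ []

  -- The values of `U` at w tʲ, w² tʲ, w³ tʲ for j = 0; the two tables after it are for j = 1 and 2.
  -- They are traced in the tower, where w tʲ is z^(3-j) y^(1+j) up to functions of q⁷.
  directT₀ : List (List Row)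
  directT₀ =
    inflate₁ (8 , 0 , 0 & -343 , -7 , 0 & 784 , -105 , 7 & -448 , 112 , -7 & []) ∷
    inflate₁ (64 , 0 , 0 & 4802 , 0 , 0 & -102214 , -1029 , -49 & 416500 , -24647 , 1911 & -697809 , 89131 , -5978 & 532336 , -101871 , 6517 & -153664 , 38416 , -2401 & []) ∷
    inflate₁ (-184 , 0 , 0 & 763745 , 6168 , 24 & -13650784 , -37884 , -10752 & 78758141 , -2564317 , 236866 & -199282314 , 17683365 , -1261211 & 177782388 , -38884881 , 2466170 & 148650712 , 11863341 , -511413 & -412527815 , 55513521 , -3697540 & 272945680 , -57530361 , 3647119 & -52706752 , 13176688 , -823543 & []) ∷ []

  directT₁ : List (List Row)
  directT₁ =
    inflate₁ (0 , 0 , 0 & -1029 , -7 , 0 & 14357 , 35 , 14 & -45591 , 3668 , -266 & 54096 , -9065 , 588 & -21952 , 5488 , -343 & []) ∷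
    inflate₁ (145 , 0 , 0 & -155412 , -1285 , -5 & 2927491 , 8750 , 2191 & -18866323 , 510482 , -50225 & 57992774 , -4120214 , 306005 & -89339838 , 11682923 , -781354 & 61002207 , -12876563 , 816340 & -6184976 , 3075681 , -184877 & -7529536 , 1882384 , -117649 & []) ∷
    inflate₁ (4292 , 0 , 0 & -4830211 , -38036 , -148 & 107996154 , 456911 , 66304 & -915711167 , 15033935 , -1806189 & 4350693634 , -178201191 , 15055642 & -13742991290 , 871144883 , -65879667 & 31175131428 , -2643765110 , 188872264 & -50592952417 , 5628445809 , -384712230 & 55761508285 , -8040720905 , 530596990 & -38779816327 , 6986938812 , -449654478 & 15219074640 , -3280171769 , 207532836 & -2582630848 , 645657712 , -40353607 & []) ∷ []

  directT₂ : List (List Row)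
  directT₂ =
    inflate₁ (-29 , 0 , 0 & 30465 , 250 , 1 & -600894 , -2016 , -427 & 4103316 , -100121 , 10248 & -13488965 , 888321 , -67032 & 22969338 , -2751889 , 186249 & -19438496 , 3548678 , -228095 & 6453888 , -1613472 , 100842 & []) ∷
    inflate₁ (-696 , 0 , 0 & 790156 , 6168 , 24 & -17852877 , -78358 , -10801 & 148210006 , -2518600 , 298998 & -655962265 , 29675968 , -2444365 & 1814362984 , -133796754 , 9814602 & -3409720125 , 342257748 , -23765098 & 4419400650 , -573959050 , 38387188 & -3734767505 , 621774965 , -40353607 & 1805206256 , -376359151 , 23882747 & -368947264 , 92236816 , -5764801 & []) ∷
    inflate₁ (-10440 , 0 , 0 & 11691473 , 92520 , 360 & -231350434 , -938014 , -161280 & 936244421 , -46015900 , 4030789 & 7705766656 , 374014746 , -16455082 & -100207749782 , 738457048 , -143056725 & 517467563284 , -19592726636 , 1699523840 & -1602859387920 , 106169634123 , -7966954982 & 3268340044368 , -311799379899 , 21832242579 & -4496105831581 , 565294738974 , -37966155843 & 4136002595858 , -648563171704 , 42371287350 & -2440626504967 , 459102986839 , -29417779503 & 836126737040 , -183326436601 , 11581485209 & -126548911552 , 31637227888 , -1977326743 & []) ∷ []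

  -- The values of `U` at tʲ, u tʲ, u² tʲ, u³ tʲ, reached by the recurrence. Together with the
  -- direct ones they cover the seven exponents -3, ..., 3 of `u`.
  nextT₀ : List (List Row)
  nextT₀ =
    inflate₁ (1 , 0 , 0 & []) ∷
    inflate₁ (0 , 0 , 0 & 252372 , 62 , 0 & 71928462 , 895516 , 1047 & 1391975739 , 133991515 , 1498427 & 1657513543 , 2082618531 , 90786906 & -7333874345 , 3656949968 , 841849988 & 1340636080 , -5499678807 , 1562680560 & 3057145280 , -3517945200 , 460816727 & []) ∷
    inflate₁ (0 , 0 , 0 & 6129656 , 6 , 0 & 165486266175 , 92240437 , 3198 & 184487022344660 , 745380043765 , 708991297 & 35428280876993053 , 506264833582221 , 1958321659301 & 1933288322308668430 , 74154658031535627 , 709208226650665 & 37323799240897193703 , 3440492570179800940 , 66771814221250922 & 271588584996068884950 , 60779275677695170540 , 2225358923742188892 & 626663221901524969539 , 438891814765828888562 , 30828341319183587767 & -337249114440487257792 , 1224340603049658535364 , 192921164969166289180 & -1940183655243534762999 , 672774929184708536536 , 562900279822682472244 & -338235315567459817794 , -1790004774294430393210 , 755302591692079181576 & 1269490746064801975057 , -2152242233889382659325 , 434756900618713595531 & 505902944539336036112 , -625116150116861393809 , 90789148311885384781 & 32880790981564018752 , -37337524698617965584 , 4456733717336422081 & []) ∷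
    inflate₁ (0 , 0 , 0 & 9265250 , 0 , 0 & 8506147111063 , 534767556 , 657 & 124803098017821977 , 84326115990071 , 12913032802 & 234705799819374198973 , 613705879153583685 , 538927442229771 & 113701822703894306453719 , 780756412725989774214 , 1922491973550294951 & 19873153663350301642500039 , 294462375936943705935451 , 1504052007611895069482 & 1515549819663577871670680932 , 43315914686134388087043828 , 392691661582015547370605 & 56571591788678362965363521377 , 2922086027877748757173294776 , 43071103489952546910771751 & 1107309146443778610246480264468 , 100063173854336509640277561646 , 2284227468926403669202973264 & 11755238557280191296452165215116 , 1854082638322135013811152081052 , 64164582995135508118881196164 & 67366026132979556179767472922810 , 19270954445683973612156805544470 , 1014188422354007120281719802053 & 192456051821159927790256960803726 , 113423122520914534215021326074533 , 9383624935624028698351961896377 & 174663853089662647658599718547152 , 367155055929375072987016279391949 , 52042238298930836597129592649658 & -320371912327041529464333311910618 , 571626214320479176742528960116032 , 174834047719308305144354133783649 & -751898756997421338592065987731803 , 122136205749537035688083749277792 , 355031592259138468128907954497562 & -241467199634948423406711213393285 , -844434084114760718442063134436411 , 428947784321141556463745356544724 & 445876399911325680529101149381234 , -1143085472972349869449619225808309 , 298298884049024254218914156944620 & 392795817137971673582630901810621 , -603496878655829266847981272120734 , 112631903010313445587241597242128 & 108426448931155592466024999660807 , -138233480047223573796554792254422 , 20863179285113620470283583891765 & 10279579408047106612743055832624 , -12045765580604382555772303933767 , 1566120013388003588773405632646 & 230392436295257977346957654464 , -260718713421243633671003410032 , 30326277125985661071607265511 & []) ∷ []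

  nextT₁ : List (List Row)
  nextT₁ =
    inflate₁ (1 , 0 , 0 & 48 , 1 , 0 & -64 , 16 , -1 & []) ∷
    inflate₁ (0 , 0 , 0 & 2028845 , 574 , 0 & 575439438 , 7180019 , 8624 & 11135671547 , 1071939435 , 11993387 & 13260462663 , 16660894691 , 726300442 & -58671549097 , 29255666384 , 6734795396 & 10725555120 , -43997515863 , 12501449968 & 24457008576 , -28143523184 , 3686531415 & []) ∷
    inflate₁ (0 , 0 , 0 & 54794187 , 147 , 0 & 1344409665965 , 781035860 , 33595 & 1480295822902967 , 6023403406839 , 5841053477 & 283597723024600348 , 4058969523277144 , 15755813937983 & 15467966197586674653 , 593522307109742171 , 5680900924184269 & 298593489673474952215 , 27526534517437844637 , 534329762967965146 & 2172702920914533447062 , 486240437985392495356 , 17803972756722476331 & 5013298103159698729027 , 3511132860711433918450 , 246629509513862273463 & -2697987431952045426368 , 9794714058609555918276 , 1543371706417485756700 & -15521465912461513655287 , 5382195433111709460696 , 4503202798864543825716 & -2705882398148015937858 , -14320038336480917824378 , 6042420749327886003976 & 10155925968476354988817 , -17217937871107329029373 , 3478055204949212167819 & 4047223556330276310800 , -5000929200938263559057 , 726313186495296375885 & 263046327849929519168 , -298700197588298066960 , 35653869738651023041 & []) ∷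
    inflate₁ (0 , 0 , 0 & 101941784 , 1 , 0 & 72582530800041 , 5092558818 , 10906 & 1018172638232542420 , 705128669579135 , 114575719641 & 1890624736611348886946 , 4982613620145520618 , 4440081942268504 & 911965506173165457389845 , 6280405478395109210009 , 15537683482744315368 & 159142031466325230797801894 , 2360740180431233611459687 , 12079113238944781015588 & 12128896760409241015916293994 , 346819650467374490282893632 , 3146349271105900025146281 & 452632730899960791709810370684 , 23384351116222501155525492410 , 344780184513735326663212374 & 8858849072538689018243836563540 , 800603129631143275156390839826 , 18278265489494862210943480652 & 94042894060528125333637465547805 , 14833283185469713160643730417204 , 513364841058479857313288455768 & 538928515178483917423291491092712 , 154169532683658034630933062895692 , 8113787649356791259876843389453 & 1539645851982790545274674640170343 , 907387118958401190624508873104512 , 75069889846120319100634336416092 & 1397308151391179920751483791972960 , 2937239183141513451685920325390452 , 416339442900700358544295698211759 & -2562974238829484674233291467120794 , 4573005132997629791183357239116976 , 1398673778836337909326659173983082 & -6015188009526665527052951517585755 , 977086389190827981490981032366176 , 2840253364542092223114080101083162 & -1931736945859178260665879347070341 , -6755473492594088974635119834016827 , 3431582396359978400260873100737236 & 3567011253198191619141940571218546 , -9144683845972788156791469016976821 , 2386391080191600054463598331862252 & 3142366537660341391872897708099005 , -4827975029872773134373940222049694 , 901055224152078564615430990564112 & 867411591449244738080297866996999 , -1105867840377788590033686675078102 , 166905434280908963740745469536565 & 82236635264376853294151160788528 , -96366124644835060535413210054983 , 12528960107104028715806807664774 & 1843139490362063775369384573376 , -2085749707369949058516458114672 , 242610217007885287894635051239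 & []) ∷ []

  nextT₂ : List (List Row)
  nextT₂ =
    inflate₁ (9 , 0 , 0 & 194 , 2 , 0 & -1921 , 13 , -3 & 4592 , -511 , 35 & -3136 , 784 , -49 & []) ∷
    inflate₁ (5 , 0 , 0 & 16314349 , 5255 , 0 & 4603511950 , 57566883 , 70912 & 89084983547 , 8575558187 , 95996523 & 106084256327 , 133286878179 , 5810433818 & -469372947113 , 234045397712 , 53878358660 & 85804907440 , -351980212311 , 100011605232 & 195655914944 , -225148147056 , 29492248919 & []) ∷
    inflate₁ (0 , 0 , 0 & 486423392 , 2464 , 0 & 10920009765595 , 6600357232 , 341306 & 11877574849250698 , 48671203521514 , 48093391416 & 2270153605870623067 , 32542579683183507 , 126761163463977 & 123757006471946344364 , 4750458829038931883 , 45505095010493041 & 2388772683385995161927 , 220233027742967322062 , 4275880109877771850 & 17381577294842179447126 , 3889973364368986902028 , 142440592991479194874 & 40106323449039543576643 , 28089049626356752832498 , 1973058307795014474167 & -21583855587396726671040 , 78357626342609108323780 , 12346992744650729896220 & -124171700663307078140919 , 43057531461905282148568 , 36025626873185110114100 & -21647058174519901935938 , -114560307828779450606458 , 48339366120948410953480 & 81247407747768779098897 , -137743502968850899989757 , 27824441639593200746123 & 32377788450657798508304 , -40007433607509480881041 , 5810505491962584304717 & 2104370622796853522496 , -2389601580705738877968 , 285230957909167830721 & []) ∷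
    inflate₁ (0 , 0 , 0 & 1087950073 , 78 , 0 & 618253896323079 , 47999875764 , 159142 & 8304840463378143203 , 5891158951615614 , 1012473489126 & 15229108048080331667038 , 40448693039507509330 , 36565634092016127 & 7314546912265181969851674 , 50518670517843126079180 , 125569124116145208093 & 1274390967597619157371468341 , 18926278351246474090660652 , 97007017532645789515086 & 97067161880786743078323422000 , 2776896353800486622768417564 , 25209339799474156004178668 & 3621541824937262023625244694935 , 187136115586518381480607585980 , 2759932575489929557163536517 & 70873799785519201596832213181332 , 6405606957215479055397444647670 , 146261691363997622726990214216 & 752351037286996291574953909396654 , 118671242120280968641377813953484 , 4107304149750207508447261406252 & 4311430570342345207304951291605270 , 1233371438400434204312765628618370 , 64912543365094625225612808551253 & 12317146315180569254994686666327872 , 7259114061978670923606378028807771 , 600566241661465324029396186475775 & 11178443824524516539728108191204848 , 23497903350779209623514986860257819 , 3330727835280358507897112679157668 & -20503785432340833911338194058092122 , 36584004411451110653168718678152224 , 11189401407345710673448585009500787 & -48121487704591682691738828762964315 , 7816665059082877410921138427203680 , 22722031928088613610172981436229658 & -15453890357110153143543123772966277 , -54043794498160737603669454547561531 , 27452660145206594789821158781893332 & 28536090456846222406166043056087666 , -73157471265334218872684104770489781 , 19091128703928048601978918068722924 & 25138932305735275130742008131519933 , -38623800243991297066196959791234462 , 7208441793773196515909318133779216 & 6939292731593957902994480805686535 , -8846942723022308719930741737667542 , 1335243474247271709904440554694965 & 657893082115014826745416000435760 , -770928997158680484372540459024711 , 100231680856832229732074023921798 & 14745115922896510159548799924672 ,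 -16685997658959592457280095751792 , 1940881736063082302478857337063 & []) ∷ []

  -- The values of `U` at A w³ tʲ and A w⁴ tʲ. Up to functions of q⁷, A wᵏ tʲ is z^(3k-5-j)
  -- y^(k+2+j), and k = 3 is the least k for which the exponent of z is nonnegative for all j ≤ 2.
  directA₀ : List (List Row)
  directA₀ =
    inflate₂ (14 , 0 , 0 & 35644 , 182 , 1 & -5221328 , -30870 , -3150 & 32600120 , -966875 , 91511 & -103787194 , 6947857 , -521213 & 192058391 , -20598179 , 1416590 & -208416404 , 31666789 , -2076865 & 122623872 , -24538220 , 1563051 & -30118144 , 7529536 , -470596 & []) ∷
    inflate₂ (-1036 , 0 , 0 & 1593347 , 11606 , 49 & -267865269 , -1279229 , -149800 & 2526021687 , -33082399 , 4432736 & -13074350765 , 473987731 , -41689494 & 40519150119 , -2697250129 , 202643371 & -73071088006 , 8085444332 , -554496544 & 56793962295 , -12288488471 , 780332203 & 47385958326 , 3933006070 , -173649924 & -164963898330 , 16950985569 , -1174372318 & 174517820673 , -28345526517 , 1844736320 & -88455106544 , 18441598399 , -1170254603 & 18078415936 , -4519603984 , 282475249 & []) ∷ []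

  directA₁ : List (List Row)
  directA₁ =
    inflate₂ (266 , 0 , 0 & -355439 , -2828 , -6 & 62241928 , 286713 , 33824 & -645394281 , 6697453 , -1015665 & 3753145102 , -115017161 , 10659754 & -13733119064 , 754030277 , -59042305 & 33190602858 , -2743584284 , 197016456 & -53730180651 , 6093394657 , -415300970 & 57564832157 , -8427315519 , 555067982 & -39096056839 , 7065998940 , -454595736 & 15219074640 , -3280171769 , 207532836 & -2582630848 , 645657712 , -40353607 & []) ∷
    inflate₂ (5390 , 0 , 0 & -7494354 , -54782 , -154 & 1490669327 , 8266643 , 688646 & -16264452008 , 142806335 , -24117212 & 92141820239 , -2960179131 , 270896059 & -312654071758 , 18944806153 , -1449133840 & 737169963824 , -61143030452 , 4366763527 & -1643787172461 , 125076517510 , -9046434978 & 4315032490979 , -274507235177 , 20713635887 & -10284801931726 , 814974035085 , -58990385090 & 17416668664409 , -1914761357747 , 131120398745 & -19308272816539 , 2796141782637 , -184415983990 & 13337633832033 , -2405559220484 , 154796436452 & -5220142601520 , 1125098916767 , -71183762748 & 885842380864 , -221460595216 , 13841287201 & []) ∷ []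

  directA₂ : List (List Row)
  directA₂ =
    inflate₂ (-728 , 0 , 0 & 1175153 , 7812 , 22 & -263348582 , -1673182 , -103712 & 2959824819 , -22898204 , 4233215 & -15164972760 , 563135734 , -49766066 & 29591390668 , -3452766968 , 239172871 & 67046532420 , 6804318752 , -335755840 & -571471849298 , 16905472213 , -1610917336 & 1670551798944 , -125918430561 , 9211093157 & -2837012574641 , 319608802870 , -21806595097 & 3030982480974 , -448132570536 , 29481192314 & -2014492415047 , 367258177307 , -23606860095 & 763813073296 , -165248020665 , 10451584213 & -126548911552 , 31637227888 , -1977326743 & []) ∷
    inflate₂ (-8078 , 1 , 0 & 9959628 , 80310 , 246 & -325342451 , -459585 , -981120 & -49480486699 , -691346194 , 12688697 & 1021210552173 , 2330038053 , 731167122 & -9599065741258 , 127347071866 , -16796476760 & 54725211253608 , -1712527163795 , 157086608693 & -210625393564173 , 10746741452762 , -855096881975 & 576688050842897 , -41529026158802 , 3058747880272 & -1152436461240806 , 108404832885524 , -7603788989860 & 1693952876820120 , -198490953164336 , 13458994422685 & -1816652198384345 , 256935652897735 , -16991935421132 & 1384430121190683 , -231078030018703 , 14990961464430 & -710360564402979 , 137523074975650 , -8787240045892 & 219910371049488 , -48679807085917 , 3072765758622 & -31004483330240 , 7751120832560 , -484445052035 & []) ∷ []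

  -- The values of `U` at A uⁱ tʲ for i = -2, ..., 2, which with the direct ones cover the exponents
  -- -4, ..., 2.
  nextA₀ : List (List Row)
  nextA₀ =
    inflate₂ (6 , 0 , 0 & -684 , -22 , 0 & -43030 , -2861 , 125 & 283430 , -10661 , 945 & -570801 , 66297 , -4508 & 488432 , -90895 , 5831 & -153664 , 38416 , -2401 & []) ∷
    inflate₂ (2 , 0 , 0 & -81 , 9 , 0 & 912 , -137 , 9 & -448 , 112 , -7 & []) ∷
    inflate₂ (0 , 0 , 0 & 2647568 , 371 , 0 & 10203888576 , 78499344 , 59185 & 402521477120 , 21216493312 , 163930368 & 2204155928576 , 641324716032 , 17785098240 & -1633881489408 , 3437972815872 , 312606916608 & -6066591498240 , 825872875520 , 1306920222720 & 3554894938112 , -6388488601600 , 1353226649600 & 1732130111488 , -1983893209088 , 251763097600 & []) ∷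
    inflate₂ (0 , 0 , 0 & 43438654 , 43 , 0 & 12034558023320 , 5200827323 , 139525 & 18607555046304379 , 59430144092408 , 45447964661 & 4856004513312438948 , 54741845763372978 , 174981332016232 & 361581318204179078061 , 10742228412066152428 , 85390472120854824 & 9785094590010210703036 , 672000270460004544534 , 10731027575485835646 & 106665097272055112859047 , 16386760465523325764635 , 479915777705189312529 & 455929674716215672468720 , 171573391650125116100953 , 9074728604841401383637 & 468712211635520082564544 , 780087878282595304204944 , 79816781804349568319831 & -1091886114809725212164096 , 1315596755702887854637056 , 342396824351984274374656 & -1743929803780776469200896 , -177579851784334786691072 , 723620132099399864025088 & 436157707608846493548544 , -2340923100333793825783808 , 732863349731032454660096 & 1164277116315460907827200 , -1774727075412534362112000 , 328694065025104679534592 & 320279504170466769108992 , -389262611340797614751744 , 54851497822364693954560 & 16327887723866699595776 , -18524166099767247503360 , 2196278375900547907584 & []) ∷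
    inflate₂ (0 , 0 , 0 & 58395799 , 0 , 0 & 483024551008615 , 25437345549 , 29183 & 9045538674311770148 , 5174829977200422 , 670616843974 & 21185897412737099645442 , 47333226136060064627 , 35944776645757056 & 12609085319446134358773591 , 74170082901240865284172 , 160143885596147395656 & 2692693280851851098554766313 , 34095188408626426286147642 , 153731026636632562155850 & 251051234452347745964242272088 , 6090110558830841954248282228 , 48803432570945315151227003 & 11526980385537679223413116403840 , 499514670820223217567047084571 , 6487406888594146154823499001 & 280969015646091900848022340883068 , 20917781291966178895258793240802 , 417414896682227720314406318223 & 3794595403734805297647178945240875 , 479014982483750487696754118773382 , 14291432751960441122758186139064 & 28758714799613940105166961580596845 , 6258027313407433677972323774020033 , 277531827200322028351384792086200 & 118645325426859538277112773232010878 , 47578590869907072650346468828331587 , 3191255632530398886500579051166738 & 229567853041697070398765219918337729 , 209177091088947495370040672857659444 , 22339459419004445221657664802912656 & 36332224364922033987883670955310337 , 502949593066776200651974067513034880 , 96684964982113701240216572479773277 & -560980790657320296276005480590596144 , 517700463454783783929517179238280767 , 259873851964208839872998238492873136 & -694026297181124138922857206361771968 , -233066839814108554607895845938359312 , 430945426075586483636384827933456065 & 33403247905497424535319702096838656 , -1115242368943268801140699950905032704 , 432490980692648676048877692634791936 & 513404474585119619174184762193477632 , -1075984644677576695746383717077090304 , 253445355718854806389548481983283200 & 314539356294992151033382510130102272 , -459472579792119389809995138040070144 , 81636402019179278930453079110189056 & 70551215173234039829836728444649472 , -88522007598276228658456642839379968 , 13037411404432542519785962134831104 & 5674719300909734001308246185345024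 , -6622098235147568761796556834734080 , 851591533450836597939099838447616 & 110253253150748905464805913001984 , -124719105514499648380401015062528 , 14465852363750742915595102060544 & []) ∷ []

  nextA₁ : List (List Row)
  nextA₁ =
    inflate₂ (10 , 0 , 0 & -13439 , -130 , 0 & 1497639 , 715 , 1389 & -8973552 , 275793 , -25760 & 28259231 , -1907031 , 142835 & -51576567 , 5607707 , -384846 & 54822033 , -8432312 , 552230 & -31462704 , 6336239 , -403368 & 7529536 , -1882384 , 117649 & []) ∷
    inflate₂ (10 , 0 , 0 & 967 , 101 , 0 & -43803 , 1611 , -144 & 87479 , -10318 , 700 & -72912 , 13769 , -882 & 21952 , -5488 , 343 & []) ∷
    inflate₂ (1 , 0 , 0 & 21409456 , 3641 , 0 & 81649749056 , 630987376 , 494929 & 3220132765696 , 169757084672 , 1313313792 & 17633254080512 , 5130572382208 , 142288240640 & -13071039070208 , 27503768076288 , 2500856938496 & -48532731985920 , 6606983004160 , 10455361781760 & 28439159504896 , -51107908812800 , 10825813196800 & 13857040891904 , -15871145672704 , 2014104780800 & []) ∷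
    inflate₂ (0 , 0 , 0 & 394262015 , 926 , 0 & 98150250938264 , 44459946620 , 1494957 & 149470461241667003 , 481532076830104 , 376712067925 & 38884586466244483748 , 439255671933552754 , 1410259689232296 & 2893242391401850768301 , 86001882741266318316 , 684365012600112424 & 78283454751712763500220 , 5376941321312282304534 , 85887971987489880446 & 853321590685875168279975 , 131098557569906001019931 , 3839765593201298376721 & 3647428613654309060375792 , 1372592072554942463758681 , 72599697278419720993493 & 3749694628755217433253312 , 6240696673540285097044624 , 638537366636633769640279 & -8735082822681726589861888 , 10524764297260253505912832 , 2739176479721795056828416 & -13951436391871629473349632 , -1420641229475697047633920 , 5788961384102371860152320 & 3489261717464215977984000 , -18727384866337975139565568 , 5862906804922440140980224 & 9314216930523687262617600 , -14197816603300274896896000 , 2629552520200837436276736 & 2562236033363734152871936 , -3114100890726380918013952 , 438811982578917551636480 & 130623101790933596766208 , -148193328798137980026880 , 17570227007204383260672 & []) ∷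
    inflate₂ (0 , 0 , 0 & 649937358 , 12 , 0 & 4149358871570031 , 244989326563 , 476026 & 74004009059167288519 , 43487961056354189 , 6003431893940 & 170873649222919099076102 , 385135762261156026981 , 297250594859060920 & 101192700829095704635602348 , 597231615365828961458584 , 1296440817469279807920 & 21568787352284660726532835205 , 273478831829879901669329536 , 1235578850240376572109368 & 2009419077100044768525070897655 , 48773559950060232872255664679 , 391171888176052419209025364 & 92233667278485453670879534430448 , 3997884886892267076803347996284 , 51940500121863141828791713206 & 2247907666434663543384264571209276 , 167371704617218348362683973594098 , 3340423618417241957970012287070 & 30357411366690375337844489700089643 , 3832373806321359612715034742114950 , 114346916812251692318308419665336 & 230070721951220684868403552739810925 , 50065347928428277930505119171656129 , 2220373158868061350097148326459064 & 949161902337473660238368709575419518 , 380631097439554721753892605465280067 , 25530556280152725768393365443697682 & 1836539584057141155951383988798183105 , 1673418020026402873508843726716049460 , 178716922949206637118747989787408784 & 290656239691280325560525139824033025 , 4023593848992497833954318514795939968 , 773481421035308706403422712250079837 & -4487844486492234043608201536371021872 , 4141598911114277588096717161628364351 , 2078992066009166414572599501360779696 & -5552208656013470314396671936083152832 , -1864537274836903408126393631773781008 , 3447563870324518123241918676470331073 & 267226402730393329802684029326065664 , -8921939470814770901761802616908546048 , 3459927920626804150751817444626530304 & 4107235825203953762828824478996234240 , -8607877190237532487192118922718478336 , 2027562849826585907319460006025232384 & 2516314850609279671790066543320104960 , -3675780638617465389943343374384758784 , 653091216184602039384000440666423296 & 564409721385872318638693827557195776 , -708176060786209829267653142715039744 ,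 104299291235460340158287697078648832 & 45397754407277872010465969482760192 , -52976785881180550094372454677872640 , 6812732267606692783512798707580928 & 882026025205991243718447304015872 , -997752844115997187043208120500224 , 115726818910005943324760816484352 & []) ∷ []

  nextA₂ : List (List Row)
  nextA₂ =
    inflate₂ (-34 , 0 , 0 & 50377 , 358 , 1 & -9896893 , -56688 , -4591 & 103116545 , -1033046 , 161371 & -561483209 , 19123132 , -1716127 & 1828990219 , -115597860 , 8770510 & -3766787241 , 362061196 , -25330550 & 4954552337 , -654010791 , 43647779 & -4037831329 , 686834862 , -44471322 & 1857913008 , -389535839 , 24706290 & -368947264 , 92236816 , -5764801 & []) ∷
    inflate₂ (72 , 0 , 0 & 16782 , 905 , 0 & -1127488 , 15949 , -2133 & 4095777 , -250026 , 19173 & -7793058 , 839860 , -57722 & 8276247 , -1284535 , 84035 & -4648336 , 943593 , -60025 & 1075648 , -268912 , 16807 & []) ∷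
    inflate₂ (31 , 0 , 0 & 173106606 , 34590 , 0 & 653347116159 , 5071839501 , 4131053 & 25760749720048 , 1358257782273 , 10521477155 & 141066085856192 , 41044376290064 , 1138365562831 & -104568209801216 , 220030029004800 , 20006868353024 & -388261855887360 , 52855864033280 , 83642894254080 & 227513276039168 , -408863270502400 , 86606505574400 & 110856327135232 , -126969165381632 , 16112838246400 & []) ∷
    inflate₂ (0 , 0 , 0 & 3549331919 , 15130 , 0 & 800273935236888 , 379134619196 , 15466230 & 1200647077069935035 , 3901153742898520 , 3120035059605 & 311369112241161661092 , 3524617752675180658 , 11365492060520360 & 23150673884291107556269 , 688527532991807304684 , 5484852486722688296 & 626289222218217988871868 , 43023043838163210231830 , 687421797424106305918 & 6826579225590914638609831 , 1048824251273895257015323 , 30721639728914471323665 & 29179358636644998963950832 , 10980776095255200845025625 , 580812525746879952059093 & 29997532515410193648997824 , 49925522566558462083328656 , 5108323830707767941792087 & -69880613815085211859288064 , 84198036391179233397833728 , 21913426917021727349276672 & -111611474827976377544736768 , -11365149157413726413914112 , 46311693691276358464831488 & 27914094192461280060637184 , -149819079440044797382885376 , 46903254495972965157437440 & 74513735444189498100940800 , -113582532826402199175168000 , 21036420161606699490213888 & 20497888266909873222975488 , -24912807125811047344111616 , 3510495860631340413091840 & 1044984814327468774129664 , -1185546630385103840215040 , 140561816057635066085376 & []) ∷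
    inflate₂ (0 , 0 , 0 & 7015800421 , 611 , 0 & 35572714620657879 , 2333851746896 , 6917822 & 605298617368706016346 , 365094569212535765 , 53500888134977 & 1378119806409072890867914 , 3133283846924503235943 , 2456945149714599712 & 812104645556073735417684993 , 4808906487151852214015460 , 10494527702445003623448 & 172768305943178254626383592225 , 2193574627262316183278202054 , 9930561753000887510217510 & 16083427081971354803770322298006 , 390610014530512686020809311194 , 3135334365665327517029193261 & 738011935428791931297622756356448 , 31997220630369826127583075226333 , 415854033677880674034505301619 & 17984505665354432295197146713012732 , 1339209277430360243235688431447810 , 26732225145547996262454155554861 & 242864476019283378308443593555156779 , 30661022032706495243848031615076998 , 914898975609733709324566311370168 & 1840573804030287353024720080720518765 , 400531818795356052338549958159153601 , 17763933606857332890619101664523960 & 7593289610084057375747638803906406014 , 3045067743340095513628341754200669763 , 204248540006360990357115658028571666 & 14692290750254960206631692441812162241 , 13387354490715608455855596459316254772 , 1429745364373651252234078115672226192 & 2325237475708037269777211506053037313 , 32188727627603174400652029441270188160 , 6187864977710101235063481680825522781 & -35902741181807115112965083028066523184 , 33132752916722131044729577007532928575 , 16631946530437314451516711960674881968 & -44417655476623580139283889752098623424 , -14916318649287507035116963972845104144 , 27580514656354755019142069836066584257 & 2137814577734458106582483535019376640 , -71375519920667131155184045012614643712 , 27679423965699351144900906785397800960 & 32857886829815604578113366883557179392 , -68863017784435611267305344870561873920 , 16220502831218666908180257249473593344 & 20130518806868977082504584044795133952 , -29406245111183805291253805155591651328 , 5224729729726158778595009987610673152 & 4515277771086978549109550620457566208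 , -5665408486289678634141225141720317952 , 834394329883682721266301576629190656 & 363182035258222976083727755862081536 , -423814287049444400754979637422981120 , 54501858140853542268102389660647424 & 7056208201647929949747578432126976 , -7982022752927977496345664964001792 , 925814551280047546598086531874816 & []) ∷ []

open Tables using (ε₁; ε₂; ε₃; ε₄; ε₅; ε₆; ε₇; ε; directT₀; directT₁; directT₂; nextT₀; nextT₁; nextT₂; directA₀; directA₁; directA₂; nextA₀; nextA₁; nextA₂)

difference : P₂ → P₂ → P₂
difference x y = x ⊹₂ scale₂ −1 y

-- By the relation `Entry` below, U(H wᵏ tʲ) is w^(-3(k+j)) μ^(2(k+j)) κ₁ʲ times the projected
-- trace. The largest value of k + j is 9 + 2, which is where the height 33 comes from.
normalise : ℕ → ℕ → K₆ → P₂
normalise j k x = iter υ (height N.∸ 3 N.* (k N.+ j)) (iter ×μ (2 N.* (k N.+ j)) (iter κ₁ j (project x)))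

directs : ℕ → ℕ → List K₆ → List P₂
directs j k [] = []
directs j k (x ∷ xs) = normalise j k x ∷ directs j (suc k) xs

allProject : List K₆ → Bool
allProject [] = true
allProject (x ∷ xs) = projects x ∧ allProject xs

check-directs : List P₂ → List (List Row) → Bool
check-directs _ [] = true
check-directs [] (_ ∷ _) = false
check-directs (x ∷ xs) (l ∷ ls) = vanishes₂ (difference (pack l) x) ∧ check-directs xs ls

combine : List (List Row) → List P₂ → P₂
combine (e ∷ es) (x ∷ xs) = act e x ⊹₂ combine es xs
combine _ _ = 0₂

-- The previous values are listed with the highest exponent of `u` at the head, matching the order
-- of `ε`. Each ε has eight rows, so `act` introduces the factor w⁷, matched by `iter υ 7` on the
-- new entry.
check-next-aux : P₂ → List P₂ → List (List Row) → Bool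
check-next : List P₂ → List (List Row) → Bool
check-next prev [] = true
check-next prev (l ∷ ls) = check-next-aux (pack l) prev ls
check-next-aux x prev ls = vanishes₂ (difference (iter υ 7 x) (combine ε prev)) ∧ check-next (x ∷ prev) ls

check-window-aux : List P₂ → List (List Row) → List (List Row) → Bool
check-window-aux xs ds ns = check-directs xs ds ∧ check-next xs ns

check-window : (j k : ℕ) → List K₆ → (direct next : List (List Row)) → Bool
check-window j k xs ds ns = allProject xs ∧ check-window-aux (directs j k xs) ds ns

seed : ℕ → ℕ → V₇
seed m n = iter ×z m (iter ×y n 1₇)

-- Denominator-free form of the passage from the equation of g to that of u: w^(k+7) ε₍ₖ₊₁₎ = t⁶
-- κ₂^(2k) S₍₆₋ₖ₎, with S₀ = 1.
check-ε : ℕ → List (List Row) → List P₂ → Bool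
check-ε k (e ∷ es) (c ∷ cs) = vanishes₂ (difference (iter υ k (evalRows 0₂ e)) (iter τ 6 (iter κ₂ (2 N.* k) c))) ∧ check-ε (suc k) es cs
check-ε k _ _ = true

descending : List P₂
descending = S₆ ∷ S₅ ∷ S₄ ∷ S₃ ∷ S₂ ∷ S₁ ∷ 1₂ ∷ []

ε-check : check-ε 0 ε descending ≡ true
ε-check = refl

-- The norm of g, namely S₇ = -w⁶ κ₂²/t⁶. After reversal of the equation this is the coefficient of
-- u⁷, by which the other coefficients are divided.
constant-check : vanishes₂ (iter τ 6 S₇ ⊹₂ iter υ 6 (iter κ₂ 2 1₂)) ≡ true
constant-check = refl

windowT₀ : check-window 0 1 (orbit 7 (seed 3 1)) directT₀ nextT₀ ≡ true
windowT₀ = refl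

windowT₁ : check-window 1 1 (orbit 7 (seed 2 2)) directT₁ nextT₁ ≡ true
windowT₁ = refl

windowT₂ : check-window 2 1 (orbit 7 (seed 1 3)) directT₂ nextT₂ ≡ true
windowT₂ = refl

windowA₀ : check-window 0 3 (orbit 7 (seed 4 5)) directA₀ nextA₀ ≡ true
windowA₀ = refl

windowA₁ : check-window 1 3 (orbit 7 (seed 3 6)) directA₁ nextA₁ ≡ true
windowA₁ = refl

windowA₂ : check-window 2 3 (orbit 7 (seed 2 7)) directA₂ nextA₂ ≡ true
windowA₂ = refl

-- Soundness of the packed computations in an arbitrary commutative ring

∧-true : ∀ {a b} → a ∧ b ≡ true → (a ≡ true) × (b ≡ true)
∧-true {true} {true} refl = refl , refl

isZeroℤ⇒≡0 : ∀ z → isZeroℤ z ≡ true → z ≡ + 0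
isZeroℤ⇒≡0 (+ zero) _ = refl
isZeroℤ⇒≡0 (+ suc _) ()
isZeroℤ⇒≡0 -[1+ _ ] ()

-1ℤ : ℤ
-1ℤ = −1

module Eval (R : CommutativeRing 0ℓ 0ℓ) (s : CommutativeRing.Carrier R) where
  open Ring R

  opaque
    ⟦_⟧ᵖ : Packed → Carrier
    ⟦ x ⟧ᵖ = eval 1 (poly x) (s ∷ [])

    ⟦⟧-⊹ : ∀ x y → ⟦ x ⊹ y ⟧ᵖ ≈ ⟦ x ⟧ᵖ + ⟦ y ⟧ᵖ
    ⟦⟧-⊹ (packed x _ _ _ _) (packed y _ _ _ _) = eval-+ 1 x y (s ∷ [])

    ⟦⟧-◂ : ∀ c x → ⟦ c ◂ x ⟧ᵖ ≈ ι c * ⟦ x ⟧ᵖ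
    ⟦⟧-◂ c (packed x _ _ _ _) = eval-scale 0 c x s []

    ⟦⟧-shift : ∀ x → ⟦ shift x ⟧ᵖ ≈ s * ⟦ x ⟧ᵖ
    ⟦⟧-shift (packed x _ _ _ _) = +-congʳ ι-0 ⨾ +-identityˡ _

    ⟦⟧-[] : ⟦ lit [] ⟧ᵖ ≈ 0#
    ⟦⟧-[] = ≈-refl

    ⟦⟧-∷ : ∀ c p → ⟦ lit (c ∷ p) ⟧ᵖ ≈ ι c + s * ⟦ lit p ⟧ᵖ
    ⟦⟧-∷ c p = ≈-refl

    vanishes⇒≈0 : ∀ x → vanishes x ≡ true → ⟦ x ⟧ᵖ ≈ 0#
    vanishes⇒≈0 (packed p v β v≡ ≤β) eq = go p (trans (sym v≡) (isZeroℤ⇒≡0 v (proj₁ (∧-true eq))))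
      (N.≤-<-trans ≤β (N.<ᵇ⇒< β base (subst Data.Bool.T (sym (proj₂ (∧-true {isZeroℤ v} eq))) tt)))
      where
      go : ∀ p → evalℤ p ≡ + 0 → norm p N.< base → eval 1 p (s ∷ []) ≈ 0#
      go [] _ _ = ≈-refl
      go (c ∷ p) e l = +-cong (reflexive (cong ι (proj₁ parts)) ⨾ ι-0) (*-congˡ (go p (proj₂ parts) (N.≤-<-trans (N.m≤n+m (norm p) Z.∣ c ∣) l)) ⨾ zeroʳ s) ⨾ +-identityˡ 0#
        where
        parts : (c ≡ + 0) × (evalℤ p ≡ + 0)
        parts = small-multiple c (evalℤ p) base e (N.≤-<-trans (N.m≤m+n Z.∣ c ∣ (norm p)) l)

  module Pair (t : Carrier) where
    opaque
      ⟦_⟧₂ : P₂ → Carrier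
      ⟦ x ⟧₂ = ⟦ part₀ x ⟧ᵖ + ⟦ part₁ x ⟧ᵖ * t

      ⟦⟧₂-def : ∀ x → ⟦ x ⟧₂ ≈ ⟦ part₀ x ⟧ᵖ + ⟦ part₁ x ⟧ᵖ * t
      ⟦⟧₂-def x = ≈-refl

    -- An operator is described by the scalar that it multiplies by; compositions and sums of
    -- operators then become products and sums of scalars.
    record Acts₂ (f : P₂ → P₂) (α : Carrier) : Set where
      constructor acts₂
      field on₂ : ∀ x → ⟦ f x ⟧₂ ≈ α * ⟦ x ⟧₂
    open Acts₂ public

    opaque
      unfolding ⟦_⟧₂

      ⟦⟧₂-⊹ : ∀ x y → ⟦ x ⊹₂ y ⟧₂ ≈ ⟦ x ⟧₂ + ⟦ y ⟧₂
      ⟦⟧₂-⊹ (pr x x′) (pr y y′) = +-cong (⟦⟧-⊹ x y) (*-congʳ (⟦⟧-⊹ x′ y′))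
        ⨾ ring! 5 (⟦ x ⟧ᵖ) (⟦ y ⟧ᵖ) (⟦ x′ ⟧ᵖ) (⟦ y′ ⟧ᵖ) t (λ a b c d t → (a :+ b) :+ (c :+ d) :* t , (a :+ c :* t) :+ (b :+ d :* t))

      scale-acts : ∀ c → Acts₂ (scale₂ c) (ι c)
      scale-acts c = acts₂ λ { (pr x y) → +-cong (⟦⟧-◂ c x) (*-congʳ (⟦⟧-◂ c y))
        ⨾ ring! 4 (ι c) (⟦ x ⟧ᵖ) (⟦ y ⟧ᵖ) t (λ c a b t → c :* a :+ c :* b :* t , c :* (a :+ b :* t)) }

      shift-acts : Acts₂ shift₂ s
      shift-acts = acts₂ λ { (pr x y) → +-cong (⟦⟧-shift x) (*-congʳ (⟦⟧-shift y))
        ⨾ ring! 4 s (⟦ x ⟧ᵖ) (⟦ y ⟧ᵖ) t (λ c a b t → c :* a :+ c :* b :* t , c :* (a :+ b :* t)) }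

    sum-acts : ∀ {f g α β} → Acts₂ f α → Acts₂ g β → Acts₂ (λ x → f x ⊹₂ g x) (α + β)
    sum-acts {f} {g} F G = acts₂ λ x → ⟦⟧₂-⊹ (f x) (g x) ⨾ +-cong (on₂ F x) (on₂ G x) ⨾ ≈-sym (distribʳ ⟦ x ⟧₂ _ _)

    comp-acts : ∀ {f g α β} → Acts₂ f α → Acts₂ g β → Acts₂ (λ x → f (g x)) (α * β)
    comp-acts {f} {g} F G = acts₂ λ x → on₂ F (g x) ⨾ *-congˡ (on₂ G x) ⨾ ≈-sym (*-assoc _ _ ⟦ x ⟧₂)

    cong-acts : ∀ {f α β} → α ≈ β → Acts₂ f α → Acts₂ f β
    cong-acts α≈β F = acts₂ λ x → on₂ F x ⨾ *-congʳ α≈β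

    iter-acts : ∀ {f α} → Acts₂ f α → ∀ n → Acts₂ (iter f n) (α ^ n)
    iter-acts F zero = acts₂ λ x → ≈-sym (*-identityˡ ⟦ x ⟧₂)
    iter-acts {f} F (suc n) = acts₂ λ x → on₂ F (iter f n x) ⨾ *-congˡ (on₂ (iter-acts F n) x) ⨾ ≈-sym (*-assoc _ _ ⟦ x ⟧₂)

    opaque
      unfolding ⟦_⟧₂

      vanishes₂⇒≈0 : ∀ x → vanishes₂ x ≡ true → ⟦ x ⟧₂ ≈ 0#
      vanishes₂⇒≈0 (pr x y) eq = +-cong (vanishes⇒≈0 x (proj₁ (∧-true eq))) (*-congʳ (vanishes⇒≈0 y (proj₂ (∧-true {vanishes x} eq))) ⨾ zeroˡ t) ⨾ +-identityˡ 0#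

    module Operators (tt≈ : t * t ≈ (s * s + s - ι (+ 3)) * t - ι (+ 8)) where

      opaque
        unfolding ⟦_⟧₂

        τ-acts : Acts₂ τ t
        τ-acts = acts₂ λ { (pr a b) → mod! 11 s t (⟦ a ⟧ᵖ) (⟦ b ⟧ᵖ) (⟦ −8 ◂ b ⟧ᵖ) (⟦ a ⊹ (shift (b ⊹ shift b) ⊹ −3 ◂ b) ⟧ᵖ) (⟦ shift (b ⊹ shift b) ⊹ −3 ◂ b ⟧ᵖ) (⟦ shift (b ⊹ shift b) ⟧ᵖ) (⟦ b ⊹ shift b ⟧ᵖ) (⟦ shift b ⟧ᵖ) (⟦ −3 ◂ b ⟧ᵖ)
          (λ s t a b x₁ x₂ x₃ x₄ x₅ x₆ x₇ →
            (x₁ :+ x₂ :* t , t :* (a :+ b :* t)) ,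
            (𝟙 , x₁ , con −8 :* b) ∷ (t , x₂ , a :+ x₃) ∷ (t , x₃ , x₄ :+ x₇) ∷ (t , x₄ , s :* x₅) ∷ (t :* s , x₅ , b :+ x₆) ∷ (t :* s , x₆ , s :* b) ∷ (t , x₇ , con −3 :* b)
            ∷ (:- b , t :* t , (s :* s :+ s :- # 3) :* t :- # 8) ∷ [])
          (⟦⟧-◂ _ b , ⟦⟧-⊹ a _ , ⟦⟧-⊹ _ _ , ⟦⟧-shift _ , ⟦⟧-⊹ b _ , ⟦⟧-shift b , ⟦⟧-◂ _ b , tt≈) }

      υ-acts : Acts₂ υ ((s - ι (+ 4)) * t + ι (+ 8))
      υ-acts = cong-acts (ring! 2 s t (λ s t → # 8 :+ (s :* t :+ con −4 :* t) , (s :- # 4) :* t :+ # 8))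
        (sum-acts (scale-acts (+ 8)) (sum-acts (comp-acts shift-acts τ-acts) (comp-acts (scale-acts −4) τ-acts)))

      κ₁-acts : Acts₂ κ₁ (s * s + ι (+ 2) * s - ι (+ 7) - t)
      κ₁-acts = cong-acts (ring! 2 s t (λ s t → s :* (# 2 :+ s) :+ (con −7 :+ con −1 :* t) , s :* s :+ # 2 :* s :- # 7 :- t))
        (sum-acts (comp-acts shift-acts (sum-acts (scale-acts (+ 2)) shift-acts)) (sum-acts (scale-acts −7) (comp-acts (scale-acts -1ℤ) τ-acts)))

      κ₂-acts : Acts₂ κ₂ (t - ι (+ 5) - s)
      κ₂-acts = cong-acts (ring! 2 s t (λ s t → t :+ con −1 :* (# 5 :+ s) , t :- # 5 :- s))
        (sum-acts τ-acts (comp-acts (scale-acts -1ℤ) (sum-acts (scale-acts (+ 5)) shift-acts)))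

      μ-acts : Acts₂ ×μ ((s * s - ι (+ 7) * s + ι (+ 13)) * t - ι (+ 8))
      μ-acts = cong-acts (ring! 2 s t (λ s t → con −8 :+ (# 13 :* t :+ s :* (con −7 :* t :+ s :* t)) , (s :* s :- # 7 :* s :+ # 13) :* t :- # 8))
        (sum-acts (scale-acts −8) (sum-acts (comp-acts (scale-acts (+ 13)) τ-acts) (comp-acts shift-acts (sum-acts (comp-acts (scale-acts −7) τ-acts) (comp-acts shift-acts τ-acts)))))

  module Cubic (r₁ : Carrier) where
    opaque
      ⟦_⟧₃ : K₃ → Carrier
      ⟦ x ⟧₃ = ⟦ x₀ x ⟧ᵖ + r₁ * (⟦ x₁ x ⟧ᵖ + r₁ * ⟦ x₂ x ⟧ᵖ)

      ⟦⟧₃-add : ∀ x y → ⟦ add₃ x y ⟧₃ ≈ ⟦ x ⟧₃ + ⟦ y ⟧₃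
      ⟦⟧₃-add (k₃ a b c) (k₃ a′ b′ c′) = +-cong (⟦⟧-⊹ a a′) (*-congˡ (+-cong (⟦⟧-⊹ b b′) (*-congˡ (⟦⟧-⊹ c c′))))
        ⨾ ring! 7 r₁ (⟦ a ⟧ᵖ) (⟦ b ⟧ᵖ) (⟦ c ⟧ᵖ) (⟦ a′ ⟧ᵖ) (⟦ b′ ⟧ᵖ) (⟦ c′ ⟧ᵖ) (λ r a b c a′ b′ c′ →
          (a :+ a′) :+ r :* ((b :+ b′) :+ r :* (c :+ c′)) , (a :+ r :* (b :+ r :* c)) :+ (a′ :+ r :* (b′ :+ r :* c′)))

      ⟦⟧₃-scale : ∀ z x → ⟦ scale₃ z x ⟧₃ ≈ ι z * ⟦ x ⟧₃
      ⟦⟧₃-scale z (k₃ a b c) = +-cong (⟦⟧-◂ z a) (*-congˡ (+-cong (⟦⟧-◂ z b) (*-congˡ (⟦⟧-◂ z c))))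
        ⨾ ring! 5 r₁ (ι z) (⟦ a ⟧ᵖ) (⟦ b ⟧ᵖ) (⟦ c ⟧ᵖ) (λ r z a b c → z :* a :+ r :* (z :* b :+ r :* (z :* c)) , z :* (a :+ r :* (b :+ r :* c)))

      ⟦⟧₃-shift : ∀ x → ⟦ shift₃ x ⟧₃ ≈ s * ⟦ x ⟧₃
      ⟦⟧₃-shift (k₃ a b c) = +-cong (⟦⟧-shift a) (*-congˡ (+-cong (⟦⟧-shift b) (*-congˡ (⟦⟧-shift c))))
        ⨾ ring! 5 r₁ s (⟦ a ⟧ᵖ) (⟦ b ⟧ᵖ) (⟦ c ⟧ᵖ) (λ r z a b c → z :* a :+ r :* (z :* b :+ r :* (z :* c)) , z :* (a :+ r :* (b :+ r :* c)))

      vanishes₃⇒≈0 : ∀ x → vanishes₃ x ≡ true → ⟦ x ⟧₃ ≈ 0#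
      vanishes₃⇒≈0 (k₃ a b c) eq = mod! 4 r₁ (⟦ a ⟧ᵖ) (⟦ b ⟧ᵖ) (⟦ c ⟧ᵖ) (λ r a b c → (a :+ r :* (b :+ r :* c) , 𝟘) , (𝟙 , a , 𝟘) ∷ (r , b , 𝟘) ∷ (r :* r , c , 𝟘) ∷ [])
        (vanishes⇒≈0 a (proj₁ (∧-true eq)) , vanishes⇒≈0 b (proj₁ (∧-true bc)) , vanishes⇒≈0 c (proj₂ (∧-true {vanishes b} bc)))
        where
        bc : vanishes b ∧ vanishes c ≡ true
        bc = proj₂ (∧-true {vanishes a} eq)

      ⟦⟧₃-def : ∀ a b c → ⟦ k₃ a b c ⟧₃ ≈ ⟦ a ⟧ᵖ + r₁ * (⟦ b ⟧ᵖ + r₁ * ⟦ c ⟧ᵖ)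
      ⟦⟧₃-def a b c = ≈-refl

    module Relation (cubic : r₁ * (r₁ * r₁) ≈ s * (r₁ * r₁) + (1# + s) * r₁ + 1#) where
      opaque
        unfolding ⟦_⟧₃

        ρ₁₃-acts : ∀ x → ⟦ ρ₁₃ x ⟧₃ ≈ r₁ * ⟦ x ⟧₃
        ρ₁₃-acts (k₃ a b c) = mod! 9 s r₁ (⟦ a ⟧ᵖ) (⟦ b ⟧ᵖ) (⟦ c ⟧ᵖ) (⟦ a ⊹ (c ⊹ shift c) ⟧ᵖ) (⟦ c ⊹ shift c ⟧ᵖ) (⟦ shift c ⟧ᵖ) (⟦ b ⊹ shift c ⟧ᵖ)
          (λ s r a b c x y z w → (c :+ r :* (x :+ r :* w) , r :* (a :+ r :* (b :+ r :* c))) ,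
            (r , x , a :+ y) ∷ (r , y , c :+ z) ∷ (r :+ r :* r , z , s :* c) ∷ (r :* r , w , b :+ z) ∷ (:- c , r :* (r :* r) , s :* (r :* r) :+ (𝟙 :+ s) :* r :+ 𝟙) ∷ [])
          (⟦⟧-⊹ a _ , ⟦⟧-⊹ c _ , ⟦⟧-shift c , ⟦⟧-⊹ b _ , cubic)

module EvalHom (R : CommutativeRing 0ℓ 0ℓ) (W : CommutativeRing.Carrier R → CommutativeRing.Carrier R)
    (W-cong : ∀ {x y} → CommutativeRing._≈_ R x y → CommutativeRing._≈_ R (W x) (W y))
    (W-+ : ∀ x y → CommutativeRing._≈_ R (W (CommutativeRing._+_ R x y)) (CommutativeRing._+_ R (W x) (W y)))
    (W-* : ∀ x y → CommutativeRing._≈_ R (W (CommutativeRing._*_ R x y)) (CommutativeRing._*_ R (W x) (W y)))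
    (W-1 : CommutativeRing._≈_ R (W (CommutativeRing.1# R)) (CommutativeRing.1# R)) where
  open Ring R

  W-0 : W 0# ≈ 0#
  W-0 = x+x≈x⇒x≈0 (W 0#) (≈-sym (W-+ 0# 0#) ⨾ W-cong (+-identityˡ 0#))

  W-neg : ∀ x → W (- x) ≈ - W x
  W-neg x = mod! 2 (W (- x)) (W x) (λ a b → (a , :- b) , (𝟙 , a :+ b , 𝟘) ∷ [])
    (≈-sym (W-+ (- x) x) ⨾ W-cong (-‿inverseˡ x) ⨾ W-0)

  W-ι : ∀ z → W (ι z) ≈ ι z
  W-ι (+ n) = posit n
    where
    posit : ∀ n → W (ι (+ n)) ≈ ι (+ n)
    posit zero = W-cong ι-0 ⨾ W-0 ⨾ ≈-sym ι-0
    posit (suc n) = W-cong (ι-+ (+ 1) (+ n)) ⨾ W-+ _ _ ⨾ +-cong (W-cong ι-1 ⨾ W-1 ⨾ ≈-sym ι-1) (posit n) ⨾ ≈-sym (ι-+ (+ 1) (+ n))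
  W-ι -[1+ n ] = W-cong (ι-neg (+ suc n)) ⨾ W-neg _ ⨾ -‿cong (W-ι (+ suc n)) ⨾ ≈-sym (ι-neg (+ suc n))

  W-^ : ∀ x n → W (x ^ n) ≈ W x ^ n
  W-^ x zero = W-1
  W-^ x (suc n) = W-* x (x ^ n) ⨾ *-congˡ (W-^ x n)

  opaque
    unfolding Eval.⟦_⟧ᵖ

    -- Since W is a ring homomorphism fixing the integers, one packed polynomial evaluated at s° and
    -- at s gives a function and its image under q ↦ q⁷.
    W-⟦⟧ : ∀ {s s′} → W s ≈ s′ → ∀ x → W (Eval.⟦_⟧ᵖ R s x) ≈ Eval.⟦_⟧ᵖ R s′ x
    W-⟦⟧ {s} {s′} eq x = go (poly x)
      where
      go : ∀ p → W (eval 1 p (s ∷ [])) ≈ eval 1 p (s′ ∷ [])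
      go [] = W-0
      go (k ∷ p) = W-+ _ _ ⨾ +-cong (W-ι k) (W-* _ _ ⨾ *-cong eq (go p))

-- The tower in a ring of series, and its action on seven coordinates

record TowerData (R : CommutativeRing 0ℓ 0ℓ) : Set where
  open Ring R
  field
    s r₁ r₂ r₃ T a b c : Carrier
    cubic : r₁ * (r₁ * r₁) ≈ s * (r₁ * r₁) + (1# + s) * r₁ + 1#
    quadratic : r₂ * r₂ ≈ (s - r₁) * r₂ - (r₁ * r₁ - s * r₁ - (1# + s))
    r-sum : s ≈ r₁ + r₂ + r₃
    r-prod : r₁ * r₂ * r₃ ≈ 1#
    r-unit : (1# + r₁) * (1# + r₂) * (1# + r₃) ≈ 1#
    T≈ : T ≈ s * (1# + s) + (1# + s * (1# + s)) * r₁ - s * (r₁ * r₁) + r₂ * (ι (+ 3) * (r₁ * r₁) - (1# + s * (1# + ι (+ 2) * r₁)))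
    a² : a * a ≈ - (r₁ * (r₂ * (1# + r₁))) * c
    b² : b * b ≈ - (r₁ * (r₃ * (1# + r₃)) * a)
    c² : c * c ≈ (1# + r₂ * ((1# + r₁) * (1# + r₂))) * b
    abc : a * b * c ≈ - 1#
  -- The parameter h is -b²/a, and λ⁻ = 1/(1 + h). The elements r₁, r₂, r₃ are the roots of X³ - sX²
  -- - (1 + s)X - 1; evaluated at 0 and at -1 it gives `r-prod` and `r-unit`, from which the inverse
  -- relations follow.
  h h⁻¹ λ⁻ : Carrier
  h = r₁ * (r₃ * (1# + r₃))
  h⁻¹ = r₂ * ((1# + r₁) * (1# + r₂))
  λ⁻ = - (r₁ * (r₂ * (1# + r₁)))

module Tower (R : CommutativeRing 0ℓ 0ℓ) (D : TowerData R) where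
  open Ring R
  open TowerData D public
  open Eval R s
  open Pair T
  open Cubic r₁
  open Relation cubic

  opaque
    ⟦_⟧₆ : K₆ → Carrier
    ⟦ x ⟧₆ = ⟦ lo x ⟧₃ + r₂ * ⟦ hi x ⟧₃

    ⟦⟧₆-def : ∀ x → ⟦ x ⟧₆ ≈ ⟦ lo x ⟧₃ + r₂ * ⟦ hi x ⟧₃
    ⟦⟧₆-def x = ≈-refl

    ⟦⟧₆-⊹ : ∀ x y → ⟦ x ⊹₆ y ⟧₆ ≈ ⟦ x ⟧₆ + ⟦ y ⟧₆
    ⟦⟧₆-⊹ (k₆ x x′) (k₆ y y′) = +-cong (⟦⟧₃-add x y) (*-congˡ (⟦⟧₃-add x′ y′))
      ⨾ ring! 5 r₂ (⟦ x ⟧₃) (⟦ y ⟧₃) (⟦ x′ ⟧₃) (⟦ y′ ⟧₃) (λ r a b c d → (a :+ b) :+ r :* (c :+ d) , (a :+ r :* c) :+ (b :+ r :* d))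

  record Acts (f : K₆ → K₆) (α : Carrier) : Set where
    constructor acts
    field on : ∀ x → ⟦ f x ⟧₆ ≈ α * ⟦ x ⟧₆
  open Acts public

  opaque
    unfolding ⟦_⟧₆

    scale₆-acts : ∀ z → Acts (scale₆ z) (ι z)
    scale₆-acts z = acts λ { (k₆ x y) → +-cong (⟦⟧₃-scale z x) (*-congˡ (⟦⟧₃-scale z y))
      ⨾ ring! 4 r₂ (ι z) (⟦ x ⟧₃) (⟦ y ⟧₃) (λ r z a b → z :* a :+ r :* (z :* b) , z :* (a :+ r :* b)) }

    shift₆-acts : Acts shift₆ s
    shift₆-acts = acts λ { (k₆ x y) → +-cong (⟦⟧₃-shift x) (*-congˡ (⟦⟧₃-shift y))
      ⨾ ring! 4 r₂ s (⟦ x ⟧₃) (⟦ y ⟧₃) (λ r z a b → z :* a :+ r :* (z :* b) , z :* (a :+ r :* b)) }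

    ρ₁-acts : Acts ρ₁ r₁
    ρ₁-acts = acts λ { (k₆ x y) → +-cong (ρ₁₃-acts x) (*-congˡ (ρ₁₃-acts y))
      ⨾ ring! 4 r₂ r₁ (⟦ x ⟧₃) (⟦ y ⟧₃) (λ r z a b → z :* a :+ r :* (z :* b) , z :* (a :+ r :* b)) }

    ρ₂-acts-on : ∀ x → ⟦ ρ₂ x ⟧₆ ≈ r₂ * ⟦ x ⟧₆
    ρ₂-acts-on (k₆ x y) = +-cong lo-part (*-congˡ hi-part)
      ⨾ mod! 5 s r₁ r₂ (⟦ x ⟧₃) (⟦ y ⟧₃)
        (λ s r t x y → ((y :+ s :* y) :+ (s :* (r :* y) :+ con -1ℤ :* (r :* (r :* y))) :+ t :* (x :+ (s :* y :+ con -1ℤ :* (r :* y))) , t :* (x :+ t :* y)) ,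
          (:- y , t :* t , (s :- r) :* t :- (r :* r :- s :* r :- (𝟙 :+ s))) ∷ [])
        quadratic
      where
      ρy : K₃
      ρy = ρ₁₃ y
      lo-part : ⟦ add₃ (add₃ y (shift₃ y)) (add₃ (shift₃ ρy) (scale₃ -1ℤ (ρ₁₃ ρy))) ⟧₃ ≈ (⟦ y ⟧₃ + s * ⟦ y ⟧₃) + (s * (r₁ * ⟦ y ⟧₃) + ι -1ℤ * (r₁ * (r₁ * ⟦ y ⟧₃)))
      lo-part = ⟦⟧₃-add _ _ ⨾ +-cong (⟦⟧₃-add y _ ⨾ +-congˡ (⟦⟧₃-shift y))
        (⟦⟧₃-add _ _ ⨾ +-cong (⟦⟧₃-shift ρy ⨾ *-congˡ (ρ₁₃-acts y)) (⟦⟧₃-scale -1ℤ _ ⨾ *-congˡ (ρ₁₃-acts ρy ⨾ *-congˡ (ρ₁₃-acts y))))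
      hi-part : ⟦ add₃ x (add₃ (shift₃ y) (scale₃ -1ℤ ρy)) ⟧₃ ≈ ⟦ x ⟧₃ + (s * ⟦ y ⟧₃ + ι -1ℤ * (r₁ * ⟦ y ⟧₃))
      hi-part = ⟦⟧₃-add x _ ⨾ +-congˡ (⟦⟧₃-add _ _ ⨾ +-cong (⟦⟧₃-shift y) (⟦⟧₃-scale -1ℤ ρy ⨾ *-congˡ (ρ₁₃-acts y)))

    ρ₂-acts : Acts ρ₂ r₂
    ρ₂-acts = acts ρ₂-acts-on

    vanishes₆⇒≈0 : ∀ x → vanishes₆ x ≡ true → ⟦ x ⟧₆ ≈ 0#
    vanishes₆⇒≈0 (k₆ x y) eq = +-cong (vanishes₃⇒≈0 x (proj₁ (∧-true eq))) (*-congˡ (vanishes₃⇒≈0 y (proj₂ (∧-true {vanishes₃ x} eq))) ⨾ zeroʳ r₂) ⨾ +-identityˡ 0#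

  sum-acts₆ : ∀ {f g α β} → Acts f α → Acts g β → Acts (λ x → f x ⊹₆ g x) (α + β)
  sum-acts₆ {f} {g} F G = acts λ x → ⟦⟧₆-⊹ (f x) (g x) ⨾ +-cong (on F x) (on G x) ⨾ ≈-sym (distribʳ ⟦ x ⟧₆ _ _)

  comp-acts₆ : ∀ {f g α β} → Acts f α → Acts g β → Acts (λ x → f (g x)) (α * β)
  comp-acts₆ {f} {g} F G = acts λ x → on F (g x) ⨾ *-congˡ (on G x) ⨾ ≈-sym (*-assoc _ _ ⟦ x ⟧₆)

  cong-acts₆ : ∀ {f α β} → α ≈ β → Acts f α → Acts f β
  cong-acts₆ α≈β F = acts λ x → on F x ⨾ *-congʳ α≈β

  id-acts : Acts idK 1#
  id-acts = acts λ x → ≈-sym (*-identityˡ ⟦ x ⟧₆)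

  neg-acts : Acts neg₆ (- 1#)
  neg-acts = cong-acts₆ (≈-sym (*-identityʳ _) ⨾ neg-one* 1#) (scale₆-acts -1ℤ)

  neg≈ : ∀ x → ⟦ neg₆ x ⟧₆ ≈ - ⟦ x ⟧₆
  neg≈ x = on neg-acts x ⨾ ring! 1 (⟦ x ⟧₆) (λ x → :- 𝟙 :* x , :- x)

  ρ₃-acts : Acts ρ₃ r₃
  ρ₃-acts = cong-acts₆ (mod! 4 s r₁ r₂ r₃ (λ s x y z → (s :+ :- 𝟙 :* (x :+ y) , z) , (𝟙 , s , x :+ y :+ z) ∷ []) r-sum)
    (sum-acts₆ shift₆-acts (comp-acts₆ neg-acts (sum-acts₆ ρ₁-acts ρ₂-acts)))

  ⁺ρ₁-acts : Acts ⁺ρ₁ (1# + r₁)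
  ⁺ρ₁-acts = sum-acts₆ id-acts ρ₁-acts

  ⁺ρ₂-acts : Acts ⁺ρ₂ (1# + r₂)
  ⁺ρ₂-acts = sum-acts₆ id-acts ρ₂-acts

  ⁺ρ₃-acts : Acts ⁺ρ₃ (1# + r₃)
  ⁺ρ₃-acts = sum-acts₆ id-acts ρ₃-acts

  ×h-acts : Acts ×h h
  ×h-acts = comp-acts₆ ρ₁-acts (comp-acts₆ ρ₃-acts ⁺ρ₃-acts)

  ×h⁻¹-acts : Acts ×h⁻¹ h⁻¹
  ×h⁻¹-acts = comp-acts₆ ρ₂-acts (comp-acts₆ ⁺ρ₁-acts ⁺ρ₂-acts)

  ×λ-acts : Acts ×λ λ⁻
  ×λ-acts = cong-acts₆ (ring! 2 r₁ r₂ (λ x y → :- 𝟙 :* (x :* (y :* (𝟙 :+ x))) , :- (x :* (y :* (𝟙 :+ x)))))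
    (comp-acts₆ neg-acts (comp-acts₆ ρ₁-acts (comp-acts₆ ρ₂-acts ⁺ρ₁-acts)))

  ×[1+h⁻¹]-acts : Acts ×[1+h⁻¹] (1# + h⁻¹)
  ×[1+h⁻¹]-acts = sum-acts₆ id-acts ×h⁻¹-acts

  ×T-acts : Acts ×T T
  ×T-acts = cong-acts₆ (mod! 4 s r₁ r₂ T
      (λ s x y T → (s :* (𝟙 :+ s) :+ (x :+ s :* (x :+ s :* x)) :+ :- 𝟙 :* (s :* (x :* x)) :+ y :* (# 3 :* (x :* x) :+ :- 𝟙 :* (𝟙 :+ s :* (𝟙 :+ # 2 :* x))) , T) ,
        (:- 𝟙 , T , s :* (𝟙 :+ s) :+ (𝟙 :+ s :* (𝟙 :+ s)) :* x :- s :* (x :* x) :+ y :* (# 3 :* (x :* x) :- (𝟙 :+ s :* (𝟙 :+ # 2 :* x)))) ∷ []) T≈)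
    (sum-acts₆ (sum-acts₆ (sum-acts₆ (comp-acts₆ shift₆-acts (sum-acts₆ id-acts shift₆-acts))
      (sum-acts₆ ρ₁-acts (comp-acts₆ shift₆-acts (sum-acts₆ ρ₁-acts (comp-acts₆ shift₆-acts ρ₁-acts)))))
      (comp-acts₆ neg-acts (comp-acts₆ shift₆-acts (comp-acts₆ ρ₁-acts ρ₁-acts))))
      (comp-acts₆ ρ₂-acts (sum-acts₆ (comp-acts₆ (scale₆-acts (+ 3)) (comp-acts₆ ρ₁-acts ρ₁-acts))
        (comp-acts₆ neg-acts (sum-acts₆ id-acts (comp-acts₆ shift₆-acts (sum-acts₆ id-acts (comp-acts₆ (scale₆-acts (+ 2)) ρ₁-acts))))))))

  h⁻¹h : h⁻¹ * h ≈ 1#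
  h⁻¹h = mod! 3 r₁ r₂ r₃ (λ x y z → (y :* ((𝟙 :+ x) :* (𝟙 :+ y)) :* (x :* (z :* (𝟙 :+ z))) , 𝟙) ,
      (x :* y :* z , (𝟙 :+ x) :* (𝟙 :+ y) :* (𝟙 :+ z) , 𝟙) ∷ (𝟙 , x :* y :* z , 𝟙) ∷ []) (r-unit , r-prod)

  λ-h⁻¹ : λ⁻ * (1# + h⁻¹) ≈ h⁻¹
  λ-h⁻¹ = mod! 3 r₁ r₂ r₃ (λ x y z → (:- (x :* (y :* (𝟙 :+ x))) :* (𝟙 :+ y :* ((𝟙 :+ x) :* (𝟙 :+ y))) , y :* ((𝟙 :+ x) :* (𝟙 :+ y))) ,
      (:- (y :* (𝟙 :+ x) :* x :* y) , (𝟙 :+ x) :* (𝟙 :+ y) :* (𝟙 :+ z) , 𝟙) ∷ (y :* (𝟙 :+ x) :* (𝟙 :+ x) :* (𝟙 :+ y) , x :* y :* z , 𝟙) ∷ []) (r-unit , r-prod)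

  opaque
    ⟦_⟧₇ : V₇ → Carrier
    ⟦ v₇ x xa xb xc xab xbc xca ⟧₇ = ⟦ x ⟧₆ + (⟦ xa ⟧₆ * a + (⟦ xb ⟧₆ * b + (⟦ xc ⟧₆ * c + (⟦ xab ⟧₆ * (a * b) + (⟦ xbc ⟧₆ * (b * c) + ⟦ xca ⟧₆ * (c * a))))))

    ×affine-acts : ∀ {f g k α β γ} → Acts f α → Acts g β → Acts k γ → ∀ v →
                   ⟦ ×affine f g k v ⟧₇ ≈ (α * a + β * b + γ * c - 1#) * ⟦ v ⟧₇
    ×affine-acts {f} {g} {k} {α} {β} {γ} F G H (v₇ x xa xb xc xab xbc xca) =
      +-cong (⟨-⟩ (o {x} ⟨+⟩ (on F xbc ⟨+⟩ (on G xca ⟨+⟩ on H xab)))) (+-cong (*-congʳ (on F x ⟨+⟩ ⟨-⟩ (o {xa} ⟨+⟩ (×h-acts ⟨*⟩ on G xb ⟨+⟩ (on H xbc ⟨+⟩ ×h-acts ⟨*⟩ on H xbc))))) (+-cong (*-congʳ (on G x ⟨+⟩ ⟨-⟩ (o {xb}) ⟨+⟩ (×h⁻¹-acts ⟨*⟩ on F xca ⟨+⟩ ×[1+h⁻¹]-acts ⟨*⟩ on H xc))) (+-cong (*-congʳ (on H x ⟨+⟩ ×λ-acts ⟨*⟩ on F xa ⟨+⟩ ⟨-⟩ (o {xc} ⟨+⟩ ×h-acts ⟨*⟩ ×λ-acts ⟨*⟩ on G xab))) (+-cong (*-congʳ (⟨-⟩ (o {xab}) ⟨+⟩ ×[1+h⁻¹]-acts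 ⟨*⟩ on H xca ⟨+⟩ (on F xb ⟨+⟩ on G xa))) (+-cong (*-congʳ (⟨-⟩ (o {xbc}) ⟨+⟩ ×λ-acts ⟨*⟩ on F xab ⟨+⟩ (on G xc ⟨+⟩ on H xb))) (*-congʳ (⟨-⟩ (o {xca} ⟨+⟩ ×h-acts ⟨*⟩ on G xbc) ⟨+⟩ (on F xc ⟨+⟩ on H xa))))))))
      -- With all coordinates replaced by scalars, what is left is a polynomial identity modulo the
      -- multiplication table of a, b, c.
      ⨾ mod! 16 (⟦ x ⟧₆) (⟦ xa ⟧₆) (⟦ xb ⟧₆) (⟦ xc ⟧₆) (⟦ xab ⟧₆) (⟦ xbc ⟧₆) (⟦ xca ⟧₆) α β γ a b c h h⁻¹ λ⁻
        (λ X A B C D E F α β γ a b c h i l →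
          ( :- (X :+ (α :* E :+ (β :* F :+ γ :* D)))
            :+ ((α :* X :- (A :+ (h :* (β :* B) :+ (γ :* E :+ h :* (γ :* E))))) :* a
            :+ ((β :* X :- B :+ (i :* (α :* F) :+ (𝟙 :+ i) :* (γ :* C))) :* b
            :+ ((γ :* X :+ l :* (α :* A) :- (C :+ h :* (l :* (β :* D)))) :* c
            :+ ((:- D :+ (𝟙 :+ i) :* (γ :* F) :+ (α :* B :+ β :* A)) :* (a :* b)
            :+ ((:- E :+ l :* (α :* D) :+ (β :* C :+ γ :* B)) :* (b :* c)
            :+ (:- (F :+ h :* (β :* E)) :+ (α :* C :+ γ :* A)) :* (c :* a))))))
          , (α :* a :+ β :* b :+ γ :* c :- 𝟙) :* (X :+ (A :* a :+ (B :* b :+ (C :* c :+ (D :* (a :* b) :+ (E :* (b :* c) :+ F :* (c :* a)))))))) ,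
          (:- (α :* A :+ α :* D :* b :+ α :* F :* c :- h :* β :* D) , a :* a , l :* c) ∷
          (:- (β :* B :+ β :* D :* a :+ β :* E :* c :+ γ :* E :* (𝟙 :+ i)) , b :* b , :- (h :* a)) ∷
          (:- (γ :* C :+ γ :* E :* b :+ γ :* F :* a :+ α :* F :* l) , c :* c , (𝟙 :+ i) :* b) ∷
          (:- (α :* E :+ β :* F :+ γ :* D) , a :* b :* c , :- 𝟙) ∷
          (:- (α :* F :* b) , l :* (𝟙 :+ i) , i) ∷
          (γ :* E :* a , i :* h , 𝟙) ∷ [])
        (a² , b² , c² , abc , λ-h⁻¹ , h⁻¹h)
      where
      infixl 6 _⟨+⟩_
      _⟨+⟩_ : ∀ {x y X Y} → ⟦ x ⟧₆ ≈ X → ⟦ y ⟧₆ ≈ Y → ⟦ x ⊹₆ y ⟧₆ ≈ X + Y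
      p ⟨+⟩ r = ⟦⟧₆-⊹ _ _ ⨾ +-cong p r
      ⟨-⟩ : ∀ {x X} → ⟦ x ⟧₆ ≈ X → ⟦ neg₆ x ⟧₆ ≈ - X
      ⟨-⟩ p = neg≈ _ ⨾ -‿cong p
      infixr 7 _⟨*⟩_
      _⟨*⟩_ : ∀ {f φ x X} → Acts f φ → ⟦ x ⟧₆ ≈ X → ⟦ f x ⟧₆ ≈ φ * X
      A ⟨*⟩ p = on A _ ⨾ *-congˡ p
      o : ∀ {x} → ⟦ x ⟧₆ ≈ ⟦ x ⟧₆
      o = ≈-refl

    ⟦⟧₇-def : ∀ x xa xb xc xab xbc xca → ⟦ v₇ x xa xb xc xab xbc xca ⟧₇ ≈
              ⟦ x ⟧₆ + (⟦ xa ⟧₆ * a + (⟦ xb ⟧₆ * b + (⟦ xc ⟧₆ * c + (⟦ xab ⟧₆ * (a * b) + (⟦ xbc ⟧₆ * (b * c) + ⟦ xca ⟧₆ * (c * a))))))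
    ⟦⟧₇-def x xa xb xc xab xbc xca = ≈-refl

  z y g : Carrier
  z = a + b + c - 1#
  y = r₃ * a + r₂ * b + r₁ * c - 1#
  g = z * (z * (z * y))

  ×z-acts : ∀ v → ⟦ ×z v ⟧₇ ≈ z * ⟦ v ⟧₇
  ×z-acts v = ×affine-acts id-acts id-acts id-acts v ⨾ *-congʳ (ring! 3 a b c (λ a b c → 𝟙 :* a :+ 𝟙 :* b :+ 𝟙 :* c :- 𝟙 , a :+ b :+ c :- 𝟙))

  ×y-acts : ∀ v → ⟦ ×y v ⟧₇ ≈ y * ⟦ v ⟧₇
  ×y-acts = ×affine-acts ρ₃-acts ρ₂-acts ρ₁-acts

  ×g-acts : ∀ v → ⟦ ×g v ⟧₇ ≈ g * ⟦ v ⟧₇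
  ×g-acts v = begin
    ⟦ ×g v ⟧₇ ≈⟨ ×z-acts (×z (×z (×y v))) ⟩
    z * ⟦ ×z (×z (×y v)) ⟧₇ ≈⟨ *-congˡ (×z-acts (×z (×y v))) ⟩
    z * (z * ⟦ ×z (×y v) ⟧₇) ≈⟨ *-congˡ (*-congˡ (×z-acts (×y v))) ⟩
    z * (z * (z * ⟦ ×y v ⟧₇)) ≈⟨ *-congˡ (*-congˡ (*-congˡ (×y-acts v))) ⟩
    z * (z * (z * (y * ⟦ v ⟧₇))) ≈⟨ ring! 3 z y (⟦ v ⟧₇) (λ z y v → z :* (z :* (z :* (y :* v))) , z :* (z :* (z :* y)) :* v) ⟩
    g * ⟦ v ⟧₇ ∎

  0ᵖ≈ : ⟦ 0ᵖ ⟧ᵖ ≈ 0#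
  0ᵖ≈ = ⟦⟧-[]

  const₃≈ : ∀ x → ⟦ k₃ x 0ᵖ 0ᵖ ⟧₃ ≈ ⟦ x ⟧ᵖ
  const₃≈ x = ⟦⟧₃-def x 0ᵖ 0ᵖ ⨾ mod! 3 r₁ (⟦ x ⟧ᵖ) (⟦ 0ᵖ ⟧ᵖ) (λ r x o → (x :+ r :* (o :+ r :* o) , x) , (r :+ r :* r , o , 𝟘) ∷ []) 0ᵖ≈

  const₆≈ : ∀ x → ⟦ k₆ (k₃ x 0ᵖ 0ᵖ) 0₃ ⟧₆ ≈ ⟦ x ⟧ᵖ
  const₆≈ x = ⟦⟧₆-def (k₆ (k₃ x 0ᵖ 0ᵖ) 0₃) ⨾ +-cong (const₃≈ x) (*-congˡ (const₃≈ 0ᵖ ⨾ 0ᵖ≈)) ⨾ +-congˡ (zeroʳ r₂) ⨾ +-identityʳ _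

  embed≈ : ∀ x → ⟦ embed x ⟧₆ ≈ ⟦ x ⟧₂
  embed≈ (pr x y) = ⟦⟧₆-⊹ _ _ ⨾ +-cong (const₆≈ x) (on ×T-acts (k₆ (k₃ y 0ᵖ 0ᵖ) 0₃) ⨾ *-congˡ (const₆≈ y) ⨾ *-comm T ⟦ y ⟧ᵖ) ⨾ ≈-sym (⟦⟧₂-def (pr x y))

  projects⇒≈ : ∀ k → projects k ≡ true → ⟦ k ⟧₆ ≈ ⟦ project k ⟧₂
  projects⇒≈ k eq = sub≈0⇒≈ (begin
    ⟦ k ⟧₆ - ⟦ embed (project k) ⟧₆ ≈⟨ ≈-sym (⟦⟧₆-⊹ k (neg₆ (embed (project k))) ⨾ +-congˡ (neg≈ (embed (project k)))) ⟩
    ⟦ k ⊹₆ neg₆ (embed (project k)) ⟧₆ ≈⟨ vanishes₆⇒≈0 (k ⊹₆ neg₆ (embed (project k))) eq ⟩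
    0# ∎) ⨾ embed≈ (project k)

  opaque
    unfolding ⟦_⟧₇

    addHead≈ : ∀ x v → ⟦ addHead x v ⟧₇ ≈ ⟦ v ⟧₇ + ⟦ x ⟧₂
    addHead≈ x (v₇ e _ _ _ _ _ _) = +-congʳ (⟦⟧₆-⊹ e (embed x) ⨾ +-congˡ (embed≈ x))
      ⨾ +-assoc _ _ _ ⨾ +-congˡ (+-comm _ _) ⨾ ≈-sym (+-assoc _ _ _)

    one₇≈ : ⟦ 1₇ ⟧₇ ≈ 1#
    one₇≈ = mod! 5 (⟦ k₆ (k₃ (lit (+ 1 ∷ [])) 0ᵖ 0ᵖ) 0₃ ⟧₆) (⟦ 0₆ ⟧₆) a b c
      (λ x o a b c → (x :+ (o :* a :+ (o :* b :+ (o :* c :+ (o :* (a :* b) :+ (o :* (b :* c) :+ o :* (c :* a)))))) , 𝟙) ,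
        (𝟙 , x , 𝟙) ∷ (a :+ b :+ c :+ a :* b :+ b :* c :+ c :* a , o , 𝟘) ∷ [])
      (const₆≈ (lit (+ 1 ∷ [])) ⨾ ⟦⟧-∷ (+ 1) [] ⨾ +-cong ι-1 (*-congˡ ⟦⟧-[] ⨾ zeroʳ s) ⨾ +-identityʳ 1# , const₆≈ 0ᵖ ⨾ 0ᵖ≈)

    vanishes₇⇒≈0 : ∀ v → vanishes₇ v ≡ true → ⟦ v ⟧₇ ≈ 0#
    vanishes₇⇒≈0 (v₇ x xa xb xc xab xbc xca) eq = mod! 10 (⟦ x ⟧₆) (⟦ xa ⟧₆) (⟦ xb ⟧₆) (⟦ xc ⟧₆) (⟦ xab ⟧₆) (⟦ xbc ⟧₆) (⟦ xca ⟧₆) a b c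
      (λ X A B C D E F a b c → (X :+ (A :* a :+ (B :* b :+ (C :* c :+ (D :* (a :* b) :+ (E :* (b :* c) :+ F :* (c :* a)))))) , 𝟘) ,
        (𝟙 , X , 𝟘) ∷ (a , A , 𝟘) ∷ (b , B , 𝟘) ∷ (c , C , 𝟘) ∷ (a :* b , D , 𝟘) ∷ (b :* c , E , 𝟘) ∷ (c :* a , F , 𝟘) ∷ [])
      (go x e₀ , go xa (proj₁ (∧-true e₁′)) , go xb (proj₁ (∧-true e₂)) , go xc (proj₁ (∧-true e₃)) , go xab (proj₁ (∧-true e₄)) , go xbc (proj₁ (∧-true e₅)) , go xca (proj₂ (∧-true {vanishes₆ xbc} e₅)))
      where
      go : ∀ x → vanishes₆ x ≡ true → ⟦ x ⟧₆ ≈ 0#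
      go = vanishes₆⇒≈0
      e₀ : vanishes₆ x ≡ true
      e₀ = proj₁ (∧-true eq)
      e₁′ : vanishes₆ xa ∧ vanishes₆ xb ∧ vanishes₆ xc ∧ vanishes₆ xab ∧ vanishes₆ xbc ∧ vanishes₆ xca ≡ true
      e₁′ = proj₂ (∧-true {vanishes₆ x} eq)
      e₂ : vanishes₆ xb ∧ vanishes₆ xc ∧ vanishes₆ xab ∧ vanishes₆ xbc ∧ vanishes₆ xca ≡ true
      e₂ = proj₂ (∧-true {vanishes₆ xa} e₁′)
      e₃ : vanishes₆ xc ∧ vanishes₆ xab ∧ vanishes₆ xbc ∧ vanishes₆ xca ≡ true
      e₃ = proj₂ (∧-true {vanishes₆ xb} e₂)
      e₄ : vanishes₆ xab ∧ vanishes₆ xbc ∧ vanishes₆ xca ≡ true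
      e₄ = proj₂ (∧-true {vanishes₆ xc} e₃)
      e₅ : vanishes₆ xbc ∧ vanishes₆ xca ≡ true
      e₅ = proj₂ (∧-true {vanishes₆ xab} e₄)

  hornerᴿ : Carrier → List P₂ → Carrier
  hornerᴿ x [] = x
  hornerᴿ x (k ∷ ks) = hornerᴿ (g * x + ⟦ k ⟧₂) ks

  horner≈ : ∀ v x ks → ⟦ v ⟧₇ ≈ x → ⟦ horner v ks ⟧₇ ≈ hornerᴿ x ks
  horner≈ v x [] e = e
  horner≈ v x (k ∷ ks) e = horner≈ (addHead k (×g v)) (g * x + ⟦ k ⟧₂) ks
    (addHead≈ k (×g v) ⨾ +-congʳ (×g-acts v ⨾ *-congˡ e))

  equation : hornerᴿ 1# coefficient ≈ 0#
  equation = ≈-sym (horner≈ 1₇ 1# coefficient one₇≈) ⨾ vanishes₇⇒≈0 (horner 1₇ coefficient) equation-check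

  start≈ : ∀ m n → ⟦ iter ×z m (iter ×y n 1₇) ⟧₇ ≈ z ^ m * y ^ n
  start≈ zero zero = one₇≈ ⨾ ≈-sym (*-identityˡ 1#)
  start≈ zero (suc n) = ×y-acts (iter ×y n 1₇) ⨾ *-congˡ (start≈ zero n ⨾ *-identityˡ _) ⨾ ≈-sym (*-identityˡ _)
  start≈ (suc m) n = ×z-acts (iter ×z m (iter ×y n 1₇)) ⨾ *-congˡ (start≈ m n) ⨾ ≈-sym (*-assoc _ _ _)

-- The series over which everything is computed: W is q ↦ q⁷, and s°, r₁°, r₂°
-- are s, r₁, r₂ read as series in q instead of q⁷.
record Dissection (R : CommutativeRing 0ℓ 0ℓ) : Set where
  open Ring R
  field
    tower : TowerData R
  module D = TowerData tower
  field
    W U : Carrier → Carrier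
    W-cong : ∀ {x y} → x ≈ y → W x ≈ W y
    W-+ : ∀ x y → W (x + y) ≈ W x + W y
    W-* : ∀ x y → W (x * y) ≈ W x * W y
    W-1 : W 1# ≈ 1#
    U-cong : ∀ {x y} → x ≈ y → U x ≈ U y
    U-+ : ∀ x y → U (x + y) ≈ U x + U y
    U-W : ∀ x y → U (W x * y) ≈ x * U y
    U-1 : U 1# ≈ 1#
    s° r₁° r₂° : Carrier
    W-s : W s° ≈ D.s
    W-r₁ : W r₁° ≈ D.r₁
    W-r₂ : W r₂° ≈ D.r₂
    U-a : U D.a ≈ 0#
    U-b : U D.b ≈ 0#
    U-c : U D.c ≈ 0#
    U-ab : U (D.a * D.b) ≈ 0#
    U-bc : U (D.b * D.c) ≈ 0#
    U-ca : U (D.c * D.a) ≈ 0#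

-- The relations `w-eq`, `t-eq` and `A≈` express w, t and A by monomials in z and y up to functions
-- of q⁷, which pass through `U`; `t²` and `w≈` describe the level 14 curve.
record Setup (R : CommutativeRing 0ℓ 0ℓ) : Set where
  open Ring R
  field
    dissection : Dissection R
  open Dissection dissection public
  field
    t u w A z⁻¹ κ⁻¹ : Carrier
    W-t : W t ≈ D.T
    uw : u * w ≈ 1#
    t² : t * t ≈ (s° * s° + s° - ι (+ 3)) * t - ι (+ 8)
    w≈ : w ≈ (s° - ι (+ 4)) * t + ι (+ 8)
    z-inv : (D.a + D.b + D.c - 1#) * z⁻¹ ≈ 1#
    κ-inv : W (t - ι (+ 5) - s°) * κ⁻¹ ≈ 1#
    w-eq : w * (W (t - ι (+ 5) - s°) * W (t - ι (+ 5) - s°)) ≈ Tower.g R tower * W w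
    t-eq : t * Tower.z R tower * (W (t - ι (+ 5) - s°) * W (t - ι (+ 5) - s°)) ≈ Tower.y R tower * W w * W (s° * s° + ι (+ 2) * s° - ι (+ 7) - t)
    A≈ : A ≈ Tower.y R tower * Tower.y R tower * z⁻¹ ^ 5

module Trace (R : CommutativeRing 0ℓ 0ℓ) (S : Dissection R) where
  open Ring R
  open Dissection S
  open Tower R tower using (⟦_⟧₆; ⟦⟧₆-def; ⟦_⟧₇; ⟦⟧₇-def)
  open EvalHom R W W-cong W-+ W-* W-1
  module HiC = Eval.Cubic R D.s D.r₁
  open Eval R s° using (⟦_⟧ᵖ)

  Image : Carrier → Set
  Image x = ∃ λ x° → W x° ≈ x

  image-+ : ∀ {x y} → Image x → Image y → Image (x + y)
  image-+ (x , p) (y , r) = x + y , W-+ x y ⨾ +-cong p r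

  image-* : ∀ {x y} → Image x → Image y → Image (x * y)
  image-* (x , p) (y , r) = x * y , W-* x y ⨾ *-cong p r

  image-cong : ∀ {x y} → y ≈ x → Image x → Image y
  image-cong e (x , p) = x , p ⨾ ≈-sym e

  image₃ : ∀ x → Image HiC.⟦ x ⟧₃
  image₃ (k₃ a b c) = image-cong (HiC.⟦⟧₃-def a b c) (image-+ (im a) (image-* (r₁° , W-r₁) (image-+ (im b) (image-* (r₁° , W-r₁) (im c)))))
    where
    im : ∀ x → Image (Eval.⟦_⟧ᵖ R D.s x)
    im x = ⟦ x ⟧ᵖ , W-⟦⟧ W-s x

  image₆ : ∀ x → Image ⟦ x ⟧₆
  image₆ x = image-cong (⟦⟧₆-def x) (image-+ (image₃ (lo x)) (image-* (r₂° , W-r₂) (image₃ (hi x))))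

  -- Every coordinate in `K₆` is a polynomial in s, r₁, r₂, hence a function of q⁷, and passes
  -- through `U`.
  U-kill : ∀ x {a} → U a ≈ 0# → U (⟦ x ⟧₆ * a) ≈ 0#
  U-kill x {a} e = U-cong (*-congʳ (≈-sym (proj₂ (image₆ x)))) ⨾ U-W _ a ⨾ *-congˡ e ⨾ zeroʳ _

  trace₇ : ∀ v → U ⟦ v ⟧₇ ≈ U ⟦ eᵒ v ⟧₆
  trace₇ (v₇ x xa xb xc xab xbc xca) = begin
    U ⟦ v₇ x xa xb xc xab xbc xca ⟧₇ ≈⟨ U-cong (⟦⟧₇-def x xa xb xc xab xbc xca) ⟩
    U (⟦ x ⟧₆ + _) ≈⟨ U-+ _ _ ⟩
    U ⟦ x ⟧₆ + U _ ≈⟨ +-congˡ (zeros (U-kill xa U-a) (zeros (U-kill xb U-b) (zeros (U-kill xc U-c) (zeros (U-kill xab U-ab) (zeros (U-kill xbc U-bc) (U-kill xca U-ca)))))) ⟩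
    U ⟦ x ⟧₆ + 0# ≈⟨ +-identityʳ _ ⟩
    U ⟦ x ⟧₆ ∎
    where
    zeros : ∀ {a b} → U a ≈ 0# → U b ≈ 0# → U (a + b) ≈ 0#
    zeros p r = U-+ _ _ ⨾ +-cong p r ⨾ +-identityˡ 0#

-- The equation of u over the functions of q⁷, and the values of U in the windows

module Main (R : CommutativeRing 0ℓ 0ℓ) (S : Setup R) where
  open Ring R
  open Setup S
  open Trace R dissection
  open Tower R tower using (⟦_⟧₆; ⟦⟧₆-def; ⟦_⟧₇; ⟦⟧₇-def; z; y; g; ×g-acts; start≈; projects⇒≈; hornerᴿ; equation)
  open EvalHom R W W-cong W-+ W-* W-1
  module Hi = Eval.Pair R D.s D.T
  open Eval R s° using (⟦_⟧ᵖ; ⟦⟧-[]; ⟦⟧-∷)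
  open Eval.Pair R s° t
  open Operators t²

  κ₁° κ₂° μ° : Carrier
  κ₁° = s° * s° + ι (+ 2) * s° - ι (+ 7) - t
  κ₂° = t - ι (+ 5) - s°
  μ° = (s° * s° - ι (+ 7) * s° + ι (+ 13)) * t - ι (+ 8)

  μκ₂ : μ° * κ₂° ≈ w * w
  μκ₂ = mod! 3 s° t w (λ s t w →
      (((s :* s :- # 7 :* s :+ # 13) :* t :- # 8) :* (t :- # 5 :- s) , w :* w) ,
      ((s :* s :- # 7 :* s :+ # 13) :- (s :- # 4) :* (s :- # 4) , t :* t , (s :* s :+ s :- # 3) :* t :- # 8) ∷
      (:- (w :+ ((s :- # 4) :* t :+ # 8)) , w , (s :- # 4) :* t :+ # 8) ∷ []) (t² , w≈)

  W-⟦⟧₂ : ∀ x → W ⟦ x ⟧₂ ≈ Hi.⟦ x ⟧₂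
  W-⟦⟧₂ x = W-cong (⟦⟧₂-def x) ⨾ W-+ _ _ ⨾ +-cong (W-⟦⟧ W-s (part₀ x)) (W-* _ _ ⨾ *-cong (W-⟦⟧ W-s (part₁ x)) W-t) ⨾ ≈-sym (Hi.⟦⟧₂-def x)

  U-⟦⟧₂ : ∀ k → projects k ≡ true → U ⟦ k ⟧₆ ≈ ⟦ project k ⟧₂
  U-⟦⟧₂ k eq = begin
    U ⟦ k ⟧₆ ≈⟨ U-cong (projects⇒≈ k eq ⨾ ≈-sym (*-identityʳ _ ⨾ W-⟦⟧₂ (project k))) ⟩
    U (W ⟦ project k ⟧₂ * 1#) ≈⟨ U-W _ 1# ⟩
    ⟦ project k ⟧₂ * U 1# ≈⟨ *-congˡ U-1 ⨾ *-identityʳ _ ⟩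
    ⟦ project k ⟧₂ ∎

  TraceList : Carrier → List K₆ → Set
  TraceList X [] = ⊤
  TraceList X (k ∷ ks) = (U X ≈ ⟦ project k ⟧₂) × TraceList (g * X) ks

  trace-orbit : ∀ n v X → ⟦ v ⟧₇ ≈ X → allProject (orbit n v) ≡ true → TraceList X (orbit n v)
  trace-orbit zero v X e ok = tt
  trace-orbit (suc n) v X e ok = U-cong (≈-sym e) ⨾ trace₇ v ⨾ U-⟦⟧₂ (eᵒ v) (proj₁ (∧-true ok))
    , trace-orbit n (×g v) (g * X) (×g-acts v ⨾ *-congˡ e) (proj₂ (∧-true {projects (eᵒ v)} ok))

  ^-+ : ∀ x m n → x ^ (m N.+ n) ≈ x ^ m * x ^ n
  ^-+ x zero n = ≈-sym (*-identityˡ _)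
  ^-+ x (suc m) n = *-congˡ (^-+ x m n) ⨾ ≈-sym (*-assoc _ _ _)

  ^-cong : ∀ {x y} n → x ≈ y → x ^ n ≈ y ^ n
  ^-cong zero e = ≈-refl
  ^-cong (suc n) e = *-cong e (^-cong n e)

  ^-distrib : ∀ x y n → (x * y) ^ n ≈ x ^ n * y ^ n
  ^-distrib x y zero = ≈-sym (*-identityˡ 1#)
  ^-distrib x y (suc n) = *-congˡ (^-distrib x y n) ⨾ ring! 4 x y (x ^ n) (y ^ n) (λ x y a b → (x :* y) :* (a :* b) , (x :* a) :* (y :* b))

  one-^ : ∀ n → 1# ^ n ≈ 1#
  one-^ zero = ≈-refl
  one-^ (suc n) = *-identityˡ _ ⨾ one-^ n

  ^-inv : ∀ {x y} n → x * y ≈ 1# → x ^ n * y ^ n ≈ 1#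
  ^-inv {x} {y} n e = ≈-sym (^-distrib x y n) ⨾ ^-cong n e ⨾ one-^ n

  ^-² : ∀ x n → (x * x) ^ n ≈ x ^ (2 N.* n)
  ^-² x n = ^-distrib x x n ⨾ *-congˡ (≈-sym (^-+ x n 0 ⨾ *-identityʳ _)) ⨾ ≈-sym (^-+ x n (n N.+ 0))

  ^-³ : ∀ x n → (x * (x * x)) ^ n ≈ x ^ (3 N.* n)
  ^-³ x n = ^-distrib x (x * x) n ⨾ *-congˡ (^-² x n) ⨾ ≈-sym (^-+ x n (2 N.* n))

  wᴺ-cancel : ∀ n {x y} → w ^ n * x ≈ w ^ n * y → x ≈ y
  wᴺ-cancel n {x} {y} e = mod! 4 (w ^ n) (u ^ n) x y (λ a b x y → (x , y) , (b , a :* x , a :* y) ∷ (y :- x , b :* a , 𝟙) ∷ []) (e , ^-inv n uw)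

  Ũ : Carrier
  Ũ = W w

  ũ : Carrier
  ũ = W u

  ũŨ : ũ * Ũ ≈ 1#
  ũŨ = ≈-sym (W-* u w) ⨾ W-cong uw ⨾ W-1

  rowᴿ : Row → Carrier
  rowᴿ (a , b , c) = ι a + (ι b * t + ι c * (t * t))

  valueR : List Row → Carrier
  valueR [] = 0#
  valueR (r ∷ rs) = rowᴿ r + u * valueR rs

  υ-w : Acts₂ υ w
  υ-w = cong-acts (≈-sym w≈) υ-acts

  lit₁ : ∀ x → ⟦ lit (x ∷ []) ⟧ᵖ ≈ ι x
  lit₁ x = ⟦⟧-∷ x [] ⨾ +-congˡ (*-congˡ ⟦⟧-[] ⨾ zeroʳ s°) ⨾ +-identityʳ _

  packRow≈ : ∀ r → ⟦ packRow r ⟧₂ ≈ rowᴿ r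
  packRow≈ (a , b , c) = ⟦⟧₂-def (packRow (a , b , c)) ⨾ mod! 7 s° t (ι a) (ι b) (ι c) (⟦ lit (a Z.+ −8 Z.* c ∷ []) ⟧ᵖ) (⟦ lit (b Z.+ −3 Z.* c ∷ c ∷ c ∷ []) ⟧ᵖ)
    (λ s t a b c x y → (x :+ y :* t , a :+ (b :* t :+ c :* (t :* t))) ,
      (𝟙 , x , a :+ con −8 :* c) ∷ (t , y , b :+ con −3 :* c :+ s :* (c :+ s :* c)) ∷ (:- c , t :* t , (s :* s :+ s :- # 3) :* t :- # 8) ∷ [])
    ( lit₁ _ ⨾ ι-+ a _ ⨾ +-congˡ (ι-* −8 c)
    , ⟦⟧-∷ _ (c ∷ c ∷ []) ⨾ +-cong (ι-+ b _ ⨾ +-congˡ (ι-* −3 c)) (*-congˡ (⟦⟧-∷ c (c ∷ []) ⨾ +-congˡ (*-congˡ (lit₁ c))))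
    , t²)

  evalRows≈ : ∀ acc rows → ⟦ evalRows acc rows ⟧₂ ≈ w ^ length rows * (⟦ acc ⟧₂ + u * valueR rows)
  evalRows≈ acc [] = ring! 2 (⟦ acc ⟧₂) u (λ x u → x , 𝟙 :* (x :+ u :* 𝟘))
  evalRows≈ acc (r ∷ rows) = evalRows≈ (υ acc ⊹₂ packRow r) rows
    ⨾ mod! 7 (⟦ υ acc ⊹₂ packRow r ⟧₂) (⟦ acc ⟧₂) (rowᴿ r) u w (w ^ length rows) (valueR rows)
      (λ x a r u w k v → (k :* (x :+ u :* v) , (w :* k) :* (a :+ u :* (r :+ u :* v))) , (k , x , w :* a :+ r) ∷ (:- (k :* (r :+ u :* v)) , u :* w , 𝟙) ∷ [])
      (⟦⟧₂-⊹ (υ acc) (packRow r) ⨾ +-cong (on₂ υ-w acc) (packRow≈ r) , uw)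

  0₂≈ : ⟦ 0₂ ⟧₂ ≈ 0#
  0₂≈ = ⟦⟧₂-def 0₂ ⨾ +-cong ⟦⟧-[] (*-congʳ ⟦⟧-[] ⨾ zeroˡ t) ⨾ +-identityˡ 0#

  1₂≈ : ⟦ 1₂ ⟧₂ ≈ 1#
  1₂≈ = ⟦⟧₂-def 1₂ ⨾ +-cong (lit₁ (+ 1) ⨾ ι-1) (*-congʳ ⟦⟧-[] ⨾ zeroˡ t) ⨾ +-identityʳ 1#

  evalRows₀≈ : ∀ rows → ⟦ evalRows 0₂ rows ⟧₂ ≈ w ^ length rows * (u * valueR rows)
  evalRows₀≈ rows = evalRows≈ 0₂ rows ⨾ *-congˡ (+-congʳ 0₂≈ ⨾ +-identityˡ _)

  difference≈ : ∀ x y → vanishes₂ (difference x y) ≡ true → ⟦ x ⟧₂ ≈ ⟦ y ⟧₂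
  difference≈ x y eq = sub≈0⇒≈ (≈-sym (⟦⟧₂-⊹ x (scale₂ −1 y) ⨾ +-congˡ (on₂ (scale-acts −1) y ⨾ neg-one* _)) ⨾ vanishes₂⇒≈0 (difference x y) eq)

  ε-term : ∀ k e c → length e ≡ 8 → vanishes₂ (difference (iter υ k (evalRows 0₂ e)) (iter τ 6 (iter κ₂ (2 N.* k) c))) ≡ true →
           w ^ (k N.+ 7) * valueR e ≈ t ^ 6 * (κ₂° ^ (2 N.* k) * ⟦ c ⟧₂)
  ε-term k e c len eq = begin
    w ^ (k N.+ 7) * valueR e ≈⟨ *-congʳ (^-+ w k 7) ⟩
    w ^ k * w ^ 7 * valueR e ≈⟨ mod! 5 (w ^ k) (w ^ 7) w u (valueR e) (λ a b w u v → (a :* b :* v , a :* ((w :* b) :* (u :* v))) , (:- (a :* b :* v) , u :* w , 𝟙) ∷ []) uw ⟩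
    w ^ k * (w ^ 8 * (u * valueR e)) ≈⟨ *-congˡ (≈-sym (evalRows₀≈ e ⨾ *-congʳ (reflexive (cong (w ^_) len)))) ⟩
    w ^ k * ⟦ evalRows 0₂ e ⟧₂ ≈⟨ ≈-sym (on₂ (iter-acts υ-w k) (evalRows 0₂ e)) ⟩
    ⟦ iter υ k (evalRows 0₂ e) ⟧₂ ≈⟨ difference≈ (iter υ k (evalRows 0₂ e)) (iter τ 6 (iter κ₂ (2 N.* k) c)) eq ⟩
    ⟦ iter τ 6 (iter κ₂ (2 N.* k) c) ⟧₂ ≈⟨ on₂ (iter-acts τ-acts 6) (iter κ₂ (2 N.* k) c) ⟩
    t ^ 6 * ⟦ iter κ₂ (2 N.* k) c ⟧₂ ≈⟨ *-congˡ (on₂ (iter-acts κ₂-acts (2 N.* k)) c) ⟩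
    t ^ 6 * (κ₂° ^ (2 N.* k) * ⟦ c ⟧₂) ∎

  value : List Row → Carrier
  value e = W (valueR e)

  lin : List (List Row) → ℕ → Carrier
  lin (e ∷ es) (suc m) = value e * u ^ m + lin es m
  lin _ _ = 0#

  ε-termᵂ : ∀ k e c → length e ≡ 8 → vanishes₂ (difference (iter υ k (evalRows 0₂ e)) (iter τ 6 (iter κ₂ (2 N.* k) c))) ≡ true →
            Ũ ^ (k N.+ 7) * value e ≈ W (t ^ 6) * ((W κ₂° * W κ₂°) ^ k * Hi.⟦ c ⟧₂)
  ε-termᵂ k e c len eq = begin
    Ũ ^ (k N.+ 7) * value e ≈⟨ *-congʳ (≈-sym (W-^ w (k N.+ 7))) ⨾ ≈-sym (W-* _ _) ⟩
    W (w ^ (k N.+ 7) * valueR e) ≈⟨ W-cong (ε-term k e c len eq) ⟩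
    W (t ^ 6 * (κ₂° ^ (2 N.* k) * ⟦ c ⟧₂)) ≈⟨ W-* _ _ ⨾ *-congˡ (W-* _ _ ⨾ *-cong (W-^ κ₂° (2 N.* k) ⨾ ≈-sym (^-² (W κ₂°) k)) (W-⟦⟧₂ c)) ⟩
    W (t ^ 6) * ((W κ₂° * W κ₂°) ^ k * Hi.⟦ c ⟧₂) ∎

  constant-term : W (t ^ 6) * Hi.⟦ S₇ ⟧₂ + Ũ ^ 6 * (W κ₂° * W κ₂°) ≈ 0#
  constant-term = begin
    W (t ^ 6) * Hi.⟦ S₇ ⟧₂ + Ũ ^ 6 * (W κ₂° * W κ₂°)
      ≈⟨ +-cong (*-congˡ (≈-sym (W-⟦⟧₂ S₇)) ⨾ ≈-sym (W-* _ _)) (*-cong (≈-sym (W-^ w 6)) (≈-sym (W-* κ₂° κ₂°)) ⨾ ≈-sym (W-* _ _)) ⟩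
    W (t ^ 6 * ⟦ S₇ ⟧₂) + W (w ^ 6 * (κ₂° * κ₂°)) ≈⟨ ≈-sym (W-+ _ _) ⟩
    W (t ^ 6 * ⟦ S₇ ⟧₂ + w ^ 6 * (κ₂° * κ₂°)) ≈⟨ W-cong (+-cong (≈-sym (on₂ (iter-acts τ-acts 6) S₇)) (≈-sym κ-part) ⨾ ≈-sym (⟦⟧₂-⊹ (iter τ 6 S₇) (iter υ 6 (iter κ₂ 2 1₂)))) ⟩
    W ⟦ iter τ 6 S₇ ⊹₂ iter υ 6 (iter κ₂ 2 1₂) ⟧₂ ≈⟨ W-cong (vanishes₂⇒≈0 (iter τ 6 S₇ ⊹₂ iter υ 6 (iter κ₂ 2 1₂)) constant-check) ⟩
    W 0# ≈⟨ W-0 ⟩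
    0# ∎
    where
    κ-part : ⟦ iter υ 6 (iter κ₂ 2 1₂) ⟧₂ ≈ w ^ 6 * (κ₂° * κ₂°)
    κ-part = on₂ (iter-acts υ-w 6) (iter κ₂ 2 1₂) ⨾ *-congˡ (on₂ (iter-acts κ₂-acts 2) 1₂ ⨾ *-congˡ 1₂≈ ⨾ ring! 1 κ₂° (λ k → (k :* (k :* 𝟙)) :* 𝟙 , k :* k))

  K : Carrier
  K = W κ₂° * W κ₂°

  -- The equation of g multiplied by (Ũ u)⁷: by `w-eq` and u w = 1 one has g Ũ u = K, which turns
  -- powers of g into powers of K and reverses the order of the coefficients.
  scaled-equation : W (t ^ 6) * (K ^ 7 + Hi.⟦ S₁ ⟧₂ * K ^ 6 * (Ũ * u) + Hi.⟦ S₂ ⟧₂ * K ^ 5 * (Ũ * u) ^ 2 + Hi.⟦ S₃ ⟧₂ * K ^ 4 * (Ũ * u) ^ 3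
                    + Hi.⟦ S₄ ⟧₂ * K ^ 3 * (Ũ * u) ^ 4 + Hi.⟦ S₅ ⟧₂ * K ^ 2 * (Ũ * u) ^ 5 + Hi.⟦ S₆ ⟧₂ * K * (Ũ * u) ^ 6 + Hi.⟦ S₇ ⟧₂ * (Ũ * u) ^ 7) ≈ 0#
  scaled-equation = *-congˡ (subst-K gY≈K ⨾ ring! 9 g (Ũ * u) (Hi.⟦ S₁ ⟧₂) (Hi.⟦ S₂ ⟧₂) (Hi.⟦ S₃ ⟧₂) (Hi.⟦ S₄ ⟧₂) (Hi.⟦ S₅ ⟧₂) (Hi.⟦ S₆ ⟧₂) (Hi.⟦ S₇ ⟧₂)
      (λ g y a b c d e f h → form (g :* y) y a b c d e f h , y :^ 7 :* (g :* (g :* (g :* (g :* (g :* (g :* (g :* 𝟙 :+ a) :+ b) :+ c) :+ d) :+ e) :+ f) :+ h))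
      ⨾ *-congˡ equation ⨾ zeroʳ _) ⨾ zeroʳ _
    where
    form : ∀ {n} (k y a b c d e f h : Ex n) → Ex n
    form k y a b c d e f h = k :^ 7 :+ a :* k :^ 6 :* y :+ b :* k :^ 5 :* y :^ 2 :+ c :* k :^ 4 :* y :^ 3 :+ d :* k :^ 3 :* y :^ 4 :+ e :* k :^ 2 :* y :^ 5 :+ f :* k :* y :^ 6 :+ h :* y :^ 7
    gY≈K : K ≈ g * (Ũ * u)
    gY≈K = mod! 5 K g Ũ u w (λ k g U u w → (k , g :* (U :* u)) , (u , w :* k , g :* U) ∷ (:- k , u :* w , 𝟙) ∷ []) (w-eq , uw)
    subst-K : ∀ {x} → K ≈ x → (K ^ 7 + Hi.⟦ S₁ ⟧₂ * K ^ 6 * (Ũ * u) + Hi.⟦ S₂ ⟧₂ * K ^ 5 * (Ũ * u) ^ 2 + Hi.⟦ S₃ ⟧₂ * K ^ 4 * (Ũ * u) ^ 3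
                    + Hi.⟦ S₄ ⟧₂ * K ^ 3 * (Ũ * u) ^ 4 + Hi.⟦ S₅ ⟧₂ * K ^ 2 * (Ũ * u) ^ 5 + Hi.⟦ S₆ ⟧₂ * K * (Ũ * u) ^ 6 + Hi.⟦ S₇ ⟧₂ * (Ũ * u) ^ 7)
                  ≈ (x ^ 7 + Hi.⟦ S₁ ⟧₂ * x ^ 6 * (Ũ * u) + Hi.⟦ S₂ ⟧₂ * x ^ 5 * (Ũ * u) ^ 2 + Hi.⟦ S₃ ⟧₂ * x ^ 4 * (Ũ * u) ^ 3
                    + Hi.⟦ S₄ ⟧₂ * x ^ 3 * (Ũ * u) ^ 4 + Hi.⟦ S₅ ⟧₂ * x ^ 2 * (Ũ * u) ^ 5 + Hi.⟦ S₆ ⟧₂ * x * (Ũ * u) ^ 6 + Hi.⟦ S₇ ⟧₂ * (Ũ * u) ^ 7)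
    subst-K e = +-congʳ (+-cong (+-cong (+-cong (+-cong (+-cong (+-cong (^-cong 7 e) (t-cong 6 e)) (t-cong 5 e)) (t-cong 4 e)) (t-cong 3 e)) (t-cong 2 e)) (*-congʳ (*-congˡ e)))
      where
      t-cong : ∀ n {x y σ v} → x ≈ y → σ * x ^ n * v ≈ σ * y ^ n * v
      t-cong n e = *-congʳ (*-congˡ (^-cong n e))

  -- In the reversed equation u⁷ has the coefficient S₇, which `constant-term` makes a known
  -- product. The common factor K Ũ¹³ is cancelled through the inverses of κ₂(q⁷) and of Ũ.
  u-equation : u ^ 7 ≈ lin ε 7
  u-equation = ≈-sym (sub≈0⇒≈ (mod! 6 K Ũ κ⁻¹ ũ (W κ₂°) (lin ε 7 - u ^ 7)
      (λ k U i v κ x → (x , 𝟘) , (i :* i :* v :^ 13 , k :* U :^ 13 :* x , 𝟘)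
        ∷ (:- (U :^ 13 :* x :* i :* i :* v :^ 13) , k , κ :* κ) ∷ (:- (U :^ 13 :* x :* v :^ 13 :* (κ :* i :+ 𝟙)) , κ :* i , 𝟙) ∷ (:- x , v :^ 13 :* U :^ 13 , 𝟙) ∷ [])
      (cleared , ≈-refl , κ-inv , ^-inv 13 ũŨ)))
    where
    cleared : K * Ũ ^ 13 * (lin ε 7 - u ^ 7) ≈ 0#
    cleared = mod! 19 Ũ u K (W (t ^ 6)) (Hi.⟦ S₁ ⟧₂) (Hi.⟦ S₂ ⟧₂) (Hi.⟦ S₃ ⟧₂) (Hi.⟦ S₄ ⟧₂) (Hi.⟦ S₅ ⟧₂) (Hi.⟦ S₆ ⟧₂) (Hi.⟦ S₇ ⟧₂) (Hi.⟦ 1₂ ⟧₂) (value ε₁) (value ε₂) (value ε₃) (value ε₄) (value ε₅) (value ε₆) (value ε₇)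
      (λ U u k T a b c d e f h o eᵒ e₂ e₃ e₄ e₅ e₆ e₇ →
        (k :* U :^ 13 :* ((eᵒ :* u :^ 6 :+ (e₂ :* u :^ 5 :+ (e₃ :* u :^ 4 :+ (e₄ :* u :^ 3 :+ (e₅ :* u :^ 2 :+ (e₆ :* u :^ 1 :+ (e₇ :* u :^ 0 :+ 𝟘))))))) :- u :^ 7) , 𝟘) ,
        (k :* (U :* u) :^ 6 , U :^ 7 :* eᵒ , T :* (k :^ 0 :* f)) ∷
        (k :* (U :* u) :^ 5 , U :^ 8 :* e₂ , T :* (k :^ 1 :* e)) ∷
        (k :* (U :* u) :^ 4 , U :^ 9 :* e₃ , T :* (k :^ 2 :* d)) ∷
        (k :* (U :* u) :^ 3 , U :^ 10 :* e₄ , T :* (k :^ 3 :* c)) ∷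
        (k :* (U :* u) :^ 2 , U :^ 11 :* e₅ , T :* (k :^ 4 :* b)) ∷
        (k :* (U :* u) , U :^ 12 :* e₆ , T :* (k :^ 5 :* a)) ∷
        (k , U :^ 13 :* e₇ , T :* (k :^ 6 :* o)) ∷
        (T :* k :^ 7 , o , 𝟙) ∷
        (:- (U :* u) :^ 7 , T :* h :+ U :^ 6 :* k , 𝟘) ∷
        (𝟙 , T :* (k :^ 7 :+ a :* k :^ 6 :* (U :* u) :+ b :* k :^ 5 :* (U :* u) :^ 2 :+ c :* k :^ 4 :* (U :* u) :^ 3
                    :+ d :* k :^ 3 :* (U :* u) :^ 4 :+ e :* k :^ 2 :* (U :* u) :^ 5 :+ f :* k :* (U :* u) :^ 6 :+ h :* (U :* u) :^ 7) , 𝟘) ∷ [])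
      ( ε-termᵂ 0 ε₁ S₆ refl (proj₁ c₁) , ε-termᵂ 1 ε₂ S₅ refl (proj₁ c₂) , ε-termᵂ 2 ε₃ S₄ refl (proj₁ c₃) , ε-termᵂ 3 ε₄ S₃ refl (proj₁ c₄)
      , ε-termᵂ 4 ε₅ S₂ refl (proj₁ c₅) , ε-termᵂ 5 ε₆ S₁ refl (proj₁ c₆) , ε-termᵂ 6 ε₇ 1₂ refl (proj₁ c₇)
      , ≈-sym (W-⟦⟧₂ 1₂) ⨾ W-cong 1₂≈ ⨾ W-1 , constant-term , scaled-equation)
      where
      test : ℕ → List Row → P₂ → Bool
      test k e c = vanishes₂ (difference (iter υ k (evalRows 0₂ e)) (iter τ 6 (iter κ₂ (2 N.* k) c)))
      c₁ = ∧-true {test 0 ε₁ S₆} ε-check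
      c₂ = ∧-true {test 1 ε₂ S₅} (proj₂ c₁)
      c₃ = ∧-true {test 2 ε₃ S₄} (proj₂ c₂)
      c₄ = ∧-true {test 3 ε₄ S₃} (proj₂ c₃)
      c₅ = ∧-true {test 4 ε₅ S₂} (proj₂ c₄)
      c₆ = ∧-true {test 5 ε₆ S₁} (proj₂ c₅)
      c₇ = ∧-true {test 6 ε₇ 1₂} (proj₂ c₆)

  U-0 : U 0# ≈ 0#
  U-0 = x+x≈x⇒x≈0 (U 0#) (≈-sym (U-+ 0# 0#) ⨾ U-cong (+-identityˡ 0#))

  linᵁ : Carrier → List (List Row) → ℕ → Carrier
  linᵁ X (e ∷ es) (suc m) = valueR e * U (X * u ^ m) + linᵁ X es m
  linᵁ X _ _ = 0#

  U-lin : ∀ X es m → U (X * lin es m) ≈ linᵁ X es m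
  U-lin X [] m = U-cong (zeroʳ X) ⨾ U-0
  U-lin X (e ∷ es) zero = U-cong (zeroʳ X) ⨾ U-0
  U-lin X (e ∷ es) (suc m) = begin
    U (X * (value e * u ^ m + lin es m)) ≈⟨ U-cong (ring! 4 X (value e) (u ^ m) (lin es m) (λ x v p l → x :* (v :* p :+ l) , v :* (x :* p) :+ x :* l)) ⟩
    U (value e * (X * u ^ m) + X * lin es m) ≈⟨ U-+ _ _ ⟩
    U (value e * (X * u ^ m)) + U (X * lin es m) ≈⟨ +-cong (U-W (valueR e) _) (U-lin X es m) ⟩
    valueR e * U (X * u ^ m) + linᵁ X es m ∎

  recurrence : ∀ X → U (X * u ^ 7) ≈ linᵁ X ε 7
  recurrence X = U-cong (*-congˡ u-equation) ⨾ U-lin X ε 7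

  pack≈ : ∀ rows → length rows N.≤ 34 → ⟦ pack rows ⟧₂ ≈ w ^ 33 * valueR rows
  pack≈ rows short = begin
    ⟦ iter υ (34 N.∸ length rows) (evalRows 0₂ rows) ⟧₂ ≈⟨ on₂ (iter-acts υ-w (34 N.∸ length rows)) (evalRows 0₂ rows) ⟩
    w ^ (34 N.∸ length rows) * ⟦ evalRows 0₂ rows ⟧₂ ≈⟨ *-congˡ (evalRows₀≈ rows) ⟩
    w ^ (34 N.∸ length rows) * (w ^ length rows * (u * valueR rows)) ≈⟨ ≈-sym (*-assoc _ _ _) ⟩
    w ^ (34 N.∸ length rows) * w ^ length rows * (u * valueR rows) ≈⟨ *-congʳ (≈-sym (^-+ w (34 N.∸ length rows) (length rows))) ⟩
    w ^ (34 N.∸ length rows N.+ length rows) * (u * valueR rows) ≡⟨ cong (λ n → w ^ n * (u * valueR rows)) (N.m∸n+n≡m short) ⟩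
    w * w ^ 33 * (u * valueR rows) ≈⟨ mod! 4 w u (w ^ 33) (valueR rows) (λ w u p v → (w :* p :* (u :* v) , p :* v) , (p :* v , u :* w , 𝟙) ∷ []) uw ⟩
    w ^ 33 * valueR rows ∎

  actRows≈ : ∀ x acc rows → ⟦ actRows x (τ x) (τ (τ x)) acc rows ⟧₂ ≈ w ^ length rows * (⟦ acc ⟧₂ + u * (valueR rows * ⟦ x ⟧₂))
  actRows≈ x acc [] = ring! 3 (⟦ acc ⟧₂) u (⟦ x ⟧₂) (λ a u x → a , 𝟙 :* (a :+ u :* (𝟘 :* x)))
  actRows≈ x acc ((a , b , c) ∷ rows) = actRows≈ x acc′ rows
    ⨾ mod! 11 (⟦ acc′ ⟧₂) (⟦ acc ⟧₂) (ι a) (ι b) (ι c) t u w (w ^ length rows) (valueR rows) (⟦ x ⟧₂)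
      (λ s r a b c t u w k v x →
        (k :* (s :+ u :* (v :* x)) , (w :* k) :* (r :+ u :* ((a :+ (b :* t :+ c :* (t :* t)) :+ u :* v) :* x))) ,
        (k , s , w :* r :+ (a :* x :+ (b :* (t :* x) :+ c :* (t :* (t :* x))))) ∷ (:- (k :* ((a :+ (b :* t :+ c :* (t :* t)) :+ u :* v) :* x)) , u :* w , 𝟙) ∷ [])
      (acc′≈ , uw)
    where
    acc′ : P₂
    acc′ = υ acc ⊹₂ (scale₂ a x ⊹₂ (scale₂ b (τ x) ⊹₂ scale₂ c (τ (τ x))))
    acc′≈ : ⟦ acc′ ⟧₂ ≈ w * ⟦ acc ⟧₂ + (ι a * ⟦ x ⟧₂ + (ι b * (t * ⟦ x ⟧₂) + ι c * (t * (t * ⟦ x ⟧₂))))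
    acc′≈ = ⟦⟧₂-⊹ (υ acc) _ ⨾ +-cong (on₂ υ-w acc) (⟦⟧₂-⊹ (scale₂ a x) _ ⨾ +-cong (on₂ (scale-acts a) x)
      (⟦⟧₂-⊹ (scale₂ b (τ x)) _ ⨾ +-cong (on₂ (scale-acts b) (τ x) ⨾ *-congˡ (on₂ τ-acts x))
        (on₂ (scale-acts c) (τ (τ x)) ⨾ *-congˡ (on₂ τ-acts (τ x) ⨾ *-congˡ (on₂ τ-acts x)))))

  act≈ : ∀ e x → length e ≡ 8 → ⟦ act e x ⟧₂ ≈ w ^ 7 * (valueR e * ⟦ x ⟧₂)
  act≈ e x len = begin
    ⟦ act e x ⟧₂ ≈⟨ actRows≈ x 0₂ e ⟩
    w ^ length e * (⟦ 0₂ ⟧₂ + u * (valueR e * ⟦ x ⟧₂)) ≡⟨ cong (λ n → w ^ n * (⟦ 0₂ ⟧₂ + u * (valueR e * ⟦ x ⟧₂))) len ⟩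
    w * w ^ 7 * (⟦ 0₂ ⟧₂ + u * (valueR e * ⟦ x ⟧₂)) ≈⟨ mod! 5 w u (w ^ 7) (⟦ 0₂ ⟧₂) (valueR e * ⟦ x ⟧₂) (λ w u p o v → (w :* p :* (o :+ u :* v) , p :* v) , (p :* v , u :* w , 𝟙) ∷ (w :* p , o , 𝟘) ∷ []) (uw , 0₂≈) ⟩
    w ^ 7 * (valueR e * ⟦ x ⟧₂) ∎

  Previous : Carrier → ℕ → List P₂ → Set
  Previous X zero xs = ⊤
  Previous X (suc m) [] = ⊥
  Previous X (suc m) (x ∷ xs) = (⟦ x ⟧₂ ≈ w ^ 33 * U (X * u ^ m)) × Previous X m xs

  Octets : List (List Row) → ℕ → Set
  Octets [] zero = ⊤
  Octets [] (suc m) = ⊥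
  Octets (e ∷ es) zero = ⊥
  Octets (e ∷ es) (suc m) = (length e ≡ 8) × Octets es m

  combine≈ : ∀ X es m xs → Octets es m → Previous X m xs → ⟦ combine es xs ⟧₂ ≈ w ^ 7 * (w ^ 33 * linᵁ X es m)
  combine≈ X [] zero xs _ _ = 0₂≈ ⨾ ring! 2 (w ^ 7) (w ^ 33) (λ a b → 𝟘 , a :* (b :* 𝟘))
  combine≈ X (e ∷ es) (suc m) (x ∷ xs) (l , ls) (p , ps) = begin
    ⟦ act e x ⊹₂ combine es xs ⟧₂ ≈⟨ ⟦⟧₂-⊹ (act e x) (combine es xs) ⟩
    ⟦ act e x ⟧₂ + ⟦ combine es xs ⟧₂ ≈⟨ +-cong (act≈ e x l ⨾ *-congˡ (*-congˡ p)) (combine≈ X es m xs ls ps) ⟩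
    w ^ 7 * (valueR e * (w ^ 33 * U (X * u ^ m))) + w ^ 7 * (w ^ 33 * linᵁ X es m)
      ≈⟨ ring! 5 (w ^ 7) (w ^ 33) (valueR e) (U (X * u ^ m)) (linᵁ X es m) (λ a b v x l → a :* (v :* (b :* x)) :+ a :* (b :* l) , a :* (b :* (v :* x :+ l))) ⟩
    w ^ 7 * (w ^ 33 * (valueR e * U (X * u ^ m) + linᵁ X es m)) ∎

  Short : List (List Row) → Set
  Short [] = ⊤
  Short (l ∷ ls) = (length l N.≤ 34) × Short ls

  Next : Carrier → List (List Row) → Set
  Next X [] = ⊤
  Next X (l ∷ ls) = (U (X * u ^ 7) ≈ valueR l) × Next (X * u) ls

  shift-u : ∀ X m → X * u * u ^ m ≈ X * u ^ suc m
  shift-u X m = *-assoc X u (u ^ m)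

  previous-shift : ∀ X m xs → Previous X (suc m) xs → Previous (X * u) m xs
  previous-shift X zero xs p = tt
  previous-shift X (suc m) (x ∷ xs) (p , ps) = p ⨾ *-congˡ (U-cong (≈-sym (shift-u X m))) , previous-shift X m xs ps

  -- Passing to the next entry replaces X by X u: the oldest of the seven previous values is dropped
  -- and the entry just verified takes the head of the list.
  next-sound : ∀ X prev ls → Short ls → Previous X 7 prev → check-next prev ls ≡ true → Next X ls
  next-sound X prev [] _ _ _ = tt
  next-sound X prev (l ∷ ls) (sh , shs) ps eq = ≈-sym l≈ , next-sound (X * u) (pack l ∷ prev) ls shs
      (pl ⨾ *-congˡ (l≈ ⨾ U-cong (≈-sym (shift-u X 6))) , previous-shift X 6 prev ps) (proj₂ (∧-true {vanishes₂ (difference (iter υ 7 (pack l)) (combine ε prev))} eq))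
    where
    pl : ⟦ pack l ⟧₂ ≈ w ^ 33 * valueR l
    pl = pack≈ l sh
    l≈ : valueR l ≈ U (X * u ^ 7)
    l≈ = wᴺ-cancel 33 (wᴺ-cancel 7 (begin
      w ^ 7 * (w ^ 33 * valueR l) ≈⟨ *-congˡ (≈-sym pl) ⟩
      w ^ 7 * ⟦ pack l ⟧₂ ≈⟨ ≈-sym (on₂ (iter-acts υ-w 7) (pack l)) ⟩
      ⟦ iter υ 7 (pack l) ⟧₂ ≈⟨ difference≈ (iter υ 7 (pack l)) (combine ε prev) (proj₁ (∧-true eq)) ⟩
      ⟦ combine ε prev ⟧₂ ≈⟨ combine≈ X ε 7 prev (refl , refl , refl , refl , refl , refl , refl , tt) ps ⟩
      w ^ 7 * (w ^ 33 * linᵁ X ε 7) ≈⟨ *-congˡ (*-congˡ (≈-sym (recurrence X))) ⟩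
      w ^ 7 * (w ^ 33 * U (X * u ^ 7)) ∎))

  Ũ³ μ² : Carrier
  Ũ³ = Ũ * (Ũ * Ũ)
  μ² = W μ° * W μ°

  -- From μ κ₂ = w² one has μ² K = Ũ⁴, so the factor K = κ₂(q⁷)² can be exchanged for a power of
  -- w(q⁷), which `υ` clears after the trace.
  rescale : ∀ a b → a * K ≈ b * Ũ → a * Ũ³ ≈ b * μ²
  rescale a b e = mod! 6 a b (W κ₂°) Ũ ũ (W μ°) (λ a b k U v m → (a :* (U :* (U :* U)) , b :* (m :* m)) ,
      (m :* m :* v , a :* (k :* k) , b :* U) ∷ (:- (a :* v :* (m :* k :+ U :* U)) , m :* k , U :* U) ∷ (b :* (m :* m) :- a :* (U :* (U :* U)) , v :* U , 𝟙) ∷ [])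
    (e , ≈-sym (W-* μ° κ₂°) ⨾ W-cong μκ₂ ⨾ W-* w w , ũŨ)

  w-rescaled : w * Ũ³ ≈ g * μ²
  w-rescaled = rescale w g w-eq

  t-rescaled : t * z * Ũ³ ≈ y * W κ₁° * μ²
  t-rescaled = rescale (t * z) (y * W κ₁°) (t-eq ⨾ ring! 3 y Ũ (W κ₁°) (λ y U k → y :* U :* k , y :* k :* U))

  module Window (H : Carrier) (j : ℕ) where

    -- Relates H wᵏ tʲ to a monomial X in z and y by functions of q⁷ only. These leave `U`, so the
    -- trace of X in the tower determines U(H wᵏ tʲ).
    Entry : ℕ → Carrier → Set
    Entry k X = H * w ^ k * t ^ j * Ũ³ ^ (k N.+ j) ≈ X * (μ² ^ (k N.+ j) * W κ₁° ^ j)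

    Y : ℕ → Carrier
    Y k = U (H * w ^ k * t ^ j)

    entry-suc : ∀ k X → Entry k X → Entry (suc k) (g * X)
    entry-suc k X e = mod! 11 H (w ^ k) (t ^ j) (Ũ³ ^ (k N.+ j)) X (μ² ^ (k N.+ j)) (W κ₁° ^ j) w Ũ³ g μ²
      (λ h p q r x m n w c g d → (h :* (w :* p) :* q :* (c :* r) , g :* x :* (d :* m :* n)) ,
        (h :* p :* q :* r , w :* c , g :* d) ∷ (g :* d , h :* p :* q :* r , x :* (m :* n)) ∷ []) (w-rescaled , e)

    Directs : ℕ → List P₂ → Set
    Directs k [] = ⊤
    Directs k (x ∷ xs) = (⟦ x ⟧₂ ≈ w ^ 33 * Y k) × Directs (suc k) xs

    normalise≈ : ∀ k X x → Entry k X → U X ≈ ⟦ project x ⟧₂ → 3 N.* (k N.+ j) N.≤ 33 → ⟦ normalise j k x ⟧₂ ≈ w ^ 33 * Y k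
    normalise≈ k X x e UX le = begin
      ⟦ normalise j k x ⟧₂
        ≈⟨ on₂ (iter-acts υ-w (33 N.∸ 3 N.* n)) (iter ×μ (2 N.* n) (iter κ₁ j (project x))) ⨾ *-congˡ (on₂ (iter-acts μ-acts (2 N.* n)) (iter κ₁ j (project x)) ⨾ *-congˡ (on₂ (iter-acts κ₁-acts j) (project x))) ⟩
      w ^ (33 N.∸ 3 N.* n) * (μ° ^ (2 N.* n) * (κ₁° ^ j * ⟦ project x ⟧₂))
        ≈⟨ *-congˡ (*-congˡ (*-congˡ (≈-sym UX)) ⨾ ≈-sym (*-assoc _ _ _) ⨾ ≈-sym (U-W (μ° ^ (2 N.* n) * κ₁° ^ j) X)) ⟩
      w ^ (33 N.∸ 3 N.* n) * U (W (μ° ^ (2 N.* n) * κ₁° ^ j) * X)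
        ≈⟨ *-congˡ (U-cong (*-comm _ X ⨾ *-congˡ (W-* _ _ ⨾ *-cong (W-^ μ° (2 N.* n) ⨾ ≈-sym (^-² (W μ°) n)) (W-^ κ₁° j)) ⨾ ≈-sym e ⨾ *-congˡ (^-³ Ũ n ⨾ ≈-sym (W-^ w (3 N.* n))) ⨾ *-comm _ _)) ⟩
      w ^ (33 N.∸ 3 N.* n) * U (W (w ^ (3 N.* n)) * (H * w ^ k * t ^ j))
        ≈⟨ *-congˡ (U-W (w ^ (3 N.* n)) _) ⟩
      w ^ (33 N.∸ 3 N.* n) * (w ^ (3 N.* n) * Y k) ≈⟨ ≈-sym (*-assoc _ _ _) ⟩
      w ^ (33 N.∸ 3 N.* n) * w ^ (3 N.* n) * Y k ≈⟨ *-congʳ (≈-sym (^-+ w (33 N.∸ 3 N.* n) (3 N.* n))) ⟩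
      w ^ (33 N.∸ 3 N.* n N.+ 3 N.* n) * Y k ≡⟨ cong (λ m → w ^ m * Y k) (N.m∸n+n≡m le) ⟩
      w ^ 33 * Y k ∎
      where n = k N.+ j

    directs-sound : ∀ k X ks → Entry k X → TraceList X ks → k N.+ length ks N.+ j N.≤ 12 → Directs k (directs j k ks)
    directs-sound k X [] e tr le = tt
    directs-sound k X (x ∷ ks) e (p , tr) le =
      normalise≈ k X x e p (N.*-monoʳ-≤ 3 (N.≤-pred (N.≤-trans (N.s≤s (N.+-monoˡ-≤ j (N.m≤m+n k (length ks)))) le′)))
      , directs-sound (suc k) (g * X) ks (entry-suc k X e) tr le′
      where
      le′ : suc k N.+ length ks N.+ j N.≤ 12
      le′ = subst (λ m → m N.+ j N.≤ 12) (N.+-suc k (length ks)) le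

    -- Powers of `w` are rewritten as powers of `u` above the common lowest term H w^K tʲ, the form
    -- in which the recurrence takes its seven previous values.
    previous : ∀ m k K xs → K ≡ k N.+ m → length xs ≡ suc m → Directs k xs → Previous (H * w ^ K * t ^ j) (suc m) xs
    previous m k K (x ∷ xs) refl len (p , ps) = p ⨾ *-congˡ (U-cong (≈-sym (drop-power k m))) , rest m xs len ps
      where
      drop-power : ∀ k m → H * w ^ (k N.+ m) * t ^ j * u ^ m ≈ H * w ^ k * t ^ j
      drop-power k m = mod! 6 H (w ^ (k N.+ m)) (t ^ j) (u ^ m) (w ^ k) (w ^ m) (λ h a b c d e → (h :* a :* b :* c , h :* d :* b) , (h :* b :* c , a , d :* e) ∷ (h :* d :* b , c :* e , 𝟙) ∷ []) (^-+ w k m , ^-inv m uw)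
      rest : ∀ m xs → length (x ∷ xs) ≡ suc m → Directs (suc k) xs → Previous (H * w ^ (k N.+ m) * t ^ j) m xs
      rest zero xs len ps = tt
      rest (suc m) xs len ps = previous m (suc k) (k N.+ suc m) xs (N.+-suc k m) (N.suc-injective len) ps

    DirectValues : ℕ → List (List Row) → Set
    DirectValues k [] = ⊤
    DirectValues k (l ∷ ls) = (Y k ≈ valueR l) × DirectValues (suc k) ls

    direct-sound : ∀ k xs ls → Short ls → Directs k xs → check-directs xs ls ≡ true → DirectValues k ls
    direct-sound k xs [] _ _ _ = tt
    direct-sound k (x ∷ xs) (l ∷ ls) (sh , shs) (p , ps) eq =
      wᴺ-cancel 33 (≈-sym p ⨾ ≈-sym (difference≈ (pack l) x (proj₁ (∧-true eq))) ⨾ pack≈ l sh)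
      , direct-sound (suc k) xs ls shs ps (proj₂ (∧-true {vanishes₂ (difference (pack l) x)} eq))

    length-directs : ∀ k ks → length (directs j k ks) ≡ length ks
    length-directs k [] = refl
    length-directs k (x ∷ ks) = cong suc (length-directs (suc k) ks)

    length-orbit : ∀ n v → length (orbit n v) ≡ n
    length-orbit zero v = refl
    length-orbit (suc n) v = cong suc (length-orbit n (×g v))

    window-sound : ∀ k m n ds ns → Entry k (z ^ m * y ^ n) → k N.+ 7 N.+ j N.≤ 12 → Short ds → Short ns →
                   check-window j k (orbit 7 (seed m n)) ds ns ≡ true → DirectValues k ds × Next (H * w ^ (k N.+ 6) * t ^ j) ns
    window-sound k m n ds ns e le sd sn eq =
      direct-sound k xs ds sd D (proj₁ (∧-true parts)) ,
      next-sound _ xs ns sn (previous 6 k (k N.+ 6) xs refl (trans (length-directs k ks) (length-orbit 7 (seed m n))) D) (proj₂ (∧-true {check-directs xs ds} parts))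
      where
      ks = orbit 7 (seed m n)
      xs = directs j k ks
      parts : check-directs xs ds ∧ check-next xs ns ≡ true
      parts = proj₂ (∧-true {allProject ks} eq)
      D : Directs k xs
      D = directs-sound k (z ^ m * y ^ n) ks e (trace-orbit 7 (seed m n) (z ^ m * y ^ n) (start≈ m n) (proj₁ (∧-true eq)))
            (subst (λ l → k N.+ l N.+ j N.≤ 12) (sym (length-orbit 7 (seed m n))) le)

  shortᵇ : List (List Row) → Bool
  shortᵇ [] = true
  shortᵇ (l ∷ ls) = (length l N.≤ᵇ 34) ∧ shortᵇ ls

  short : ∀ ls → shortᵇ ls ≡ true → Short ls
  short [] _ = tt
  short (l ∷ ls) eq = N.≤ᵇ⇒≤ (length l) 34 (subst Data.Bool.T (sym (proj₁ (∧-true eq))) tt) , short ls (proj₂ (∧-true {length l N.≤ᵇ 34} eq))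

  module WT (j : ℕ) = Window 1# j
  module WA (j : ℕ) = Window A j

  entryT₀ : WT.Entry 0 1 (z ^ 3 * y ^ 1)
  entryT₀ = mod! 7 w t Ũ³ z y μ² (W κ₁°) (λ w t c z y m k →
      (𝟙 :* w :^ 1 :* t :^ 0 :* c :^ 1 , z :^ 3 :* y :^ 1 :* (m :^ 1 :* k :^ 0)) , (𝟙 , w :* c , z :* (z :* (z :* y)) :* m) ∷ []) w-rescaled

  entryT₁ : WT.Entry 1 1 (z ^ 2 * y ^ 2)
  entryT₁ = mod! 7 w t Ũ³ z y μ² (W κ₁°) (λ w t c z y m k →
      (𝟙 :* w :^ 1 :* t :^ 1 :* c :^ 2 , z :^ 2 :* y :^ 2 :* (m :^ 2 :* k :^ 1)) ,
      (t :* c , w :* c , z :* (z :* (z :* y)) :* m) ∷ (z :* z :* y :* m , t :* z :* c , y :* k :* m) ∷ []) (w-rescaled , t-rescaled)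

  entryT₂ : WT.Entry 2 1 (z ^ 1 * y ^ 3)
  entryT₂ = mod! 7 w t Ũ³ z y μ² (W κ₁°) (λ w t c z y m k →
      (𝟙 :* w :^ 1 :* t :^ 2 :* c :^ 3 , z :^ 1 :* y :^ 3 :* (m :^ 3 :* k :^ 2)) ,
      (t :* t :* c :* c , w :* c , z :* (z :* (z :* y)) :* m) ∷ (z :* y :* m :* (t :* z :* c :+ y :* k :* m) , t :* z :* c , y :* k :* m) ∷ []) (w-rescaled , t-rescaled)

  -- A w³ Ũ⁹ = z⁴ y⁵ μ⁶
  A-rescaled : A * w ^ 3 * Ũ³ ^ 3 ≈ z ^ 4 * y ^ 5 * μ² ^ 3
  A-rescaled = mod! 7 A w Ũ³ z y μ² z⁻¹ (λ A w c z y m i →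
      (A :* w :^ 3 :* c :^ 3 , z :^ 4 :* y :^ 5 :* m :^ 3) ,
      (A :* (w :* c :* (w :* c) :+ w :* c :* (z :^ 3 :* y :* m) :+ (z :^ 3 :* y :* m) :^ 2) , w :* c , z :* (z :* (z :* y)) :* m) ∷
      ((z :^ 3 :* y :* m) :^ 3 , A , y :* y :* i :^ 5) ∷
      (y :^ 5 :* m :^ 3 :* z :^ 4 :* ((z :* i) :^ 4 :+ (z :* i) :^ 3 :+ (z :* i) :^ 2 :+ z :* i :+ 𝟙) , z :* i , 𝟙) ∷ []) (w-rescaled , A≈ , z-inv)

  entryA₀ : WA.Entry 0 3 (z ^ 4 * y ^ 5)
  entryA₀ = mod! 8 A w t Ũ³ z y μ² (W κ₁°) (λ A w t c z y m k →
      (A :* w :^ 3 :* t :^ 0 :* c :^ 3 , z :^ 4 :* y :^ 5 :* (m :^ 3 :* k :^ 0)) , (𝟙 , A :* w :^ 3 :* c :^ 3 , z :^ 4 :* y :^ 5 :* m :^ 3) ∷ []) A-rescaled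

  entryA₁ : WA.Entry 1 3 (z ^ 3 * y ^ 6)
  entryA₁ = mod! 8 A w t Ũ³ z y μ² (W κ₁°) (λ A w t c z y m k →
      (A :* w :^ 3 :* t :^ 1 :* c :^ 4 , z :^ 3 :* y :^ 6 :* (m :^ 4 :* k :^ 1)) ,
      (t :* c , A :* w :^ 3 :* c :^ 3 , z :^ 4 :* y :^ 5 :* m :^ 3) ∷ (z :^ 3 :* y :^ 5 :* m :^ 3 , t :* z :* c , y :* k :* m) ∷ []) (A-rescaled , t-rescaled)

  entryA₂ : WA.Entry 2 3 (z ^ 2 * y ^ 7)
  entryA₂ = mod! 8 A w t Ũ³ z y μ² (W κ₁°) (λ A w t c z y m k →
      (A :* w :^ 3 :* t :^ 2 :* c :^ 5 , z :^ 2 :* y :^ 7 :* (m :^ 5 :* k :^ 2)) ,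
      (t :* t :* c :* c , A :* w :^ 3 :* c :^ 3 , z :^ 4 :* y :^ 5 :* m :^ 3) ∷ (z :^ 2 :* y :^ 5 :* m :^ 3 :* (t :* z :* c :+ y :* k :* m) , t :* z :* c , y :* k :* m) ∷ []) (A-rescaled , t-rescaled)

  valuesT₀ : WT.DirectValues 0 1 directT₀ × Next (1# * w ^ 7 * t ^ 0) nextT₀
  valuesT₀ = WT.window-sound 0 1 3 1 directT₀ nextT₀ entryT₀ (N.≤ᵇ⇒≤ 8 12 tt) (short directT₀ refl) (short nextT₀ refl) windowT₀

  valuesT₁ : WT.DirectValues 1 1 directT₁ × Next (1# * w ^ 7 * t ^ 1) nextT₁
  valuesT₁ = WT.window-sound 1 1 2 2 directT₁ nextT₁ entryT₁ (N.≤ᵇ⇒≤ 9 12 tt) (short directT₁ refl) (short nextT₁ refl) windowT₁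

  valuesT₂ : WT.DirectValues 2 1 directT₂ × Next (1# * w ^ 7 * t ^ 2) nextT₂
  valuesT₂ = WT.window-sound 2 1 1 3 directT₂ nextT₂ entryT₂ (N.≤ᵇ⇒≤ 10 12 tt) (short directT₂ refl) (short nextT₂ refl) windowT₂

  valuesA₀ : WA.DirectValues 0 3 directA₀ × Next (A * w ^ 9 * t ^ 0) nextA₀
  valuesA₀ = WA.window-sound 0 3 4 5 directA₀ nextA₀ entryA₀ (N.≤ᵇ⇒≤ 10 12 tt) (short directA₀ refl) (short nextA₀ refl) windowA₀

  valuesA₁ : WA.DirectValues 1 3 directA₁ × Next (A * w ^ 9 * t ^ 1) nextA₁
  valuesA₁ = WA.window-sound 1 3 3 6 directA₁ nextA₁ entryA₁ (N.≤ᵇ⇒≤ 11 12 tt) (short directA₁ refl) (short nextA₁ refl) windowA₁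

  valuesA₂ : WA.DirectValues 2 3 directA₂ × Next (A * w ^ 9 * t ^ 2) nextA₂
  valuesA₂ = WA.window-sound 2 3 2 7 directA₂ nextA₂ entryA₂ (N.≤ᵇ⇒≤ 12 12 tt) (short directA₂ refl) (short nextA₂ refl) windowA₂

-- Admissible shapes of terms, and tests that place table entries in them

≤ᵇ-sound : ∀ m n → (m N.≤ᵇ n) ≡ true → m N.≤ n
≤ᵇ-sound m n eq = N.≤ᵇ⇒≤ m n (subst Data.Bool.T (sym eq) tt)

Shape : Set₁
Shape = ℕ → ℕ → ℕ → Set

-- Shape of the terms 7ⁿ uˡ tʲ : their order 3 l − 2 j at infinity is at least o − 2.
record F (o D s n l j : ℕ) : Set where
  constructor shape
  field
    j≤2 : j N.≤ 2
    ord : 2 N.* j N.+ o N.≤ 3 N.* l N.+ 2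
    deg : l N.≤ D
    pow : l N.≤ n N.+ s
open F public

G : ℕ → Shape
G D = F 3 D 2

O : ℕ → Shape
O D n l j = G D n l j × (j ≡ 0 → l N.≤ 2 → 1 N.≤ n)

Up : Shape → Shape
Up P n l j = ∃ λ n′ → (n ≡ suc n′) × P n′ l j

F-mono : ∀ {o o′ D D′ s s′ n l j} → o′ N.≤ o → D N.≤ D′ → s N.≤ s′ → F o D s n l j → F o′ D′ s′ n l j
F-mono {n = n} {j = j} o≤ D≤ s≤ (shape a b c d) = shape a (N.≤-trans (N.+-monoʳ-≤ (2 N.* j) o≤) b) (N.≤-trans c D≤) (N.≤-trans d (N.+-monoʳ-≤ n s≤))

F-lift : ∀ {o D s n l j} k → F o D s n l j → F o D s (k N.+ n) l j
F-lift {s = s} {n} k (shape a b c d) = shape a b c (N.≤-trans d (N.+-monoˡ-≤ s (N.m≤n+m n k)))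

order-+ : ∀ l l′ j j′ {o o′ o″} → o″ N.+ 2 N.≤ o N.+ o′ → 2 N.* j N.+ o N.≤ 3 N.* l N.+ 2 → 2 N.* j′ N.+ o′ N.≤ 3 N.* l′ N.+ 2 →
          2 N.* (j N.+ j′) N.+ o″ N.≤ 3 N.* (l N.+ l′) N.+ 2
order-+ l l′ j j′ {o} {o′} {o″} o≤ b b′ = N.+-cancelʳ-≤ 2 _ _ (begin
  2 N.* (j N.+ j′) N.+ o″ N.+ 2 ≡⟨ trans (N.+-assoc (2 N.* (j N.+ j′)) o″ 2) (cong (N._+ (o″ N.+ 2)) (N.*-distribˡ-+ 2 j j′)) ⟩
  2 N.* j N.+ 2 N.* j′ N.+ (o″ N.+ 2) ≤⟨ N.+-monoʳ-≤ (2 N.* j N.+ 2 N.* j′) o≤ ⟩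
  2 N.* j N.+ 2 N.* j′ N.+ (o N.+ o′) ≡⟨ medial (2 N.* j) (2 N.* j′) o o′ ⟩
  2 N.* j N.+ o N.+ (2 N.* j′ N.+ o′) ≤⟨ N.+-mono-≤ b b′ ⟩
  3 N.* l N.+ 2 N.+ (3 N.* l′ N.+ 2) ≡⟨ trans (medial (3 N.* l) 2 (3 N.* l′) 2) (trans (cong (N._+ 4) (sym (N.*-distribˡ-+ 3 l l′))) (sym (N.+-assoc (3 N.* (l N.+ l′)) 2 2))) ⟩
  3 N.* (l N.+ l′) N.+ 2 N.+ 2 ∎)
  where
  open N.≤-Reasoning
  open import Algebra.Properties.CommutativeSemigroup N.+-commutativeSemigroup using () renaming (interchange to medial)

cell : (ℕ → ℕ → Bool) → (ℕ → ℕ → ℕ) → ℤ → ℕ → ℕ → Bool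
cell ok req c l j = isZeroℤ c ∨ (ok l j ∧ does (7 N.^ req l j ℕ∣.∣? Z.∣ c ∣))

rowsOK : (ℕ → ℕ → Bool) → (ℕ → ℕ → ℕ) → ℕ → List Row → Bool
rowsOK ok req l [] = true
rowsOK ok req l ((a , b , c) ∷ rows) = cell ok req a l 0 ∧ (cell ok req b l 1 ∧ (cell ok req c l 2 ∧ rowsOK ok req (suc l) rows))

divides-sound : ∀ d m → does (d ℕ∣.∣? m) ≡ true → d ℕ∣.∣ m
divides-sound d m eq with d ℕ∣.∣? m
... | yes p = p
divides-sound d m () | no _

okF : ℕ → ℕ → ℕ → ℕ → Bool
okF o D l j = (j N.≤ᵇ 2) ∧ ((2 N.* j N.+ o N.≤ᵇ 3 N.* l N.+ 2) ∧ (l N.≤ᵇ D))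

okF-sound : ∀ {o D s n l j} → l N.≤ n N.+ s → okF o D l j ≡ true → F o D s n l j
okF-sound {o} {D} {l = l} {j} pw eq = shape (≤ᵇ-sound j 2 (proj₁ (∧-true eq))) (≤ᵇ-sound _ _ (proj₁ (∧-true rest))) (≤ᵇ-sound l D (proj₂ (∧-true {2 N.* j N.+ o N.≤ᵇ 3 N.* l N.+ 2} rest))) pw
  where
  rest : (2 N.* j N.+ o N.≤ᵇ 3 N.* l N.+ 2) ∧ (l N.≤ᵇ D) ≡ true
  rest = proj₂ (∧-true {j N.≤ᵇ 2} eq)

∸-bound : ∀ l s → l N.≤ (l N.∸ s) N.+ s
∸-bound l s = N.≤-trans (N.m≤n+m∸n l s) (N.≤-reflexive (N.+-comm s (l N.∸ s)))

reqO : ℕ → ℕ → ℕ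
reqO 0 0 = 1
reqO 1 0 = 1
reqO 2 0 = 1
reqO l j = l N.∸ 2

reqO-∸ : ∀ l j → l N.∸ 2 N.≤ reqO l j
reqO-∸ 0 0 = N.z≤n
reqO-∸ 1 0 = N.z≤n
reqO-∸ 2 0 = N.z≤n
reqO-∸ (suc (suc (suc l))) 0 = N.≤-refl
reqO-∸ 0 (suc j) = N.≤-refl
reqO-∸ 1 (suc j) = N.≤-refl
reqO-∸ 2 (suc j) = N.≤-refl
reqO-∸ (suc (suc (suc l))) (suc j) = N.≤-refl

okO-sound : ∀ {D} l j → okF 3 D l j ≡ true → O D (reqO l j) l j
okO-sound l j eq = okF-sound (N.≤-trans (∸-bound l 2) (N.+-monoˡ-≤ 2 (reqO-∸ l j))) eq , small l j
  where
  small : ∀ l j → j ≡ 0 → l N.≤ 2 → 1 N.≤ reqO l j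
  small 0 .0 refl _ = N.≤-refl
  small 1 .0 refl _ = N.≤-refl
  small 2 .0 refl _ = N.≤-refl
  small (suc (suc (suc l))) .0 refl (N.s≤s (N.s≤s ()))

-- For j ≤ 2 both U(w³ tʲ uⁿ) and U(A w⁴ tʲ uⁿ) have order at least `order n` - 2 at infinity,
-- because the series before `U` have order at least 3n - 14. The least value -2 is reached by the
-- second with n = 0 and j = 2; from n = 5 on both vanish at infinity.
order : ℕ → ℕ
order 0 = 0
order 1 = 1
order 2 = 1
order 3 = 1
order 4 = 1
order (suc (suc (suc (suc (suc _))))) = 3

1≤order : ∀ n → 1 N.≤ order (suc n)
1≤order 0 = N.≤-refl
1≤order 1 = N.≤-refl
1≤order 2 = N.≤-refl
1≤order 3 = N.≤-refl
1≤order (suc (suc (suc (suc n)))) = N.s≤s N.z≤n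

nth : ℕ → List (List Row) → List Row
nth _ [] = []
nth zero (l ∷ ls) = l
nth (suc k) (l ∷ ls) = nth k ls

-- Direct entries are listed by increasing powers of `w`, that is by decreasing powers of `u`; they
-- are reversed in front of the entries obtained by recurrence.
window : List (List Row) → List (List Row) → List (List Row)
window [] ns = ns
window (d ∷ ds) ns = window ds (d ∷ ns)

windowOK : ℕ → ℕ → ℕ → List (List Row) → Bool
windowOK D s n [] = true
windowOK D s n (l ∷ ls) = rowsOK (okF (order n) D) (λ l _ → l N.∸ s) 0 l ∧ windowOK D s (suc n) ls

-- Propagation of the 7-adic bounds along the recurrence

module PAdic (R : CommutativeRing 0ℓ 0ℓ) (S : Setup R) where
  open Ring R
  open Setup S using (U; U-cong; U-+; t; u; w; A; t²; w≈; uw; W-1; s°; W; U-W)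
  open Main R S using (valueR; rowᴿ; linᵁ; recurrence; Next; U-0; ^-inv; ^-+; valuesT₀; valuesT₁; valuesT₂; valuesA₀; valuesA₁; valuesA₂; module Window)
  open EvalHom R W (Setup.W-cong S) (Setup.W-+ S) (Setup.W-* S) W-1 using (W-ι)

  -- Elimination of s° from the two defining relations: the plane equation of the level 14 curve in
  -- t and w. It is monic and cubic in t, so the powers 1, t, t² suffice.
  curve : t * (t * t) ≈ ι (+ 17) * (t * t) - ι (+ 80) * t + ι (+ 64) + ι (+ 9) * (w * t) - ι (+ 16) * w + w * w
  curve = mod! 3 s° t w (λ s t w →
    (t :* (t :* t) , # 17 :* (t :* t) :- # 80 :* t :+ # 64 :+ # 9 :* (w :* t) :- # 16 :* w :+ w :* w) ,
    (t , t :* t , (s :* s :+ s :- # 3) :* t :- # 8) ∷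
    (:- (w :+ (s :- # 4) :* t :+ # 8 :+ # 8 :* t :- # 16 :+ t) , w , (s :- # 4) :* t :+ # 8) ∷ []) (t² , w≈)

  7^ : ℕ → Carrier
  7^ n = ι (+ (7 N.^ n))

  7^-+ : ∀ m n → 7^ (m N.+ n) ≈ 7^ m * 7^ n
  7^-+ m n = reflexive (cong ι (trans (cong +_ (N.^-distribˡ-+-* 7 m n)) (Z.pos-* (7 N.^ m) (7 N.^ n)))) ⨾ ι-* _ _

  term : ℕ → ℕ → ℕ → Carrier
  term n l j = 7^ n * (u ^ l * t ^ j)

  data Span (P : Shape) (x : Carrier) : Set where
    sp-0 : x ≈ 0# → Span P x
    sp-+ : ∀ {y z} → Span P y → Span P z → x ≈ y + z → Span P x
    sp-gen : ∀ {n l j} c → P n l j → x ≈ ι c * term n l j → Span P x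

  sp-cong : ∀ {P x y} → x ≈ y → Span P x → Span P y
  sp-cong e (sp-0 p) = sp-0 (≈-sym e ⨾ p)
  sp-cong e (sp-+ a b p) = sp-+ a b (≈-sym e ⨾ p)
  sp-cong e (sp-gen c g p) = sp-gen c g (≈-sym e ⨾ p)

  sp-scale : ∀ {P x} c → Span P x → Span P (ι c * x)
  sp-scale c (sp-0 p) = sp-0 (*-congˡ p ⨾ zeroʳ _)
  sp-scale c (sp-+ a b p) = sp-+ (sp-scale c a) (sp-scale c b) (*-congˡ p ⨾ distribˡ _ _ _)
  sp-scale c (sp-gen d g p) = sp-gen (c Z.* d) g (*-congˡ p ⨾ ≈-sym (*-assoc _ _ _) ⨾ *-congʳ (≈-sym (ι-* c d)))

  record Linear (f : Carrier → Carrier) : Set where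
    field
      f-cong : ∀ {x y} → x ≈ y → f x ≈ f y
      f-+ : ∀ x y → f (x + y) ≈ f x + f y
      f-ι : ∀ c x → f (ι c * x) ≈ ι c * f x

  sp-lin : ∀ {f} → Linear f → ∀ {P Q} → (∀ {n l j} → P n l j → Span Q (f (term n l j))) → ∀ {x} → Span P x → Span Q (f x)
  sp-lin {f} lf {P} {Q} h = go
    where
    open Linear lf
    f-0 : f 0# ≈ 0#
    f-0 = x+x≈x⇒x≈0 (f 0#) (≈-sym (f-+ 0# 0#) ⨾ f-cong (+-identityˡ 0#))
    go : ∀ {x} → Span P x → Span Q (f x)
    go (sp-0 p) = sp-0 (f-cong p ⨾ f-0)
    go (sp-+ a b p) = sp-+ (go a) (go b) (f-cong p ⨾ f-+ _ _)
    go (sp-gen c g p) = sp-cong (≈-sym (f-cong p ⨾ f-ι c _)) (sp-scale c (h g))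

  mul-linear : ∀ y → Linear (λ x → x * y)
  mul-linear y = record { f-cong = *-congʳ ; f-+ = λ a b → distribʳ y a b ; f-ι = λ c a → *-assoc _ _ _ }

  mul-linearˡ : ∀ y → Linear (λ x → y * x)
  mul-linearˡ y = record { f-cong = *-congˡ ; f-+ = distribˡ y ; f-ι = λ c a → ring! 3 y (ι c) a (λ y c a → y :* (c :* a) , c :* (y :* a)) }

  U-ι : ∀ c x → U (ι c * x) ≈ ι c * U x
  U-ι c x = U-cong (*-congʳ (≈-sym (W-ι c))) ⨾ U-W (ι c) x

  sp-map : ∀ {P Q x} → (∀ {n l j} → P n l j → Q n l j) → Span P x → Span Q x
  sp-map h (sp-0 p)       = sp-0 p
  sp-map h (sp-+ a b p)   = sp-+ (sp-map h a) (sp-map h b) p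
  sp-map h (sp-gen c g p) = sp-gen c (h g) p

  gen : ∀ {P : Shape} n l j → P n l j → ∀ c → Span P (ι c * term n l j)
  gen n l j g c = sp-gen c g ≈-refl

  infixr 5 _⟨⊕⟩_
  _⟨⊕⟩_ : ∀ {P x y} → Span P x → Span P y → Span P (x + y)
  a ⟨⊕⟩ b = sp-+ a b ≈-refl

  -- The relation `curve` times u² replaces t³ by terms with no larger exponent of u and no smaller
  -- order at infinity, so all bounds of the shape persist. For J ≥ 3 the order condition forces L ≥
  -- 2, which supplies that u².
  reduce : ∀ {o D s} n L J → J N.≤ 4 → 2 N.* J N.+ o N.≤ 3 N.* L N.+ 2 → L N.≤ D → L N.≤ n N.+ s → Span (F o D s) (term n L J)
  reduce n L 0 _ a b c = sp-gen (+ 1) (shape N.z≤n a b c) (≈-sym (*-congʳ ι-1 ⨾ *-identityˡ _))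
  reduce n L 1 _ a b c = sp-gen (+ 1) (shape (N.s≤s N.z≤n) a b c) (≈-sym (*-congʳ ι-1 ⨾ *-identityˡ _))
  reduce n L 2 _ a b c = sp-gen (+ 1) (shape (N.s≤s (N.s≤s N.z≤n)) a b c) (≈-sym (*-congʳ ι-1 ⨾ *-identityˡ _))
  reduce n 0 3 _ (N.s≤s (N.s≤s ())) b c
  reduce n 1 3 _ (N.s≤s (N.s≤s (N.s≤s (N.s≤s (N.s≤s ()))))) b c
  reduce {o} {D} {s} n (suc (suc L)) 3 _ a b c = sp-cong (≈-sym eq)
      (gen n (2 N.+ L) 2 (shape ≤₂ (≤-from 4) b c) (+ 17) ⟨⊕⟩ gen n (2 N.+ L) 1 (shape ≤₁ (≤-from 2) b c) −80 ⟨⊕⟩ gen n (2 N.+ L) 0 (shape N.z≤n (≤-from 0) b c) (+ 64)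
       ⟨⊕⟩ gen n (1 N.+ L) 1 (shape ≤₁ (low₁ 2 (N.s≤s (N.s≤s N.z≤n))) (down b) (down c)) (+ 9) ⟨⊕⟩ gen n (1 N.+ L) 0 (shape N.z≤n (low₁ 0 N.z≤n) (down b) (down c)) −16
       ⟨⊕⟩ gen n L 0 (shape N.z≤n low₂ (down (down b)) (down (down c))) (+ 1))
    where
    ≤₁ : 1 N.≤ 2
    ≤₁ = N.s≤s N.z≤n
    ≤₂ : 2 N.≤ 2
    ≤₂ = N.≤-refl
    down : ∀ {m k} → suc m N.≤ k → m N.≤ k
    down = N.≤-trans (N.n≤1+n _)
    norm₂ : 3 N.* (2 N.+ L) N.+ 2 ≡ 6 N.+ (3 N.* L N.+ 2)
    norm₂ = cong (N._+ 2) (N.*-distribˡ-+ 3 2 L)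
    norm₁ : 3 N.* (1 N.+ L) N.+ 2 ≡ 3 N.+ (3 N.* L N.+ 2)
    norm₁ = cong (N._+ 2) (N.*-distribˡ-+ 3 1 L)
    low₂ : o N.≤ 3 N.* L N.+ 2
    low₂ = N.+-cancelˡ-≤ 6 _ _ (subst (6 N.+ o N.≤_) norm₂ a)
    low₁ : ∀ k → k N.≤ 3 → k N.+ o N.≤ 3 N.* (1 N.+ L) N.+ 2
    low₁ k k≤3 = subst (k N.+ o N.≤_) (sym norm₁) (N.+-mono-≤ k≤3 low₂)
    ≤-from : ∀ k {_ : Data.Bool.T (k N.≤ᵇ 6)} → k N.+ o N.≤ 3 N.* (2 N.+ L) N.+ 2
    ≤-from k {p} = N.≤-trans (N.+-monoˡ-≤ o (N.≤ᵇ⇒≤ k 6 p)) a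
    eq : term n (2 N.+ L) 3 ≈ ι (+ 17) * term n (2 N.+ L) 2 + (ι −80 * term n (2 N.+ L) 1 + (ι (+ 64) * term n (2 N.+ L) 0
           + (ι (+ 9) * term n (1 N.+ L) 1 + (ι −16 * term n (1 N.+ L) 0 + ι (+ 1) * term n L 0))))
    eq = mod! 5 (7^ n) (u ^ L) u t w (λ N p u t w →
        (N :* (u :* (u :* p) :* t :^ 3) , # 17 :* (N :* (u :* (u :* p) :* t :^ 2)) :+ (con −80 :* (N :* (u :* (u :* p) :* t :^ 1)) :+ (# 64 :* (N :* (u :* (u :* p) :* t :^ 0))
           :+ (# 9 :* (N :* (u :* p :* t :^ 1)) :+ (con −16 :* (N :* (u :* p :* t :^ 0)) :+ # 1 :* (N :* (p :* t :^ 0))))))) ,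
        (N :* u :* u :* p , t :* (t :* t) , # 17 :* (t :* t) :- # 80 :* t :+ # 64 :+ # 9 :* (w :* t) :- # 16 :* w :+ w :* w) ∷
        (N :* p :* (# 9 :* u :* t :- # 16 :* u :+ (u :* w :+ 𝟙)) , u :* w , 𝟙) ∷ []) (curve , uw)
  reduce n 0 4 _ (N.s≤s (N.s≤s ())) b c
  reduce n 1 4 _ (N.s≤s (N.s≤s (N.s≤s (N.s≤s (N.s≤s ()))))) b c
  reduce {o} {D} {s} n (suc (suc L)) 4 _ a b c = sp-cong (≈-sym eq)
      (sp-scale (+ 17) (reduce n (2 N.+ L) 3 (N.s≤s (N.s≤s (N.s≤s N.z≤n))) (≤-from 6) b c)
       ⟨⊕⟩ gen n (2 N.+ L) 2 (shape ≤₂ (≤-from 4) b c) −80 ⟨⊕⟩ gen n (2 N.+ L) 1 (shape ≤₁ (≤-from 2) b c) (+ 64)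
       ⟨⊕⟩ gen n (1 N.+ L) 2 (shape ≤₂ (low₁ 4) (down b) (down c)) (+ 9) ⟨⊕⟩ gen n (1 N.+ L) 1 (shape ≤₁ (low₁ 2) (down b) (down c)) −16
       ⟨⊕⟩ gen n L 1 (shape ≤₁ low₂ (down (down b)) (down (down c))) (+ 1))
    where
    ≤₁ : 1 N.≤ 2
    ≤₁ = N.s≤s N.z≤n
    ≤₂ : 2 N.≤ 2
    ≤₂ = N.≤-refl
    down : ∀ {m k} → suc m N.≤ k → m N.≤ k
    down = N.≤-trans (N.n≤1+n _)
    norm₂ : 3 N.* (2 N.+ L) N.+ 2 ≡ 6 N.+ (3 N.* L N.+ 2)
    norm₂ = cong (N._+ 2) (N.*-distribˡ-+ 3 2 L)
    norm₁ : 3 N.* (1 N.+ L) N.+ 2 ≡ 3 N.+ (3 N.* L N.+ 2)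
    norm₁ = cong (N._+ 2) (N.*-distribˡ-+ 3 1 L)
    low₂ : 2 N.+ o N.≤ 3 N.* L N.+ 2
    low₂ = N.+-cancelˡ-≤ 6 _ _ (subst (8 N.+ o N.≤_) norm₂ a)
    low₁ : ∀ k {_ : Data.Bool.T (k N.≤ᵇ 5)} → k N.+ o N.≤ 3 N.* (1 N.+ L) N.+ 2
    low₁ k {p} = N.≤-trans (N.+-monoˡ-≤ o (N.≤ᵇ⇒≤ k 5 p)) (subst (5 N.+ o N.≤_) (sym norm₁) (N.+-monoʳ-≤ 3 low₂))
    ≤-from : ∀ k {_ : Data.Bool.T (k N.≤ᵇ 8)} → k N.+ o N.≤ 3 N.* (2 N.+ L) N.+ 2
    ≤-from k {p} = N.≤-trans (N.+-monoˡ-≤ o (N.≤ᵇ⇒≤ k 8 p)) a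
    eq : term n (2 N.+ L) 4 ≈ ι (+ 17) * term n (2 N.+ L) 3 + (ι −80 * term n (2 N.+ L) 2 + (ι (+ 64) * term n (2 N.+ L) 1
           + (ι (+ 9) * term n (1 N.+ L) 2 + (ι −16 * term n (1 N.+ L) 1 + ι (+ 1) * term n L 1))))
    eq = mod! 5 (7^ n) (u ^ L) u t w (λ N p u t w →
        (N :* (u :* (u :* p) :* t :^ 4) , # 17 :* (N :* (u :* (u :* p) :* t :^ 3)) :+ (con −80 :* (N :* (u :* (u :* p) :* t :^ 2)) :+ (# 64 :* (N :* (u :* (u :* p) :* t :^ 1))
           :+ (# 9 :* (N :* (u :* p :* t :^ 2)) :+ (con −16 :* (N :* (u :* p :* t :^ 1)) :+ # 1 :* (N :* (p :* t :^ 1))))))) ,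
        (N :* u :* u :* p :* t , t :* (t :* t) , # 17 :* (t :* t) :- # 80 :* t :+ # 64 :+ # 9 :* (w :* t) :- # 16 :* w :+ w :* w) ∷
        (N :* p :* t :* (# 9 :* u :* t :- # 16 :* u :+ (u :* w :+ 𝟙)) , u :* w , 𝟙) ∷ []) (curve , uw)
  reduce n L (suc (suc (suc (suc (suc J))))) (N.s≤s (N.s≤s (N.s≤s (N.s≤s ())))) a b c

  term-* : ∀ n l j n′ l′ j′ → term n l j * term n′ l′ j′ ≈ term (n N.+ n′) (l N.+ l′) (j N.+ j′)
  term-* n l j n′ l′ j′ = ring! 6 (7^ n) (u ^ l) (t ^ j) (7^ n′) (u ^ l′) (t ^ j′) (λ a b c d e f → a :* (b :* c) :* (d :* (e :* f)) , a :* d :* (b :* e :* (c :* f)))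
    ⨾ ≈-sym (*-cong (7^-+ n n′) (*-cong (^-+ u l l′) (^-+ t j j′)))

  -- Orders at infinity add, but `F` records them increased by 2; hence the condition o″ + 2 ≤ o +
  -- o′. Products may contain t³ and t⁴, which `reduce` removes.
  sp-* : ∀ {o o′ o″ D D′ D″ s s′ s″} → o″ N.+ 2 N.≤ o N.+ o′ → D N.+ D′ N.≤ D″ → s N.+ s′ N.≤ s″ →
         ∀ {x y} → Span (F o D s) x → Span (F o′ D′ s′) y → Span (F o″ D″ s″) (x * y)
  sp-* {o} {o′} {o″} {D} {D′} {D″} {s} {s′} {s″} o≤ D≤ s≤ {x} {y} X Y =
    sp-lin (mul-linear y) (λ {n} {l} {j} g → sp-lin (mul-linearˡ (term n l j)) (λ {n′} {l′} {j′} g′ → sp-cong (≈-sym (term-* n l j n′ l′ j′)) (prod n l j n′ l′ j′ g g′)) Y) X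
    where
    open import Algebra.Properties.CommutativeSemigroup N.+-commutativeSemigroup using () renaming (interchange to medial)
    prod : ∀ n l j n′ l′ j′ → F o D s n l j → F o′ D′ s′ n′ l′ j′ → Span (F o″ D″ s″) (term (n N.+ n′) (l N.+ l′) (j N.+ j′))
    prod n l j n′ l′ j′ (shape a b c d) (shape a′ b′ c′ d′) = reduce (n N.+ n′) (l N.+ l′) (j N.+ j′) (N.+-mono-≤ a a′) (order-+ l l′ j j′ o≤ b b′)
        (N.≤-trans (N.+-mono-≤ c c′) D≤)
        (N.≤-trans (N.+-mono-≤ d d′) (N.≤-trans (N.≤-reflexive (medial n s n′ s′)) (N.+-monoʳ-≤ (n N.+ n′) s≤)))

  cell-span : ∀ {P : Shape} ok req → (∀ l j → ok l j ≡ true → P (req l j) l j) → ∀ c l j → cell ok req c l j ≡ true → Span P (ι c * (u ^ l * t ^ j))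
  cell-span {P} ok req sound c l j eq = go (isZeroℤ c) refl
    where
    go : ∀ b → isZeroℤ c ≡ b → Span P (ι c * (u ^ l * t ^ j))
    go true e = sp-0 (*-congʳ (reflexive (cong ι (isZeroℤ⇒≡0 c e)) ⨾ ι-0) ⨾ zeroˡ _)
    go false e = sp-gen (ℤ∣.quotient d) (sound l j (proj₁ (∧-true both)))
        (*-congʳ (reflexive (cong ι (ℤ∣._∣_.equality d)) ⨾ ι-* _ _) ⨾ *-assoc _ _ _)
      where
      both : ok l j ∧ does (7 N.^ req l j ℕ∣.∣? Z.∣ c ∣) ≡ true
      both = subst (λ b → b ∨ (ok l j ∧ does (7 N.^ req l j ℕ∣.∣? Z.∣ c ∣)) ≡ true) e eq
      d : + (7 N.^ req l j) ℤ∣.∣ c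
      d = ℤ∣.∣ᵤ⇒∣ (divides-sound _ _ (proj₂ (∧-true {ok l j} both)))

  rows-span : ∀ {P : Shape} ok req → (∀ l j → ok l j ≡ true → P (req l j) l j) → ∀ l rows → rowsOK ok req l rows ≡ true → Span P (u ^ l * valueR rows)
  rows-span ok req sound l [] eq = sp-0 (zeroʳ _)
  rows-span ok req sound l ((a , b , c) ∷ rows) eq = sp-cong
      (ring! 7 (u ^ l) u t (ι a) (ι b) (ι c) (valueR rows) (λ p u t a b c v →
        a :* (p :* t :^ 0) :+ (b :* (p :* t :^ 1) :+ (c :* (p :* t :^ 2) :+ (u :* p) :* v)) , p :* ((a :+ (b :* t :+ c :* (t :* t))) :+ u :* v)))
      (cell-span ok req sound a l 0 (proj₁ (∧-true eq)) ⟨⊕⟩ cell-span ok req sound b l 1 (proj₁ (∧-true eq₁)) ⟨⊕⟩ cell-span ok req sound c l 2 (proj₁ (∧-true eq₂)) ⟨⊕⟩ rows-span ok req sound (suc l) rows (proj₂ (∧-true {cell ok req c l 2} eq₂)))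
    where
    eq₁ = proj₂ (∧-true {cell ok req a l 0} eq)
    eq₂ = proj₂ (∧-true {cell ok req b l 1} eq₁)

  table-span : ∀ {P : Shape} ok req → (∀ l j → ok l j ≡ true → P (req l j) l j) → ∀ rows {x} → x ≈ valueR rows → rowsOK ok req 0 rows ≡ true → Span P x
  table-span ok req sound rows e eq = sp-cong (*-identityˡ _ ⨾ ≈-sym e) (rows-span ok req sound 0 rows eq)

  F-table : ∀ o D s rows {x} → x ≈ valueR rows → rowsOK (okF o D) (λ l _ → l N.∸ s) 0 rows ≡ true → Span (F o D s) x
  F-table o D s = table-span (okF o D) (λ l _ → l N.∸ s) (λ l j → okF-sound (∸-bound l s))

  -- In these seven memberships the last index 1 says that 7^(l-1) divides the coefficients at uˡ.
  -- The orders at infinity are at least 1 for ε₁ and ε₂, 2 for ε₃ and ε₄, and 3 for the others.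
  ε₁-span : Span (F 3 7 1) (valueR ε₁)
  ε₁-span = F-table 3 7 1 ε₁ ≈-refl refl
  ε₂-span : Span (F 3 7 1) (valueR ε₂)
  ε₂-span = F-table 3 7 1 ε₂ ≈-refl refl
  ε₃-span : Span (F 4 7 1) (valueR ε₃)
  ε₃-span = F-table 4 7 1 ε₃ ≈-refl refl
  ε₄-span : Span (F 4 7 1) (valueR ε₄)
  ε₄-span = F-table 4 7 1 ε₄ ≈-refl refl
  ε₅-span : Span (F 5 7 1) (valueR ε₅)
  ε₅-span = F-table 5 7 1 ε₅ ≈-refl refl
  ε₆-span : Span (F 5 7 1) (valueR ε₆)
  ε₆-span = F-table 5 7 1 ε₆ ≈-refl refl
  ε₇-span : Span (F 5 7 1) (valueR ε₇)
  ε₇-span = F-table 5 7 1 ε₇ ≈-refl refl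

  module Sequence (Z : Carrier) (D₀ s₀ : ℕ) where

    seq : ℕ → Carrier
    seq n = U (Z * u ^ n)

    -- Multiplication by an ε raises the degree in u by at most 7 and the excess of l over the
    -- exponent of 7 by at most 1. So the initial bounds hold up to n = 6 and grow by one such step
    -- with each further index.
    Bounded : ℕ → Set
    Bounded n = Span (F (order n) (D₀ N.+ 7 N.* (n N.∸ 6)) (s₀ N.+ (n N.∸ 6))) (seq n)

    Values : ℕ → List (List Row) → Set
    Values n [] = ⊤
    Values n (l ∷ ls) = (seq n ≈ valueR l) × Values (suc n) ls

    Seven : ℕ → Set
    Seven n = Bounded n × Bounded (1 N.+ n) × Bounded (2 N.+ n) × Bounded (3 N.+ n) × Bounded (4 N.+ n) × Bounded (5 N.+ n) × Bounded (6 N.+ n)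

    -- The new value must have order at least 1 at infinity. The weakest coefficients ε₁ and ε₂ meet
    -- values of index at least 5, which already vanish there; ε₃ and ε₄ need order -1 of their
    -- partners, and the remaining three only -2.
    step : ∀ n → Seven n → Bounded (7 N.+ n)
    step n (b₀ , b₁ , b₂ , b₃ , b₄ , b₅ , b₆) = sp-cong (≈-sym eq)
        ( prod 6 (N.m≤m+n 5 _) (≤ᵇ 6 6) ε₁-span b₆
        ⟨⊕⟩ prod 5 (N.m≤m+n 5 _) (≤ᵇ 5 6) ε₂-span b₅
        ⟨⊕⟩ prod 4 (N.+-monoʳ-≤ 4 (1≤order (3 N.+ n))) (≤ᵇ 4 6) ε₃-span b₄
        ⟨⊕⟩ prod 3 (N.+-monoʳ-≤ 4 (1≤order (2 N.+ n))) (≤ᵇ 3 6) ε₄-span b₃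
        ⟨⊕⟩ prod 2 (N.m≤m+n 5 _) (≤ᵇ 2 6) ε₅-span b₂
        ⟨⊕⟩ prod 1 (N.m≤m+n 5 _) (≤ᵇ 1 6) ε₆-span b₁
        ⟨⊕⟩ prod 0 (N.m≤m+n 5 _) (≤ᵇ 0 6) ε₇-span b₀
        ⟨⊕⟩ sp-0 ≈-refl)
      where
      ≤ᵇ : ∀ m k {_ : Data.Bool.T (m N.≤ᵇ k)} → m N.≤ k
      ≤ᵇ m k {p} = N.≤ᵇ⇒≤ m k p
      prod : ∀ m {o x} → 5 N.≤ o N.+ order (m N.+ n) → m N.≤ 6 → Span (F o 7 1) x → Bounded (m N.+ n) → Span (F 3 (D₀ N.+ 7 N.* suc n) (s₀ N.+ suc n)) (x * seq (m N.+ n))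
      prod m o≤ m≤6 X Y = sp-* o≤ D≤ s≤ X Y
        where
        k≤n : (m N.+ n) N.∸ 6 N.≤ n
        k≤n = N.≤-trans (N.∸-monoˡ-≤ 6 (N.+-monoˡ-≤ n m≤6)) (N.≤-reflexive (N.m+n∸m≡n 6 n))
        D≤ : 7 N.+ (D₀ N.+ 7 N.* ((m N.+ n) N.∸ 6)) N.≤ D₀ N.+ 7 N.* suc n
        D≤ = N.≤-trans (N.+-monoʳ-≤ 7 (N.+-monoʳ-≤ D₀ (N.*-monoʳ-≤ 7 k≤n))) (N.≤-reflexive (trans (sym (N.+-assoc 7 D₀ (7 N.* n))) (trans (cong (N._+ 7 N.* n) (N.+-comm 7 D₀)) (trans (N.+-assoc D₀ 7 (7 N.* n)) (cong (D₀ N.+_) (sym (N.*-suc 7 n)))))))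
        s≤ : 1 N.+ (s₀ N.+ ((m N.+ n) N.∸ 6)) N.≤ s₀ N.+ suc n
        s≤ = N.≤-trans (N.s≤s (N.+-monoʳ-≤ s₀ k≤n)) (N.≤-reflexive (sym (N.+-suc s₀ n)))
      at : ∀ m → U (Z * u ^ n * u ^ m) ≈ seq (m N.+ n)
      at m = U-cong (*-assoc _ _ _ ⨾ *-congˡ (*-comm _ _ ⨾ ≈-sym (^-+ u m n)))
      eq : seq (7 N.+ n) ≈ valueR ε₁ * seq (6 N.+ n) + (valueR ε₂ * seq (5 N.+ n) + (valueR ε₃ * seq (4 N.+ n) + (valueR ε₄ * seq (3 N.+ n)
             + (valueR ε₅ * seq (2 N.+ n) + (valueR ε₆ * seq (1 N.+ n) + (valueR ε₇ * seq n + 0#))))))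
      eq = ≈-sym (at 7) ⨾ recurrence (Z * u ^ n)
        ⨾ +-cong (*-congˡ (at 6)) (+-cong (*-congˡ (at 5)) (+-cong (*-congˡ (at 4)) (+-cong (*-congˡ (at 3)) (+-cong (*-congˡ (at 2)) (+-cong (*-congˡ (at 1)) (+-congʳ (*-congˡ (at 0))))))))

    seven : Seven 0 → ∀ n → Seven n
    seven b zero = b
    seven b (suc n) with seven b n
    ... | (b₀ , b₁ , b₂ , b₃ , b₄ , b₅ , b₆) = b₁ , b₂ , b₃ , b₄ , b₅ , b₆ , step n (b₀ , b₁ , b₂ , b₃ , b₄ , b₅ , b₆)

    initial : ∀ {l₀ l₁ l₂ l₃ l₄ l₅ l₆} → let ls = l₀ ∷ l₁ ∷ l₂ ∷ l₃ ∷ l₄ ∷ l₅ ∷ l₆ ∷ [] in Values 0 ls → windowOK D₀ s₀ 0 ls ≡ true → ∀ n → Bounded n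
    initial {l₀} {l₁} {l₂} {l₃} {l₄} {l₅} {l₆} (v₀ , v₁ , v₂ , v₃ , v₄ , v₅ , v₆ , _) ok n = proj₁ (seven
        ( bound 0 l₀ refl v₀ (proj₁ c₀) , bound 1 l₁ refl v₁ (proj₁ c₁) , bound 2 l₂ refl v₂ (proj₁ c₂) , bound 3 l₃ refl v₃ (proj₁ c₃)
        , bound 4 l₄ refl v₄ (proj₁ c₄) , bound 5 l₅ refl v₅ (proj₁ c₅) , bound 6 l₆ refl v₆ (proj₁ c₆) ) n)
      where
      test : ℕ → List Row → Bool
      test n l = rowsOK (okF (order n) D₀) (λ l _ → l N.∸ s₀) 0 l
      bound : ∀ n l → n N.∸ 6 ≡ 0 → seq n ≈ valueR l → test n l ≡ true → Bounded n
      bound n l e v eq = subst (λ k → Span (F (order n) (D₀ N.+ 7 N.* k) (s₀ N.+ k)) (seq n)) (sym e)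
        (sp-map (F-mono N.≤-refl (N.m≤m+n D₀ 0) (N.m≤m+n s₀ 0)) (F-table (order n) D₀ s₀ l v eq))
      c₀ = ∧-true {test 0 l₀} ok
      c₁ = ∧-true {test 1 l₁} (proj₂ c₀)
      c₂ = ∧-true {test 2 l₂} (proj₂ c₁)
      c₃ = ∧-true {test 3 l₃} (proj₂ c₂)
      c₄ = ∧-true {test 4 l₄} (proj₂ c₃)
      c₅ = ∧-true {test 5 l₅} (proj₂ c₄)
      c₆ = ∧-true {test 6 l₆} (proj₂ c₅)

    next-values : ∀ X n ls → X * u ^ 7 ≈ Z * u ^ n → Next X ls → Values n ls
    next-values X n [] e _ = tt
    next-values X n (l ∷ ls) e (v , vs) = U-cong (≈-sym e) ⨾ v , next-values (X * u) (suc n) ls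
      (ring! 3 X u (u ^ 7) (λ x u p → x :* u :* p , u :* (x :* p)) ⨾ *-congˡ e ⨾ ring! 3 Z u (u ^ n) (λ x u p → u :* (x :* p) , x :* (u :* p))) vs

    initial′ : ∀ ls → length ls ≡ 7 → Values 0 ls → windowOK D₀ s₀ 0 ls ≡ true → ∀ n → Bounded n
    initial′ (l₀ ∷ l₁ ∷ l₂ ∷ l₃ ∷ l₄ ∷ l₅ ∷ l₆ ∷ []) refl v ok = initial {l₀} {l₁} {l₂} {l₃} {l₄} {l₅} {l₆} v ok

    value-at : ∀ k n ls → k N.< length ls → Values n ls → seq (k N.+ n) ≈ valueR (nth k ls)
    value-at zero n (l ∷ ls) _ (v , _) = v
    value-at (suc k) n (l ∷ ls) (N.s≤s k<) (_ , vs) = reflexive (cong seq (sym (N.+-suc k n))) ⨾ value-at k (suc n) ls k< vs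

  drop-power : ∀ H k m j → H * w ^ (k N.+ m) * t ^ j * u ^ m ≈ H * w ^ k * t ^ j
  drop-power H k m j = mod! 6 H (w ^ (k N.+ m)) (t ^ j) (u ^ m) (w ^ k) (w ^ m) (λ h a b c d e → (h :* a :* b :* c , h :* d :* b) , (h :* b :* c , a , d :* e) ∷ (h :* d :* b , c :* e , 𝟙) ∷ []) (^-+ w k m , ^-inv m uw)

  -- The sequences start at the lowest exponents -3 and -4 of the two windows. The pairs 21, 1 and
  -- 22, 2 bound the degree in u and the excess of l over the exponent of 7 in their seven initial
  -- values.
  module ST (j : ℕ) = Sequence (1# * w ^ 3 * t ^ j) 21 1
  module SA (j : ℕ) = Sequence (A * w ^ 4 * t ^ j) 22 2

  valuesT : ∀ j ds ns → length ds ≡ 3 → Window.DirectValues 1# j 1 ds × Next (1# * w ^ 7 * t ^ j) ns → ST.Values j 0 (window ds ns)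
  valuesT j (d₁ ∷ d₂ ∷ d₃ ∷ []) ns refl ((v₁ , v₂ , v₃ , _) , vs) = U-cong (*-identityʳ _) ⨾ v₃ , U-cong (drop-power 1# 2 1 j) ⨾ v₂ , U-cong (drop-power 1# 1 2 j) ⨾ v₁ ,
    ST.next-values j (1# * w ^ 7 * t ^ j) 3 ns (drop-power 1# 0 7 j ⨾ ≈-sym (drop-power 1# 0 3 j)) vs

  valuesA : ∀ j ds ns → length ds ≡ 2 → Window.DirectValues A j 3 ds × Next (A * w ^ 9 * t ^ j) ns → SA.Values j 0 (window ds ns)
  valuesA j (d₁ ∷ d₂ ∷ []) ns refl ((v₁ , v₂ , _) , vs) = U-cong (*-identityʳ _) ⨾ v₂ , U-cong (drop-power A 3 1 j) ⨾ v₁ ,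
    SA.next-values j (A * w ^ 9 * t ^ j) 2 ns (drop-power A 2 7 j ⨾ ≈-sym (drop-power A 2 2 j)) vs

  wT₀ wT₁ wT₂ wA₀ wA₁ wA₂ : List (List Row)
  wT₀ = window directT₀ nextT₀
  wT₁ = window directT₁ nextT₁
  wT₂ = window directT₂ nextT₂
  wA₀ = window directA₀ nextA₀
  wA₁ = window directA₁ nextA₁
  wA₂ = window directA₂ nextA₂

  vT₀ : ST.Values 0 0 wT₀
  vT₀ = valuesT 0 directT₀ nextT₀ refl valuesT₀
  vT₁ : ST.Values 1 0 wT₁
  vT₁ = valuesT 1 directT₁ nextT₁ refl valuesT₁
  vT₂ : ST.Values 2 0 wT₂
  vT₂ = valuesT 2 directT₂ nextT₂ refl valuesT₂
  vA₀ : SA.Values 0 0 wA₀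
  vA₀ = valuesA 0 directA₀ nextA₀ refl valuesA₀
  vA₁ : SA.Values 1 0 wA₁
  vA₁ = valuesA 1 directA₁ nextA₁ refl valuesA₁
  vA₂ : SA.Values 2 0 wA₂
  vA₂ = valuesA 2 directA₂ nextA₂ refl valuesA₂

  boundedT : ∀ j → j N.≤ 2 → ∀ n → ST.Bounded j n
  boundedT 0 _ = ST.initial′ 0 wT₀ refl vT₀ refl
  boundedT 1 _ = ST.initial′ 1 wT₁ refl vT₁ refl
  boundedT 2 _ = ST.initial′ 2 wT₂ refl vT₂ refl
  boundedT (suc (suc (suc j))) (N.s≤s (N.s≤s ()))

  boundedA : ∀ j → j N.≤ 2 → ∀ n → SA.Bounded j n
  boundedA 0 _ = SA.initial′ 0 wA₀ refl vA₀ refl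
  boundedA 1 _ = SA.initial′ 1 wA₁ refl vA₁ refl
  boundedA 2 _ = SA.initial′ 2 wA₂ refl vA₂ refl
  boundedA (suc (suc (suc j))) (N.s≤s (N.s≤s ()))

  seqT≈ : ∀ j i → ST.seq j (3 N.+ i) ≈ U (u ^ i * t ^ j)
  seqT≈ j i = U-cong (mod! 4 w u (u ^ i) (t ^ j) (λ w u p q → (𝟙 :* w :^ 3 :* q :* (u :* (u :* (u :* p))) , p :* q) , (p :* q :* (u :* w :* (u :* w) :+ u :* w :+ 𝟙) , u :* w , 𝟙) ∷ []) uw)

  seqA≈ : ∀ j i → SA.seq j (4 N.+ i) ≈ U (A * (u ^ i * t ^ j))
  seqA≈ j i = U-cong (mod! 5 A w u (u ^ i) (t ^ j) (λ A w u p q → (A :* w :^ 4 :* q :* (u :* (u :* (u :* (u :* p)))) , A :* (p :* q)) ,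
    (A :* p :* q :* ((u :* w) :^ 3 :+ (u :* w) :^ 2 :+ u :* w :+ 𝟙) , u :* w , 𝟙) ∷ []) uw)

  U-linear : Linear U
  U-linear = record { f-cong = U-cong ; f-+ = U-+ ; f-ι = U-ι }

  UA-linear : Linear (λ x → U (A * x))
  UA-linear = record { f-cong = λ e → U-cong (*-congˡ e) ; f-+ = λ x y → U-cong (distribˡ A x y) ⨾ U-+ _ _
    ; f-ι = λ c x → U-cong (ring! 3 A (ι c) x (λ a c x → a :* (c :* x) , c :* (a :* x))) ⨾ U-ι c (A * x) }

  sp-7^ : ∀ {P Q : Shape} k → (∀ {n l j} → P n l j → Q (k N.+ n) l j) → ∀ {x} → Span P x → Span Q (7^ k * x)
  sp-7^ k h = sp-lin (mul-linearˡ (7^ k)) (λ {n} {l} {j} g → sp-gen (+ 1) (h g) (≈-sym (*-assoc _ _ _) ⨾ *-congʳ (≈-sym (7^-+ k n)) ⨾ ≈-sym (*-congʳ ι-1 ⨾ *-identityˡ _)))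

  U-term : ∀ n l j → U (term n l j) ≈ 7^ n * U (u ^ l * t ^ j)
  U-term n l j = U-ι _ _

  G-table : ∀ D rows {x} → x ≈ valueR rows → rowsOK (okF 3 D) (λ l _ → l N.∸ 2) 0 rows ≡ true → Span (G D) x
  G-table D = F-table 3 D 2

  UpG-table : ∀ D rows {x} → x ≈ valueR rows → rowsOK (okF 3 D) (λ l _ → suc (l N.∸ 2)) 0 rows ≡ true → Span (Up (G D)) x
  UpG-table D = table-span (okF 3 D) (λ l _ → suc (l N.∸ 2)) (λ l j eq → l N.∸ 2 , refl , okF-sound (∸-bound l 2) eq)

  O-table : ∀ D rows {x} → x ≈ valueR rows → rowsOK (okF 3 D) reqO 0 rows ≡ true → Span (O D) x
  O-table D = table-span (okF 3 D) reqO okO-sound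

  UpO-table : ∀ D rows {x} → x ≈ valueR rows → rowsOK (okF 3 D) (λ l j → suc (reqO l j)) 0 rows ≡ true → Span (Up (O D)) x
  UpO-table D = table-span (okF 3 D) (λ l j → suc (reqO l j)) (λ l j eq → reqO l j , refl , okO-sound l j eq)

  small : ∀ m {n} {_ : Data.Bool.T (m N.<ᵇ n)} → m N.< n
  small m {n} {p} = N.<ᵇ⇒< m n p

  -- Not divisible by 7: the coefficient of u is 252372. For u² it is 6129656, again prime to 7.
  -- This is why `O` asks for a factor 7 at u and u², while ut, u²t and u²t² need none.
  U-u : Span (G 21) (U (u ^ 1 * t ^ 0))
  U-u = G-table 21 (nth 4 wT₀) (≈-sym (seqT≈ 0 1) ⨾ ST.value-at 0 4 0 wT₀ (small 4) vT₀) refl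
  U-u² : Span (G 21) (U (u ^ 2 * t ^ 0))
  U-u² = G-table 21 (nth 5 wT₀) (≈-sym (seqT≈ 0 2) ⨾ ST.value-at 0 5 0 wT₀ (small 5) vT₀) refl
  U-ut : Span (Up (G 21)) (U (u ^ 1 * t ^ 1))
  U-ut = UpG-table 21 (nth 4 wT₁) (≈-sym (seqT≈ 1 1) ⨾ ST.value-at 1 4 0 wT₁ (small 4) vT₁) refl
  U-u²t : Span (Up (G 21)) (U (u ^ 2 * t ^ 1))
  U-u²t = UpG-table 21 (nth 5 wT₁) (≈-sym (seqT≈ 1 2) ⨾ ST.value-at 1 5 0 wT₁ (small 5) vT₁) refl
  U-u²t² : Span (Up (G 21)) (U (u ^ 2 * t ^ 2))
  U-u²t² = UpG-table 21 (nth 5 wT₂) (≈-sym (seqT≈ 2 2) ⨾ ST.value-at 2 5 0 wT₂ (small 5) vT₂) refl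

  UA-u : Span (O 22) (U (A * (u ^ 1 * t ^ 0)))
  UA-u = O-table 22 (nth 5 wA₀) (≈-sym (seqA≈ 0 1) ⨾ SA.value-at 0 5 0 wA₀ (small 5) vA₀) refl
  UA-u² : Span (O 22) (U (A * (u ^ 2 * t ^ 0)))
  UA-u² = O-table 22 (nth 6 wA₀) (≈-sym (seqA≈ 0 2) ⨾ SA.value-at 0 6 0 wA₀ (small 6) vA₀) refl
  UA-ut : Span (O 22) (U (A * (u ^ 1 * t ^ 1)))
  UA-ut = O-table 22 (nth 5 wA₁) (≈-sym (seqA≈ 1 1) ⨾ SA.value-at 1 5 0 wA₁ (small 5) vA₁) refl
  UA-u²t : Span (O 22) (U (A * (u ^ 2 * t ^ 1)))
  UA-u²t = O-table 22 (nth 6 wA₁) (≈-sym (seqA≈ 1 2) ⨾ SA.value-at 1 6 0 wA₁ (small 6) vA₁) refl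
  UA-u²t² : Span (O 22) (U (A * (u ^ 2 * t ^ 2)))
  UA-u²t² = O-table 22 (nth 6 wA₂) (≈-sym (seqA≈ 2 2) ⨾ SA.value-at 2 6 0 wA₂ (small 6) vA₂) refl

  -- The start of the induction: U(A) is L₁, and it already carries one factor 7.
  UA-1 : Span (Up (O 8)) (U A)
  UA-1 = sp-cong (U-cong (ring! 3 A t u (λ a t u → a :* (u :^ 0 :* t :^ 0) , a)))
    (UpO-table 8 (nth 4 wA₀) (≈-sym (seqA≈ 0 0) ⨾ SA.value-at 0 4 0 wA₀ (small 4) vA₀) refl)

  Up-extract : ∀ {P : Shape} {x} → Span (Up P) x → ∃ λ y → (x ≈ ι (+ 7) * y) × Span P y
  Up-extract (sp-0 p) = 0# , p ⨾ ≈-sym (zeroʳ _) , sp-0 ≈-refl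
  Up-extract (sp-+ a b p) with Up-extract a | Up-extract b
  ... | y , e , Y | z , f , Z = y + z , p ⨾ +-cong e f ⨾ ≈-sym (distribˡ _ _ _) , (Y ⟨⊕⟩ Z)
  Up-extract (sp-gen {l = l} {j} c (n , refl , g) p) = ι c * term n l j
    , p ⨾ *-congˡ (*-congʳ (7^-+ 1 n)) ⨾ ring! 4 (ι c) (ι (+ 7)) (7^ n) (u ^ l * t ^ j) (λ c s n x → c :* (s :* n :* x) , s :* (c :* (n :* x))) , gen n l j g c

  -- For l ≥ 3 the exponent n is at least l - 2 ≥ 1, and at uᵐ the value U(uˡ tʲ) contributes at
  -- least m - (l - 2). The total at uᵐ is at least m, while 7 times `G` needs m - 1. The five
  -- smaller terms are settled by their tables.
  stepT-term : ∀ D → 3 N.≤ D → ∀ n l j → O D n l j → Span (Up (G (7 N.* D))) (U (term n l j))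
  stepT-term D 3≤D n l j o = sp-cong (≈-sym (U-term n l j)) (go n l j o)
    where
    widen : ∀ {n l j} → G 21 n l j → G (7 N.* D) n l j
    widen = F-mono N.≤-refl (N.*-monoʳ-≤ 7 3≤D) N.≤-refl
    lift : ∀ k {x} → Span (Up (G 21)) x → Span (Up (G (7 N.* D))) (7^ k * x)
    lift k = sp-7^ k (λ { (n , refl , g) → k N.+ n , N.+-suc k n , F-lift k (widen g) })
    raise : ∀ n {x} → 1 N.≤ n → Span (G 21) x → Span (Up (G (7 N.* D))) (7^ n * x)
    raise (suc n) _ = sp-7^ (suc n) (λ {m} g → n N.+ m , refl , F-lift n (widen g))
    go : ∀ n l j → O D n l j → Span (Up (G (7 N.* D))) (7^ n * U (u ^ l * t ^ j))
    go n 0 0 (shape _ (N.s≤s (N.s≤s ())) _ _ , _)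
    go n 0 (suc j) (shape _ b _ _ , _) = ⊥-elim (absurd (N.≤-trans (N.m≤n+m 3 (2 N.* suc j)) b))
      where
      absurd : 3 N.≤ 2 → ⊥
      absurd (N.s≤s (N.s≤s ()))
    go n 1 0 (g , c) = raise n (c refl (N.s≤s N.z≤n)) U-u
    go n 1 1 (g , c) = lift n U-ut
    go n 1 2 (shape _ (N.s≤s (N.s≤s (N.s≤s (N.s≤s (N.s≤s ()))))) _ _ , _)
    go n 2 0 (g , c) = raise n (c refl N.≤-refl) U-u²
    go n 2 1 (g , c) = lift n U-u²t
    go n 2 2 (g , c) = lift n U-u²t²
    go n (suc (suc _)) (suc (suc (suc j))) (shape (N.s≤s (N.s≤s ())) _ _ _ , _)
    go n 1 (suc (suc (suc j))) (shape (N.s≤s (N.s≤s ())) _ _ _ , _)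
    go n (suc (suc (suc i))) j (shape a b c d , _) = large n (N.≤-pred (N.≤-pred (N.≤-trans d (N.≤-reflexive (N.+-comm n 2)))))
      where
      large : ∀ n → suc i N.≤ n → Span (Up (G (7 N.* D))) (7^ n * U (u ^ (3 N.+ i) * t ^ j))
      large (suc n) (N.s≤s i≤n) = sp-7^ (suc n) conv (sp-cong (seqT≈ j (3 N.+ i)) (boundedT j a (6 N.+ i)))
        where
        conv : ∀ {m l k} → F 3 (21 N.+ 7 N.* i) (1 N.+ i) m l k → Up (G (7 N.* D)) (suc n N.+ m) l k
        conv {m} (shape a b c′ d) = n N.+ m , refl , shape a b (N.≤-trans c′ (N.≤-trans (N.≤-reflexive (sym (N.*-distribˡ-+ 7 3 i))) (N.*-monoʳ-≤ 7 c)))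
          (N.≤-trans d (N.≤-trans (N.+-monoʳ-≤ m (N.s≤s i≤n)) (N.≤-trans (N.≤-reflexive (trans (N.+-comm m (suc n)) (sym (N.+-suc n m)))) (N.≤-trans (N.+-monoʳ-≤ n (N.≤-reflexive (N.+-comm 1 m))) (N.≤-trans (N.≤-reflexive (sym (N.+-assoc n m 1))) (N.+-monoʳ-≤ (n N.+ m) (N.s≤s N.z≤n)))))))

  stepT : ∀ D → 3 N.≤ D → ∀ {x} → Span (O D) x → ∃ λ y → (U x ≈ ι (+ 7) * y) × Span (G (7 N.* D)) y
  stepT D 3≤D X = Up-extract (sp-lin U-linear (λ {n} {l} {j} → stepT-term D 3≤D n l j) X)

  O-lift : ∀ {D n l j} k → O D n l j → O D (k N.+ n) l j
  O-lift {n = n} k (g , c) = F-lift k g , λ e l≤ → N.≤-trans (c e l≤) (N.m≤n+m n k)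

  -- Here U(A uˡ tʲ) contributes at least m - l at uᵐ, so n ≥ l - 2 gives exactly the m - 2 that `G`
  -- needs. For l ≥ 3 one has n ≥ 1, which provides the additional factor demanded by `O`.
  stepA-term : ∀ D → 2 N.≤ D → ∀ n l j → G D n l j → Span (O (7 N.* D N.+ 8)) (U (A * term n l j))
  stepA-term D 2≤D n l j g = sp-cong (≈-sym (Linear.f-ι UA-linear (+ (7 N.^ n)) (u ^ l * t ^ j))) (go n l j g)
    where
    lift : ∀ k {x} → Span (O 22) x → Span (O (7 N.* D N.+ 8)) (7^ k * x)
    lift k = sp-7^ k (λ { (g , c) → O-lift k (F-mono N.≤-refl (N.+-monoˡ-≤ 8 (N.*-monoʳ-≤ 7 2≤D)) N.≤-refl g , c) })
    go : ∀ n l j → G D n l j → Span (O (7 N.* D N.+ 8)) (7^ n * U (A * (u ^ l * t ^ j)))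
    go n 0 0 (shape _ (N.s≤s (N.s≤s ())) _ _)
    go n 0 (suc j) (shape _ b _ _) = ⊥-elim (absurd (N.≤-trans (N.m≤n+m 3 (2 N.* suc j)) b))
      where
      absurd : 3 N.≤ 2 → ⊥
      absurd (N.s≤s (N.s≤s ()))
    go n 1 0 g = lift n UA-u
    go n 1 1 g = lift n UA-ut
    go n 1 2 (shape _ (N.s≤s (N.s≤s (N.s≤s (N.s≤s (N.s≤s ()))))) _ _)
    go n 2 0 g = lift n UA-u²
    go n 2 1 g = lift n UA-u²t
    go n 2 2 g = lift n UA-u²t²
    go n (suc (suc _)) (suc (suc (suc j))) (shape (N.s≤s (N.s≤s ())) _ _ _)
    go n 1 (suc (suc (suc j))) (shape (N.s≤s (N.s≤s ())) _ _ _)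
    go n (suc (suc (suc i))) j (shape a b c d) = large (N.≤-pred (N.≤-pred (N.≤-trans d (N.≤-reflexive (N.+-comm n 2)))))
      where
      large : suc i N.≤ n → Span (O (7 N.* D N.+ 8)) (7^ n * U (A * (u ^ (3 N.+ i) * t ^ j)))
      large i<n = sp-7^ n conv (sp-cong (seqA≈ j (3 N.+ i)) (boundedA j a (7 N.+ i)))
        where
        conv : ∀ {m l k} → F 3 (22 N.+ 7 N.* suc i) (2 N.+ suc i) m l k → O (7 N.* D N.+ 8) (n N.+ m) l k
        conv {m} (shape a b c′ d) = shape a b (N.≤-trans c′ (N.≤-trans (N.≤-reflexive degree) (N.+-monoˡ-≤ 8 (N.*-monoʳ-≤ 7 c))))
          (N.≤-trans d (N.≤-trans (N.+-monoʳ-≤ m (N.+-monoʳ-≤ 2 i<n)) (N.≤-reflexive (trans (N.+-comm m (2 N.+ n)) (trans (N.+-assoc 2 n m) (N.+-comm 2 (n N.+ m)))))))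
          , λ _ _ → N.≤-trans (N.≤-trans (N.s≤s N.z≤n) i<n) (N.m≤m+n n m)
          where
          degree : 22 N.+ 7 N.* suc i ≡ 7 N.* (3 N.+ i) N.+ 8
          degree = trans (cong (22 N.+_) (N.*-suc 7 i)) (trans (N.+-comm 8 (21 N.+ 7 N.* i)) (cong (N._+ 8) (sym (N.*-distribˡ-+ 7 3 i))))

  stepA : ∀ D → 2 N.≤ D → ∀ {x} → Span (G D) x → Span (O (7 N.* D N.+ 8)) (U (A * x))
  stepA D 2≤D = sp-lin UA-linear (λ {n} {l} {j} → stepA-term D 2≤D n l j)

-- Watson's equation and further identities in the tower

1₆ : K₆
1₆ = k₆ (k₃ (lit (+ 1 ∷ [])) 0ᵖ 0ᵖ) 0₃

raiseHead : K₆ → V₇ → V₇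
raiseHead k (v₇ x a b c ab bc ca) = v₇ (x ⊹₆ k) a b c ab bc ca

-- Multiplication by R = 1/(1 + h) - h + 1/h - 7, which is invariant under the substitution h ↦
-- -1/(1 + h) of order three. It is identified later as (η(7τ)/η(49τ))⁴.
×R : K₆ → K₆
×R x = ×λ x ⊹₆ neg₆ (×h x) ⊹₆ ×h⁻¹ x ⊹₆ scale₆ −7 x

linear : ℤ → ℤ → K₆
linear m n = scale₆ m (×R 1₆) ⊹₆ scale₆ n 1₆

-- Coefficients of derivatives. With θ = q d/dq they satisfy 7h(1 + h) θz = (αa + βb + γc) θh and
-- h(1 + h) θR = ϱ θh, as shown in `Watson`.
×α ×β ×γ ×ϱ : K₆ → K₆
×α x = neg₆ (x ⊹₆ scale₆ (+ 3) (×h x))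
×β x = scale₆ (+ 3) x ⊹₆ scale₆ (+ 2) (×h x)
×γ x = ×h x ⊹₆ scale₆ −2 x
×ϱ x = ×λ x ⊹₆ scale₆ −2 x ⊹₆ neg₆ (×h x ⊹₆ ×h (×h x) ⊹₆ ×h⁻¹ x)

opaque
  -- The cofactor of z in Watson's equation
  -- z⁷ + 7z⁶ + 21z⁵ + 49z⁴ + (7R + 147)z³ + (35R + 343)z² + (49R + 343)z = R².
  watson twisted : V₇
  watson = step (+ 49) (+ 343) (step (+ 35) (+ 343) (step (+ 7) (+ 147) (step +0 (+ 49) (step +0 (+ 21) (step +0 (+ 7) 1₇)))))
    where
    step : ℤ → ℤ → V₇ → V₇
    step m n v = raiseHead (linear m n) (×z v)
  twisted = ×affine ×α ×β ×γ watson

  twisted≡ : twisted ≡ ×affine ×α ×β ×γ watson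
  twisted≡ = refl

  watson-check : vanishes₇ (raiseHead (neg₆ (×R (×R 1₆))) (×z watson)) ≡ true
  watson-check = refl

  -- `×affine` multiplies by an element with constant -1, whereas αa + βb + γc has no constant;
  -- adding `watson` back corrects this.
  derivative-check : vanishes₆ ((eᵒ twisted ⊹₆ eᵒ watson) ⊹₆ scale₆ −2 (×R (×ϱ 1₆))) ≡ true
  derivative-check = refl

module TowerIdentities (R : CommutativeRing 0ℓ 0ℓ) (D : TowerData R) where
  open Ring R
  open Tower R D
  open Eval R s using (⟦⟧-∷; ⟦⟧-[])

  1₆≈ : ⟦ 1₆ ⟧₆ ≈ 1#
  1₆≈ = const₆≈ (lit (+ 1 ∷ [])) ⨾ ⟦⟧-∷ (+ 1) [] ⨾ +-cong ι-1 (*-congˡ ⟦⟧-[] ⨾ zeroʳ s) ⨾ +-identityʳ 1#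

  value : ∀ {f α} → Acts f α → ⟦ f 1₆ ⟧₆ ≈ α
  value F = on F 1₆ ⨾ *-congˡ 1₆≈ ⨾ *-identityʳ _

  -- Applying an operator to 1 yields the coordinates of its scalar, so an identity in the tower is
  -- decided by evaluation.
  acts-zero : ∀ {f α} → Acts f α → vanishes₆ (f 1₆) ≡ true → α ≈ 0#
  acts-zero {f} F e = ≈-sym (value F) ⨾ vanishes₆⇒≈0 (f 1₆) e

  infixl 6 _⟨+⟩_
  infixr 7 _⟨*⟩_
  _⟨+⟩_ : ∀ {f g α β} → Acts f α → Acts g β → Acts (λ x → f x ⊹₆ g x) (α + β)
  _⟨+⟩_ = sum-acts₆
  _⟨*⟩_ : ∀ {f g α β} → Acts f α → Acts g β → Acts (λ x → f (g x)) (α * β)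
  _⟨*⟩_ = comp-acts₆

  T² : T * T ≈ (s * s + s - ι (+ 3)) * T - ι (+ 8)
  T² = mod! 2 s T (λ s T → (T :* T , (s :* s :+ s :- # 3) :* T :- # 8) ,
      (𝟙 , T :* T :+ :- 𝟙 :* (s :* s :+ s :+ con −3) :* T :+ # 8 , 𝟘) ∷ [])
    (acts-zero (×T-acts ⟨*⟩ ×T-acts ⟨+⟩ (neg-acts ⟨*⟩ (shift₆-acts ⟨*⟩ shift₆-acts ⟨+⟩ shift₆-acts ⟨+⟩ scale₆-acts −3)) ⟨*⟩ ×T-acts ⟨+⟩ scale₆-acts (+ 8)) refl)

  -- The components of the dissection of φ(-q) will be X₁ = -ξ₁ ac, X₂ = -ξ₂ bc and X₄ = -ξ₄ ab; the
  -- product of the ξ is what identifies T.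
  ξ₁ ξ₂ ξ₄ : Carrier
  ξ₁ = 1# + - 1# * r₂ * h * (1# + r₃ * λ⁻)
  ξ₂ = 1# + r₃ * λ⁻ * (1# + r₁ * (1# + h⁻¹))
  ξ₄ = 1# + r₁ * (1# + h⁻¹) * (1# + - 1# * r₂ * h)

  ξ-product : ξ₁ * ξ₂ * ξ₄ * T ≈ - ι (+ 8)
  ξ-product = mod! 4 ξ₁ ξ₂ ξ₄ T (λ x y w T → (x :* y :* w :* T , :- # 8) , (𝟙 , x :* y :* w :* T :+ # 8 , 𝟘) ∷ [])
    (acts-zero (((op₁ ⟨*⟩ op₂) ⟨*⟩ op₄) ⟨*⟩ ×T-acts ⟨+⟩ scale₆-acts (+ 8)) refl)
    where
    op₁ : Acts _ ξ₁
    op₁ = id-acts ⟨+⟩ ((neg-acts ⟨*⟩ ρ₂-acts) ⟨*⟩ ×h-acts) ⟨*⟩ (id-acts ⟨+⟩ ρ₃-acts ⟨*⟩ ×λ-acts)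
    op₂ : Acts _ ξ₂
    op₂ = id-acts ⟨+⟩ (ρ₃-acts ⟨*⟩ ×λ-acts) ⟨*⟩ (id-acts ⟨+⟩ ρ₁-acts ⟨*⟩ ×[1+h⁻¹]-acts)
    op₄ : Acts _ ξ₄
    op₄ = id-acts ⟨+⟩ (ρ₁-acts ⟨*⟩ ×[1+h⁻¹]-acts) ⟨*⟩ (id-acts ⟨+⟩ (neg-acts ⟨*⟩ ρ₂-acts) ⟨*⟩ ×h-acts)

  Rᴷ : Carrier
  Rᴷ = λ⁻ - h + h⁻¹ - ι (+ 7)

  R-acts : Acts ×R Rᴷ
  R-acts = cong-acts₆ (ring! 3 λ⁻ h h⁻¹ (λ l h i → l :+ :- 𝟙 :* h :+ i :+ con −7 , l :- h :+ i :- # 7))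
    (×λ-acts ⟨+⟩ neg-acts ⟨*⟩ ×h-acts ⟨+⟩ ×h⁻¹-acts ⟨+⟩ scale₆-acts −7)

  κ₁≈ : s * s + ι (+ 2) * s - ι (+ 7) - T ≈ Rᴷ
  κ₁≈ = mod! 3 s T Rᴷ (λ s T R → (s :* s :+ # 2 :* s :- # 7 :- T , R) ,
      (𝟙 , s :* s :+ # 2 :* s :+ con −7 :+ :- 𝟙 :* (T :+ R) , 𝟘) ∷ [])
    (acts-zero (shift₆-acts ⟨*⟩ shift₆-acts ⟨+⟩ scale₆-acts (+ 2) ⟨*⟩ shift₆-acts ⟨+⟩ scale₆-acts −7 ⟨+⟩ neg-acts ⟨*⟩ (×T-acts ⟨+⟩ R-acts)) refl)

  -- The right-hand side is R with q replaced by q², rewritten by a′ = r₁ c, b′ = r₃ a, c′ = r₂ b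
  -- and the multiplication table.
  κ₂≈ : T - ι (+ 5) - s ≈ r₁ * r₁ * r₁ * r₃ * (1# + h⁻¹) + r₃ * r₃ * r₃ * r₂ * λ⁻ - r₂ * r₂ * r₂ * r₁ * h - ι (+ 8)
  κ₂≈ = mod! 8 s T r₁ r₂ r₃ h h⁻¹ λ⁻ (λ s T x y w h i l →
      (T :- # 5 :- s , x :* x :* x :* w :* (𝟙 :+ i) :+ w :* w :* w :* y :* l :- y :* y :* y :* x :* h :- # 8) ,
      (𝟙 , T :+ # 3 :+ :- 𝟙 :* s :+ :- 𝟙 :* (x :* (x :* (x :* (w :* (𝟙 :+ i))))) :+ :- 𝟙 :* (w :* (w :* (w :* (y :* l)))) :+ y :* (y :* (y :* (x :* h))) , 𝟘) ∷ [])
    (acts-zero (×T-acts ⟨+⟩ scale₆-acts (+ 3) ⟨+⟩ neg-acts ⟨*⟩ shift₆-acts ⟨+⟩ neg-acts ⟨*⟩ (ρ₁-acts ⟨*⟩ ρ₁-acts ⟨*⟩ ρ₁-acts ⟨*⟩ ρ₃-acts ⟨*⟩ ×[1+h⁻¹]-acts)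
      ⟨+⟩ neg-acts ⟨*⟩ (ρ₃-acts ⟨*⟩ ρ₃-acts ⟨*⟩ ρ₃-acts ⟨*⟩ ρ₂-acts ⟨*⟩ ×λ-acts) ⟨+⟩ ρ₂-acts ⟨*⟩ ρ₂-acts ⟨*⟩ ρ₂-acts ⟨*⟩ ρ₁-acts ⟨*⟩ ×h-acts) refl)

  raiseHead≈ : ∀ k v → ⟦ raiseHead k v ⟧₇ ≈ ⟦ v ⟧₇ + ⟦ k ⟧₆
  raiseHead≈ k (v₇ x xa xb xc xab xbc xca) = ⟦⟧₇-def _ _ _ _ _ _ _ ⨾ +-congʳ (⟦⟧₆-⊹ x k)
    ⨾ +-assoc _ _ _ ⨾ +-congˡ (+-comm _ _) ⨾ ≈-sym (+-assoc _ _ _) ⨾ +-congʳ (≈-sym (⟦⟧₇-def x xa xb xc xab xbc xca))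

  z* z~ ϱ : Carrier
  z* = ⟦ watson ⟧₇
  z~ = - (1# + ι (+ 3) * h) * a + (ι (+ 3) + ι (+ 2) * h) * b + (h - ι (+ 2)) * c
  ϱ = λ⁻ - ι (+ 2) - h - h * h - h⁻¹

  zz* : z * z* ≈ Rᴷ * Rᴷ
  zz* = mod! 4 (z * z*) Rᴷ (⟦ neg₆ (×R (×R 1₆)) ⟧₆) (⟦ ×z watson ⟧₇) (λ x R n v → (x , R :* R) ,
      (𝟙 , v :+ n , 𝟘) ∷ (:- 𝟙 , n , :- 𝟙 :* (R :* R)) ∷ (:- 𝟙 , v , x) ∷ [])
    ( ≈-sym (raiseHead≈ (neg₆ (×R (×R 1₆))) (×z watson)) ⨾ vanishes₇⇒≈0 (raiseHead (neg₆ (×R (×R 1₆))) (×z watson)) watson-check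
    , value (neg-acts ⟨*⟩ R-acts ⟨*⟩ R-acts) , ×z-acts watson)

  α-acts : Acts ×α (- (1# + ι (+ 3) * h))
  α-acts = cong-acts₆ (ring! 1 h (λ h → :- 𝟙 :* (𝟙 :+ # 3 :* h) , :- (𝟙 :+ # 3 :* h))) (neg-acts ⟨*⟩ (id-acts ⟨+⟩ scale₆-acts (+ 3) ⟨*⟩ ×h-acts))

  β-acts : Acts ×β (ι (+ 3) + ι (+ 2) * h)
  β-acts = scale₆-acts (+ 3) ⟨+⟩ scale₆-acts (+ 2) ⟨*⟩ ×h-acts

  γ-acts : Acts ×γ (h - ι (+ 2))
  γ-acts = cong-acts₆ (ring! 1 h (λ h → h :+ con −2 , h :- # 2)) (×h-acts ⟨+⟩ scale₆-acts −2)

  ϱ-acts : Acts ×ϱ ϱ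
  ϱ-acts = cong-acts₆ (ring! 3 λ⁻ h h⁻¹ (λ l h i → l :+ con −2 :+ :- 𝟙 :* (h :+ h :* h :+ i) , l :- # 2 :- h :- h :* h :- i))
    (×λ-acts ⟨+⟩ scale₆-acts −2 ⟨+⟩ neg-acts ⟨*⟩ (×h-acts ⟨+⟩ ×h-acts ⟨*⟩ ×h-acts ⟨+⟩ ×h⁻¹-acts))

  z~z* : z~ * z* ≈ ⟦ twisted ⟧₇ + ⟦ watson ⟧₇
  z~z* = mod! 5 (- (1# + ι (+ 3) * h) * a) ((ι (+ 3) + ι (+ 2) * h) * b) ((h - ι (+ 2)) * c) z* (⟦ twisted ⟧₇) (λ x y w v t →
      ((x :+ y :+ w) :* v , t :+ v) , (:- 𝟙 , t , (x :+ y :+ w :- 𝟙) :* v) ∷ []) (reflexive (cong ⟦_⟧₇ twisted≡) ⨾ ×affine-acts α-acts β-acts γ-acts watson)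

  heads≈ : ⟦ eᵒ twisted ⟧₆ + ⟦ eᵒ watson ⟧₆ ≈ ι (+ 2) * (Rᴷ * ϱ)
  heads≈ = mod! 6 (⟦ eᵒ twisted ⟧₆) (⟦ eᵒ watson ⟧₆) (⟦ eᵒ twisted ⊹₆ eᵒ watson ⟧₆) (⟦ scale₆ −2 (×R (×ϱ 1₆)) ⟧₆) Rᴷ ϱ (λ x y v n R r → (x :+ y , # 2 :* (R :* r)) ,
      (𝟙 , v :+ n , 𝟘) ∷ (:- 𝟙 , v , x :+ y) ∷ (:- 𝟙 , n , con −2 :* (R :* r)) ∷ [])
    ( ≈-sym (⟦⟧₆-⊹ (eᵒ twisted ⊹₆ eᵒ watson) _) ⨾ vanishes₆⇒≈0 ((eᵒ twisted ⊹₆ eᵒ watson) ⊹₆ scale₆ −2 (×R (×ϱ 1₆))) derivative-check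
    , ⟦⟧₆-⊹ (eᵒ twisted) (eᵒ watson) , value (scale₆-acts −2 ⟨*⟩ R-acts ⟨*⟩ ϱ-acts))

-- The ring of formal power series under convolution

open import Defs using (Series; sumℤ; _⊛_; oneS; powS; factor; geom; prodOver; euler; eulerInv; Laurent; mkL; val; ser; coeff; _≈_; _+L_; _*L_; scale; powL; zeroL; oneL; U7; isEven; p7; sum3)


infix 4 _≋_
_≋_ : Series → Series → Set
f ≋ g = ∀ n → f n ≡ g n

∑ : ℕ → (ℕ → ℤ) → ℤ
∑ zero F = + 0
∑ (suc n) F = F 0 Z.+ ∑ n (λ k → F (suc k))

sumℤ-applyUpTo : ∀ n (G : ℕ → ℕ) F → sumℤ (map F (applyUpTo G n)) ≡ ∑ n (λ k → F (G k))
sumℤ-applyUpTo zero G F = refl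
sumℤ-applyUpTo (suc n) G F = cong (Z._+_ (F (G 0))) (sumℤ-applyUpTo n (λ k → G (suc k)) F)

∑-cong : ∀ n {F G : ℕ → ℤ} → (∀ k → k N.< n → F k ≡ G k) → ∑ n F ≡ ∑ n G
∑-cong zero eq = refl
∑-cong (suc n) eq = cong₂ Z._+_ (eq 0 (N.s≤s N.z≤n)) (∑-cong n (λ k k<n → eq (suc k) (N.s≤s k<n)))

conv : Series → Series → Series
conv f g n = ∑ (suc n) (λ k → f k Z.* g (n N.∸ k))

⊛≋conv : ∀ f g → f ⊛ g ≋ conv f g
⊛≋conv f g n = sumℤ-applyUpTo (suc n) (λ k → k) (λ k → f k Z.* g (n N.∸ k))

tail : Series → Series
tail f n = f (suc n)

infixl 6 _⊞_
_⊞_ : Series → Series → Series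
(f ⊞ g) n = f n Z.+ g n

⊟_ : Series → Series
(⊟ f) n = Z.- f n

0S : Series
0S _ = + 0

infixl 7 _·_
_·_ : ℤ → Series → Series
(c · f) n = c Z.* f n

conv-cong : ∀ {f f′ g g′} → f ≋ f′ → g ≋ g′ → conv f g ≋ conv f′ g′
conv-cong p r n = ∑-cong (suc n) (λ k _ → cong₂ Z._*_ (p k) (r (n N.∸ k)))

conv-suc′ : ∀ f g n → conv f g (suc n) ≡ conv f (tail g) n Z.+ f (suc n) Z.* g 0
conv-suc′ f g zero = ring! 4 (f 0) (g 1) (f 1) (g 0) (λ a b c d → a :* b :+ (c :* d :+ 𝟘) , (a :* b :+ 𝟘) :+ c :* d)
  where open ℤR
conv-suc′ f g (suc n) = begin
  f 0 Z.* g (2 N.+ n) Z.+ conv (tail f) g (suc n)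
    ≡⟨ cong (Z._+_ (f 0 Z.* g (2 N.+ n))) (conv-suc′ (tail f) g n) ⟩
  f 0 Z.* g (2 N.+ n) Z.+ (conv (tail f) (tail g) n Z.+ f (2 N.+ n) Z.* g 0)
    ≡⟨ sym (Z.+-assoc (f 0 Z.* g (2 N.+ n)) _ _) ⟩
  conv f (tail g) (suc n) Z.+ f (2 N.+ n) Z.* g 0 ∎
  where open ≡-Reasoning

conv-comm : ∀ f g → conv f g ≋ conv g f
conv-comm f g zero = cong (Z._+ + 0) (Z.*-comm (f 0) (g 0))
conv-comm f g (suc n) = begin
  f 0 Z.* g (suc n) Z.+ conv (tail f) g n ≡⟨ cong₂ Z._+_ (Z.*-comm (f 0) (g (suc n))) (conv-comm (tail f) g n) ⟩
  g (suc n) Z.* f 0 Z.+ conv g (tail f) n ≡⟨ Z.+-comm (g (suc n) Z.* f 0) _ ⟩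
  conv g (tail f) n Z.+ g (suc n) Z.* f 0 ≡⟨ sym (conv-suc′ g f n) ⟩
  conv g f (suc n) ∎
  where open ≡-Reasoning

-- The combination c f + g is what arises as the tail of a product, f₀ g′ + f′ g with g′ and f′ the
-- tails; associativity follows from it by induction.
conv-linˡ : ∀ c f g h n → conv (c · f ⊞ g) h n ≡ c Z.* conv f h n Z.+ conv g h n
conv-linˡ c f g h zero = ring! 4 c (f 0) (g 0) (h 0) (λ c f g h → (c :* f :+ g) :* h :+ 𝟘 , c :* (f :* h :+ 𝟘) :+ (g :* h :+ 𝟘))
  where open ℤR
conv-linˡ c f g h (suc n) = trans (cong (Z._+_ ((c Z.* f 0 Z.+ g 0) Z.* h (suc n))) (conv-linˡ c (tail f) (tail g) h n))
  (ring! 6 c (f 0) (g 0) (h (suc n)) (conv (tail f) h n) (conv (tail g) h n)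
    (λ c f g h x y → (c :* f :+ g) :* h :+ (c :* x :+ y) , c :* (f :* h :+ x) :+ (g :* h :+ y)))
  where open ℤR

conv-assoc : ∀ f g h → conv (conv f g) h ≋ conv f (conv g h)
conv-assoc f g h zero = ring! 3 (f 0) (g 0) (h 0) (λ f g h → (f :* g :+ 𝟘) :* h :+ 𝟘 , f :* (g :* h :+ 𝟘) :+ 𝟘)
  where open ℤR
conv-assoc f g h (suc n) = begin
  conv f g 0 Z.* h (suc n) Z.+ conv (tail (conv f g)) h n
    ≡⟨ cong (Z._+_ (conv f g 0 Z.* h (suc n))) (trans (conv-linˡ (f 0) (tail g) (conv (tail f) g) h n) (cong (Z._+_ (f 0 Z.* conv (tail g) h n)) (conv-assoc (tail f) g h n))) ⟩
  conv f g 0 Z.* h (suc n) Z.+ (f 0 Z.* conv (tail g) h n Z.+ conv (tail f) (conv g h) n)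
    ≡⟨ ring! 5 (f 0) (g 0) (h (suc n)) (conv (tail g) h n) (conv (tail f) (conv g h) n)
         (λ f g h x y → (f :* g :+ 𝟘) :* h :+ (f :* x :+ y) , f :* (g :* h :+ x) :+ y) ⟩
  conv f (conv g h) (suc n) ∎
  where open ≡-Reasoning
        open ℤR using (ring!)

conv-zeroˡ : ∀ g → conv 0S g ≋ 0S
conv-zeroˡ g zero = refl
conv-zeroˡ g (suc n) = trans (Z.+-identityˡ _) (conv-zeroˡ g n)

conv-oneˡ : ∀ g → conv oneS g ≋ g
conv-oneˡ g zero = trans (Z.+-identityʳ _) (Z.*-identityˡ (g 0))
conv-oneˡ g (suc n) = trans (cong₂ Z._+_ (Z.*-identityˡ (g (suc n))) (conv-zeroˡ g n)) (Z.+-identityʳ _)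

⊛-cong : ∀ {f f′ g g′} → f ≋ f′ → g ≋ g′ → f ⊛ g ≋ f′ ⊛ g′
⊛-cong {f} {f′} {g} {g′} p r n = trans (⊛≋conv f g n) (trans (conv-cong p r n) (sym (⊛≋conv f′ g′ n)))

⊛-comm : ∀ f g → f ⊛ g ≋ g ⊛ f
⊛-comm f g n = trans (⊛≋conv f g n) (trans (conv-comm f g n) (sym (⊛≋conv g f n)))

⊛-assoc : ∀ f g h → (f ⊛ g) ⊛ h ≋ f ⊛ (g ⊛ h)
⊛-assoc f g h n = begin
  ((f ⊛ g) ⊛ h) n ≡⟨ ⊛≋conv (f ⊛ g) h n ⟩
  conv (f ⊛ g) h n ≡⟨ conv-cong {g = h} (⊛≋conv f g) (λ _ → refl) n ⟩
  conv (conv f g) h n ≡⟨ conv-assoc f g h n ⟩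
  conv f (conv g h) n ≡⟨ conv-cong {f} (λ _ → refl) (λ k → sym (⊛≋conv g h k)) n ⟩
  conv f (g ⊛ h) n ≡⟨ sym (⊛≋conv f (g ⊛ h) n) ⟩
  (f ⊛ (g ⊛ h)) n ∎
  where open ≡-Reasoning

⊛-identityˡ : ∀ g → oneS ⊛ g ≋ g
⊛-identityˡ g n = trans (⊛≋conv oneS g n) (conv-oneˡ g n)

⊛-linˡ : ∀ c f g h → (c · f ⊞ g) ⊛ h ≋ c · (f ⊛ h) ⊞ g ⊛ h
⊛-linˡ c f g h n = trans (⊛≋conv (c · f ⊞ g) h n) (trans (conv-linˡ c f g h n)
  (sym (cong₂ Z._+_ (cong (Z._*_ c) (⊛≋conv f h n)) (⊛≋conv g h n))))

⊛-distribʳ : ∀ h f g → (f ⊞ g) ⊛ h ≋ f ⊛ h ⊞ g ⊛ h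
⊛-distribʳ h f g n = begin
  ((f ⊞ g) ⊛ h) n ≡⟨ ⊛-cong {f ⊞ g} {(+ 1) · f ⊞ g} {h} {h} (λ k → cong (Z._+ g k) (sym (Z.*-identityˡ (f k)))) (λ _ → refl) n ⟩
  (((+ 1) · f ⊞ g) ⊛ h) n ≡⟨ ⊛-linˡ (+ 1) f g h n ⟩
  + 1 Z.* (f ⊛ h) n Z.+ (g ⊛ h) n ≡⟨ cong (Z._+ (g ⊛ h) n) (Z.*-identityˡ ((f ⊛ h) n)) ⟩
  (f ⊛ h ⊞ g ⊛ h) n ∎
  where open ≡-Reasoning

⊛-zeroˡ : ∀ g → 0S ⊛ g ≋ 0S
⊛-zeroˡ g n = trans (⊛≋conv 0S g n) (conv-zeroˡ g n)

≋-refl : ∀ {f} → f ≋ f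
≋-refl _ = refl

infix 4 _≅_
record _≅_ (f g : Series) : Set where
  constructor pw
  field un : f ≋ g
open _≅_ public

𝕊 : CommutativeRing 0ℓ 0ℓ
𝕊 = record
  { Carrier = Series ; _≈_ = _≅_ ; _+_ = _⊞_ ; _*_ = _⊛_ ; -_ = ⊟_ ; 0# = 0S ; 1# = oneS
  ; isCommutativeRing = record
    { isRing = record
      { +-isAbelianGroup = record
        { isGroup = record
          { isMonoid = record
            { isSemigroup = record
              { isMagma = record { isEquivalence = record { refl = pw (λ _ → refl) ; sym = λ p → pw (λ n → sym (un p n)) ; trans = λ p r → pw (λ n → trans (un p n) (un r n)) }
                                 ; ∙-cong = λ p r → pw (λ n → cong₂ Z._+_ (un p n) (un r n)) }
              ; assoc = λ f g h → pw (λ n → Z.+-assoc (f n) (g n) (h n)) }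
            ; identity = (λ f → pw (λ n → Z.+-identityˡ (f n))) , (λ f → pw (λ n → Z.+-identityʳ (f n))) }
          ; inverse = (λ f → pw (λ n → Z.+-inverseˡ (f n))) , (λ f → pw (λ n → Z.+-inverseʳ (f n)))
          ; ⁻¹-cong = λ p → pw (λ n → cong Z.-_ (un p n)) }
        ; comm = λ f g → pw (λ n → Z.+-comm (f n) (g n)) }
      ; *-cong = λ {f} {f′} {g} {g′} p r → pw (⊛-cong {f} {f′} {g} {g′} (un p) (un r))
      ; *-assoc = λ f g h → pw (⊛-assoc f g h)
      ; *-identity = (λ f → pw (⊛-identityˡ f)) , (λ f → pw (λ n → trans (⊛-comm f oneS n) (⊛-identityˡ f n)))
      ; distrib = (λ h f g → pw (λ n → trans (⊛-comm h (f ⊞ g) n) (trans (⊛-distribʳ h f g n) (cong₂ Z._+_ (⊛-comm f h n) (⊛-comm g h n))))) , (λ h f g → pw (⊛-distribʳ h f g)) }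
    ; *-comm = λ f g → pw (⊛-comm f g) } }

module 𝕊R = Ring 𝕊

-- The ring of Laurent series

shiftS : ℕ → Series → Series
shiftS zero f n = f n
shiftS (suc k) f zero = + 0
shiftS (suc k) f (suc n) = shiftS k f n

conv-shift : ∀ k f g → conv (shiftS k f) g ≋ shiftS k (conv f g)
conv-shift zero f g n = refl
conv-shift (suc k) f g zero = refl
conv-shift (suc k) f g (suc n) = trans (Z.+-identityˡ _) (conv-shift k f g n)

shiftS-cong : ∀ k {f g} → f ≋ g → shiftS k f ≋ shiftS k g
shiftS-cong zero p n = p n
shiftS-cong (suc k) p zero = refl
shiftS-cong (suc k) p (suc n) = shiftS-cong k p n

⊛-shift : ∀ k f g → shiftS k f ⊛ g ≋ shiftS k (f ⊛ g)
⊛-shift k f g n = trans (⊛≋conv (shiftS k f) g n) (trans (conv-shift k f g n) (shiftS-cong k (λ m → sym (⊛≋conv f g m)) n))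

at : Series → ℤ → ℤ
at s (+ n) = s n
at s -[1+ _ ] = + 0

coeff≡at : ∀ f m → coeff f m ≡ at (ser f) (m Z.- val f)
coeff≡at f m with m Z.- val f
... | + n = refl
... | -[1+ n ] = refl

at-cong : ∀ {s s′} → s ≋ s′ → ∀ x → at s x ≡ at s′ x
at-cong p (+ n) = p n
at-cong p -[1+ _ ] = refl

at-shift : ∀ k s x → at (shiftS k s) x ≡ at s (x Z.- + k)
at-shift zero s x = trans (at-cong {shiftS zero s} {s} (λ _ → refl) x) (cong (at s) (sym (Z.+-identityʳ x)))
at-shift (suc k) s (+ zero) = refl
at-shift (suc k) s (+ (suc n)) = trans (at-shift k s (+ n)) (cong (at s) (trans (Z.m-n≡m⊖n n k) (sym (trans (Z.m-n≡m⊖n (suc n) (suc k)) (Z.[1+m]⊖[1+n]≡m⊖n n k)))))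
at-shift (suc k) s -[1+ n ] = refl

infixl 1 _⟫_
_⟫_ : ∀ {A : Set} {x y z : A} → x ≡ y → y ≡ z → x ≡ z
_⟫_ = trans

≈L-refl : ∀ {f} → f ≈ f
≈L-refl m = refl

≈L-trans : ∀ {f g h} → f ≈ g → g ≈ h → f ≈ h
≈L-trans p r m = trans (p m) (r m)

mkL-cong : ∀ {v v′ s s′} → v ≡ v′ → s ≋ s′ → mkL v s ≈ mkL v′ s′
mkL-cong {v} {_} {s} {s′} refl p m = coeff≡at (mkL v s) m ⟫ at-cong p (m Z.- v) ⟫ sym (coeff≡at (mkL v s′) m)

shift-≈ : ∀ v k s → mkL v (shiftS k s) ≈ mkL (v Z.+ + k) s
shift-≈ v k s m = begin
  coeff (mkL v (shiftS k s)) m ≡⟨ coeff≡at (mkL v (shiftS k s)) m ⟩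
  at (shiftS k s) (m Z.- v) ≡⟨ at-shift k s (m Z.- v) ⟩
  at s (m Z.- v Z.- + k) ≡⟨ cong (at s) (ℤR.ring! 3 m v (+ k) (λ m v k → m :- v :- k , m :- (v :+ k))) ⟩
  at s (m Z.- (v Z.+ + k)) ≡⟨ sym (coeff≡at (mkL (v Z.+ + k) s) m) ⟩
  coeff (mkL (v Z.+ + k) s) m ∎
  where open ≡-Reasoning

gap : ∀ {i j} → i Z.≤ j → ∃ λ k → j ≡ i Z.+ + k
gap {i} {j} i≤j = Z.∣ j Z.- i ∣ , (ℤR.ring! 2 i j (λ i j → j , i :+ (j :- i))
  ⟫ cong (Z._+_ i) (sym (Z.0≤i⇒+∣i∣≡i (Z.i≤j⇒0≤j-i i≤j))))

-- The stored `val` is only a lower bound for the exponents, so equal series may carry different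
-- data. At a common lower bound equality becomes equality of power series, and the product can be
-- seen to respect it.
record Rebased (f : Laurent) (v : ℤ) : Set where
  constructor rebased
  field
    s : Series
    eq : f ≈ mkL v s
    mul : ∀ g → f *L g ≈ mkL (v Z.+ val g) (s ⊛ ser g)

rebase : ∀ f {v} → v Z.≤ val f → Rebased f v
rebase f {v} v≤ = rebased s′ (λ m → mkL-cong {val f} {v Z.+ + k} {ser f} {ser f} eq (≋-refl {ser f}) m ⟫ sym (shift-≈ v k (ser f) m))
  (λ g m → mkL-cong {val f Z.+ val g} {v Z.+ val g Z.+ + k} {ser f ⊛ ser g} {ser f ⊛ ser g} (val-eq g) (≋-refl {ser f ⊛ ser g}) m
    ⟫ sym (shift-≈ (v Z.+ val g) k (ser f ⊛ ser g) m)
    ⟫ mkL-cong {v Z.+ val g} {v Z.+ val g} {shiftS k (ser f ⊛ ser g)} {s′ ⊛ ser g} refl (λ n → sym (⊛-shift k (ser f) (ser g) n)) m)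
  where
  k = proj₁ (gap v≤)
  eq = proj₂ (gap v≤)
  s′ = shiftS k (ser f)
  val-eq : ∀ g → val f Z.+ val g ≡ v Z.+ val g Z.+ + k
  val-eq g = cong (Z._+ val g) eq ⟫ ℤR.ring! 3 v (+ k) (val g) (λ v k g → v :+ k :+ g , v :+ g :+ k)

coeff-mkL : ∀ v s n → coeff (mkL v s) (v Z.+ + n) ≡ s n
coeff-mkL v s n = coeff≡at (mkL v s) (v Z.+ + n) ⟫ cong (at s) (ℤR.ring! 2 v (+ n) (λ v n → v :+ n :- v , n))

mkL-injective : ∀ {v s s′} → mkL v s ≈ mkL v s′ → s ≋ s′
mkL-injective {v} {s} {s′} p n = sym (coeff-mkL v s n) ⟫ p (v Z.+ + n) ⟫ coeff-mkL v s′ n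

data Position (v m : ℤ) : Set where
  above : ∀ n → m ≡ v Z.+ + n → Position v m
  below : ∀ n → m ≡ v Z.+ -[1+ n ] → Position v m

position : ∀ v m → Position v m
position v m with m Z.- v in eq
... | + n = above n (ℤR.ring! 2 v m (λ v m → m , v :+ (m :- v)) ⟫ cong (Z._+_ v) eq)
... | -[1+ n ] = below n (ℤR.ring! 2 v m (λ v m → m , v :+ (m :- v)) ⟫ cong (Z._+_ v) eq)

coeff-below : ∀ f {m} → m Z.< val f → coeff f m ≡ + 0
coeff-below f {m} m<v with position (val f) m
... | above n eq = ⊥-elim (Z.<⇒≱ m<v (Z.≤-trans (Z.≤-reflexive (sym (Z.+-identityʳ (val f)))) (Z.≤-trans (Z.+-monoʳ-≤ (val f) (Z.+≤+ N.z≤n)) (Z.≤-reflexive (sym eq)))))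
... | below n eq = coeff≡at f m ⟫ cong (at (ser f)) (cong (Z._- val f) eq ⟫ ℤR.ring! 2 (val f) (-[1+ n ]) (λ v n → v :+ n :- v , n))

below-val : ∀ v n → v Z.+ -[1+ n ] Z.< v
below-val v n = Z.<-≤-trans (Z.+-monoʳ-< v (Z.-<+ {n} {0})) (Z.≤-reflexive (Z.+-identityʳ v))

coeff-+ : ∀ f g m → coeff (f +L g) m ≡ coeff f m Z.+ coeff g m
coeff-+ f g m with position (val f Z.⊓ val g) m
... | above n refl = coeff-mkL (val f Z.⊓ val g) _ n
... | below n refl = coeff-below (f +L g) (below-val _ n)
  ⟫ sym (cong₂ Z._+_ (coeff-below f (Z.<-≤-trans (below-val _ n) (Z.i⊓j≤i (val f) (val g))))
                     (coeff-below g (Z.<-≤-trans (below-val _ n) (Z.i⊓j≤j (val f) (val g)))))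

*L-comm : ∀ f g → f *L g ≈ g *L f
*L-comm f g = mkL-cong (Z.+-comm (val f) (val g)) (⊛-comm (ser f) (ser g))

*L-congʳ : ∀ f f′ g → f ≈ f′ → f *L g ≈ f′ *L g
*L-congʳ f f′ g p = go (rebase f (Z.i⊓j≤i (val f) (val f′))) (rebase f′ (Z.i⊓j≤j (val f) (val f′)))
  where
  v = val f Z.⊓ val f′
  w = v Z.+ val g
  go : Rebased f v → Rebased f′ v → f *L g ≈ f′ *L g
  go (rebased s f≈ fg) (rebased s′ f′≈ f′g) =
    λ m → fg g m ⟫ mkL-cong {w} {w} {s ⊛ ser g} {s′ ⊛ ser g} refl (⊛-cong {s} {s′} {ser g} {ser g} s≋s′ (≋-refl {ser g})) m ⟫ sym (f′g g m)
    where
    s≋s′ : s ≋ s′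
    s≋s′ = mkL-injective {v} {s} {s′} (λ m → sym (f≈ m) ⟫ p m ⟫ f′≈ m)

*L-cong : ∀ {f f′ g g′} → f ≈ f′ → g ≈ g′ → f *L g ≈ f′ *L g′
*L-cong {f} {f′} {g} {g′} p r = λ m → *L-congʳ f f′ g p m ⟫ *L-comm f′ g m ⟫ *L-congʳ g g′ f′ r m ⟫ *L-comm g′ f′ m

coeff-⊞ : ∀ v s s′ m → coeff (mkL v (s ⊞ s′)) m ≡ coeff (mkL v s) m Z.+ coeff (mkL v s′) m
coeff-⊞ v s s′ m = coeff≡at (mkL v (s ⊞ s′)) m ⟫ at-⊞ (m Z.- v) ⟫ sym (cong₂ Z._+_ (coeff≡at (mkL v s) m) (coeff≡at (mkL v s′) m))
  where
  at-⊞ : ∀ x → at (s ⊞ s′) x ≡ at s x Z.+ at s′ x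
  at-⊞ (+ n) = refl
  at-⊞ -[1+ n ] = refl

*L-distribʳ : ∀ h f g → (f +L g) *L h ≈ f *L h +L g *L h
*L-distribʳ h f g = go (rebase f (Z.i⊓j≤i (val f) (val g))) (rebase g (Z.i⊓j≤j (val f) (val g)))
  where
  v = val f Z.⊓ val g
  w = v Z.+ val h
  go : Rebased f v → Rebased g v → (f +L g) *L h ≈ f *L h +L g *L h
  go (rebased s f≈ fh) (rebased s′ g≈ gh) = λ m → *L-congʳ (f +L g) (mkL v (s ⊞ s′)) h sum≈ m
    ⟫ mkL-cong {w} {w} {(s ⊞ s′) ⊛ ser h} {s ⊛ ser h ⊞ s′ ⊛ ser h} refl (⊛-distribʳ (ser h) s s′) m ⟫ coeff-⊞ w (s ⊛ ser h) (s′ ⊛ ser h) m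
    ⟫ sym (coeff-+ (f *L h) (g *L h) m ⟫ cong₂ Z._+_ (fh h m) (gh h m))
    where
    sum≈ : f +L g ≈ mkL v (s ⊞ s′)
    sum≈ m = coeff-+ f g m ⟫ cong₂ Z._+_ (f≈ m) (g≈ m) ⟫ sym (coeff-⊞ v s s′ m)

negL : Laurent → Laurent
negL f = mkL (val f) (⊟ ser f)

coeff-neg : ∀ f m → coeff (negL f) m ≡ Z.- coeff f m
coeff-neg f m = coeff≡at (negL f) m ⟫ at-⊟ (m Z.- val f) ⟫ cong Z.-_ (sym (coeff≡at f m))
  where
  at-⊟ : ∀ x → at (⊟ ser f) x ≡ Z.- at (ser f) x
  at-⊟ (+ n) = refl
  at-⊟ -[1+ n ] = refl

coeff-zero : ∀ m → coeff zeroL m ≡ + 0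
coeff-zero m = coeff≡at zeroL m ⟫ at-0 (m Z.- + 0)
  where
  at-0 : ∀ x → at (λ _ → + 0) x ≡ + 0
  at-0 (+ n) = refl
  at-0 -[1+ n ] = refl

*L-assoc : ∀ f g h → (f *L g) *L h ≈ f *L (g *L h)
*L-assoc f g h = mkL-cong (Z.+-assoc (val f) (val g) (val h)) (⊛-assoc (ser f) (ser g) (ser h))

*L-identityˡ : ∀ f → oneL *L f ≈ f
*L-identityˡ f = mkL-cong (Z.+-identityˡ (val f)) (⊛-identityˡ (ser f))

infix 4 _≃_
record _≃_ (f g : Laurent) : Set where
  constructor co
  field at-coeff : f ≈ g
open _≃_ public

infixl 6 _⊕_
infixl 7 _⊗_
opaque
  -- Opaque copies of the operations, so that later equations are handled by the ring laws and do
  -- not unfold into coefficient functions.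
  _⊕_ _⊗_ : Laurent → Laurent → Laurent
  _⊕_ = _+L_
  _⊗_ = _*L_

  ⊝_ : Laurent → Laurent
  ⊝_ = negL

  0ℒ 1ℒ : Laurent
  0ℒ = zeroL
  1ℒ = oneL

  isCommutativeRing : IsCommutativeRing _≃_ _⊕_ _⊗_ ⊝_ 0ℒ 1ℒ
  isCommutativeRing = record
    { isRing = record
      { +-isAbelianGroup = record
        { isGroup = record
          { isMonoid = record
            { isSemigroup = record
              { isMagma = record { isEquivalence = record { refl = co (λ _ → refl) ; sym = λ p → co (λ m → sym (at-coeff p m)) ; trans = λ p r → co (λ m → trans (at-coeff p m) (at-coeff r m)) }
                                 ; ∙-cong = λ {f} {f′} {g} {g′} p r → co (λ m → coeff-+ f g m ⟫ cong₂ Z._+_ (at-coeff p m) (at-coeff r m) ⟫ sym (coeff-+ f′ g′ m)) }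
              ; assoc = λ f g h → co (λ m → coeff-+ (f +L g) h m ⟫ cong (Z._+ coeff h m) (coeff-+ f g m) ⟫ Z.+-assoc (coeff f m) (coeff g m) (coeff h m)
                                  ⟫ sym (coeff-+ f (g +L h) m ⟫ cong (Z._+_ (coeff f m)) (coeff-+ g h m))) }
            ; identity = (λ f → co (λ m → coeff-+ zeroL f m ⟫ cong (Z._+ coeff f m) (coeff-zero m) ⟫ Z.+-identityˡ (coeff f m)))
                       , (λ f → co (λ m → coeff-+ f zeroL m ⟫ cong (Z._+_ (coeff f m)) (coeff-zero m) ⟫ Z.+-identityʳ (coeff f m))) }
          ; inverse = (λ f → co (λ m → coeff-+ (negL f) f m ⟫ cong (Z._+ coeff f m) (coeff-neg f m) ⟫ Z.+-inverseˡ (coeff f m) ⟫ sym (coeff-zero m)))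
                    , (λ f → co (λ m → coeff-+ f (negL f) m ⟫ cong (Z._+_ (coeff f m)) (coeff-neg f m) ⟫ Z.+-inverseʳ (coeff f m) ⟫ sym (coeff-zero m)))
          ; ⁻¹-cong = λ {f} {g} p → co (λ m → coeff-neg f m ⟫ cong Z.-_ (at-coeff p m) ⟫ sym (coeff-neg g m)) }
        ; comm = λ f g → co (λ m → coeff-+ f g m ⟫ Z.+-comm (coeff f m) (coeff g m) ⟫ sym (coeff-+ g f m)) }
      ; *-cong = λ {f} {f′} {g} {g′} p r → co (*L-cong {f} {f′} {g} {g′} (at-coeff p) (at-coeff r))
      ; *-assoc = λ f g h → co (*L-assoc f g h)
      ; *-identity = (λ f → co (*L-identityˡ f)) , (λ f → co (λ m → *L-comm f oneL m ⟫ *L-identityˡ f m))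
      ; distrib = (λ h f g → co (λ m → *L-comm h (f +L g) m ⟫ *L-distribʳ h f g m ⟫ coeff-+ (f *L h) (g *L h) m
                     ⟫ cong₂ Z._+_ (*L-comm f h m) (*L-comm g h m) ⟫ sym (coeff-+ (h *L f) (h *L g) m))) , (λ h f g → co (*L-distribʳ h f g)) }
    ; *-comm = λ f g → co (*L-comm f g) }

𝕃 : CommutativeRing 0ℓ 0ℓ
𝕃 = record { isCommutativeRing = isCommutativeRing }

module 𝕃R = Ring 𝕃

-- Substitution q ↦ qᵏ

Vs : (k : ℕ) .{{_ : N.NonZero k}} → Series → Series
Vs k f n = if n ℕ÷.% k N.≡ᵇ 0 then f (n ℕ÷./ k) else + 0

Vs-mul : ∀ k .{{_ : N.NonZero k}} f n → Vs k f (n N.* k) ≡ f n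
Vs-mul k f n = cong₂ (λ x y → if x N.≡ᵇ 0 then f y else + 0) (ℕ÷.m*n%n≡0 n k) (ℕ÷.m*n/n≡m n k)

Vs-rem : ∀ k .{{_ : N.NonZero k}} f r n → suc r N.< k → Vs k f (suc r N.+ n N.* k) ≡ + 0
Vs-rem k f r n r<k = cong (λ x → if x N.≡ᵇ 0 then f ((suc r N.+ n N.* k) ℕ÷./ k) else + 0) (ℕ÷.[m+kn]%n≡m%n (suc r) n k ⟫ ℕ÷.m<n⇒m%n≡m r<k)

shiftS-+ : ∀ k h m → shiftS k h (k N.+ m) ≡ h m
shiftS-+ zero h m = refl
shiftS-+ (suc k) h m = shiftS-+ k h m

shiftS-< : ∀ k h m → m N.< k → shiftS k h m ≡ + 0
shiftS-< (suc k) h zero _ = refl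
shiftS-< (suc k) h (suc m) (N.s≤s m<k) = shiftS-< k h m m<k

data Digits (k : ℕ) : ℕ → Set where
  digits : ∀ r n → r N.< k → Digits k (r N.+ n N.* k)

toDigits : ∀ k .{{_ : N.NonZero k}} m → Digits k m
toDigits k m = subst (Digits k) (sym (ℕ÷.m≡m%n+[m/n]*n m k)) (digits (m ℕ÷.% k) (m ℕ÷./ k) (ℕ÷.m%n<n m k))

Vs-head : ∀ k .{{_ : N.NonZero k}} f → Vs k f ≋ f 0 · oneS ⊞ shiftS k (Vs k (tail f))
Vs-head k f m with toDigits k m
Vs-head k f .(0 N.+ 0 N.* k) | digits zero zero r<k =
  Vs-mul k f 0 ⟫ sym (cong₂ Z._+_ (Z.*-identityʳ (f 0)) (shiftS-< k _ 0 r<k) ⟫ Z.+-identityʳ (f 0))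
Vs-head k f .(suc r N.+ 0 N.* k) | digits (suc r) zero r<k =
  Vs-rem k f r 0 r<k ⟫ sym (cong₂ Z._+_ (Z.*-zeroʳ (f 0)) (shiftS-< k _ _ (subst (N._< k) (sym (N.+-identityʳ (suc r))) r<k)))
Vs-head k f .(zero N.+ suc n N.* k) | digits zero (suc n) r<k =
  Vs-mul k f (suc n) ⟫ sym (cong₂ Z._+_ (cong (Z._*_ (f 0)) (one-pos k (n N.* k) r<k) ⟫ Z.*-zeroʳ (f 0)) (shiftS-+ k _ (n N.* k) ⟫ Vs-mul k (tail f) n) ⟫ Z.+-identityˡ _)
  where
  one-pos : ∀ k m → 0 N.< k → oneS (k N.+ m) ≡ + 0
  one-pos (suc k) m _ = refl
Vs-head k f .(suc r N.+ suc n N.* k) | digits (suc r) (suc n) r<k =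
  Vs-rem k f r (suc n) r<k ⟫ sym (cong₂ Z._+_ (Z.*-zeroʳ (f 0)) (cong (shiftS k _) (ring-ℕ (suc r) k (n N.* k)) ⟫ shiftS-+ k _ (suc r N.+ n N.* k) ⟫ Vs-rem k (tail f) r n r<k))
  where
  ring-ℕ : ∀ r k m → r N.+ (k N.+ m) ≡ k N.+ (r N.+ m)
  ring-ℕ r k m = sym (N.+-assoc r k m) ⟫ cong (N._+ m) (N.+-comm r k) ⟫ N.+-assoc k r m

section : ℕ → ℕ → Series → Series
section k r g i = g (r N.+ i N.* k)

-- Multiplication by f(qᵏ) preserves classes of exponents modulo k, and on each class it is ordinary
-- multiplication by f. The induction splits off the constant term of f by `Vs-head`.
conv-Vs : ∀ k .{{_ : N.NonZero k}} f g r n → r N.< k → conv (Vs k f) g (r N.+ n N.* k) ≡ conv f (section k r g) n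
conv-Vs k f g r n r<k = unfold (r N.+ n N.* k) ⟫ go n
  where
  unfold : ∀ m → conv (Vs k f) g m ≡ f 0 Z.* g m Z.+ shiftS k (conv (Vs k (tail f)) g) m
  unfold m = conv-cong {g = g} (Vs-head k f) ≋-refl m ⟫ conv-linˡ (f 0) oneS (shiftS k (Vs k (tail f))) g m ⟫ cong₂ Z._+_ (cong (Z._*_ (f 0)) (conv-oneˡ g m)) (conv-shift k (Vs k (tail f)) g m)
  go : ∀ n → f 0 Z.* g (r N.+ n N.* k) Z.+ shiftS k (conv (Vs k (tail f)) g) (r N.+ n N.* k) ≡ conv f (section k r g) n
  go zero = cong (Z._+_ (f 0 Z.* g (r N.+ 0))) (shiftS-< k _ _ (subst (N._< k) (sym (N.+-identityʳ r)) r<k))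
  go (suc n) = cong (Z._+_ (f 0 Z.* g (r N.+ (k N.+ n N.* k))))
    (cong (shiftS k _) (ring-ℕ r k (n N.* k)) ⟫ shiftS-+ k _ (r N.+ n N.* k) ⟫ conv-Vs k (tail f) g r n r<k)
    where
    ring-ℕ : ∀ r k m → r N.+ (k N.+ m) ≡ k N.+ (r N.+ m)
    ring-ℕ r k m = sym (N.+-assoc r k m) ⟫ cong (N._+ m) (N.+-comm r k) ⟫ N.+-assoc k r m

⊛-Vs : ∀ k .{{_ : N.NonZero k}} f g r n → r N.< k → (Vs k f ⊛ g) (r N.+ n N.* k) ≡ (f ⊛ section k r g) n
⊛-Vs k f g r n r<k = ⊛≋conv (Vs k f) g _ ⟫ conv-Vs k f g r n r<k ⟫ sym (⊛≋conv f (section k r g) n)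

Vs-⊛ : ∀ k .{{_ : N.NonZero k}} f g → Vs k (f ⊛ g) ≋ Vs k f ⊛ Vs k g
Vs-⊛ k f g m with toDigits k m
... | digits zero n r<k = Vs-mul k (f ⊛ g) n ⟫ sym (⊛-Vs k f (Vs k g) 0 n r<k ⟫ ⊛-cong {f} ≋-refl (Vs-mul k g) n)
... | digits (suc r) n r<k = Vs-rem k (f ⊛ g) r n r<k ⟫ sym (⊛-Vs k f (Vs k g) (suc r) n r<k
        ⟫ ⊛-cong {f} ≋-refl (λ i → Vs-rem k g r i r<k) n ⟫ ⊛-comm f 0S n ⟫ ⊛-zeroˡ f n)

Vr : (k : ℕ) .{{_ : N.NonZero k}} → Laurent → Laurent
Vr k f = mkL (+ k Z.* val f) (Vs k (ser f))

δ₀ : ℕ → ℤ → ℤ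
δ₀ zero c = c
δ₀ (suc _) c = + 0

at-Vs : ∀ k .{{_ : N.NonZero k}} s r y → r N.< k → at (Vs k s) (+ r Z.+ + k Z.* y) ≡ δ₀ r (at s y)
at-Vs k s r (+ n) r<k = cong (at (Vs k s)) (cong (Z._+_ (+ r)) (sym (Z.pos-* k n) ⟫ cong +_ (N.*-comm k n))) ⟫ go r r<k
  where
  go : ∀ r → r N.< k → Vs k s (r N.+ n N.* k) ≡ δ₀ r (s n)
  go zero _ = Vs-mul k s n
  go (suc r) r<k = Vs-rem k s r n r<k
at-Vs (suc k) s r -[1+ n ] r<k = cong (at (Vs (suc k) s)) neg ⟫ δ0 r
  where
  neg : + r Z.+ + suc k Z.* -[1+ n ] ≡ -[1+ (n N.+ k N.* suc n) N.∸ r ]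
  neg = Z.⊖-< (N.<-≤-trans r<k (N.s≤s (N.≤-trans (N.m≤m*n k (suc n)) (N.m≤n+m _ n))))
     ⟫ cong (λ x → Z.- + x) (N.+-∸-assoc 1 (N.≤-trans (N.≤-pred r<k) (N.≤-trans (N.m≤m*n k (suc n)) (N.m≤n+m _ n))))
  δ0 : ∀ r → + 0 ≡ δ₀ r +0
  δ0 zero = refl
  δ0 (suc r) = refl

coeff-Vr : ∀ k .{{_ : N.NonZero k}} f r x → r N.< k → coeff (Vr k f) (+ r Z.+ + k Z.* x) ≡ δ₀ r (coeff f x)
coeff-Vr k f r x r<k = coeff≡at (Vr k f) (+ r Z.+ + k Z.* x)
  ⟫ cong (at (Vs k (ser f))) (ℤR.ring! 4 (+ r) (+ k) x (val f) (λ r k x v → r :+ k :* x :- k :* v , r :+ k :* (x :- v)))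
  ⟫ at-Vs k (ser f) r (x Z.- val f) r<k ⟫ cong (δ₀ r) (sym (coeff≡at f x))

data Digitsℤ (k : ℕ) : ℤ → Set where
  digitsℤ : ∀ r x → r N.< k → Digitsℤ k (+ r Z.+ + k Z.* x)

toDigitsℤ : ∀ k .{{_ : N.NonZero k}} m → Digitsℤ k m
toDigitsℤ (suc k) m = subst (Digitsℤ (suc k)) (cong (Z._+_ (+ (m ℤ÷.%ℕ suc k))) (Z.*-comm (+ suc k) (m ℤ÷./ℕ suc k)) ⟫ sym (ℤ÷.a≡a%ℕn+[a/ℕn]*n m (suc k)))
  (digitsℤ (m ℤ÷.%ℕ suc k) (m ℤ÷./ℕ suc k) (ℤ÷.n%ℕd<d m (suc k)))

Vr-cong : ∀ k .{{_ : N.NonZero k}} {f g} → f ≈ g → Vr k f ≈ Vr k g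
Vr-cong k {f} {g} p m with toDigitsℤ k m
... | digitsℤ r x r<k = coeff-Vr k f r x r<k ⟫ cong (δ₀ r) (p x) ⟫ sym (coeff-Vr k g r x r<k)

Vr-+ : ∀ k .{{_ : N.NonZero k}} f g → Vr k (f +L g) ≈ Vr k f +L Vr k g
Vr-+ k f g m with toDigitsℤ k m
... | digitsℤ r x r<k = coeff-Vr k (f +L g) r x r<k ⟫ cong (δ₀ r) (coeff-+ f g x) ⟫ δ₀-+ r
  ⟫ sym (coeff-+ (Vr k f) (Vr k g) (+ r Z.+ + k Z.* x) ⟫ cong₂ Z._+_ (coeff-Vr k f r x r<k) (coeff-Vr k g r x r<k))
  where
  δ₀-+ : ∀ r {c d} → δ₀ r (c Z.+ d) ≡ δ₀ r c Z.+ δ₀ r d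
  δ₀-+ zero = refl
  δ₀-+ (suc _) = refl

Vr-neg : ∀ k .{{_ : N.NonZero k}} f → Vr k (negL f) ≈ negL (Vr k f)
Vr-neg k f m with toDigitsℤ k m
... | digitsℤ r x r<k = coeff-Vr k (negL f) r x r<k ⟫ cong (δ₀ r) (coeff-neg f x) ⟫ δ₀-neg r
  ⟫ sym (coeff-neg (Vr k f) (+ r Z.+ + k Z.* x) ⟫ cong Z.-_ (coeff-Vr k f r x r<k))
  where
  δ₀-neg : ∀ r {c} → δ₀ r (Z.- c) ≡ Z.- δ₀ r c
  δ₀-neg zero = refl
  δ₀-neg (suc _) = refl

Vr-* : ∀ k .{{_ : N.NonZero k}} f g → Vr k (f *L g) ≈ Vr k f *L Vr k g
Vr-* k f g = mkL-cong (Z.*-distribˡ-+ (+ k) (val f) (val g)) (Vs-⊛ k (ser f) (ser g))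

qr : ℤ → Laurent
qr m = mkL m oneS

qr-* : ∀ m n → qr m *L qr n ≈ qr (m Z.+ n)
qr-* m n = mkL-cong {m Z.+ n} refl (⊛-identityˡ oneS)

Vs-one : ∀ k .{{_ : N.NonZero k}} → Vs k oneS ≋ oneS
Vs-one k m with toDigits k m
Vs-one k .(0 N.+ 0 N.* k) | digits zero zero r<k = Vs-mul k oneS 0
Vs-one k .(0 N.+ suc n N.* k) | digits zero (suc n) r<k = Vs-mul k oneS (suc n) ⟫ one-pos k (n N.* k) r<k
  where
  one-pos : ∀ k m → 0 N.< k → + 0 ≡ oneS (k N.+ m)
  one-pos (suc k) m _ = refl
Vs-one k .(suc r N.+ n N.* k) | digits (suc r) n r<k = Vs-rem k oneS r n r<k

Vr-q : ∀ k .{{_ : N.NonZero k}} m → Vr k (qr m) ≈ qr (+ k Z.* m)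
Vr-q k m = mkL-cong {+ k Z.* m} refl (Vs-one k)

Vr-one : ∀ k .{{_ : N.NonZero k}} → Vr k oneL ≈ oneL
Vr-one k = ≈L-trans {Vr k oneL} {qr (+ k Z.* + 0)} {oneL} (Vr-q k +0) (mkL-cong {s = oneS} (Z.*-zeroʳ (+ k)) ≋-refl)

-- The operator U₇

-- Below the chosen bound -|val f| nothing is lost, because 7m < val f for every such m.
coeff-U7 : ∀ f m → coeff (U7 f) m ≡ coeff f (+ 7 Z.* m)
coeff-U7 f m with position (Z.- (+ Z.∣ val f ∣)) m
... | above n refl = coeff-mkL (Z.- (+ Z.∣ val f ∣)) _ n
... | below n refl = coeff-below (U7 f) (below-val _ n) ⟫ sym (coeff-below f (bound (val f)))
  where
  bound : ∀ v → + 7 Z.* (Z.- (+ Z.∣ v ∣) Z.+ -[1+ n ]) Z.< v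
  bound v = Z.≤-<-trans (Z.≤-reflexive (Z.*-comm (+ 7) x)) (Z.≤-<-trans (neg-mul x (Z.<⇒≤ x<0)) (Z.<-≤-trans (below-val _ n) (-∣∣ v)))
    where
    x = Z.- (+ Z.∣ v ∣) Z.+ -[1+ n ]
    -∣∣ : ∀ v → Z.- (+ Z.∣ v ∣) Z.≤ v
    -∣∣ (+ zero) = Z.≤-refl
    -∣∣ (+ suc n) = Z.-≤+
    -∣∣ -[1+ n ] = Z.≤-refl
    x<0 : x Z.< + 0
    x<0 = Z.<-≤-trans (below-val _ n) (Z.neg-mono-≤ (Z.+≤+ {0} {Z.∣ v ∣} N.z≤n))
    neg-mul : ∀ x → x Z.≤ + 0 → x Z.* + 7 Z.≤ x
    neg-mul (+ zero) _ = Z.≤-refl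
    neg-mul (+ suc n) (Z.+≤+ ())
    neg-mul -[1+ n ] _ = Z.-≤- (N.≤-trans (N.m≤m*n n 7) (N.m≤n+m (n N.* 7) 6))

U7-cong : ∀ {f g} → f ≈ g → U7 f ≈ U7 g
U7-cong {f} {g} p m = coeff-U7 f m ⟫ p (+ 7 Z.* m) ⟫ sym (coeff-U7 g m)

U7-+ : ∀ f g → U7 (f +L g) ≈ U7 f +L U7 g
U7-+ f g m = coeff-U7 (f +L g) m ⟫ coeff-+ f g (+ 7 Z.* m) ⟫ sym (coeff-+ (U7 f) (U7 g) m ⟫ cong₂ Z._+_ (coeff-U7 f m) (coeff-U7 g m))

at-7 : ∀ s x → at s (+ 7 Z.* x) ≡ at (section 7 0 s) x
at-7 s (+ n) = cong (at s) (sym (Z.pos-* 7 n)) ⟫ cong s (N.*-comm 7 n)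
at-7 s -[1+ n ] = refl

U7-rebased : ∀ g v s → g ≈ mkL (+ 7 Z.* v) s → U7 g ≈ mkL v (section 7 0 s)
U7-rebased g v s p m = coeff-U7 g m ⟫ p (+ 7 Z.* m) ⟫ coeff≡at (mkL (+ 7 Z.* v) s) (+ 7 Z.* m)
  ⟫ cong (at s) (ℤR.ring! 3 m v (+ 7) (λ m v k → k :* m :- k :* v , k :* (m :- v)))
  ⟫ at-7 s (m Z.- v) ⟫ sym (coeff≡at (mkL v (section 7 0 s)) m)

multiple-below : ∀ w → ∃ λ v → + 7 Z.* v Z.≤ w
multiple-below (+ n) = + 0 , Z.+≤+ N.z≤n
multiple-below -[1+ n ] = -[1+ n ] , Z.-≤- (N.m≤m+n n _)

-- After g is rebased to a lower bound divisible by 7, `U7` is the section of its series at class 0,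
-- and the claim is the case r = 0 of `⊛-Vs`.
U7-V : ∀ f g → U7 (Vr 7 f *L g) ≈ f *L U7 g
U7-V f g = go (proj₁ (multiple-below (val g))) (rebase g (proj₂ (multiple-below (val g))))
  where
  go : ∀ v → Rebased g (+ 7 Z.* v) → U7 (Vr 7 f *L g) ≈ f *L U7 g
  go v (rebased s g≈ _) = λ m →
    U7-rebased (Vr 7 f *L g) (val f Z.+ v) (Vs 7 (ser f) ⊛ s) Vg≈ m
    ⟫ mkL-cong {val f Z.+ v} {val f Z.+ v} {section 7 0 (Vs 7 (ser f) ⊛ s)} {ser f ⊛ section 7 0 s} refl (λ n → ⊛-Vs 7 (ser f) s 0 n (N.s≤s N.z≤n)) m
    ⟫ sym (*L-cong {f} {f} {U7 g} {mkL v (section 7 0 s)} (≈L-refl {f}) (U7-rebased g v s g≈) m)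
    where
    Vg≈ : Vr 7 f *L g ≈ mkL (+ 7 Z.* (val f Z.+ v)) (Vs 7 (ser f) ⊛ s)
    Vg≈ m = *L-cong {Vr 7 f} {Vr 7 f} {g} {mkL (+ 7 Z.* v) s} (≈L-refl {Vr 7 f}) g≈ m
      ⟫ mkL-cong {+ 7 Z.* val f Z.+ + 7 Z.* v} {+ 7 Z.* (val f Z.+ v)} {Vs 7 (ser f) ⊛ s} {Vs 7 (ser f) ⊛ s} (sym (Z.*-distribˡ-+ (+ 7) (val f) v)) ≋-refl m

U7-one : U7 oneL ≈ oneL
U7-one = ≈L-trans {U7 oneL} {mkL +0 (section 7 0 oneS)} (U7-rebased oneL +0 oneS (≈L-refl {oneL})) (mkL-cong {+ 0} refl λ { zero → refl ; (suc n) → refl })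

U7-q : ∀ r x → suc r N.< 7 → U7 (qr (+ suc r Z.+ + 7 Z.* x)) ≈ zeroL
U7-q r x r<7 m = coeff-U7 (qr _) m ⟫ coeff≡at (qr (+ suc r Z.+ + 7 Z.* x)) (+ 7 Z.* m) ⟫ go ⟫ sym (coeff-zero m)
  where
  open import Data.Nat.Divisibility using (_∣_; divides; >⇒∤)
  go : at oneS (+ 7 Z.* m Z.- (+ suc r Z.+ + 7 Z.* x)) ≡ + 0
  go with + 7 Z.* m Z.- (+ suc r Z.+ + 7 Z.* x) in eq
  ... | -[1+ _ ] = refl
  ... | + suc _ = refl
  ... | + zero = ⊥-elim (absurd (m Z.- x) (ℤR.sub≈0⇒≈ (regroup (+ 7 Z.* m) (+ 7 Z.* x) (+ suc r) (Z.*-distribˡ-+ (+ 7) m (Z.- x) ⟫ cong (Z._+_ (+ 7 Z.* m)) (sym (Z.neg-distribʳ-* (+ 7) x))) ⟫ eq)))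
    where
    regroup : ∀ a b c {d} → d ≡ a Z.- b → d Z.- c ≡ a Z.- (c Z.+ b)
    regroup a b c refl = ℤR.ring! 3 a b c (λ a b c → a :- b :- c , a :- (c :+ b))
    absurd : ∀ y → + 7 Z.* y ≡ + suc r → ⊥
    absurd (+ n) e = >⇒∤ r<7 (divides n (sym (Z.+-injective (Z.pos-* 7 n ⟫ e)) ⟫ N.*-comm 7 n))
    absurd -[1+ n ] ()

Vs-Vs : ∀ k l .{{_ : N.NonZero k}} .{{_ : N.NonZero l}} .{{_ : N.NonZero (l N.* k)}} f → Vs k (Vs l f) ≋ Vs (l N.* k) f
Vs-Vs k l f m = go₁ (toDigits k m)
  where
  go₁ : ∀ {m} → Digits k m → Vs k (Vs l f) m ≡ Vs (l N.* k) f m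
  go₁ (digits r n r<k) = go₂ (toDigits l n)
    where
    regroup : ∀ r′ n′ → (r N.+ r′ N.* k) N.+ n′ N.* (l N.* k) ≡ r N.+ (r′ N.+ n′ N.* l) N.* k
    regroup r′ n′ = N.+-assoc r (r′ N.* k) _ ⟫ cong (r N.+_) (cong (r′ N.* k N.+_) (sym (N.*-assoc n′ l k)) ⟫ sym (N.*-distribʳ-+ k r′ (n′ N.* l)))
    go₂ : ∀ {n} → Digits l n → Vs k (Vs l f) (r N.+ n N.* k) ≡ Vs (l N.* k) f (r N.+ n N.* k)
    go₂ (digits r′ n′ r′<l) = left r r<k r′ r′<l ⟫ split k r<k r r′ ⟫ sym (right (r N.+ r′ N.* k) bound) ⟫ cong (Vs (l N.* k) f) (regroup r′ n′)
      where
      bound : r N.+ r′ N.* k N.< l N.* k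
      bound = N.<-≤-trans (N.+-monoˡ-< (r′ N.* k) r<k) (N.*-monoˡ-≤ k r′<l)
      left : ∀ r → r N.< k → ∀ r′ → r′ N.< l → Vs k (Vs l f) (r N.+ (r′ N.+ n′ N.* l) N.* k) ≡ δ₀ r (δ₀ r′ (f n′))
      left zero _ zero _ = Vs-mul k (Vs l f) (n′ N.* l) ⟫ Vs-mul l f n′
      left zero _ (suc r′) <l = Vs-mul k (Vs l f) (suc r′ N.+ n′ N.* l) ⟫ Vs-rem l f r′ n′ <l
      left (suc r) <k r′ _ = Vs-rem k (Vs l f) r (r′ N.+ n′ N.* l) <k
      right : ∀ x → x N.< l N.* k → Vs (l N.* k) f (x N.+ n′ N.* (l N.* k)) ≡ δ₀ x (f n′)
      right zero _ = Vs-mul (l N.* k) f n′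
      right (suc x) p = Vs-rem (l N.* k) f x n′ p
      split : ∀ k {r₀} → r₀ N.< k → ∀ r r′ → δ₀ r (δ₀ r′ (f n′)) ≡ δ₀ (r N.+ r′ N.* k) (f n′)
      split k _ zero zero = refl
      split (suc k) _ zero (suc r′) = refl
      split k _ (suc r) r′ = refl

-- The derivation q d/dq, and leading terms

θr : Laurent → Laurent
θr f = mkL (val f) (λ n → (val f Z.+ + n) Z.* ser f n)

coeff-θr : ∀ f m → coeff (θr f) m ≡ m Z.* coeff f m
coeff-θr f m = go (position (val f) m)
  where
  go : Position (val f) m → coeff (θr f) m ≡ m Z.* coeff f m
  go (above n refl) = coeff-mkL (val f) (ser (θr f)) n ⟫ cong (Z._*_ (val f Z.+ + n)) (sym (coeff-mkL (val f) (ser f) n))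
  go (below n refl) = coeff-below (θr f) (below-val (val f) n) ⟫ sym (cong (Z._*_ m) (coeff-below f (below-val (val f) n)) ⟫ Z.*-zeroʳ m)

twist : ℤ → Series → Series
twist v s n = (v Z.+ + n) Z.* s n

conv-twist : ∀ v w f g n → conv (twist v f) g n Z.+ conv f (twist w g) n ≡ (v Z.+ w Z.+ + n) Z.* conv f g n
conv-twist v w f g zero = ℤR.ring! 4 v w (f 0) (g 0) (λ v w f g →
  ((v :+ 𝟘) :* f) :* g :+ 𝟘 :+ (f :* ((w :+ 𝟘) :* g) :+ 𝟘) , (v :+ w :+ 𝟘) :* (f :* g :+ 𝟘))
conv-twist v w f g (suc n) = begin
  twist v f 0 Z.* g (suc n) Z.+ conv (tail (twist v f)) g n Z.+ (f 0 Z.* twist w g (suc n) Z.+ conv (tail f) (twist w g) n)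
    ≡⟨ cong (λ x → twist v f 0 Z.* g (suc n) Z.+ x Z.+ (f 0 Z.* twist w g (suc n) Z.+ conv (tail f) (twist w g) n))
         (conv-cong {tail (twist v f)} {twist (v Z.+ + 1) (tail f)} {g} {g} (λ k → cong (Z._* f (suc k)) (sym (Z.+-assoc v (+ 1) (+ k)))) ≋-refl n) ⟩
  twist v f 0 Z.* g (suc n) Z.+ X Z.+ (f 0 Z.* twist w g (suc n) Z.+ Y)
    ≡⟨ ℤR.mod! 8 v w (f 0) (g (suc n)) X Y C (+ n)
         (λ v w f g X Y C n →
           (((v :+ 𝟘) :* f) :* g :+ X :+ (f :* ((w :+ (𝟙 :+ n)) :* g) :+ Y) , (v :+ w :+ (𝟙 :+ n)) :* (f :* g :+ C))
           , (𝟙 , X :+ Y , (v :+ 𝟙 :+ w :+ n) :* C) ∷ [])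
         (conv-twist (v Z.+ + 1) w (tail f) g n) ⟩
  (v Z.+ w Z.+ + suc n) Z.* (f 0 Z.* g (suc n) Z.+ C) ∎
  where
  open ≡-Reasoning
  X = conv (twist (v Z.+ + 1) (tail f)) g n
  Y = conv (tail f) (twist w g) n
  C = conv (tail f) g n

θr-* : ∀ f g → θr (f *L g) ≈ θr f *L g +L f *L θr g
θr-* f g = λ m → mkL-cong {v} {v} {twist v (ser f ⊛ ser g)} {twist (val f) (ser f) ⊛ ser g ⊞ ser f ⊛ twist (val g) (ser g)} refl leibniz m
  ⟫ coeff-⊞ v (twist (val f) (ser f) ⊛ ser g) (ser f ⊛ twist (val g) (ser g)) m ⟫ sym (coeff-+ (θr f *L g) (f *L θr g) m)
  where
  v = val f Z.+ val g
  leibniz : twist v (ser f ⊛ ser g) ≋ twist (val f) (ser f) ⊛ ser g ⊞ ser f ⊛ twist (val g) (ser g)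
  leibniz n = cong (Z._*_ (v Z.+ + n)) (⊛≋conv (ser f) (ser g) n) ⟫ sym (conv-twist (val f) (val g) (ser f) (ser g) n)
    ⟫ sym (cong₂ Z._+_ (⊛≋conv (twist (val f) (ser f)) (ser g) n) (⊛≋conv (ser f) (twist (val g) (ser g)) n))

-- The constant coefficient of g vanishes because ℤ has no zero divisors; its tail then satisfies
-- the same hypothesis.
conv-domain : ∀ s → s 0 ≢ + 0 → ∀ n g → conv g s ≋ 0S → g n ≡ + 0
conv-domain s s≢0 zero g p = [ (λ e → e) , (λ e → ⊥-elim (s≢0 e)) ]′ (Z.i*j≡0⇒i≡0∨j≡0 (g 0) (sym (Z.+-identityʳ (g 0 Z.* s 0)) ⟫ p 0))
conv-domain s s≢0 (suc n) g p = conv-domain s s≢0 n (tail g)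
  (λ k → sym (Z.+-identityˡ (conv (tail g) s k)) ⟫ cong (Z._+ conv (tail g) s k) (sym (Z.*-zeroˡ (s (suc k))) ⟫ cong (Z._* s (suc k)) (sym (conv-domain s s≢0 zero g p))) ⟫ p (suc k))

coeffr-one : ∀ m → m ≢ + 0 → coeff oneL m ≡ + 0
coeffr-one m m≢0 = coeff≡at oneL m ⟫ cong (at oneS) (Z.+-identityʳ m) ⟫ go m m≢0
  where
  go : ∀ m → m ≢ + 0 → at oneS m ≡ + 0
  go (+ zero) m≢0 = ⊥-elim (m≢0 refl)
  go (+ suc n) _ = refl
  go -[1+ n ] _ = refl

-- The coefficient c may be 0, so this also records bare lower bounds for the order; that allows
-- sums to be taken at a common exponent.
record Lead (f : Laurent) (n c : ℤ) : Set where
  constructor lead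
  field
    lser : Series
    leq : f ≃ mkL n lser
    lhead : lser 0 ≡ c

opaque
  unfolding _⊕_

  V : (k : ℕ) .{{_ : N.NonZero k}} → Laurent → Laurent
  V = Vr

  U : Laurent → Laurent
  U = U7

  qᵐ : ℤ → Laurent
  qᵐ = qr

  θ : Laurent → Laurent
  θ = θr

  coeff-⊕ : ∀ f g m → coeff (f ⊕ g) m ≡ coeff f m Z.+ coeff g m
  coeff-⊕ = coeff-+

  coeff-⊝ : ∀ f m → coeff (⊝ f) m ≡ Z.- coeff f m
  coeff-⊝ = coeff-neg

  coeff-0 : ∀ m → coeff 0ℒ m ≡ + 0
  coeff-0 = coeff-zero

  coeff-1 : ∀ m → m ≢ + 0 → coeff 1ℒ m ≡ + 0
  coeff-1 = coeffr-one

  coeff-1-0 : coeff 1ℒ +0 ≡ + 1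
  coeff-1-0 = refl

  ⊕≡+L : ∀ f g → f +L g ≡ f ⊕ g
  ⊕≡+L f g = refl

  ⊗≡*L : ∀ f g → f *L g ≡ f ⊗ g
  ⊗≡*L f g = refl

  0≡zeroL : zeroL ≡ 0ℒ
  0≡zeroL = refl

  1≡oneL : oneL ≡ 1ℒ
  1≡oneL = refl

  U≡U7 : ∀ f → U7 f ≡ U f
  U≡U7 f = refl

  q≡mkL : ∀ m → qᵐ m ≡ mkL m oneS
  q≡mkL m = refl

  mkL-⊗ : ∀ v w s s′ → mkL v s ⊗ mkL w s′ ≡ mkL (v Z.+ w) (s ⊛ s′)
  mkL-⊗ v w s s′ = refl

  q0≡1 : qᵐ +0 ≡ 1ℒ
  q0≡1 = refl

  lead-* : ∀ {f g n m c d} → Lead f n c → Lead g m d → Lead (f ⊗ g) (n Z.+ m) (c Z.* d)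
  lead-* {f} {g} {n} {m} (lead s eq refl) (lead s′ eq′ refl) = lead (s ⊛ s′)
    (co (*L-cong {f} {mkL n s} {g} {mkL m s′} (at-coeff eq) (at-coeff eq′))) (Z.+-identityʳ (s 0 Z.* s′ 0))

  lead-+ : ∀ {f g n c d} → Lead f n c → Lead g n d → Lead (f ⊕ g) n (c Z.+ d)
  lead-+ {f} {g} {n} (lead s eq refl) (lead s′ eq′ refl) = lead (s ⊞ s′)
    (co λ m → coeff-+ f g m ⟫ cong₂ Z._+_ (at-coeff eq m) (at-coeff eq′ m) ⟫ sym (coeff-⊞ n s s′ m)) refl

  lead-neg : ∀ {f n c} → Lead f n c → Lead (⊝ f) n (Z.- c)
  lead-neg {f} {n} (lead s eq refl) = lead (⊟ s) (co λ m → coeff-neg f m ⟫ cong Z.-_ (at-coeff eq m) ⟫ sym (coeff-neg (mkL n s) m)) refl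

  lead-V : ∀ k .{{_ : N.NonZero k}} {f n c} → Lead f n c → Lead (V k f) (+ k Z.* n) c
  lead-V k {f} {n} (lead s eq refl) = lead (Vs k s) (co (Vr-cong k {f} {mkL n s} (at-coeff eq))) (Vs-mul k s 0)

  lead-q : ∀ n → Lead (qᵐ n) n (+ 1)
  lead-q n = lead oneS (co λ _ → refl) refl

  lead-cancel : ∀ {f n c} g → Lead f n c → c ≢ + 0 → f ⊗ g ≃ 0ℒ → g ≃ 0ℒ
  lead-cancel {f} {n} g (lead s eq refl) c≢0 p = co λ m → coeff≡at g m ⟫ at-0 (m Z.- val g) ⟫ sym (coeff-zero m)
    where
    prod≋0 : s ⊛ ser g ≋ 0S
    prod≋0 k = sym (coeff-mkL (n Z.+ val g) (s ⊛ ser g) k) ⟫ sym (*L-congʳ f (mkL n s) g (at-coeff eq) (n Z.+ val g Z.+ + k)) ⟫ at-coeff p (n Z.+ val g Z.+ + k) ⟫ coeff-zero (n Z.+ val g Z.+ + k)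
    at-0 : ∀ x → at (ser g) x ≡ + 0
    at-0 (+ k) = conv-domain s c≢0 k (ser g) (λ j → conv-comm (ser g) s j ⟫ sym (⊛≋conv s (ser g) j) ⟫ prod≋0 j)
    at-0 -[1+ k ] = refl

  coeff-θ : ∀ f m → coeff (θ f) m ≡ m Z.* coeff f m
  coeff-θ = coeff-θr

  θ-* : ∀ f g → θ (f ⊗ g) ≃ θ f ⊗ g ⊕ f ⊗ θ g
  θ-* f g = co (θr-* f g)

  V-cong : ∀ k .{{_ : N.NonZero k}} {f g} → f ≃ g → V k f ≃ V k g
  V-cong k {f} {g} p = co (Vr-cong k {f} {g} (at-coeff p))

  V-+ : ∀ k .{{_ : N.NonZero k}} f g → V k (f ⊕ g) ≃ V k f ⊕ V k g
  V-+ k f g = co (Vr-+ k f g)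

  V-neg : ∀ k .{{_ : N.NonZero k}} f → V k (⊝ f) ≃ ⊝ V k f
  V-neg k f = co (Vr-neg k f)

  V-* : ∀ k .{{_ : N.NonZero k}} f g → V k (f ⊗ g) ≃ V k f ⊗ V k g
  V-* k f g = co (Vr-* k f g)

  V-one : ∀ k .{{_ : N.NonZero k}} → V k 1ℒ ≃ 1ℒ
  V-one k = co (Vr-one k)

  V-q : ∀ k .{{_ : N.NonZero k}} m → V k (qᵐ m) ≃ qᵐ (+ k Z.* m)
  V-q k m = co (Vr-q k m)

  V-V : ∀ k l .{{_ : N.NonZero k}} .{{_ : N.NonZero l}} .{{_ : N.NonZero (l N.* k)}} f → V k (V l f) ≃ V (l N.* k) f
  V-V k l f = co (mkL-cong {+ k Z.* (+ l Z.* val f)} {+ (l N.* k) Z.* val f} {Vs k (Vs l (ser f))} {Vs (l N.* k) (ser f)}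
    (sym (Z.*-assoc (+ k) (+ l) (val f)) ⟫ cong (Z._* val f) (Z.*-comm (+ k) (+ l) ⟫ sym (Z.pos-* l k))) (Vs-Vs k l (ser f)))

  q+ : ∀ m n → qᵐ m ⊗ qᵐ n ≃ qᵐ (m Z.+ n)
  q+ m n = co (qr-* m n)

  U-W : ∀ f g → U (V 7 f ⊗ g) ≃ f ⊗ U g
  U-W f g = co (U7-V f g)

  U-cong : ∀ {f g} → f ≃ g → U f ≃ U g
  U-cong {f} {g} p = co (U7-cong {f} {g} (at-coeff p))

  U-+ : ∀ f g → U (f ⊕ g) ≃ U f ⊕ U g
  U-+ f g = co (U7-+ f g)

  U-one : U 1ℒ ≃ 1ℒ
  U-one = co U7-one

  U-q : ∀ r x → suc r N.< 7 → U (qᵐ (+ suc r Z.+ + 7 Z.* x)) ≃ 0ℒ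
  U-q r x r<7 = co (U7-q r x r<7)

  coeff-V : ∀ k .{{_ : N.NonZero k}} f r x → r N.< k → coeff (V k f) (+ r Z.+ + k Z.* x) ≡ δ₀ r (coeff f x)
  coeff-V = coeff-Vr

  coeff-U : ∀ f m → coeff (U f) m ≡ coeff f (+ 7 Z.* m)
  coeff-U = coeff-U7

coeff-ι : ∀ z f m → coeff (𝕃R.ι z ⊗ f) m ≡ z Z.* coeff f m
coeff-ι z f m = go z
  where
  open 𝕃R
  posit : ∀ n → coeff (ι (+ n) * f) m ≡ + n Z.* coeff f m
  posit zero = at-coeff (*-congʳ ι-0 ⨾ zeroˡ f) m ⟫ coeff-0 m ⟫ sym (Z.*-zeroˡ (coeff f m))
  posit (suc n) = at-coeff (*-congʳ (ι-+ (+ 1) (+ n) ⨾ +-congʳ ι-1) ⨾ distribʳ f 1# (ι (+ n)) ⨾ +-congʳ (*-identityˡ f)) m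
    ⟫ coeff-⊕ f (ι (+ n) * f) m ⟫ cong (Z._+_ (coeff f m)) (posit n) ⟫ sym (Z.suc-* (+ n) (coeff f m))
  go : ∀ z → coeff (ι z * f) m ≡ z Z.* coeff f m
  go (+ n) = posit n
  go -[1+ n ] = at-coeff (*-congʳ (ι-neg (+ suc n)) ⨾ ≈-sym (-‿distribˡ-* (ι (+ suc n)) f)) m ⟫ coeff-⊝ (ι (+ suc n) * f) m
    ⟫ cong Z.-_ (posit (suc n)) ⟫ Z.neg-distribˡ-* (+ suc n) (coeff f m)

ι-cancel : ∀ z f → z ≢ + 0 → 𝕃R.ι z ⊗ f ≃ 0ℒ → f ≃ 0ℒ
ι-cancel z f z≢0 p = co λ m → [ (λ z≡0 → ⊥-elim (z≢0 z≡0)) , (λ e → e ⟫ sym (coeff-0 m)) ]′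
  (Z.i*j≡0⇒i≡0∨j≡0 z (sym (coeff-ι z f m) ⟫ at-coeff p m ⟫ coeff-0 m))

scale≃ι : ∀ z f → scale z f ≃ 𝕃R.ι z ⊗ f
scale≃ι z f = co λ m → coeff≡at (scale z f) m ⟫ at-scale (m Z.- val f) ⟫ cong (Z._*_ z) (sym (coeff≡at f m)) ⟫ sym (coeff-ι z f m)
  where
  at-scale : ∀ x → at (λ n → z Z.* ser f n) x ≡ z Z.* at (ser f) x
  at-scale (+ n) = refl
  at-scale -[1+ n ] = sym (Z.*-zeroʳ z)

lead-cong : ∀ {f g n c} → f ≃ g → Lead f n c → Lead g n c
lead-cong p (lead s eq h) = lead s (𝕃R.≈-trans (𝕃R.≈-sym p) eq) h

lead-lower : ∀ {f n m c} k → m ≡ n Z.+ + suc k → Lead f m c → Lead f n +0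
lead-lower {n = n} k refl (lead s eq _) = lead (shiftS (suc k) s) (𝕃R.≈-trans eq (co λ m → sym (shift-≈ n (suc k) s m))) refl

θ-cong : ∀ {f g} → f ≃ g → θ f ≃ θ g
θ-cong {f} {g} p = co λ m → coeff-θ f m ⟫ cong (Z._*_ m) (at-coeff p m) ⟫ sym (coeff-θ g m)

θ-+ : ∀ f g → θ (f ⊕ g) ≃ θ f ⊕ θ g
θ-+ f g = co λ m → coeff-θ (f ⊕ g) m ⟫ cong (Z._*_ m) (coeff-⊕ f g m) ⟫ Z.*-distribˡ-+ m (coeff f m) (coeff g m)
  ⟫ sym (coeff-⊕ (θ f) (θ g) m ⟫ cong₂ Z._+_ (coeff-θ f m) (coeff-θ g m))

θ-neg : ∀ f → θ (⊝ f) ≃ ⊝ (θ f)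
θ-neg f = co λ m → coeff-θ (⊝ f) m ⟫ cong (Z._*_ m) (coeff-⊝ f m) ⟫ sym (Z.neg-distribʳ-* m (coeff f m)) ⟫ sym (coeff-⊝ (θ f) m ⟫ cong Z.-_ (coeff-θ f m))

θ-constant : ∀ f → θ f ≃ 0ℒ → coeff f +0 ≡ + 1 → f ≃ 1ℒ
θ-constant f p c = co go
  where
  go : ∀ m → coeff f m ≡ coeff 1ℒ m
  go (+ zero) = c ⟫ sym coeff-1-0
  go m@(+ (suc _)) = vanish m (λ ()) ⟫ sym (coeff-1 m (λ ()))
    where
    vanish : ∀ m → m ≢ + 0 → coeff f m ≡ + 0
    vanish m m≢0 = [ (λ e → ⊥-elim (m≢0 e)) , (λ e → e) ]′ (Z.i*j≡0⇒i≡0∨j≡0 m (sym (coeff-θ f m) ⟫ at-coeff p m ⟫ coeff-0 m))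
  go m@(-[1+ _ ]) = vanish m (λ ()) ⟫ sym (coeff-1 m (λ ()))
    where
    vanish : ∀ m → m ≢ + 0 → coeff f m ≡ + 0
    vanish m m≢0 = [ (λ e → ⊥-elim (m≢0 e)) , (λ e → e) ]′ (Z.i*j≡0⇒i≡0∨j≡0 m (sym (coeff-θ f m) ⟫ at-coeff p m ⟫ coeff-0 m))

-- Exponent classes modulo 7

W : Laurent → Laurent
W = V 7

record Cls (r : ℤ) (f : Laurent) : Set where
  constructor cls
  field
    core : Laurent
    ceq : f ≃ qᵐ r ⊗ W core

private
  module Q = 𝕃R

W-* : ∀ f g → W (f ⊗ g) ≃ W f ⊗ W g
W-* f g = V-* 7 f g

cls-cong : ∀ {r f g} → f ≃ g → Cls r f → Cls r g
cls-cong p (cls k e) = cls k (Q.≈-trans (Q.≈-sym p) e)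

cls-* : ∀ {r s f g} → Cls r f → Cls s g → Cls (r Z.+ s) (f ⊗ g)
cls-* {r} {s} {f} {g} (cls k e) (cls l e′) = cls (k ⊗ l) (begin
  f * g ≈⟨ *-cong e e′ ⟩
  (qᵐ r * W k) * (qᵐ s * W l) ≈⟨ ring! 4 (qᵐ r) (W k) (qᵐ s) (W l) (λ a b c d → (a :* b) :* (c :* d) , (a :* c) :* (b :* d)) ⟩
  (qᵐ r * qᵐ s) * (W k * W l) ≈⟨ *-cong (q+ r s) (≈-sym (W-* k l)) ⟩
  qᵐ (r Z.+ s) * W (k * l) ∎)
  where open 𝕃R

cls-+ : ∀ {r f g} → Cls r f → Cls r g → Cls r (f ⊕ g)
cls-+ {r} (cls k e) (cls l e′) = cls (k ⊕ l) (+-cong e e′ ⨾ ≈-sym (distribˡ _ _ _) ⨾ *-congˡ (≈-sym ((V-+ 7 k l))))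
  where open 𝕃R

cls-neg : ∀ {r f} → Cls r f → Cls r (⊝ f)
cls-neg {r} (cls k e) = cls (⊝ k) (-‿cong e ⨾ -‿distribʳ-* _ _ ⨾ *-congˡ (≈-sym ((V-neg 7 k))))
  where open 𝕃R
        open import Algebra.Properties.Ring ring using (-‿distribʳ-*)

cls-mod : ∀ {r f} s x → r ≡ s Z.+ + 7 Z.* x → Cls r f → Cls s f
cls-mod {f = f} s x refl (cls k e) = cls (qᵐ x ⊗ k) (begin
  f ≈⟨ e ⟩
  qᵐ (s Z.+ + 7 Z.* x) * W k ≈⟨ *-congʳ (≈-sym (q+ s (+ 7 Z.* x))) ⟩
  qᵐ s * qᵐ (+ 7 Z.* x) * W k ≈⟨ *-assoc _ _ _ ⟩
  qᵐ s * (qᵐ (+ 7 Z.* x) * W k) ≈⟨ *-congˡ (*-congʳ (≈-sym ((V-q 7 x)))) ⟩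
  qᵐ s * (W (qᵐ x) * W k) ≈⟨ *-congˡ (≈-sym (W-* (qᵐ x) k)) ⟩
  qᵐ s * W (qᵐ x * k) ∎)
  where open 𝕃R

W-cls : ∀ f → Cls +0 (W f)
W-cls f = cls f (Q.≈-sym (Q.≈-trans (Q.*-congʳ (Q.reflexive q0≡1)) (Q.*-identityˡ (W f))))

ι-cls : ∀ z → Cls +0 (𝕃R.ι z)
ι-cls z = cls-cong (W-ι z) (W-cls (𝕃R.ι z))
  where
  open 𝕃R
  W-posit : ∀ n → W (ι (+ n)) ≃ ι (+ n)
  W-posit zero = V-cong 7 (id (ι-0)) ⨾ x+x≈x⇒x≈0 _ (≈-sym ((V-+ 7 0ℒ 0ℒ)) ⨾ V-cong 7 (id ((+-identityˡ 0ℒ)))) ⨾ ≈-sym ι-0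
  W-posit (suc n) = V-cong 7 (id ((ι-+ (+ 1) (+ n)))) ⨾ (V-+ 7 (ι (+ 1)) (ι (+ n)))
    ⨾ +-cong (V-cong 7 (id (ι-1)) ⨾ (V-one 7) ⨾ ≈-sym ι-1) (W-posit n) ⨾ ≈-sym (ι-+ (+ 1) (+ n))
  W-ι : ∀ z → W (ι z) ≃ ι z
  W-ι (+ n) = W-posit n
  W-ι -[1+ n ] = V-cong 7 (id ((ι-neg (+ suc n)))) ⨾ (V-neg 7 (ι (+ suc n))) ⨾ -‿cong (W-posit (suc n)) ⨾ ≈-sym (ι-neg (+ suc n))

U-cancel : ∀ f → U (W f) ≃ f
U-cancel f = U-cong (≈-sym (*-identityʳ (W f))) ⨾ U-W f 1ℒ ⨾ *-congˡ U-one ⨾ *-identityʳ f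
  where open 𝕃R

W-injective : ∀ {f g} → W f ≃ W g → f ≃ g
W-injective {f} {g} p = ≈-sym (U-cancel f) ⨾ U-cong p ⨾ U-cancel g
  where open 𝕃R

W-U : ∀ {f} → Cls +0 f → f ≃ W (U f)
W-U {f} (cls k e₀) = e ⨾ *-identityˡ (W k) ⨾ V-cong 7 (id ((≈-sym (U-cong (e ⨾ *-identityˡ (W k)) ⨾ U-cancel k))))
  where
  open 𝕃R
  e : f ≃ 1# * W k
  e = e₀ ⨾ *-congʳ (reflexive q0≡1)

-- Vanishing of the part in class r. Unlike `Cls`, it is closed under sums of series from different
-- classes.
Off : ℤ → Laurent → Set
Off r f = U (qᵐ (Z.- r) ⊗ f) ≃ 0ℒ

off-cls : ∀ {s f} r i x → s ≡ r Z.+ (+ suc i Z.+ + 7 Z.* x) → suc i N.< 7 → Cls s f → Off r f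
off-cls {s} {f} r i x refl i<7 (cls k e) = begin
  U (qᵐ (Z.- r) * f) ≈⟨ U-cong (*-congˡ e) ⟩
  U (qᵐ (Z.- r) * (qᵐ s * W k)) ≈⟨ U-cong (ring! 3 (qᵐ (Z.- r)) (qᵐ s) (W k) (λ a b c → a :* (b :* c) , c :* (a :* b))) ⟩
  U (W k * (qᵐ (Z.- r) * qᵐ s)) ≈⟨ U-W k _ ⟩
  k * U (qᵐ (Z.- r) * qᵐ s) ≈⟨ *-congˡ (U-cong (q+ (Z.- r) s)) ⟩
  k * U (qᵐ (Z.- r Z.+ s)) ≡⟨ cong (λ y → k * U (qᵐ y)) (ℤR.ring! 3 r (+ suc i) (+ 7 Z.* x) (λ r i x → :- r :+ (r :+ (i :+ x)) , i :+ x)) ⟩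
  k * U (qᵐ (+ suc i Z.+ + 7 Z.* x)) ≈⟨ *-congˡ (U-q i x i<7) ⟩
  k * 0# ≈⟨ zeroʳ k ⟩
  0# ∎
  where open 𝕃R

off-+ : ∀ {r f g} → Off r f → Off r g → Off r (f ⊕ g)
off-+ {r} {f} {g} p p′ = U-cong (distribˡ (qᵐ (Z.- r)) f g) ⨾ U-+ _ _ ⨾ +-cong p p′ ⨾ +-identityˡ _
  where open 𝕃R

-- Multiplication by q^(-r) brings f into class 0, where `U` loses nothing, while `U` annihilates
-- the image of g.
separate : ∀ {r f g} → Cls r f → Off r g → f ⊕ g ≃ 0ℒ → f ≃ 0ℒ
separate {r} {f} {g} (cls k e) off p = begin
  f ≈⟨ e ⟩
  qᵐ r * W k ≈⟨ *-congˡ (V-cong 7 (id (k≃0))) ⟩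
  qᵐ r * W 0# ≈⟨ *-congˡ (x+x≈x⇒x≈0 _ (≈-sym ((V-+ 7 0ℒ 0ℒ)) ⨾ V-cong 7 (id ((+-identityˡ 0ℒ))))) ⟩
  qᵐ r * 0# ≈⟨ zeroʳ _ ⟩
  0# ∎
  where
  open 𝕃R
  shift-back : qᵐ (Z.- r) * f ≃ W k
  shift-back = begin
    qᵐ (Z.- r) * f ≈⟨ *-congˡ e ⟩
    qᵐ (Z.- r) * (qᵐ r * W k) ≈⟨ ≈-sym (*-assoc _ _ _) ⟩
    qᵐ (Z.- r) * qᵐ r * W k ≈⟨ *-congʳ (q+ (Z.- r) r) ⟩
    qᵐ (Z.- r Z.+ r) * W k ≡⟨ cong (λ y → qᵐ y * W k) (Z.+-inverseˡ r) ⟩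
    qᵐ +0 * W k ≈⟨ *-congʳ (reflexive q0≡1) ⨾ *-identityˡ _ ⟩
    W k ∎
  k≃0 : k ≃ 0#
  k≃0 = begin
    k ≈⟨ ≈-sym (U-cancel k) ⟩
    U (W k) ≈⟨ U-cong (≈-sym shift-back) ⟩
    U (qᵐ (Z.- r) * f) ≈⟨ ≈-sym (+-congˡ off ⨾ +-identityʳ _) ⟩
    U (qᵐ (Z.- r) * f) + U (qᵐ (Z.- r) * g) ≈⟨ ≈-sym (U-+ _ _) ⟩
    U (qᵐ (Z.- r) * f + qᵐ (Z.- r) * g) ≈⟨ U-cong (≈-sym (distribˡ _ f g)) ⟩
    U (qᵐ (Z.- r) * (f + g)) ≈⟨ U-cong (*-congˡ p ⨾ zeroʳ _) ⟩
    U 0# ≈⟨ x+x≈x⇒x≈0 _ (≈-sym (U-+ 0# 0#) ⨾ U-cong (+-identityˡ 0#)) ⟩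
    0# ∎

open Data.Nat.Solver.+-*-Solver using () renaming (solve to solveℕ; _:+_ to _+'_; _:*_ to _*'_; _:=_ to _='_; con to con')
open 𝕃R hiding (_≈_)

q^ : ℕ → Laurent
q^ n = qᵐ (+ n)

q^-+ : ∀ m n → q^ m * q^ n ≃ q^ (m N.+ n)
q^-+ m n = q+ (+ m) (+ n)

q^0 : q^ 0 ≃ 1#
q^0 = reflexive q0≡1

-- Power series, and congruence of power series modulo qᴺ

Int : Laurent → Set
Int f = ∃ λ c → Lead f +0 c

int-cong : ∀ {f g} → f ≃ g → Int f → Int g
int-cong e (c , l) = c , lead-cong e l

int-+ : ∀ {f g} → Int f → Int g → Int (f + g)
int-+ (_ , l) (_ , l′) = _ , lead-+ l l′

int-* : ∀ {f g} → Int f → Int g → Int (f * g)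
int-* (_ , l) (_ , l′) = _ , lead-* l l′

int-neg : ∀ {f} → Int f → Int (- f)
int-neg (_ , l) = _ , lead-neg l

int-1 : Int 1#
int-1 = _ , lead-cong q^0 (lead-q +0)

int-q : ∀ n → Int (q^ n)
int-q zero = _ , lead-q +0
int-q (suc n) = _ , lead-lower n refl (lead-q (+ suc n))

int-0 : Int 0#
int-0 = int-cong (-‿inverseʳ 1#) (int-+ int-1 (int-neg int-1))

int-mkL : ∀ s → Int (mkL +0 s)
int-mkL s = s 0 , lead s ≈-refl refl

int-ιℕ : ∀ n → Int (ι (+ n))
int-ιℕ zero = int-cong (≈-sym ι-0) int-0
int-ιℕ (suc n) = int-cong (+-congʳ (≈-sym ι-1) ⨾ ≈-sym (ι-+ (+ 1) (+ n))) (int-+ int-1 (int-ιℕ n))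

int-ι : ∀ z → Int (ι z)
int-ι (+ n) = int-ιℕ n
int-ι -[1+ n ] = int-cong (≈-sym (ι-neg (+ suc n))) (int-neg (int-ιℕ (suc n)))

int-V : ∀ k .{{_ : N.NonZero k}} {f} → Int f → Int (V k f)
int-V k {f} (c , l) = c , subst (λ v → Lead (V k f) v c) (Z.*-zeroʳ (+ k)) (lead-V k l)

record Agr (N : ℕ) (f g : Laurent) : Set where
  constructor agr
  field
    {rest} : Laurent
    integral : Int rest
    agrees : f ≃ g + q^ N * rest
open Agr

agr-≈ : ∀ {N f g} → f ≃ g → Agr N f g
agr-≈ e = agr int-0 (e ⨾ ≈-sym (+-congˡ (zeroʳ _) ⨾ +-identityʳ _))

agr-sym : ∀ {N f g} → Agr N f g → Agr N g f
agr-sym {N} {f} {g} (agr {h} i e) = agr (int-neg i) (mod! 4 f g (q^ N) h (λ f g q h → (g , f :+ q :* :- h) , (:- 𝟙 , f , g :+ q :* h) ∷ []) e)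

agr-trans : ∀ {N f g k} → Agr N f g → Agr N g k → Agr N f k
agr-trans {N} {f} {g} {k} (agr {h} i e) (agr {h′} i′ e′) = agr (int-+ i i′)
  (mod! 6 f g k (q^ N) h h′ (λ f g k q h h′ → (f , k :+ q :* (h :+ h′)) , (𝟙 , f , g :+ q :* h) ∷ (𝟙 , g , k :+ q :* h′) ∷ []) (e , e′))

agr-+ : ∀ {N f g f′ g′} → Agr N f g → Agr N f′ g′ → Agr N (f + f′) (g + g′)
agr-+ {N} {f} {g} {f′} {g′} (agr {h} i e) (agr {h′} i′ e′) = agr (int-+ i i′)
  (mod! 7 f g f′ g′ (q^ N) h h′ (λ f g f′ g′ q h h′ → (f :+ f′ , g :+ g′ :+ q :* (h :+ h′)) , (𝟙 , f , g :+ q :* h) ∷ (𝟙 , f′ , g′ :+ q :* h′) ∷ []) (e , e′))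

agr-* : ∀ {N f g f′ g′} → Int f → Int g′ → Agr N f g → Agr N f′ g′ → Agr N (f * f′) (g * g′)
agr-* {N} {f} {g} {f′} {g′} if ig′ (agr {h} i e) (agr {h′} i′ e′) = agr (int-+ (int-* if i′) (int-* i ig′))
  (mod! 7 f g f′ g′ (q^ N) h h′ (λ f g f′ g′ q h h′ → (f :* f′ , g :* g′ :+ q :* (f :* h′ :+ h :* g′)) , (g′ , f , g :+ q :* h) ∷ (f , f′ , g′ :+ q :* h′) ∷ []) (e , e′))

agr-weaken : ∀ {M N f g} → N N.≤ M → Agr M f g → Agr N f g
agr-weaken {M} {N} N≤M (agr {h} i e) = agr (int-* (int-q (M N.∸ N)) i)
  (e ⨾ +-congˡ (*-congʳ (≈-sym (q^-+ N (M N.∸ N) ⨾ reflexive (cong q^ (N.m+[n∸m]≡n N≤M)))) ⨾ *-assoc _ _ _))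

agr-V : ∀ k .{{_ : N.NonZero k}} {N f g} → Agr N f g → Agr N (V k f) (V k g)
agr-V k {N} {f} {g} (agr {h} i e) = agr-weaken (N.m≤n*m N k) (agr {k N.* N} (int-V k i)
  (V-cong k e ⨾ V-+ k g _ ⨾ +-congˡ (V-* k (q^ N) h ⨾ *-congʳ (V-q k (+ N) ⨾ reflexive (cong qᵐ (sym (Z.pos-* k N)))))))

agr-coeff : ∀ {N f g} → Agr N f g → ∀ m → m Z.< + N → coeff f m ≡ coeff g m
agr-coeff {N} {f} {g} (agr {h} (c , l) e) m m<N = at-coeff e m ⟫ coeff-⊕ g (q^ N * h) m
  ⟫ cong (Z._+_ (coeff g m)) (at-coeff (Lead.leq high) m ⟫ coeff-below (mkL _ (Lead.lser high)) (Z.<-≤-trans m<N (Z.≤-reflexive (sym (Z.+-identityʳ (+ N)))))) ⟫ Z.+-identityʳ (coeff g m)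
  where high = lead-* (lead-q (+ N)) l

agr-all : ∀ {f g} → (∀ N → Agr N f g) → f ≃ g
agr-all a = co λ m → agr-coeff (a (suc Z.∣ m ∣)) m (within m)
  where
  within : ∀ m → m Z.< + suc Z.∣ m ∣
  within (+ n) = Z.+<+ N.≤-refl
  within -[1+ n ] = Z.-<+

drop : ℕ → Series → Series
drop N s n = s (N N.+ n)

shift-drop : ∀ N s → (∀ n → n N.< N → s n ≡ + 0) → shiftS N (drop N s) ≋ s
shift-drop zero s z n = refl
shift-drop (suc N) s z zero = sym (z 0 (N.s≤s N.z≤n))
shift-drop (suc N) s z (suc n) = shift-drop N (tail s) (λ k k<N → z (suc k) (N.s≤s k<N)) n

q-shift : ∀ N s → q^ N * mkL +0 s ≃ mkL +0 (shiftS N s)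
q-shift N s = *-congʳ (reflexive (q≡mkL (+ N))) ⨾ reflexive (mkL-⊗ (+ N) +0 oneS s)
  ⨾ (co λ m → mkL-cong {+ N Z.+ + 0} {+ 0 Z.+ + N} {oneS ⊛ s} {s} (Z.+-comm (+ N) +0) (⊛-identityˡ s) m ⟫ sym (shift-≈ +0 N s m))

mkL-+ : ∀ s s′ → mkL +0 s + mkL +0 s′ ≃ mkL +0 (s ⊞ s′)
mkL-+ s s′ = co λ m → coeff-⊕ (mkL +0 s) (mkL +0 s′) m ⟫ sym (coeff-⊞ +0 s s′ m)

mkL≈ : ∀ {s s′} → s ≋ s′ → mkL +0 s ≃ mkL +0 s′
mkL≈ {s} {s′} p = co (mkL-cong {+ 0} {+ 0} {s} {s′} refl p)

agr-mkL : ∀ N {s s′} → (∀ n → n N.< N → s n ≡ s′ n) → Agr N (mkL +0 s) (mkL +0 s′)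
agr-mkL N {s} {s′} p = agr (int-mkL (drop N d)) (≈-sym (+-congˡ (q-shift N (drop N d) ⨾ mkL≈ (shift-drop N d zeros))
    ⨾ mkL-+ s′ d ⨾ mkL≈ (λ n → ℤR.ring! 2 (s n) (s′ n) (λ a b → b :+ (a :- b) , a))))
  where
  d : Series
  d n = s n Z.- s′ n
  zeros : ∀ n → n N.< N → d n ≡ + 0
  zeros n n<N = cong (Z._- s′ n) (p n n<N) ⟫ Z.+-inverseʳ (s′ n)

-- Limits of coefficientwise stable sequences

record Stable (F : ℕ → Laurent) : Set where
  field
    stable-int : ∀ n → Int (F n)
    stable-step : ∀ n → Agr n (F (suc n)) (F n)
open Stable

opaque
  -- Coefficient n is read from the term n + 1, the earliest that `Stable` guarantees modulo
  -- q^(n+1).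
  lim : (ℕ → Laurent) → Laurent
  lim F = mkL +0 (λ n → coeff (F (suc n)) (+ n))

  lim-int : ∀ F → Int (lim F)
  lim-int F = int-mkL _

  stable-+ : ∀ {F} → Stable F → ∀ n k → Agr n (F (k N.+ n)) (F n)
  stable-+ S n zero = agr-≈ ≈-refl
  stable-+ S n (suc k) = agr-trans (agr-weaken (N.m≤n+m n k) (stable-step S (k N.+ n))) (stable-+ S n k)

  int≈ : ∀ {f} → Int f → f ≃ mkL +0 (λ n → coeff f (+ n))
  int≈ {f} (c , lead s e _) = e ⨾ mkL≈ (λ n → sym (at-coeff e (+ n) ⟫ coeff-mkL +0 s n))

  lim-agr : ∀ {F} → Stable F → ∀ n → Agr n (lim F) (F n)
  lim-agr {F} S n = agr-trans (agr-mkL n same) (agr-≈ (≈-sym (int≈ (stable-int S n))))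
    where
    same : ∀ k → k N.< n → coeff (F (suc k)) (+ k) ≡ coeff (F n) (+ k)
    same k k<n = sym (cong (λ m → coeff (F m) (+ k)) (sym (N.m∸n+n≡m k<n)) ⟫ agr-coeff (stable-+ S (suc k) (n N.∸ suc k)) (+ k) (Z.+<+ N.≤-refl))

lim-unique : ∀ {F f} → Stable F → (∀ n → Agr n f (F n)) → f ≃ lim F
lim-unique S a = agr-all (λ n → agr-trans (a n) (agr-sym (lim-agr S n)))

-- Infinite products

∏ : (ℕ → Laurent) → ℕ → Laurent
∏ F zero = 1#
∏ F (suc n) = ∏ F n * F n

∏-cong : ∀ {F G} → (∀ n → F n ≃ G n) → ∀ n → ∏ F n ≃ ∏ G n
∏-cong e zero = ≈-refl
∏-cong e (suc n) = *-cong (∏-cong e n) (e n)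

∏-* : ∀ F G n → ∏ (λ i → F i * G i) n ≃ ∏ F n * ∏ G n
∏-* F G zero = ≈-sym (*-identityˡ 1#)
∏-* F G (suc n) = *-congʳ (∏-* F G n) ⨾ ring! 4 (∏ F n) (∏ G n) (F n) (G n) (λ a b c d → (a :* b) :* (c :* d) , (a :* c) :* (b :* d))

∏-split : ∀ F p m → ∏ F (p N.+ m) ≃ ∏ F p * ∏ (λ i → F (p N.+ i)) m
∏-split F p zero = reflexive (cong (∏ F) (N.+-identityʳ p)) ⨾ ≈-sym (*-identityʳ _)
∏-split F p (suc m) = reflexive (cong (∏ F) (N.+-suc p m)) ⨾ *-congʳ (∏-split F p m) ⨾ *-assoc _ _ _

∏-int : ∀ {F} → (∀ i → Int (F i)) → ∀ n → Int (∏ F n)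
∏-int i zero = int-1
∏-int i (suc n) = int-* (∏-int i n) (i n)

∏-one : ∀ n → ∏ (λ _ → 1#) n ≃ 1#
∏-one zero = ≈-refl
∏-one (suc n) = *-identityʳ _ ⨾ ∏-one n

∏-agr : ∀ {N F G} → (∀ i → Int (F i)) → (∀ i → Int (G i)) → (∀ i → Agr N (F i) (G i)) → ∀ m → Agr N (∏ F m) (∏ G m)
∏-agr iF iG a zero = agr-≈ ≈-refl
∏-agr iF iG a (suc m) = agr-* (∏-int iF m) (iG m) (∏-agr iF iG a m) (a m)

one-q : ℕ → Laurent
one-q n = 1# - q^ n

one-q-int : ∀ n → Int (one-q n)
one-q-int n = int-+ int-1 (int-neg (int-q n))

stable-∏ : ∀ {F} → (∀ i → Int (F i)) → (∀ i → Agr i (F i) 1#) → Stable (∏ F)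
stable-∏ i a = record { stable-int = ∏-int i ; stable-step = λ n → agr-trans (agr-* (∏-int i n) int-1 (agr-≈ ≈-refl) (a n)) (agr-≈ (*-identityʳ _)) }

one-q-agr : ∀ N n → N N.≤ n → Agr N (one-q n) 1#
one-q-agr N n le = agr-weaken le (agr (int-neg int-1) (+-congˡ (ring! 1 (q^ n) (λ q → :- q , q :* :- 𝟙))))

-- ℙ c a = Π_{i ≥ 0} (1 − q^{c i + a})

fac : ℕ → ℕ → ℕ → Laurent
fac c a i = one-q (c N.* i N.+ a)

ℙₙ : ℕ → ℕ → ℕ → Laurent
ℙₙ c a = ∏ (fac c a)

ℙ-stable : ∀ c a .{{_ : N.NonZero c}} → Stable (ℙₙ c a)
ℙ-stable c a = stable-∏ (λ i → one-q-int _) (λ i → one-q-agr i _ (N.≤-trans (N.m≤n*m i c) (N.m≤m+n _ a)))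

ℙ : ℕ → ℕ → Laurent
ℙ c a = lim (ℙₙ c a)

ℙₙ-regroup : ∀ m c a n → ℙₙ c a (n N.* m) ≃ ∏ (λ j → ℙₙ (c N.* m) (a N.+ c N.* j) n) m
ℙₙ-regroup m c a zero = ≈-sym (∏-one m)
ℙₙ-regroup m c a (suc n) = begin
  ℙₙ c a (m N.+ n N.* m) ≡⟨ cong (ℙₙ c a) (N.+-comm m (n N.* m)) ⟩
  ℙₙ c a (n N.* m N.+ m) ≈⟨ ∏-split (fac c a) (n N.* m) m ⟩
  ℙₙ c a (n N.* m) * ∏ (λ i → fac c a (n N.* m N.+ i)) m
    ≈⟨ *-cong (ℙₙ-regroup m c a n) (∏-cong (λ i → reflexive (cong one-q (exponent i))) m) ⟩
  ∏ (λ j → ℙₙ (c N.* m) (a N.+ c N.* j) n) m * ∏ (λ j → fac (c N.* m) (a N.+ c N.* j) n) m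
    ≈⟨ ≈-sym (∏-* _ _ m) ⟩
  ∏ (λ j → ℙₙ (c N.* m) (a N.+ c N.* j) (suc n)) m ∎
  where
  exponent : ∀ i → c N.* (n N.* m N.+ i) N.+ a ≡ c N.* m N.* n N.+ (a N.+ c N.* i)
  exponent i = solveℕ 5 (λ c n m i a → c *' (n *' m +' i) +' a =' c *' m *' n +' (a +' c *' i)) refl c n m i a

ℙ-regroup : ∀ m c a .{{_ : N.NonZero c}} .{{_ : N.NonZero m}} .{{_ : N.NonZero (c N.* m)}} → ℙ c a ≃ ∏ (λ j → ℙ (c N.* m) (a N.+ c N.* j)) m
ℙ-regroup m c a = agr-all (λ n → agr-trans (agr-weaken (N.m≤m*n n m) (lim-agr (ℙ-stable c a) (n N.* m)))
  (agr-trans (agr-≈ (ℙₙ-regroup m c a n)) (agr-sym (∏-agr (λ j → lim-int _) (λ j → stable-int (ℙ-stable (c N.* m) _) n) (λ j → lim-agr (ℙ-stable (c N.* m) _) n) m))))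

V-∏ : ∀ k .{{_ : N.NonZero k}} F n → V k (∏ F n) ≃ ∏ (λ i → V k (F i)) n
V-∏ k F zero = V-one k
V-∏ k F (suc n) = V-* k (∏ F n) (F n) ⨾ *-congʳ (V-∏ k F n)

V-one-q : ∀ k .{{_ : N.NonZero k}} n → V k (one-q n) ≃ one-q (k N.* n)
V-one-q k n = V-+ k 1# (- q^ n) ⨾ +-cong (V-one k) (V-neg k (q^ n) ⨾ -‿cong (V-q k (+ n) ⨾ reflexive (cong qᵐ (sym (Z.pos-* k n)))))

V-ℙ : ∀ k c a .{{_ : N.NonZero k}} .{{_ : N.NonZero c}} .{{_ : N.NonZero (k N.* c)}} → V k (ℙ c a) ≃ ℙ (k N.* c) (k N.* a)
V-ℙ k c a = lim-unique (ℙ-stable (k N.* c) (k N.* a)) (λ n → agr-trans (agr-V k (lim-agr (ℙ-stable c a) n))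
  (agr-≈ (V-∏ k (fac c a) n ⨾ ∏-cong (λ i → V-one-q k (c N.* i N.+ a)
    ⨾ reflexive (cong one-q (trans (N.*-distribˡ-+ k (c N.* i) a) (cong (N._+ k N.* a) (sym (N.*-assoc k c i)))))) n)))

-- Geometric series as inverses of the factors 1 - qʲ

geom-head : ∀ j → geom (suc j) ≋ oneS ⊞ shiftS (suc j) (geom (suc j))
geom-head j n = go (N.<-≤-connex n (suc j))
  where
  go : n N.< suc j ⊎ suc j N.≤ n → geom (suc j) n ≡ oneS n Z.+ shiftS (suc j) (geom (suc j)) n
  go (inj₁ n<) = small n n< ⟫ sym (cong (Z._+_ (oneS n)) (shiftS-< (suc j) (geom (suc j)) n n<) ⟫ Z.+-identityʳ (oneS n))
    where
    small : ∀ n → n N.< suc j → geom (suc j) n ≡ oneS n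
    small zero _ = cong (λ b → if b then + 1 else + 0) (dec-true (suc j ℕ∣.∣? 0) (_ ℕ∣.∣0))
    small (suc n) n< = cong (λ b → if b then + 1 else + 0) (dec-false (suc j ℕ∣.∣? suc n) (ℕ∣.>⇒∤ n<))
  go (inj₂ j≤) = cong (geom (suc j)) (sym (N.m+[n∸m]≡n j≤)) ⟫ large (n N.∸ suc j) ⟫ cong (λ m → oneS m Z.+ shiftS (suc j) (geom (suc j)) m) (N.m+[n∸m]≡n j≤)
    where
    large : ∀ m → geom (suc j) (suc j N.+ m) ≡ oneS (suc j N.+ m) Z.+ shiftS (suc j) (geom (suc j)) (suc j N.+ m)
    large m = same (suc j ℕ∣.∣? m) ⟫ sym (Z.+-identityˡ _ ⟫ shiftS-+ j (geom (suc j)) m)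
      where
      same : Dec (suc j ℕ∣.∣ m) → geom (suc j) (suc j N.+ m) ≡ geom (suc j) m
      same (yes p) = cong (λ b → if b then + 1 else + 0) (dec-true (suc j ℕ∣.∣? (suc j N.+ m)) (ℕ∣.∣m∣n⇒∣m+n ℕ∣.∣-refl p) ⟫ sym (dec-true (suc j ℕ∣.∣? m) p))
      same (no ¬p) = cong (λ b → if b then + 1 else + 0) (dec-false (suc j ℕ∣.∣? (suc j N.+ m)) (λ p → ¬p (ℕ∣.∣m+n∣m⇒∣n p ℕ∣.∣-refl)) ⟫ sym (dec-false (suc j ℕ∣.∣? m) ¬p))

ginv : ℕ → Laurent
ginv j = mkL +0 (geom j)

ginv-int : ∀ j → Int (ginv j)
ginv-int j = int-mkL _

mkL-one : mkL +0 oneS ≃ 1#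
mkL-one = reflexive (sym (q≡mkL +0)) ⨾ q^0

ginv-inverse : ∀ j → ginv (suc j) * one-q (suc j) ≃ 1#
ginv-inverse j = mod! 2 (ginv (suc j)) (q^ (suc j)) (λ g q → (g :* (𝟙 :- q) , 𝟙) , (𝟙 , g , 𝟙 :+ q :* g) ∷ [])
  (mkL≈ (geom-head j) ⨾ ≈-sym (mkL-+ oneS _) ⨾ +-cong mkL-one (≈-sym (q-shift (suc j) (geom (suc j)))))

factor≈ : ∀ j → mkL +0 (factor (suc j)) ≃ one-q (suc j)
factor≈ j = mkL≈ same ⨾ ≈-sym (mkL-+ oneS _) ⨾ +-cong mkL-one (mkL-neg (shiftS (suc j) oneS) ⨾ -‿cong (≈-sym (q-shift (suc j) oneS) ⨾ *-congˡ mkL-one ⨾ *-identityʳ _))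
  where
  mkL-neg : ∀ s → mkL +0 (⊟ s) ≃ - mkL +0 s
  mkL-neg s = co λ m → at⊟ m ⟫ sym (coeff-⊝ (mkL +0 s) m)
    where
    at⊟ : ∀ m → coeff (mkL +0 (⊟ s)) m ≡ Z.- coeff (mkL +0 s) m
    at⊟ m = coeff≡at (mkL +0 (⊟ s)) m ⟫ go (m Z.- + 0) ⟫ cong Z.-_ (sym (coeff≡at (mkL +0 s) m))
      where
      go : ∀ x → at (⊟ s) x ≡ Z.- at s x
      go (+ n) = refl
      go -[1+ n ] = refl
  same : factor (suc j) ≋ oneS ⊞ ⊟ shiftS (suc j) oneS
  same zero = refl
  same (suc n) = tail-same (n N.≟ j) ⟫ sym (Z.+-identityˡ _)
    where
    hit : ∀ j → shiftS j oneS j ≡ + 1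
    hit zero = refl
    hit (suc j) = hit j
    miss : ∀ j n → n ≢ j → shiftS j oneS n ≡ + 0
    miss zero zero ne = ⊥-elim (ne refl)
    miss zero (suc n) ne = refl
    miss (suc j) zero ne = refl
    miss (suc j) (suc n) ne = miss j n (λ e → ne (cong suc e))
    tail-same : Dec (n ≡ j) → factor (suc j) (suc n) ≡ Z.- shiftS j oneS n
    tail-same (yes refl) = cong (λ b → if b then Z.- (+ 1) else + 0) (dec-true (suc n N.≟ suc j) refl) ⟫ cong Z.-_ (sym (hit j))
    tail-same (no ne) = cong (λ b → if b then Z.- (+ 1) else + 0) (dec-false (suc n N.≟ suc j) (λ e → ne (N.suc-injective e))) ⟫ cong Z.-_ (sym (miss j n ne))

-- Sums of Laurent series and their convergence

∑ᴸ : (ℕ → Laurent) → ℕ → Laurent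
∑ᴸ F zero = 0#
∑ᴸ F (suc n) = ∑ᴸ F n + F n

∑ᴸ-cong : ∀ {F G} n → (∀ k → k N.< n → F k ≃ G k) → ∑ᴸ F n ≃ ∑ᴸ G n
∑ᴸ-cong zero e = ≈-refl
∑ᴸ-cong (suc n) e = +-cong (∑ᴸ-cong n (λ k k<n → e k (N.m<n⇒m<1+n k<n))) (e n N.≤-refl)

∑ᴸ-+ : ∀ F G n → ∑ᴸ (λ k → F k + G k) n ≃ ∑ᴸ F n + ∑ᴸ G n
∑ᴸ-+ F G zero = ≈-sym (+-identityˡ 0#)
∑ᴸ-+ F G (suc n) = +-congʳ (∑ᴸ-+ F G n) ⨾ ring! 4 (∑ᴸ F n) (∑ᴸ G n) (F n) (G n) (λ a b c d → (a :+ b) :+ (c :+ d) , (a :+ c) :+ (b :+ d))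

∑ᴸ-*ʳ : ∀ F x n → ∑ᴸ F n * x ≃ ∑ᴸ (λ k → F k * x) n
∑ᴸ-*ʳ F x zero = zeroˡ x
∑ᴸ-*ʳ F x (suc n) = distribʳ x _ _ ⨾ +-congʳ (∑ᴸ-*ʳ F x n)

∑ᴸ-front : ∀ F n → ∑ᴸ F (suc n) ≃ F 0 + ∑ᴸ (λ k → F (suc k)) n
∑ᴸ-front F zero = +-comm 0# (F 0)
∑ᴸ-front F (suc n) = +-congʳ (∑ᴸ-front F n) ⨾ +-assoc _ _ _

∑ᴸ-agr : ∀ {N F G} n → (∀ k → k N.< n → Agr N (F k) (G k)) → Agr N (∑ᴸ F n) (∑ᴸ G n)
∑ᴸ-agr zero a = agr-≈ ≈-refl
∑ᴸ-agr (suc n) a = agr-+ (∑ᴸ-agr n (λ k k<n → a k (N.m<n⇒m<1+n k<n))) (a n N.≤-refl)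

∑ᴸ-int : ∀ {F} → (∀ k → Int (F k)) → ∀ n → Int (∑ᴸ F n)
∑ᴸ-int i zero = int-0
∑ᴸ-int i (suc n) = int-+ (∑ᴸ-int i n) (i n)

record Low (k : ℕ) (f : Laurent) : Set where
  constructor low
  field
    {body} : Laurent
    body-int : Int body
    low≈ : f ≃ q^ k * body
open Low

low-int : ∀ {k f} → Low k f → Int f
low-int {k} (low i e) = int-cong (≈-sym e) (int-* (int-q k) i)

low-agr : ∀ {k f} → Low k f → Agr k f 0#
low-agr (low i e) = agr i (e ⨾ ≈-sym (+-identityˡ _))

low-+ : ∀ {k f g} → Low k f → Low k g → Low k (f + g)
low-+ (low i e) (low i′ e′) = low (int-+ i i′) (+-cong e e′ ⨾ ≈-sym (distribˡ _ _ _))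

low-*ˡ : ∀ {k f g} → Int g → Low k f → Low k (g * f)
low-*ˡ {k} {f} {g} j (low {h} i e) = low (int-* j i) (*-congˡ e ⨾ ring! 3 g (q^ k) h (λ g q h → g :* (q :* h) , q :* (g :* h)))

low-q : ∀ {k n} → k N.≤ n → Low k (q^ n)
low-q {k} {n} le = low (int-q (n N.∸ k)) (≈-sym (q^-+ k (n N.∸ k) ⨾ reflexive (cong q^ (N.m+[n∸m]≡n le))))

stable-∑ : ∀ {F} → (∀ k → Low k (F k)) → Stable (∑ᴸ F)
stable-∑ l = record { stable-int = ∑ᴸ-int (λ k → low-int (l k)) ; stable-step = λ n → agr-trans (agr-+ (agr-≈ ≈-refl) (low-agr (l n))) (agr-≈ (+-identityʳ _)) }

agr-q : ∀ k {N f g} → Agr N f g → Agr (k N.+ N) (q^ k * f) (q^ k * g)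
agr-q k {N} {f} {g} (agr {h} i e) = agr i (*-congˡ e ⨾ distribˡ _ _ _ ⨾ +-congˡ (≈-sym (*-assoc _ _ _) ⨾ *-congʳ (q^-+ k N)))

ginv-inv : ∀ m → 0 N.< m → ginv m * one-q m ≃ 1#
ginv-inv (suc j) _ = ginv-inverse j

-- Finite q-factorials in base qᶜ and a common finite form of two product identities

module Poch (c : ℕ) .{{nz : N.NonZero c}} where

  Q : ℕ → Laurent
  Q k = q^ (c N.* k)

  Q-+ : ∀ m n → Q m * Q n ≃ Q (m N.+ n)
  Q-+ m n = q^-+ _ _ ⨾ reflexive (cong q^ (sym (N.*-distribˡ-+ c m n)))

  Q0 : Q 0 ≃ 1#
  Q0 = reflexive (cong q^ (N.*-zeroʳ c)) ⨾ q^0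

  poch inv : ℕ → Laurent
  poch = ℙₙ c c
  inv = ∏ (λ i → ginv (c N.* i N.+ c))

  fac≈ : ∀ i → fac c c i ≃ 1# - Q (suc i)
  fac≈ i = reflexive (cong one-q (trans (N.+-comm (c N.* i) c) (sym (N.*-suc c i))))

  pos : ∀ i → 0 N.< c N.* i N.+ c
  pos i = N.<-≤-trans (N.>-nonZero⁻¹ c) (N.m≤n+m c (c N.* i))

  inv-suc : ∀ n → inv n ≃ (1# - Q (suc n)) * inv (suc n)
  inv-suc n = mod! 4 (inv n) (ginv (c N.* n N.+ c)) (fac c c n) (1# - Q (suc n)) (λ i g o p → (i , p :* (i :* g)) , (:- i , g :* o , 𝟙) ∷ (i :* g , o , p) ∷ [])
    (ginv-inv _ (pos n) , fac≈ n)

  inv-poch : ∀ n → inv n * poch n ≃ 1#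
  inv-poch zero = *-identityˡ 1#
  inv-poch (suc n) = mod! 4 (inv n) (ginv (c N.* n N.+ c)) (fac c c n) (poch n) (λ i g o p → ((i :* g) :* (p :* o) , 𝟙) , (g :* o , i :* p , 𝟙) ∷ (𝟙 , g :* o , 𝟙) ∷ [])
    (inv-poch n , ginv-inv _ (pos n))

  inv-int : ∀ n → Int (inv n)
  inv-int = ∏-int (λ i → ginv-int (c N.* i N.+ c))

  inv-stable : Stable inv
  inv-stable = stable-∏ (λ i → ginv-int (c N.* i N.+ c)) (λ i → agr-weaken (N.≤-trans (N.m≤n*m i c) (N.m≤m+n _ c)) (one-agr _ (pos i)))
    where
    one-agr : ∀ m → 0 N.< m → Agr m (ginv m) 1#
    one-agr m 0<m = agr (ginv-int m) (mod! 2 (ginv m) (q^ m) (λ g q → (g , 𝟙 :+ q :* g) , (𝟙 , g :* (𝟙 :- q) , 𝟙) ∷ []) (ginv-inv m 0<m))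

  inv∞ E : Laurent
  inv∞ = lim inv
  E = ℙ c c

  inv∞-E : inv∞ * E ≃ 1#
  inv∞-E = agr-all (λ n → agr-trans (agr-* (lim-int _) (stable-int (ℙ-stable c c) n) (lim-agr inv-stable n) (lim-agr (ℙ-stable c c) n)) (agr-≈ (inv-poch n)))

-- A finite form of the triple product and of Jacobi's identity: the sum
-- S n = Σ_{k ≤ n} M k / ((q)_{n−k} (q)_{n+k+1}) in base q^c satisfies a
-- first order recurrence in n.
module Closed (c : ℕ) .{{nz : N.NonZero c}} (M f : ℕ → Laurent)
    (M-low : ∀ k → Low k (M k)) (f-int : ∀ n → Int (f n)) (f-agr : ∀ n → Agr n (f n) 1#)
    (rec : ∀ n k → k N.≤ n → M k * f n ≃ M k * (1# + q^ (c N.* (2 N.+ (n N.+ n)))) + q^ (c N.* (n N.∸ k)) * M (suc k) + q^ (c N.* (suc n N.+ k)) * M (k N.∸ 1)) where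

  open Poch c

  -- The inverse of (Q; Q)ₙ₋ₖ for k ≤ n, and 0 for k > n, so that sums may run past n.
  iv : ℕ → ℕ → Laurent
  iv n zero = inv n
  iv zero (suc k) = 0#
  iv (suc n) (suc k) = iv n k

  iv-up : ∀ n k → k N.≤ n → iv n k ≃ (1# - Q (suc n N.∸ k)) * iv (suc n) k
  iv-up n zero _ = inv-suc n
  iv-up (suc n) (suc k) (N.s≤s k≤n) = iv-up n k k≤n

  iv-right : ∀ n k → k N.≤ n → iv n (suc k) ≃ (1# - Q (n N.∸ k)) * iv n k
  iv-right zero zero _ = ≈-sym (*-congʳ (+-congˡ (-‿cong Q0) ⨾ -‿inverseʳ 1#) ⨾ zeroˡ _)
  iv-right (suc n) zero _ = inv-suc n
  iv-right (suc n) (suc k) (N.s≤s k≤n) = iv-right n k k≤n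

  iv-zero : ∀ n k → n N.< k → iv n k ≃ 0#
  iv-zero zero (suc k) _ = ≈-refl
  iv-zero (suc n) (suc k) (N.s≤s n<k) = iv-zero n k n<k

  iv-diag : ∀ n k → k N.≤ n → iv n k ≃ inv (n N.∸ k)
  iv-diag n zero _ = ≈-refl
  iv-diag (suc n) (suc k) (N.s≤s k≤n) = iv-diag n k k≤n

  C : ℕ → ℕ → Laurent
  C n k = iv n k * inv (suc (n N.+ k))

  D : ℕ → Laurent
  D n = (1# - Q (2 N.+ (n N.+ n))) * (1# - Q (3 N.+ (n N.+ n)))

  -- The coefficient at k - 1. Since 1/((Q)ₙ₋ₖ (Q)ₙ₊ₖ₊₁) is symmetric under k ↦ -k - 1, its value at
  -- k = -1 is `C n 0`; the truncated `k N.∸ 1` in the hypothesis on M expresses the same symmetry.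
  C⁻ : ℕ → ℕ → Laurent
  C⁻ n zero = C n 0
  C⁻ n (suc k) = C n k

  -- For k ≤ n every term is a multiple of `C (suc n) k`, and dividing it out leaves a polynomial
  -- identity in X = Q^(n+1-k), Y = Q^(n+2+k) and neighbouring powers, where X Y = Q^(2n+3).
  C-rec : ∀ n k → k N.≤ suc n → D n * C (suc n) k ≃ (1# + Q (2 N.+ (n N.+ n))) * C n k + Q (2 N.+ n N.+ k) * C n (suc k) + Q (suc n N.∸ k) * C⁻ n k
  C-rec n k k≤ = go (N.≤⇒≤′ k≤)
    where
    inner : ∀ n k → k N.≤ n → C⁻ n k ≃ iv (suc n) k * inv (n N.+ k) →
            D n * C (suc n) k ≃ (1# + Q (2 N.+ (n N.+ n))) * C n k + Q (2 N.+ n N.+ k) * C n (suc k) + Q (suc n N.∸ k) * C⁻ n k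
    inner n k k≤n C⁻≈ = mod! 14 (Q (2 N.+ (n N.+ n))) (Q (3 N.+ (n N.+ n))) X X′ Y Y′ I J (iv n k) (iv n (suc k)) (inv (suc (n N.+ k))) (inv (n N.+ k)) (inv (suc (n N.+ suc k))) (C⁻ n k)
      (λ S T X X′ Y Y′ I J i₀ i₁ j₁ j₀ j₂ c →
        ((𝟙 :- S) :* (𝟙 :- T) :* (I :* J) , (𝟙 :+ S) :* (i₀ :* j₁) :+ Y :* (i₁ :* j₂) :+ X :* c) ,
        (:- (𝟙 :- T :+ (𝟙 :- X) :* (𝟙 :- Y)) :* (I :* J) , S , X :* Y′) ∷
        (:- (𝟙 :- X :* Y′) :* (I :* J) , T , X :* Y) ∷
        (:- (𝟙 :+ S) :* j₁ , i₀ , (𝟙 :- X) :* I) ∷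
        (:- ((𝟙 :+ S) :* (𝟙 :- X) :* I :+ X :* I :* (𝟙 :- Y′)) , j₁ , (𝟙 :- Y) :* J) ∷
        (:- (Y :* j₂) , i₁ , (𝟙 :- X′) :* i₀) ∷
        (:- (Y :* j₂ :* (𝟙 :- X′)) , i₀ , (𝟙 :- X) :* I) ∷
        (:- (Y :* (𝟙 :- X′) :* (𝟙 :- X) :* I) , j₂ , J) ∷
        (:- X , c , I :* j₀) ∷
        (:- (X :* I) , j₀ , (𝟙 :- Y′) :* j₁) ∷
        ((𝟙 :- X) :* (I :* J) , X′ :* Y , X :* Y′) ∷ [])
      ( ≈-sym (Q-+ (suc n N.∸ k) (suc n N.+ k) ⨾ reflexive (cong Q (trans (sym (N.+-assoc (suc n N.∸ k) (suc n) k)) (trans (cong (N._+ k) (N.+-comm (suc n N.∸ k) (suc n))) (trans (N.+-assoc (suc n) (suc n N.∸ k) k) (trans (cong (suc n N.+_) (N.m∸n+n≡m (N.m≤n⇒m≤1+n k≤n))) (N.+-suc (suc n) n)))))))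
      , ≈-sym (Q-+ (suc n N.∸ k) (2 N.+ n N.+ k) ⨾ reflexive (cong Q (trans (sym (N.+-assoc (suc n N.∸ k) (2 N.+ n) k)) (trans (cong (N._+ k) (N.+-comm (suc n N.∸ k) (2 N.+ n))) (trans (N.+-assoc (2 N.+ n) (suc n N.∸ k) k) (trans (cong (2 N.+ n N.+_) (N.m∸n+n≡m (N.m≤n⇒m≤1+n k≤n))) (N.+-suc (2 N.+ n) n)))))))
      , iv-up n k k≤n , inv-suc (suc (n N.+ k)) , iv-right n k k≤n , iv-up n k k≤n , reflexive (cong inv (cong suc (N.+-suc n k))) , C⁻≈ , inv-suc (n N.+ k)
      , Q-+ (n N.∸ k) (2 N.+ n N.+ k) ⨾ reflexive (cong Q (trans (N.+-suc (n N.∸ k) (suc n N.+ k)) (cong (N._+ (suc n N.+ k)) (sym (N.+-∸-assoc 1 k≤n))))) ⨾ ≈-sym (Q-+ (suc n N.∸ k) (suc n N.+ k)))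
      where
      X = Q (suc n N.∸ k)
      X′ = Q (n N.∸ k)
      Y = Q (2 N.+ n N.+ k)
      Y′ = Q (suc n N.+ k)
      I = iv (suc n) k
      J = inv (suc (suc n N.+ k))
    C⁻-eq : ∀ k → C⁻ n k ≃ iv (suc n) k * inv (n N.+ k)
    C⁻-eq zero = *-comm _ _ ⨾ reflexive (cong₂ (λ a b → inv (suc a) * inv b) (N.+-identityʳ n) (sym (N.+-identityʳ n)))
    C⁻-eq (suc k) = *-congˡ (reflexive (cong inv (sym (N.+-suc n k))))
    go : ∀ {k} → k N.≤′ suc n → D n * C (suc n) k ≃ (1# + Q (2 N.+ (n N.+ n))) * C n k + Q (2 N.+ n N.+ k) * C n (suc k) + Q (suc n N.∸ k) * C⁻ n k
    go {k} (N.≤′-step k≤′) = inner n k (N.≤′⇒≤ k≤′) (C⁻-eq k)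
    -- The case k = n + 1, where `C n k` and `C n (suc k)` vanish and only the term at k - 1
    -- survives.
    go N.≤′-refl = mod! 11 (Q (2 N.+ (n N.+ n))) (Q (3 N.+ (n N.+ n))) (iv n n) (inv (suc (suc (n N.+ suc n)))) (inv (suc (suc (suc (n N.+ n))))) (inv (suc (suc (n N.+ n)))) (inv (suc (n N.+ n))) (C n (suc n)) (C n (2 N.+ n)) (Q (2 N.+ n N.+ suc n)) (Q (n N.∸ n))
      (λ S T d j₀ j₃ j₂ j₁ a b R o → ((𝟙 :- S) :* (𝟙 :- T) :* (d :* j₀) , (𝟙 :+ S) :* a :+ R :* b :+ o :* (d :* j₁)) ,
        ((𝟙 :- S) :* (𝟙 :- T) :* d , j₀ , j₃) ∷ (:- ((𝟙 :- S) :* d) , j₂ , (𝟙 :- T) :* j₃) ∷ (:- d , j₁ , (𝟙 :- S) :* j₂) ∷ (:- (𝟙 :+ S) , a , 𝟘) ∷ (:- R , b , 𝟘) ∷ (:- (d :* j₁) , o , 𝟙) ∷ [])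
      ( reflexive (cong inv (cong (λ x → suc (suc x)) (N.+-suc n n))) , inv-suc (suc (suc (n N.+ n))) , inv-suc (suc (n N.+ n))
      , *-congʳ (iv-zero n (suc n) N.≤-refl) ⨾ zeroˡ _ , *-congʳ (iv-zero n (2 N.+ n) (N.n≤1+n _)) ⨾ zeroˡ _
      , reflexive (cong Q (N.n∸n≡0 n)) ⨾ Q0)

  S : ℕ → Laurent
  S n = ∑ᴸ (λ k → M k * C n k) (suc n)

  -- `C-rec` is weighted by M k and the sums are shifted so that everything multiplies `C n k`,
  -- whose coefficient is then the right-hand side of `rec`. At the lower end the reflected term
  -- closes the sum; beyond n the terms vanish.
  S-rec : ∀ n → D n * S (suc n) ≃ f n * S n
  S-rec n = begin
    D n * ∑ᴸ (λ k → M k * C (suc n) k) (2 N.+ n) ≈⟨ *-comm _ _ ⨾ ∑ᴸ-*ʳ _ (D n) (2 N.+ n) ⟩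
    ∑ᴸ (λ k → M k * C (suc n) k * D n) (2 N.+ n) ≈⟨ ∑ᴸ-cong (2 N.+ n) (λ k k< → expand k (N.≤-pred k<) ⨾ ≈-sym (+-assoc _ _ _)) ⟩
    ∑ᴸ (λ k → a k + B k + Γ k) (2 N.+ n) ≈⟨ ∑ᴸ-+ (λ k → a k + B k) Γ (2 N.+ n) ⨾ +-congʳ (∑ᴸ-+ a B (2 N.+ n)) ⟩
    ∑ᴸ a (2 N.+ n) + ∑ᴸ B (2 N.+ n) + ∑ᴸ Γ (2 N.+ n) ≈⟨ +-cong (+-congʳ (+-congˡ (last-a) ⨾ +-identityʳ _)) (∑ᴸ-front Γ (suc n)) ⟩
    ∑ᴸ a (suc n) + ∑ᴸ B (2 N.+ n) + (Γ 0 + ∑ᴸ (λ k → Γ (suc k)) (suc n))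
      ≈⟨ ring! 4 (∑ᴸ a (suc n)) (∑ᴸ B (2 N.+ n)) (Γ 0) (∑ᴸ (λ k → Γ (suc k)) (suc n)) (λ a b g h → a :+ b :+ (g :+ h) , a :+ h :+ (g :+ b)) ⟩
    ∑ᴸ a (suc n) + ∑ᴸ (λ k → Γ (suc k)) (suc n) + (Γ 0 + ∑ᴸ B (2 N.+ n))
      ≈⟨ +-congˡ (+-cong Γ₀≈β₀ (∑ᴸ-cong (2 N.+ n) (λ k _ → B≈β k)) ⨾ ≈-sym (∑ᴸ-front β (2 N.+ n)) ⨾ +-cong (+-congˡ (zero-β (suc n) N.≤-refl) ⨾ +-identityʳ _) (zero-β (2 N.+ n) (N.n≤1+n _)) ⨾ +-identityʳ _) ⟩
    ∑ᴸ a (suc n) + ∑ᴸ (λ k → Γ (suc k)) (suc n) + ∑ᴸ β (suc n)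
      ≈⟨ ≈-sym (∑ᴸ-+ (λ k → a k + Γ (suc k)) β (suc n) ⨾ +-congʳ (∑ᴸ-+ a (λ k → Γ (suc k)) (suc n))) ⟩
    ∑ᴸ (λ k → a k + Γ (suc k) + β k) (suc n) ≈⟨ ∑ᴸ-cong (suc n) (λ k k< → collect k (N.≤-pred k<)) ⟩
    ∑ᴸ (λ k → M k * C n k * f n) (suc n) ≈⟨ ≈-sym (∑ᴸ-*ʳ _ (f n) (suc n)) ⨾ *-comm _ _ ⟩
    f n * S n ∎
    where
    a B Γ β : ℕ → Laurent
    a k = M k * ((1# + Q (2 N.+ (n N.+ n))) * C n k)
    B k = M k * (Q (2 N.+ n N.+ k) * C n (suc k))
    Γ k = M k * (Q (suc n N.∸ k) * C⁻ n k)
    β k = M (k N.∸ 1) * (Q (suc n N.+ k) * C n k)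
    Γ₀≈β₀ : Γ 0 ≃ β 0
    Γ₀≈β₀ = reflexive (cong (λ m → M 0 * (Q (suc m) * C n 0)) (sym (N.+-identityʳ n)))
    B≈β : ∀ k → B k ≃ β (suc k)
    B≈β k = reflexive (cong (λ m → M k * (Q (suc m) * C n (suc k))) (sym (N.+-suc n k)))
    C-zero : ∀ k → n N.< k → C n k ≃ 0#
    C-zero k n<k = *-congʳ (iv-zero n k n<k) ⨾ zeroˡ _
    last-a : a (suc n) ≃ 0#
    last-a = *-congˡ (*-congˡ (C-zero (suc n) N.≤-refl) ⨾ zeroʳ _) ⨾ zeroʳ _
    zero-β : ∀ k → n N.< k → β k ≃ 0#
    zero-β k n<k = *-congˡ (*-congˡ (C-zero k n<k) ⨾ zeroʳ _) ⨾ zeroʳ _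
    expand : ∀ k → k N.≤ suc n → M k * C (suc n) k * D n ≃ a k + (B k + Γ k)
    expand k k≤ = mod! 6 (M k) (C (suc n) k) (D n) ((1# + Q (2 N.+ (n N.+ n))) * C n k) (Q (2 N.+ n N.+ k) * C n (suc k)) (Q (suc n N.∸ k) * C⁻ n k)
      (λ m c d x y z → (m :* c :* d , m :* x :+ (m :* y :+ m :* z)) , (m , d :* c , x :+ y :+ z) ∷ []) (C-rec n k k≤)
    collect : ∀ k → k N.≤ n → a k + Γ (suc k) + β k ≃ M k * C n k * f n
    collect k k≤n = mod! 8 (M k) (M (suc k)) (M (k N.∸ 1)) (1# + Q (2 N.+ (n N.+ n))) (C n k) (Q (n N.∸ k)) (Q (suc n N.+ k)) (f n)
      (λ m m₁ m₀ o c x y f → (m :* (o :* c) :+ m₁ :* (x :* c) :+ m₀ :* (y :* c) , m :* c :* f) , (:- c , m :* f , m :* o :+ x :* m₁ :+ y :* m₀) ∷ []) (rec n k k≤n)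

  finite : ∀ n → S n * poch (suc (n N.+ n)) ≃ M 0 * ∏ f n
  finite zero = mod! 3 (M 0) (inv 1) (poch 1) (λ m i p → ((𝟘 :+ m :* (𝟙 :* i)) :* p , m :* 𝟙) , (m , i :* p , 𝟙) ∷ []) (inv-poch 1)
  finite (suc n) = begin
    S (suc n) * poch (suc (suc n N.+ suc n)) ≡⟨ cong (λ m → S (suc n) * poch (suc m)) (cong suc (N.+-suc n n)) ⟩
    S (suc n) * (poch (suc (n N.+ n)) * fac c c (suc (n N.+ n)) * fac c c (suc (suc (n N.+ n))))
      ≈⟨ mod! 8 (S (suc n)) (S n) (poch (suc (n N.+ n))) (fac c c (suc (n N.+ n))) (fac c c (suc (suc (n N.+ n)))) (1# - Q (2 N.+ (n N.+ n))) (1# - Q (3 N.+ (n N.+ n))) (f n)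
           (λ t s p a b x y f → (t :* (p :* a :* b) , s :* p :* f) , (t :* p :* b , a , x) ∷ (t :* p :* x , b , y) ∷ (p , x :* y :* t , f :* s) ∷ []) (fac≈ (suc (n N.+ n)) , fac≈ (suc (suc (n N.+ n))) , S-rec n) ⟩
    S n * poch (suc (n N.+ n)) * f n ≈⟨ *-congʳ (finite n) ⟩
    M 0 * ∏ f n * f n ≈⟨ *-assoc _ _ _ ⟩
    M 0 * ∏ f (suc n) ∎

  -- The limit of `finite`: each `C n k` tends to 1/E² and (Q)₂ₙ₊₁ to E. The precision n - k of
  -- `C n k` is compensated by the divisibility of M k by qᵏ.
  closed : lim (∑ᴸ M) ≃ E * (M 0 * lim (∏ f))
  closed = mod! 4 (lim (∑ᴸ M)) inv∞ E (M 0 * lim (∏ f)) (λ θ i e x → (θ , e :* x) , (:- (θ :* (i :* e :+ 𝟙)) , i :* e , 𝟙) ∷ (e , θ :* (i :* i) :* e , x) ∷ []) (inv∞-E , all-n)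
    where
    M-int : ∀ k → Int (M k)
    M-int k = low-int (M-low k)
    C-agr : ∀ n k → k N.≤ n → Agr (n N.∸ k) (inv∞ * inv∞) (C n k)
    C-agr n k k≤n = agr-* (lim-int _) (inv-int (suc (n N.+ k))) (agr-trans (lim-agr inv-stable (n N.∸ k)) (agr-≈ (≈-sym (iv-diag n k k≤n))))
      (agr-weaken (N.≤-trans (N.m∸n≤m n k) (N.≤-trans (N.m≤m+n n k) (N.n≤1+n _))) (lim-agr inv-stable (suc (n N.+ k))))
    term-agr : ∀ n k → k N.≤ n → Agr n (M k * (inv∞ * inv∞)) (M k * C n k)
    term-agr n k k≤n = agr-trans (agr-≈ (*-congʳ (low≈ (M-low k)) ⨾ *-assoc _ _ _))
      (agr-trans (subst (λ N → Agr N (q^ k * (body (M-low k) * (inv∞ * inv∞))) (q^ k * (body (M-low k) * C n k))) (N.m+[n∸m]≡n k≤n)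
        (agr-q k (agr-* (body-int (M-low k)) (int-cong (≈-sym (*-congʳ (iv-diag n k k≤n))) (int-* (inv-int (n N.∸ k)) (inv-int (suc (n N.+ k))))) (agr-≈ ≈-refl) (C-agr n k k≤n))))
        (agr-≈ (≈-sym (*-congʳ (low≈ (M-low k)) ⨾ *-assoc _ _ _))))
    S-agr : ∀ n → Agr n (lim (∑ᴸ M) * (inv∞ * inv∞)) (S n)
    S-agr n = agr-trans (agr-* (lim-int _) (int-* (lim-int _) (lim-int _)) (agr-weaken (N.n≤1+n n) (lim-agr (stable-∑ M-low) (suc n))) (agr-≈ ≈-refl))
      (agr-trans (agr-≈ (∑ᴸ-*ʳ M (inv∞ * inv∞) (suc n))) (∑ᴸ-agr (suc n) (λ k k< → term-agr n k (N.≤-pred k<))))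
    all-n : lim (∑ᴸ M) * (inv∞ * inv∞) * E ≃ M 0 * lim (∏ f)
    all-n = agr-all (λ n → agr-trans (agr-* (int-* (lim-int _) (int-* (lim-int _) (lim-int _))) (stable-int (ℙ-stable c c) (suc (n N.+ n))) (S-agr n)
        (agr-weaken (N.≤-trans (N.m≤m+n n n) (N.n≤1+n _)) (lim-agr (ℙ-stable c c) (suc (n N.+ n)))))
      (agr-trans (agr-≈ (finite n)) (agr-* (M-int 0) (lim-int _) (agr-≈ ≈-refl) (agr-sym (lim-agr (stable-∏ f-int f-agr) n)))))

-- One-sided theta series and their dissection modulo 7

tri : ℕ → ℕ
tri zero = 0
tri (suc k) = tri k N.+ k

sg : ℕ → Laurent
sg zero = 1#
sg (suc k) = - sg k

sg-int : ∀ k → Int (sg k)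
sg-int zero = int-1
sg-int (suc k) = int-neg (sg-int k)

-- fam μ ν α b γ stands for Σ_{k ≥ 0} (−1)ᵏ (μ k + ν) q^{α k(k−1)/2 + (b+1) k + γ}.
record Fam : Set where
  constructor fam
  field
    μ ν : ℤ
    α b γ : ℕ

expo : Fam → ℕ → ℕ
expo (fam μ ν α b γ) k = α N.* tri k N.+ suc b N.* k N.+ γ

weight : Fam → ℕ → ℤ
weight (fam μ ν α b γ) k = μ Z.* + k Z.+ ν

termF : Fam → ℕ → Laurent
termF F k = sg k * (ι (weight F k) * q^ (expo F k))

expo-≥ : ∀ F k → k N.≤ expo F k
expo-≥ (fam μ ν α b γ) k = N.≤-trans (N.m≤m+n k (b N.* k)) (N.≤-trans (N.m≤n+m (suc b N.* k) (α N.* tri k)) (N.m≤m+n _ γ))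

term-low : ∀ F k → Low k (termF F k)
term-low F k = low-*ˡ (sg-int k) (low-*ˡ (int-ι (weight F k)) (low-q (expo-≥ F k)))

opaque
  ⟪_⟫ : Fam → Laurent
  ⟪ F ⟫ = lim (∑ᴸ (termF F))

  ⟪⟫≡lim : ∀ F → ⟪ F ⟫ ≡ lim (∑ᴸ (termF F))
  ⟪⟫≡lim F = refl

  fam-agr : ∀ F n → Agr n ⟪ F ⟫ (∑ᴸ (termF F) n)
  fam-agr F = lim-agr (stable-∑ (term-low F))

  fam-unique : ∀ F {f} → (∀ n → Agr n f (∑ᴸ (termF F) n)) → f ≃ ⟪ F ⟫
  fam-unique F = lim-unique (stable-∑ (term-low F))

lim-two : ∀ F G → lim (∑ᴸ (λ k → termF F k + termF G k)) ≃ ⟪ F ⟫ + ⟪ G ⟫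
lim-two F G = agr-all (λ n → agr-trans (lim-agr (stable-∑ (λ k → low-+ (term-low F k) (term-low G k))) n)
  (agr-trans (agr-≈ (∑ᴸ-+ (termF F) (termF G) n)) (agr-sym (agr-+ (fam-agr F n) (fam-agr G n)))))

∑ᴸ-split : ∀ F p m → ∑ᴸ F (p N.+ m) ≃ ∑ᴸ F p + ∑ᴸ (λ i → F (p N.+ i)) m
∑ᴸ-split F p zero = reflexive (cong (∑ᴸ F) (N.+-identityʳ p)) ⨾ ≈-sym (+-identityʳ _)
∑ᴸ-split F p (suc m) = reflexive (cong (∑ᴸ F) (N.+-suc p m)) ⨾ +-congʳ (∑ᴸ-split F p m) ⨾ +-assoc _ _ _

∑ᴸ-zero : ∀ n → ∑ᴸ (λ _ → 0#) n ≃ 0#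
∑ᴸ-zero zero = ≈-refl
∑ᴸ-zero (suc n) = +-identityʳ _ ⨾ ∑ᴸ-zero n

∑ᴸ-regroup : ∀ m F n → ∑ᴸ F (n N.* m) ≃ ∑ᴸ (λ r → ∑ᴸ (λ j → F (j N.* m N.+ r)) n) m
∑ᴸ-regroup m F zero = ≈-sym (∑ᴸ-zero m)
∑ᴸ-regroup m F (suc n) = reflexive (cong (∑ᴸ F) (N.+-comm m (n N.* m))) ⨾ ∑ᴸ-split F (n N.* m) m
  ⨾ +-congʳ (∑ᴸ-regroup m F n) ⨾ ≈-sym (∑ᴸ-+ (λ r → ∑ᴸ (λ j → F (j N.* m N.+ r)) n) (λ r → F (n N.* m N.+ r)) m)

sgℤ : ℕ → ℤ
sgℤ zero = + 1
sgℤ (suc k) = Z.- sgℤ k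

ι-sg : ∀ k → ι (sgℤ k) ≃ sg k
ι-sg zero = ι-1
ι-sg (suc k) = ι-neg (sgℤ k) ⨾ -‿cong (ι-sg k)

-- The part with indices 7j + r. Since (-1)^(7j+r) = (-1)ʲ (-1)ʳ, the constant sign is moved into
-- the weight.
sub : ℕ → Fam → Fam
sub r (fam μ ν α b γ) = fam (sgℤ r Z.* (μ Z.* + 7)) (sgℤ r Z.* (μ Z.* + r Z.+ ν)) (49 N.* α) (α N.* (7 N.* r N.+ 21) N.+ (7 N.* b N.+ 6)) (α N.* tri r N.+ suc b N.* r N.+ γ)

tri-7 : ∀ j r → tri (j N.* 7 N.+ r) ≡ 49 N.* tri j N.+ (7 N.* r N.+ 21) N.* j N.+ tri r
tri-7 zero r = sym (cong (N._+ tri r) (N.*-zeroʳ (7 N.* r N.+ 21)))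
tri-7 (suc j) r = trans (step (j N.* 7 N.+ r)) (trans (cong (λ x → x N.+ 7 N.* (j N.* 7 N.+ r) N.+ 21) (tri-7 j r))
  (solveℕ 4 (λ j r T t → (con' 49 *' T +' (con' 7 *' r +' con' 21) *' j +' t) +' con' 7 *' (j *' con' 7 +' r) +' con' 21
      =' con' 49 *' (T +' j) +' (con' 7 *' r +' con' 21) *' (con' 1 +' j) +' t) refl j r (tri j) (tri r)))
  where
  step : ∀ m → tri (7 N.+ m) ≡ tri m N.+ 7 N.* m N.+ 21
  step m = solveℕ 2 (λ t m → t +' m +' (con' 1 +' m) +' (con' 2 +' m) +' (con' 3 +' m) +' (con' 4 +' m) +' (con' 5 +' m) +' (con' 6 +' m) =' t +' con' 7 *' m +' con' 21) refl (tri m) m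

expo-7 : ∀ F r j → expo F (j N.* 7 N.+ r) ≡ expo (sub r F) j
expo-7 (fam μ ν α b γ) r j = trans (cong (λ x → α N.* x N.+ suc b N.* (j N.* 7 N.+ r) N.+ γ) (tri-7 j r))
  (solveℕ 7 (λ α b γ j r T t → α *' (con' 49 *' T +' (con' 7 *' r +' con' 21) *' j +' t) +' (con' 1 +' b) *' (j *' con' 7 +' r) +' γ
     =' con' 49 *' α *' T +' (con' 1 +' (α *' (con' 7 *' r +' con' 21) +' (con' 7 *' b +' con' 6))) *' j +' (α *' t +' (con' 1 +' b) *' r +' γ)) refl α b γ j r (tri j) (tri r))

sg-+ : ∀ m n → sg (m N.+ n) ≃ sg m * sg n
sg-+ zero n = ≈-sym (*-identityˡ _)
sg-+ (suc m) n = -‿cong (sg-+ m n) ⨾ -‿distribˡ-* _ _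

sg-7 : ∀ j → sg (j N.* 7) ≃ sg j
sg-7 zero = ≈-refl
sg-7 (suc j) = ring! 1 (sg (j N.* 7)) (λ s → :- :- :- :- :- :- :- s , :- s) ⨾ -‿cong (sg-7 j)

weight-7 : ∀ F r j → ι (weight (sub r F) j) ≃ sg r * ι (weight F (j N.* 7 N.+ r))
weight-7 (fam μ ν α b γ) r j = reflexive (cong ι eq) ⨾ ι-* (sgℤ r) (μ Z.* + (j N.* 7 N.+ r) Z.+ ν) ⨾ *-congʳ (ι-sg r)
  where
  eq : sgℤ r Z.* (μ Z.* + 7) Z.* + j Z.+ sgℤ r Z.* (μ Z.* + r Z.+ ν) ≡ sgℤ r Z.* (μ Z.* + (j N.* 7 N.+ r) Z.+ ν)
  eq = trans (ℤR.ring! 6 (sgℤ r) μ (+ 7) (+ j) (+ r) ν (λ s m c j r n → s :* (m :* c) :* j :+ s :* (m :* r :+ n) , s :* (m :* (j :* c :+ r) :+ n)))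
    (cong (λ x → sgℤ r Z.* (μ Z.* x Z.+ ν)) (cong (Z._+ + r) (sym (Z.pos-* j 7))))

term-7 : ∀ F r j → termF F (j N.* 7 N.+ r) ≃ termF (sub r F) j
term-7 F r j = *-cong (sg-+ (j N.* 7) r ⨾ *-congʳ (sg-7 j)) (*-congˡ (reflexive (cong q^ (expo-7 F r j))))
  ⨾ ring! 4 (sg j) (sg r) (ι (weight F (j N.* 7 N.+ r))) (q^ (expo (sub r F) j)) (λ s t w q → (s :* t) :* (w :* q) , s :* ((t :* w) :* q))
    ⨾ *-congˡ (*-congʳ (≈-sym (weight-7 F r j)))

fam-split : ∀ F → ⟪ F ⟫ ≃ ∑ᴸ (λ r → ⟪ sub r F ⟫) 7
fam-split F = agr-all (λ n → agr-trans (agr-weaken (N.m≤m*n n 7) (fam-agr F (n N.* 7)))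
  (agr-trans (agr-≈ (∑ᴸ-regroup 7 (termF F) n))
    (agr-trans (agr-≈ (∑ᴸ-cong 7 (λ r _ → ∑ᴸ-cong n (λ j _ → term-7 F r j)))) (agr-sym (∑ᴸ-agr 7 (λ r _ → fam-agr (sub r F) n))))))

V-sg : ∀ k .{{_ : N.NonZero k}} n → V k (sg n) ≃ sg n
V-sg k zero = V-one k
V-sg k (suc n) = V-neg k (sg n) ⨾ -‿cong (V-sg k n)

V-0 : ∀ k .{{_ : N.NonZero k}} → V k 0# ≃ 0#
V-0 k = x+x≈x⇒x≈0 _ (≈-sym (V-+ k 0# 0#) ⨾ V-cong k (+-identityˡ 0#))

V-ι : ∀ k .{{_ : N.NonZero k}} z → V k (ι z) ≃ ι z
V-ι k (+ n) = posit n
  where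
  posit : ∀ n → V k (ι (+ n)) ≃ ι (+ n)
  posit zero = V-cong k ι-0 ⨾ V-0 k ⨾ ≈-sym ι-0
  posit (suc n) = V-cong k (ι-+ (+ 1) (+ n)) ⨾ V-+ k _ _ ⨾ +-cong (V-cong k ι-1 ⨾ V-one k ⨾ ≈-sym ι-1) (posit n) ⨾ ≈-sym (ι-+ (+ 1) (+ n))
V-ι k -[1+ n ] = V-cong k (ι-neg (+ suc n)) ⨾ V-neg k _ ⨾ -‿cong (V-ι k (+ suc n)) ⨾ ≈-sym (ι-neg (+ suc n))

V-q^ : ∀ k .{{_ : N.NonZero k}} n → V k (q^ n) ≃ q^ (k N.* n)
V-q^ k n = V-q k (+ n) ⨾ reflexive (cong qᵐ (sym (Z.pos-* k n)))

V-∑ᴸ : ∀ k .{{_ : N.NonZero k}} F n → V k (∑ᴸ F n) ≃ ∑ᴸ (λ i → V k (F i)) n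
V-∑ᴸ k F zero = V-0 k
V-∑ᴸ k F (suc n) = V-+ k _ _ ⨾ +-congʳ (V-∑ᴸ k F n)

dilate : ℕ → Fam → Fam
dilate k (fam μ ν α b γ) = fam μ ν (suc k N.* α) (b N.+ k N.* suc b) (suc k N.* γ)

V-fam : ∀ k F → V (suc k) ⟪ F ⟫ ≃ ⟪ dilate k F ⟫
V-fam k F@(fam μ ν α b γ) = fam-unique (dilate k F) (λ n → agr-trans (agr-V (suc k) (fam-agr F n)) (agr-≈ (V-∑ᴸ (suc k) (termF F) n ⨾ ∑ᴸ-cong n (λ i _ → go i))))
  where
  go : ∀ i → V (suc k) (termF F i) ≃ termF (dilate k F) i
  go i = V-* (suc k) _ _ ⨾ *-cong (V-sg (suc k) i) (V-* (suc k) _ _ ⨾ *-cong (V-ι (suc k) _) (V-q^ (suc k) _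
    ⨾ reflexive (cong q^ (solveℕ 6 (λ k α b γ T i → (con' 1 +' k) *' (α *' T +' (con' 1 +' b) *' i +' γ) =' (con' 1 +' k) *' α *' T +' (con' 1 +' (b +' k *' (con' 1 +' b))) *' i +' (con' 1 +' k) *' γ) refl k α b γ (tri i) i))))

raise : ℕ → Fam → Fam
raise m (fam μ ν α b γ) = fam μ ν α b (m N.+ γ)

q^-fam : ∀ m F → q^ m * ⟪ F ⟫ ≃ ⟪ raise m F ⟫
q^-fam m F@(fam μ ν α b γ) = fam-unique (raise m F) (λ n → agr-trans (agr-* (int-q m) (stable-int (stable-∑ (term-low F)) n) (agr-≈ ≈-refl) (fam-agr F n))
    (agr-≈ (*-comm _ _ ⨾ ∑ᴸ-*ʳ (termF F) (q^ m) n ⨾ ∑ᴸ-cong n (λ i _ → go i))))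
  where
  go : ∀ i → termF F i * q^ m ≃ termF (raise m F) i
  go i = ring! 4 (sg i) (ι (weight F i)) (q^ (expo F i)) (q^ m) (λ s w e m → (s :* (w :* e)) :* m , s :* (w :* (e :* m)))
    ⨾ *-congˡ (*-congˡ (q^-+ (expo F i) m ⨾ reflexive (cong q^ (trans (N.+-assoc _ γ m) (cong (α N.* tri i N.+ suc b N.* i N.+_) (N.+-comm γ m))))))

scaleF : ℤ → Fam → Fam
scaleF z (fam μ ν α b γ) = fam (z Z.* μ) (z Z.* ν) α b γ

ι-fam : ∀ z F → ι z * ⟪ F ⟫ ≃ ⟪ scaleF z F ⟫
ι-fam z F@(fam μ ν α b γ) = fam-unique (scaleF z F) (λ n → agr-trans (agr-* (int-ι z) (stable-int (stable-∑ (term-low F)) n) (agr-≈ ≈-refl) (fam-agr F n))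
    (agr-≈ (*-comm _ _ ⨾ ∑ᴸ-*ʳ (termF F) (ι z) n ⨾ ∑ᴸ-cong n (λ i _ → go i))))
  where
  go : ∀ i → termF F i * ι z ≃ termF (scaleF z F) i
  go i = ring! 4 (sg i) (ι (weight F i)) (q^ (expo F i)) (ι z) (λ s w e m → (s :* (w :* e)) :* m , s :* ((m :* w) :* e))
    ⨾ *-congˡ (*-congʳ (≈-sym (ι-* z (weight F i)) ⨾ reflexive (cong ι (ℤR.ring! 4 z μ ν (+ i) (λ z m n i → z :* (m :* i :+ n) , z :* m :* i :+ z :* n)))))

-- The linear coefficient is the fourth parameter plus one, here 7(b + 1); so all exponents are
-- congruent to γ modulo 7.
fam-cls : ∀ γ μ ν α b → Cls (+ γ) ⟪ fam μ ν (7 N.* α) (b N.+ 6 N.* suc b) γ ⟫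
fam-cls γ μ ν α b = cls ⟪ fam μ ν α b 0 ⟫ (≈-sym (*-congˡ (V-fam 6 (fam μ ν α b 0)) ⨾ q^-fam γ _ ⨾ reflexive (cong (λ g → ⟪ fam μ ν (7 N.* α) (b N.+ 6 N.* suc b) g ⟫) (N.+-identityʳ γ))))

-- Jacobi's triple product

∏-front : ∀ F n → ∏ F (suc n) ≃ F 0 * ∏ (λ i → F (suc i)) n
∏-front F zero = *-comm 1# (F 0)
∏-front F (suc n) = *-congʳ (∏-front F n) ⨾ *-assoc _ _ _

module Theta (a₀ b₀ : ℕ) where
  a b c : ℕ
  a = suc a₀
  b = suc b₀
  c = a N.+ b

  -- The two halves of the sum of (-1)ᵏ q^(c k(k-1)/2 + bk) over all integers: the indices k ≥ 0,
  -- and the negative ones written as -k - 1.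
  F₁ F₂ : Fam
  F₁ = fam +0 (+ 1) c b₀ 0
  F₂ = fam +0 −1 c (a N.+ a N.+ b₀) a

  -- M pairs the indices k and -k - 1, hence M(-1) = M(0) as `Closed` requires. One factor of f is
  -- shifted to n + 1 because M(0) = 1 - qᵃ supplies the missing one.
  M f : ℕ → Laurent
  M k = termF F₁ k + termF F₂ k
  f n = fac c a (suc n) * fac c b n

  Q : ℕ → Laurent
  Q k = q^ (c N.* k)

  A₁ A₂ : ℕ → Laurent
  A₁ k = q^ (expo F₁ k)
  A₂ k = q^ (expo F₂ k)

  M≈ : ∀ k → M k ≃ sg k * (A₁ k - A₂ k)
  M≈ k = mod! 5 (sg k) (ι (weight F₁ k)) (ι (weight F₂ k)) (A₁ k) (A₂ k) (λ s v w x y → (s :* (v :* x) :+ s :* (w :* y) , s :* (x :- y)) , (s :* x , v , # 1) ∷ (s :* y , w , con −1) ∷ [])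
    (reflexive (cong ι (cong (Z._+ + 1) (Z.*-zeroˡ (+ k)))) , reflexive (cong ι (cong (Z._+ −1) (Z.*-zeroˡ (+ k)))))

  R P : ℕ → Laurent
  R n = q^ (c N.* suc n N.+ a)
  P n = q^ (c N.* n N.+ b)

  shifted : ∀ x y z w → x N.+ y ≡ z N.+ w → q^ x * q^ y ≃ q^ z * q^ w
  shifted x y z w e = q^-+ x y ⨾ reflexive (cong q^ e) ⨾ ≈-sym (q^-+ z w)

  RP : ∀ n → R n * P n ≃ Q (2 N.+ (n N.+ n))
  RP n = q^-+ _ _ ⨾ reflexive (cong q^ (solveℕ 3 (λ a b n → ((a +' b) *' (con' 1 +' n) +' a) +' ((a +' b) *' n +' b) =' (a +' b) *' (con' 2 +' (n +' n))) refl a b n))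

  up₁ : ∀ m k n → m N.+ k ≡ n → Q m * A₁ (suc k) ≃ A₁ k * P n
  up₁ m k .(m N.+ k) refl = shifted _ _ _ _ (solveℕ 5 (λ a b m k T → (a +' (con' 1 +' b)) *' m +' ((a +' (con' 1 +' b)) *' (T +' k) +' (con' 1 +' b) *' (con' 1 +' k) +' con' 0)
      =' ((a +' (con' 1 +' b)) *' T +' (con' 1 +' b) *' k +' con' 0) +' ((a +' (con' 1 +' b)) *' (m +' k) +' (con' 1 +' b))) refl a b₀ m k (tri k))

  up₂ : ∀ m k n → m N.+ k ≡ n → Q m * A₂ (suc k) ≃ A₂ k * R n
  up₂ m k .(m N.+ k) refl = shifted _ _ _ _ (solveℕ 5 (λ a b m k T → (a +' (con' 1 +' b)) *' m +' ((a +' (con' 1 +' b)) *' (T +' k) +' (con' 1 +' (a +' a +' b)) *' (con' 1 +' k) +' a)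
      =' ((a +' (con' 1 +' b)) *' T +' (con' 1 +' (a +' a +' b)) *' k +' a) +' ((a +' (con' 1 +' b)) *' (con' 1 +' (m +' k)) +' a)) refl a b₀ m k (tri k))

  down₁ : ∀ k n → Q (suc n N.+ suc k) * A₁ k ≃ A₁ (suc k) * R n
  down₁ k n = shifted _ _ _ _ (solveℕ 5 (λ a b n k T → (a +' (con' 1 +' b)) *' (con' 1 +' n +' (con' 1 +' k)) +' ((a +' (con' 1 +' b)) *' T +' (con' 1 +' b) *' k +' con' 0)
      =' ((a +' (con' 1 +' b)) *' (T +' k) +' (con' 1 +' b) *' (con' 1 +' k) +' con' 0) +' ((a +' (con' 1 +' b)) *' (con' 1 +' n) +' a)) refl a b₀ n k (tri k))

  down₂ : ∀ k n → Q (suc n N.+ suc k) * A₂ k ≃ A₂ (suc k) * P n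
  down₂ k n = shifted _ _ _ _ (solveℕ 5 (λ a b n k T → (a +' (con' 1 +' b)) *' (con' 1 +' n +' (con' 1 +' k)) +' ((a +' (con' 1 +' b)) *' T +' (con' 1 +' (a +' a +' b)) *' k +' a)
      =' ((a +' (con' 1 +' b)) *' (T +' k) +' (con' 1 +' (a +' a +' b)) *' (con' 1 +' k) +' a) +' ((a +' (con' 1 +' b)) *' n +' (con' 1 +' b))) refl a b₀ n k (tri k))

  first₁ : ∀ n → Q (suc n N.+ 0) * A₁ 0 ≃ A₂ 0 * P n
  first₁ n = shifted _ _ _ _ (solveℕ 3 (λ a b n → (a +' (con' 1 +' b)) *' (con' 1 +' n +' con' 0) +' ((a +' (con' 1 +' b)) *' con' 0 +' (con' 1 +' b) *' con' 0 +' con' 0)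
      =' ((a +' (con' 1 +' b)) *' con' 0 +' (con' 1 +' (a +' a +' b)) *' con' 0 +' a) +' ((a +' (con' 1 +' b)) *' n +' (con' 1 +' b))) refl a b₀ n)

  first₂ : ∀ n → Q (suc n N.+ 0) * A₂ 0 ≃ A₁ 0 * R n
  first₂ n = shifted _ _ _ _ (solveℕ 3 (λ a b n → (a +' (con' 1 +' b)) *' (con' 1 +' n +' con' 0) +' ((a +' (con' 1 +' b)) *' con' 0 +' (con' 1 +' (a +' a +' b)) *' con' 0 +' a)
      =' ((a +' (con' 1 +' b)) *' con' 0 +' (con' 1 +' b) *' con' 0 +' con' 0) +' ((a +' (con' 1 +' b)) *' (con' 1 +' n) +' a)) refl a b₀ n)

  last-term : ∀ n k → Q (suc n N.+ k) * M (k N.∸ 1) ≃ sg k * (A₂ k * P n - A₁ k * R n)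
  last-term n zero = mod! 6 (Q (suc n N.+ 0)) (M 0) (A₁ 0) (A₂ 0) (P n) (R n) (λ q m x y p r → (q :* m , 𝟙 :* (y :* p :- x :* r)) , (q , m , 𝟙 :* (x :- y)) ∷ (𝟙 , q :* x , y :* p) ∷ (:- 𝟙 , q :* y , x :* r) ∷ []) (M≈ 0 , first₁ n , first₂ n)
  last-term n (suc k) = mod! 9 (Q (suc n N.+ suc k)) (M k) (A₁ k) (A₂ k) (A₁ (suc k)) (A₂ (suc k)) (P n) (R n) (sg k) (λ q m x y x′ y′ p r s → (q :* m , :- s :* (y′ :* p :- x′ :* r)) ,
      (q , m , s :* (x :- y)) ∷ (s , q :* x , x′ :* r) ∷ (:- s , q :* y , y′ :* p) ∷ []) (M≈ k , down₁ k n , down₂ k n)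

  rec : ∀ n k → k N.≤ n → M k * f n ≃ M k * (1# + Q (2 N.+ (n N.+ n))) + Q (n N.∸ k) * M (suc k) + Q (suc n N.+ k) * M (k N.∸ 1)
  rec n k k≤n = mod! 12 (M k) (R n) (P n) (Q (2 N.+ (n N.+ n))) (Q (n N.∸ k)) (M (suc k)) (Q (suc n N.+ k) * M (k N.∸ 1)) (sg k) (A₁ k) (A₂ k) (A₁ (suc k)) (A₂ (suc k))
    (λ m r p S q m′ l s x y x′ y′ → (m :* ((𝟙 :- r) :* (𝟙 :- p)) , m :* (𝟙 :+ S) :+ q :* m′ :+ l) ,
      (m , r :* p , S) ∷ (:- (r :+ p) , m , s :* (x :- y)) ∷ (:- q , m′ , :- s :* (x′ :- y′)) ∷ (s , q :* x′ , x :* p) ∷ (:- s , q :* y′ , y :* r) ∷ (:- 𝟙 , l , s :* (y :* p :- x :* r)) ∷ [])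
    (RP n , M≈ k , M≈ (suc k) , up₁ (n N.∸ k) k n (N.m∸n+n≡m k≤n) , up₂ (n N.∸ k) k n (N.m∸n+n≡m k≤n) , last-term n k)

  f-int : ∀ n → Int (f n)
  f-int n = int-* (one-q-int (c N.* suc n N.+ a)) (one-q-int (c N.* n N.+ b))

  f-agr : ∀ n → Agr n (f n) 1#
  f-agr n = agr-trans (agr-* (one-q-int (c N.* suc n N.+ a)) int-1 (one-q-agr n _ (N.≤-trans (N.n≤1+n n) (N.≤-trans (N.m≤n*m (suc n) c) (N.m≤m+n _ a)))) (one-q-agr n _ (N.≤-trans (N.m≤n*m n c) (N.m≤m+n _ b)))) (agr-≈ (*-identityˡ 1#))

  open Closed c M f (λ k → low-+ (term-low F₁ k) (term-low F₂ k)) f-int f-agr rec using (closed)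

  M₀ : M 0 ≃ fac c a 0
  M₀ = M≈ 0 ⨾ *-identityˡ _ ⨾ +-cong (reflexive (cong q^ e₁) ⨾ q^0) (-‿cong (reflexive (cong q^ e₂)))
    where
    e₁ : expo F₁ 0 ≡ 0
    e₁ = solveℕ 2 (λ c b → c *' con' 0 +' b *' con' 0 +' con' 0 =' con' 0) refl c b
    e₂ : expo F₂ 0 ≡ c N.* 0 N.+ a
    e₂ = solveℕ 3 (λ c b a → c *' con' 0 +' b *' con' 0 +' a =' c *' con' 0 +' a) refl c (suc (a N.+ a N.+ b₀)) a

  product : M 0 * lim (∏ f) ≃ ℙ c a * ℙ c b
  product = agr-all (λ n → agr-trans (agr-* (low-int (low-+ (term-low F₁ 0) (term-low F₂ 0))) (∏-int f-int n) (agr-≈ M₀) (lim-agr (stable-∏ f-int f-agr) n))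
    (agr-trans (agr-≈ (fin n)) (agr-sym (agr-* (lim-int _) (stable-int (ℙ-stable c b) n) (agr-weaken (N.n≤1+n n) (lim-agr (ℙ-stable c a) (suc n))) (lim-agr (ℙ-stable c b) n)))))
    where
    fin : ∀ n → fac c a 0 * ∏ f n ≃ ℙₙ c a (suc n) * ℙₙ c b n
    fin n = *-congˡ (∏-* (λ i → fac c a (suc i)) (fac c b) n) ⨾ ≈-sym (*-assoc _ _ _) ⨾ *-congʳ (≈-sym (∏-front (fac c a) n))

  theta : ⟪ F₁ ⟫ + ⟪ F₂ ⟫ ≃ ℙ c c * (ℙ c a * ℙ c b)
  theta = ≈-sym (lim-two F₁ F₂) ⨾ closed ⨾ *-congˡ product

module Jacobi where
  -- The term (-1)ᵏ (2k + 1) q^(k(k+1)/2) is unchanged under k ↦ -k - 1, so again M(-1) = M(0), and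
  -- the recurrence holds with f n = (1 - q^(n+1))².
  F₀ : Fam
  F₀ = fam (+ 2) (+ 1) 1 0 0

  M f : ℕ → Laurent
  M = termF F₀
  f n = fac 1 1 n * fac 1 1 n

  Q : ℕ → Laurent
  Q k = q^ (1 N.* k)

  A : ℕ → Laurent
  A k = q^ (expo F₀ k)

  R : ℕ → Laurent
  R n = q^ (1 N.* n N.+ 1)

  shifted : ∀ x y z w → x N.+ y ≡ z N.+ w → q^ x * q^ y ≃ q^ z * q^ w
  shifted x y z w e = q^-+ x y ⨾ reflexive (cong q^ e) ⨾ ≈-sym (q^-+ z w)

  up : ∀ m k n → m N.+ k ≡ n → Q m * A (suc k) ≃ A k * R n
  up m k .(m N.+ k) refl = shifted _ _ _ _ (solveℕ 3 (λ m k T → con' 1 *' m +' (con' 1 *' (T +' k) +' con' 1 *' (con' 1 +' k) +' con' 0)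
      =' (con' 1 *' T +' con' 1 *' k +' con' 0) +' (con' 1 *' (m +' k) +' con' 1)) refl m k (tri k))

  down : ∀ k n → Q (suc n N.+ suc k) * A k ≃ A (suc k) * R n
  down k n = shifted _ _ _ _ (solveℕ 3 (λ n k T → con' 1 *' (con' 1 +' n +' (con' 1 +' k)) +' (con' 1 *' T +' con' 1 *' k +' con' 0)
      =' (con' 1 *' (T +' k) +' con' 1 *' (con' 1 +' k) +' con' 0) +' (con' 1 *' n +' con' 1)) refl n k (tri k))

  first : ∀ n → Q (suc n N.+ 0) * A 0 ≃ A 0 * R n
  first n = shifted _ _ _ _ (solveℕ 1 (λ n → con' 1 *' (con' 1 +' n +' con' 0) +' con' 0 =' con' 0 +' (con' 1 *' n +' con' 1)) refl n)

  RR : ∀ n → R n * R n ≃ Q (2 N.+ (n N.+ n))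
  RR n = q^-+ _ _ ⨾ reflexive (cong q^ (solveℕ 1 (λ n → (con' 1 *' n +' con' 1) +' (con' 1 *' n +' con' 1) =' con' 1 *' (con' 2 +' (n +' n))) refl n))

  weight-suc : ∀ k → ι (weight F₀ (suc k)) ≃ ι (weight F₀ k) + ι (+ 2)
  weight-suc k = reflexive (cong ι (ℤR.ring! 2 (+ 2) (+ k) (λ t k → t :* (𝟙 :+ k) :+ 𝟙 , (t :* k :+ 𝟙) :+ t))) ⨾ ι-+ (weight F₀ k) (+ 2)

  last-term : ∀ n k → Q (suc n N.+ k) * M (k N.∸ 1) ≃ - (sg k * ((ι (weight F₀ k) - ι (+ 2)) * (A k * R n)))
  last-term n zero = mod! 4 (Q (suc n N.+ 0)) (ι (weight F₀ 0)) (A 0) (R n) (λ q w a r → (q :* (𝟙 :* (w :* a)) , :- (𝟙 :* ((w :- # 2) :* (a :* r)))) , (w , q :* a , a :* r) ∷ (# 2 :* (a :* r) , w , # 1) ∷ []) (first n , ≈-refl)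
  last-term n (suc k) = mod! 7 (Q (suc n N.+ suc k)) (ι (weight F₀ k)) (ι (weight F₀ (suc k))) (A k) (A (suc k)) (R n) (sg k) (λ q w w′ a a′ r s → (q :* (s :* (w :* a)) , :- (:- s :* ((w′ :- # 2) :* (a′ :* r)))) ,
      (s :* w , q :* a , a′ :* r) ∷ (:- (s :* a′ :* r) , w′ , w :+ # 2) ∷ []) (down k n , weight-suc k)

  rec : ∀ n k → k N.≤ n → M k * f n ≃ M k * (1# + Q (2 N.+ (n N.+ n))) + Q (n N.∸ k) * M (suc k) + Q (suc n N.+ k) * M (k N.∸ 1)
  rec n k k≤n = mod! 9 (sg k) (ι (weight F₀ k)) (A k) (R n) (Q (2 N.+ (n N.+ n))) (Q (n N.∸ k)) (ι (weight F₀ (suc k))) (A (suc k)) (Q (suc n N.+ k) * M (k N.∸ 1))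
    (λ s w a r S q w′ a′ l → ((s :* (w :* a)) :* ((𝟙 :- r) :* (𝟙 :- r)) , (s :* (w :* a)) :* (𝟙 :+ S) :+ q :* (:- s :* (w′ :* a′)) :+ l) ,
      (s :* w :* a , r :* r , S) ∷ (s :* w′ , q :* a′ , a :* r) ∷ (s :* a :* r , w′ , w :+ # 2) ∷ (:- 𝟙 , l , :- (s :* ((w :- # 2) :* (a :* r)))) ∷ [])
    (RR n , up (n N.∸ k) k n (N.m∸n+n≡m k≤n) , weight-suc k , last-term n k)

  f-int : ∀ n → Int (f n)
  f-int n = int-* (one-q-int (1 N.* n N.+ 1)) (one-q-int (1 N.* n N.+ 1))

  fac-agr : ∀ n → Agr n (fac 1 1 n) 1#
  fac-agr n = one-q-agr n _ (N.≤-trans (N.m≤n*m n 1) (N.m≤m+n _ 1))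

  f-agr : ∀ n → Agr n (f n) 1#
  f-agr n = agr-trans (agr-* (one-q-int (1 N.* n N.+ 1)) int-1 (fac-agr n) (fac-agr n)) (agr-≈ (*-identityˡ 1#))

  open Closed 1 M f (term-low F₀) f-int f-agr rec using (closed)

  cube : ⟪ F₀ ⟫ ≃ ℙ 1 1 * (ℙ 1 1 * ℙ 1 1)
  cube = reflexive (⟪⟫≡lim F₀) ⨾ closed ⨾ *-congˡ (*-congʳ M₀ ⨾ *-identityˡ _ ⨾ squares)
    where
    M₀ : M 0 ≃ 1#
    M₀ = *-identityˡ _ ⨾ *-cong ι-1 q^0 ⨾ *-identityˡ 1#
    squares : lim (∏ f) ≃ ℙ 1 1 * ℙ 1 1
    squares = agr-all (λ n → agr-trans (lim-agr (stable-∏ f-int f-agr) n) (agr-trans (agr-≈ (∏-* (fac 1 1) (fac 1 1) n))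
      (agr-sym (agr-* (lim-int _) (stable-int (ℙ-stable 1 1) n) (lim-agr (ℙ-stable 1 1) n) (lim-agr (ℙ-stable 1 1) n)))))

-- The Euler products of the statement

mkL-* : ∀ s s′ → mkL +0 (s ⊛ s′) ≃ mkL +0 s * mkL +0 s′
mkL-* s s′ = reflexive (sym (mkL-⊗ +0 +0 s s′))

mkL-prod : ∀ F N → mkL +0 (prodOver F N) ≃ ∏ (λ i → mkL +0 (F (suc i))) N
mkL-prod F zero = mkL-one
mkL-prod F (suc N) = mkL-* (F (suc N)) (prodOver F N) ⨾ *-congˡ (mkL-prod F N) ⨾ *-comm _ _

mkL-pow : ∀ s n → mkL +0 (powS s n) ≃ mkL +0 s ^ n
mkL-pow s zero = mkL-one
mkL-pow s (suc n) = mkL-* s (powS s n) ⨾ *-congˡ (mkL-pow s n)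

mkL-val : ∀ v s → mkL v s ≃ qᵐ v * mkL +0 s
mkL-val v s = ≈-sym (*-congʳ (reflexive (q≡mkL v)) ⨾ reflexive (mkL-⊗ v +0 oneS s) ⨾ co (mkL-cong {v Z.+ + 0} {v} {oneS ⊛ s} {s} (Z.+-identityʳ v) (⊛-identityˡ s)))

coeff-0-mkL : ∀ s n → coeff (mkL +0 s) (+ n) ≡ s n
coeff-0-mkL s n = coeff-mkL +0 s n

module EtaProduct (k₀ : ℕ) where
  k : ℕ
  k = suc k₀

  open Poch k using (inv; inv-stable; inv-int; inv∞; inv∞-E; pos)

  e i : Laurent
  e = ℙ k k
  i = inv∞

  e-inv : e * i ≃ 1#
  e-inv = *-comm e i ⨾ inv∞-E

  -- `euler` reads its coefficient n from the product of n factors, whereas `lim` reads it from term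
  -- n + 1. Delaying the sequence by one reconciles the two; it needs consecutive products to agree
  -- modulo q^(n+1), one more power than `Stable` gives.
  delay : (ℕ → Laurent) → ℕ → Laurent
  delay F zero = F 0
  delay F (suc n) = F n

  opaque
    unfolding lim

    delayed : ∀ (F : ℕ → Laurent) s → (∀ n → s n ≡ coeff (F n) (+ n)) → mkL +0 s ≃ lim (delay F)
    delayed F s eq = mkL≈ eq

  delay-lim : ∀ F → Stable F → (∀ n → Agr (suc n) (F (suc n)) (F n)) → lim (delay F) ≃ lim F
  delay-lim F S strong = agr-all (λ n → agr-trans (agr-weaken (N.n≤1+n n) (lim-agr D (suc n))) (agr-sym (lim-agr S n)))
    where
    D : Stable (delay F)
    D = record { stable-int = λ { zero → stable-int S 0 ; (suc n) → stable-int S n }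
               ; stable-step = λ { zero → agr-≈ ≈-refl ; (suc n) → strong n } }

  exponent : ∀ i → k N.* suc i ≡ k N.* i N.+ k
  exponent i = trans (N.*-suc k i) (N.+-comm k (k N.* i))

  bound : ∀ n → suc n N.≤ k N.* n N.+ k
  bound n = N.≤-trans (N.m≤n*m (suc n) k) (N.≤-reflexive (exponent n))

  euler≈ : mkL +0 (euler k) ≃ e
  euler≈ = delayed (ℙₙ k k) (euler k) (λ n → sym (coeff-0-mkL (prodOver (λ m → factor (k N.* m)) n) n) ⟫ at-coeff (finite n) (+ n)) ⨾ delay-lim (ℙₙ k k) (ℙ-stable k k) strong
    where
    finite : ∀ n → mkL +0 (prodOver (λ m → factor (k N.* m)) n) ≃ ℙₙ k k n
    finite n = mkL-prod (λ m → factor (k N.* m)) n ⨾ ∏-cong (λ i → factor≈ (i N.+ k₀ N.* suc i) ⨾ reflexive (cong one-q (exponent i))) n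
    strong : ∀ n → Agr (suc n) (ℙₙ k k (suc n)) (ℙₙ k k n)
    strong n = agr-trans (agr-* (stable-int (ℙ-stable k k) n) int-1 (agr-≈ ≈-refl) (one-q-agr (suc n) _ (bound n))) (agr-≈ (*-identityʳ _))

  eulerInv≈ : mkL +0 (eulerInv k) ≃ i
  eulerInv≈ = delayed inv (eulerInv k) (λ n → sym (coeff-0-mkL (prodOver (λ m → geom (k N.* m)) n) n) ⟫ at-coeff (finite n) (+ n)) ⨾ delay-lim inv inv-stable strong
    where
    finite : ∀ n → mkL +0 (prodOver (λ m → geom (k N.* m)) n) ≃ inv n
    finite n = mkL-prod (λ m → geom (k N.* m)) n ⨾ ∏-cong (λ i → reflexive (cong ginv (exponent i))) n
    strong : ∀ n → Agr (suc n) (inv (suc n)) (inv n)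
    strong n = agr-trans (agr-* (inv-int n) int-1 (agr-≈ ≈-refl) (agr-weaken (bound n) (agr (ginv-int (k N.* n N.+ k))
        (mod! 2 (ginv (k N.* n N.+ k)) (q^ (k N.* n N.+ k)) (λ g q → (g , 𝟙 :+ q :* g) , (𝟙 , g :* (𝟙 :- q) , 𝟙) ∷ []) (ginv-inv _ (pos n)))))) (agr-≈ (*-identityʳ _))

E1 E2 E7 E14 E49 E98 I1 I2 I7 I14 I49 I98 : Laurent
E1 = EtaProduct.e 0
E2 = EtaProduct.e 1
E7 = EtaProduct.e 6
E14 = EtaProduct.e 13
E49 = EtaProduct.e 48
E98 = EtaProduct.e 97
I1 = EtaProduct.i 0
I2 = EtaProduct.i 1
I7 = EtaProduct.i 6
I14 = EtaProduct.i 13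
I49 = EtaProduct.i 48
I98 = EtaProduct.i 97

-- Eta quotients as a multiplicative group of exponent vectors

record Unit (e i : Laurent) : Set where
  constructor unit
  field ei : e * i ≃ 1#

zpow : Laurent → Laurent → ℤ → Laurent
zpow e i (+ n) = e ^ n
zpow e i -[1+ n ] = i ^ suc n

zpow-⊖ : ∀ {e i} → Unit e i → ∀ m n → e ^ m * i ^ n ≃ zpow e i (m Z.⊖ n)
zpow-⊖ u zero zero = *-identityˡ 1#
zpow-⊖ u (suc m) zero = *-identityʳ _
zpow-⊖ u zero (suc n) = *-identityˡ _
zpow-⊖ {e} {i} (unit ei) (suc m) (suc n) = mod! 4 e i (e ^ m) (i ^ n) (λ e i p q → ((e :* p) :* (i :* q) , p :* q) , (p :* q , e :* i , 𝟙) ∷ []) ei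
  ⨾ zpow-⊖ (unit ei) m n ⨾ reflexive (cong (zpow e i) (sym (Z.[1+m]⊖[1+n]≡m⊖n m n)))

pow-+ : ∀ x m n → x ^ (m N.+ n) ≃ x ^ m * x ^ n
pow-+ x zero n = ≈-sym (*-identityˡ _)
pow-+ x (suc m) n = *-congˡ (pow-+ x m n) ⨾ ≈-sym (*-assoc _ _ _)

zpow-+ : ∀ {e i} → Unit e i → ∀ x y → zpow e i x * zpow e i y ≃ zpow e i (x Z.+ y)
zpow-+ {e} u (+ m) (+ n) = ≈-sym (pow-+ e m n)
zpow-+ u (+ m) -[1+ n ] = zpow-⊖ u m (suc n)
zpow-+ u -[1+ m ] (+ n) = *-comm _ _ ⨾ zpow-⊖ u n (suc m)
zpow-+ {e} {i} u -[1+ m ] -[1+ n ] = ≈-sym (pow-+ i (suc m) (suc n)) ⨾ reflexive (cong (i ^_) (cong suc (N.+-suc m n)))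

V-pow : ∀ k .{{_ : N.NonZero k}} x n → V k (x ^ n) ≃ V k x ^ n
V-pow k x zero = V-one k
V-pow k x (suc n) = V-* k x (x ^ n) ⨾ *-congˡ (V-pow k x n)

pow-cong : ∀ {x y} n → x ≃ y → x ^ n ≃ y ^ n
pow-cong zero p = ≈-refl
pow-cong (suc n) p = *-cong p (pow-cong n p)

V-zpow : ∀ k .{{_ : N.NonZero k}} {e i e′ i′} → Unit e i → Unit e′ i′ → V k e ≃ e′ → ∀ x → V k (zpow e i x) ≃ zpow e′ i′ x
V-zpow k u u′ p (+ n) = V-pow k _ n ⨾ pow-cong n p
V-zpow k {e} {i} {e′} {i′} (unit ei) (unit ei′) p -[1+ n ] = V-pow k i (suc n) ⨾ pow-cong (suc n) q
  where
  q : V k i ≃ i′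
  q = mod! 4 (V k i) i′ (V k e) e′ (λ v i w e → (v , i) , (:- v , e :* i , 𝟙) ∷ (i , w :* v , 𝟙) ∷ (:- (v :* i) , w , e) ∷ [])
    (ei′ , ≈-sym (V-* k e i) ⨾ V-cong k ei ⨾ V-one k , p)

u₁ : Unit E1 I1
u₁ = unit (EtaProduct.e-inv 0)
u₂ : Unit E2 I2
u₂ = unit (EtaProduct.e-inv 1)
u₇ : Unit E7 I7
u₇ = unit (EtaProduct.e-inv 6)
u₁₄ : Unit E14 I14
u₁₄ = unit (EtaProduct.e-inv 13)
u₄₉ : Unit E49 I49
u₄₉ = unit (EtaProduct.e-inv 48)
u₉₈ : Unit E98 I98
u₉₈ = unit (EtaProduct.e-inv 97)

-- q^n times powers of the products for 1, 2, 7, 14, 49 and 98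
record Exps : Set where
  constructor ex
  field n x₁ x₂ x₇ x₁₄ x₄₉ x₉₈ : ℤ

infixl 6 _⊞ₑ_
_⊞ₑ_ : Exps → Exps → Exps
ex n a b c d e f ⊞ₑ ex n′ a′ b′ c′ d′ e′ f′ = ex (n Z.+ n′) (a Z.+ a′) (b Z.+ b′) (c Z.+ c′) (d Z.+ d′) (e Z.+ e′) (f Z.+ f′)

opaque
  mon : Exps → Laurent
  mon (ex n a b c d e f) = qᵐ n * (zpow E1 I1 a * (zpow E2 I2 b * (zpow E7 I7 c * (zpow E14 I14 d * (zpow E49 I49 e * zpow E98 I98 f)))))

  mon-def : ∀ n a b c d e f → mon (ex n a b c d e f) ≃ qᵐ n * (zpow E1 I1 a * (zpow E2 I2 b * (zpow E7 I7 c * (zpow E14 I14 d * (zpow E49 I49 e * zpow E98 I98 f)))))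
  mon-def n a b c d e f = ≈-refl

  mon-* : ∀ x y → mon x * mon y ≃ mon (x ⊞ₑ y)
  mon-* (ex n a b c d e f) (ex n′ a′ b′ c′ d′ e′ f′) = ring! 14 (qᵐ n) (zpow E1 I1 a) (zpow E2 I2 b) (zpow E7 I7 c) (zpow E14 I14 d) (zpow E49 I49 e) (zpow E98 I98 f) (qᵐ n′) (zpow E1 I1 a′) (zpow E2 I2 b′) (zpow E7 I7 c′) (zpow E14 I14 d′) (zpow E49 I49 e′) (zpow E98 I98 f′)
      (λ n a b c d e f n′ a′ b′ c′ d′ e′ f′ →
        (n :* (a :* (b :* (c :* (d :* (e :* f)))))) :* (n′ :* (a′ :* (b′ :* (c′ :* (d′ :* (e′ :* f′)))))) ,
        (n :* n′) :* ((a :* a′) :* ((b :* b′) :* ((c :* c′) :* ((d :* d′) :* ((e :* e′) :* (f :* f′)))))))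
    ⨾ *-cong (q+ n n′) (*-cong (zpow-+ u₁ a a′) (*-cong (zpow-+ u₂ b b′) (*-cong (zpow-+ u₇ c c′) (*-cong (zpow-+ u₁₄ d d′) (*-cong (zpow-+ u₄₉ e e′) (zpow-+ u₉₈ f f′))))))

  mon-0 : mon (ex +0 +0 +0 +0 +0 +0 +0) ≃ 1#
  mon-0 = *-congʳ (reflexive q0≡1) ⨾ ring! 0 (𝟙 :* (𝟙 :* (𝟙 :* (𝟙 :* (𝟙 :* (𝟙 :* 𝟙))))) , 𝟙)

  -- The exponents at 49 and 98 have to be 0, since q ↦ q⁷ would send those products to 343 and 686.
  mon-V7 : ∀ n a b c d → V 7 (mon (ex n a b c d +0 +0)) ≃ mon (ex (+ 7 Z.* n) +0 +0 a b c d)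
  mon-V7 n a b c d = V-* 7 _ _ ⨾ *-cong (V-q 7 n) (V-* 7 _ _ ⨾ *-cong (V-zpow 7 u₁ u₇ (V-ℙ 7 1 1) a) (V-* 7 _ _ ⨾ *-cong (V-zpow 7 u₂ u₁₄ (V-ℙ 7 2 2) b)
    (V-* 7 _ _ ⨾ *-cong (V-zpow 7 u₇ u₄₉ (V-ℙ 7 7 7) c) (V-* 7 _ _ ⨾ *-cong (V-zpow 7 u₁₄ u₉₈ (V-ℙ 7 14 14) d) (V-cong 7 (*-identityˡ 1#) ⨾ V-one 7)))) ⨾ tidy)
    where
    tidy : zpow E7 I7 a * (zpow E14 I14 b * (zpow E49 I49 c * (zpow E98 I98 d * 1#))) ≃ 1# * (1# * (zpow E7 I7 a * (zpow E14 I14 b * (zpow E49 I49 c * zpow E98 I98 d))))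
    tidy = ring! 4 (zpow E7 I7 a) (zpow E14 I14 b) (zpow E49 I49 c) (zpow E98 I98 d) (λ a b c d → a :* (b :* (c :* (d :* 𝟙))) , 𝟙 :* (𝟙 :* (a :* (b :* (c :* d)))))

  mon-V2 : ∀ n a c e → V 2 (mon (ex n a +0 c +0 e +0)) ≃ mon (ex (+ 2 Z.* n) +0 a +0 c +0 e)
  mon-V2 n a c e = V-cong 2 tidy₁ ⨾ V-* 2 _ _ ⨾ *-cong (V-q 2 n) (V-* 2 _ _ ⨾ *-cong (V-zpow 2 u₁ u₂ (V-ℙ 2 1 1) a) (V-* 2 _ _ ⨾ *-cong (V-zpow 2 u₇ u₁₄ (V-ℙ 2 7 7) c) (V-zpow 2 u₄₉ u₉₈ (V-ℙ 2 49 49) e))) ⨾ tidy₂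
    where
    tidy₁ : qᵐ n * (zpow E1 I1 a * (1# * (zpow E7 I7 c * (1# * (zpow E49 I49 e * 1#))))) ≃ qᵐ n * (zpow E1 I1 a * (zpow E7 I7 c * zpow E49 I49 e))
    tidy₁ = ring! 4 (qᵐ n) (zpow E1 I1 a) (zpow E7 I7 c) (zpow E49 I49 e) (λ n a b c → n :* (a :* (𝟙 :* (b :* (𝟙 :* (c :* 𝟙))))) , n :* (a :* (b :* c)))
    tidy₂ : qᵐ (+ 2 Z.* n) * (zpow E2 I2 a * (zpow E14 I14 c * zpow E98 I98 e)) ≃ qᵐ (+ 2 Z.* n) * (1# * (zpow E2 I2 a * (1# * (zpow E14 I14 c * (1# * zpow E98 I98 e)))))
    tidy₂ = ring! 4 (qᵐ (+ 2 Z.* n)) (zpow E2 I2 a) (zpow E14 I14 c) (zpow E98 I98 e) (λ n a b c → n :* (a :* (b :* c)) , n :* (𝟙 :* (a :* (𝟙 :* (b :* (𝟙 :* c))))))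

series≈ : ∀ v (s₁ s₂ s₃ s₄ : Series) {x₁ x₂ x₃ x₄} → mkL +0 s₁ ≃ x₁ → mkL +0 s₂ ≃ x₂ → mkL +0 s₃ ≃ x₃ → mkL +0 s₄ ≃ x₄ →
          mkL v (s₁ ⊛ s₂ ⊛ s₃ ⊛ s₄) ≃ qᵐ v * (x₁ * x₂ * x₃ * x₄)
series≈ v s₁ s₂ s₃ s₄ p₁ p₂ p₃ p₄ = mkL-val v (s₁ ⊛ s₂ ⊛ s₃ ⊛ s₄) ⨾ *-congˡ (mkL-* (s₁ ⊛ s₂ ⊛ s₃) s₄ ⨾ *-cong (mkL-* (s₁ ⊛ s₂) s₃ ⨾ *-cong (mkL-* s₁ s₂ ⨾ *-cong p₁ p₂) p₃) p₄)

power≈ : ∀ (s : Series) {x} n → mkL +0 s ≃ x → mkL +0 (powS s n) ≃ x ^ n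
power≈ s n p = mkL-pow s n ⨾ pow-cong n p

t≈mon : Defs.t ≃ mon (ex −2 −1 (+ 1) (+ 7) −7 +0 +0)
t≈mon = series≈ −2 (euler 2) (powS (euler 7) 7) (eulerInv 1) (powS (eulerInv 14) 7) (EtaProduct.euler≈ 1) (power≈ (euler 7) 7 (EtaProduct.euler≈ 6)) (EtaProduct.eulerInv≈ 0) (power≈ (eulerInv 14) 7 (EtaProduct.eulerInv≈ 13))
  ⨾ ≈-sym (mon-def _ _ _ _ _ _ _ ⨾ ring! 5 (qᵐ −2) E2 (E7 ^ 7) I1 (I14 ^ 7) (λ q a b c d → q :* (c :^ 1 :* (a :^ 1 :* (b :* (d :* (𝟙 :* 𝟙))))) , q :* (a :* b :* c :* d)))

u≈mon : Defs.u ≃ mon (ex (+ 3) −3 −1 −3 (+ 7) +0 +0)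
u≈mon = series≈ (+ 3) (powS (euler 14) 7) (powS (eulerInv 1) 3) (eulerInv 2) (powS (eulerInv 7) 3) (power≈ (euler 14) 7 (EtaProduct.euler≈ 13)) (power≈ (eulerInv 1) 3 (EtaProduct.eulerInv≈ 0)) (EtaProduct.eulerInv≈ 1) (power≈ (eulerInv 7) 3 (EtaProduct.eulerInv≈ 6))
  ⨾ ≈-sym (mon-def _ _ _ _ _ _ _ ⨾ ring! 5 (qᵐ (+ 3)) (E14 ^ 7) (I1 ^ 3) I2 (I7 ^ 3) (λ q a b c d → q :* (b :* (c :^ 1 :* (d :* (a :* (𝟙 :* 𝟙))))) , q :* (a :* b :* c :* d)))

A≈mon : Defs.A ≃ mon (ex (+ 2) −5 (+ 2) +0 +0 (+ 5) −2)
A≈mon = series≈ (+ 2) (powS (euler 2) 2) (powS (euler 49) 5) (powS (eulerInv 1) 5) (powS (eulerInv 98) 2) (power≈ (euler 2) 2 (EtaProduct.euler≈ 1)) (power≈ (euler 49) 5 (EtaProduct.euler≈ 48)) (power≈ (eulerInv 1) 5 (EtaProduct.eulerInv≈ 0)) (power≈ (eulerInv 98) 2 (EtaProduct.eulerInv≈ 97))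
  ⨾ ≈-sym (mon-def _ _ _ _ _ _ _ ⨾ ring! 5 (qᵐ (+ 2)) (E2 ^ 2) (E49 ^ 5) (I1 ^ 5) (I98 ^ 2) (λ q a b c d → q :* (c :* (a :* (𝟙 :* (𝟙 :* (b :* d))))) , q :* (a :* b :* c :* d)))

-- Separation of identities by classes of exponents modulo 7

fam-cls′ : ∀ μ ν α b γ → α ≡ 7 N.* (α N./ 7) → b ≡ (b N.∸ 6) N./ 7 N.+ 6 N.* suc ((b N.∸ 6) N./ 7) → Cls (+ γ) ⟪ fam μ ν α b γ ⟫
fam-cls′ μ ν α b γ eα eb = cls-cong (reflexive (cong₂ (λ x y → ⟪ fam μ ν x y γ ⟫) (sym eα) (sym eb))) (fam-cls γ μ ν (α N./ 7) ((b N.∸ 6) N./ 7))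

sub-cls : ∀ F r s x → let fam μ ν α b γ = sub r F in α ≡ 7 N.* (α N./ 7) → b ≡ (b N.∸ 6) N./ 7 N.+ 6 N.* suc ((b N.∸ 6) N./ 7) → + γ ≡ + s Z.+ + 7 Z.* + x → Cls (+ s) ⟪ sub r F ⟫
sub-cls F r s x eα eb eγ = cls-mod (+ s) (+ x) eγ (fam-cls′ _ _ _ _ _ eα eb)

off-class : ∀ r s {i f} → (s Z.- r) ℤ÷.%ℕ 7 ≡ suc i → Cls s f → Off r f
off-class r s {i} eq = off-cls r i ((s Z.- r) ℤ÷./ℕ 7) decomposition (subst (N._< 7) eq (ℤ÷.n%ℕd<d (s Z.- r) 7))
  where
  decomposition : s ≡ r Z.+ (+ suc i Z.+ + 7 Z.* ((s Z.- r) ℤ÷./ℕ 7))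
  decomposition = ℤR.ring! 2 s r (λ s r → s , r :+ (s :- r))
    ⟫ cong (Z._+_ r) (ℤ÷.a≡a%ℕn+[a/ℕn]*n (s Z.- r) 7 ⟫ cong₂ Z._+_ (cong +_ eq) (Z.*-comm ((s Z.- r) ℤ÷./ℕ 7) (+ 7)))

module Separate (f : ℕ → Laurent) (c : ∀ i → Cls (+ i) (f i)) where

  sumOf : List ℕ → Laurent
  sumOf [] = 0#
  sumOf (i ∷ is) = f i + sumOf is

  AllOff : ℕ → List ℕ → Set
  AllOff r [] = ⊤
  AllOff r (i ∷ is) = N.NonZero ((+ i Z.- + r) ℤ÷.%ℕ 7) × AllOff r is

  predecessor : ∀ m → N.NonZero m → ∃ λ k → m ≡ suc k
  predecessor (suc k) _ = k , refl

  off-0 : ∀ r → Off r 0#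
  off-0 r = U-cong (zeroʳ _) ⨾ x+x≈x⇒x≈0 _ (≈-sym (U-+ 0# 0#) ⨾ U-cong (+-identityˡ 0#))

  off-list : ∀ r is → AllOff r is → Off (+ r) (sumOf is)
  off-list r [] _ = off-0 (+ r)
  off-list r (i ∷ is) (e , a) = off-+ (off-class (+ r) (+ i) (proj₂ (predecessor _ e)) (c i)) (off-list r is a)

  pull : ∀ xs r ys → sumOf (xs ++ r ∷ ys) ≃ f r + sumOf (xs ++ ys)
  pull [] r ys = ≈-refl
  pull (x ∷ xs) r ys = +-congˡ (pull xs r ys) ⨾ ≈-sym (+-assoc _ _ _) ⨾ +-congʳ (+-comm _ _) ⨾ +-assoc _ _ _

  vanish : ∀ xs r ys → {_ : AllOff r (xs ++ ys)} → sumOf (xs ++ r ∷ ys) ≃ 0# → f r ≃ 0#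
  vanish xs r ys {a} e = separate (c r) (off-list r (xs ++ ys) a) (≈-sym (pull xs r ys) ⨾ e)

  module _ (total : sumOf (0 ∷ 1 ∷ 2 ∷ 3 ∷ 4 ∷ 5 ∷ 6 ∷ []) ≃ 0#) where
    v₀ : f 0 ≃ 0#
    v₀ = vanish [] 0 (1 ∷ 2 ∷ 3 ∷ 4 ∷ 5 ∷ 6 ∷ []) total
    v₁ : f 1 ≃ 0#
    v₁ = vanish (0 ∷ []) 1 (2 ∷ 3 ∷ 4 ∷ 5 ∷ 6 ∷ []) total
    v₂ : f 2 ≃ 0#
    v₂ = vanish (0 ∷ 1 ∷ []) 2 (3 ∷ 4 ∷ 5 ∷ 6 ∷ []) total
    v₃ : f 3 ≃ 0#
    v₃ = vanish (0 ∷ 1 ∷ 2 ∷ []) 3 (4 ∷ 5 ∷ 6 ∷ []) total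
    v₄ : f 4 ≃ 0#
    v₄ = vanish (0 ∷ 1 ∷ 2 ∷ 3 ∷ []) 4 (5 ∷ 6 ∷ []) total
    v₅ : f 5 ≃ 0#
    v₅ = vanish (0 ∷ 1 ∷ 2 ∷ 3 ∷ 4 ∷ []) 5 (6 ∷ []) total
    v₆ : f 6 ≃ 0#
    v₆ = vanish (0 ∷ 1 ∷ 2 ∷ 3 ∷ 4 ∷ 5 ∷ []) 6 [] total

mon-q : ∀ n → qᵐ n ≃ mon (ex n +0 +0 +0 +0 +0 +0)
mon-q n = ≈-sym (mon-def _ _ _ _ _ _ _ ⨾ ring! 1 (qᵐ n) (λ q → q :* (𝟙 :* (𝟙 :* (𝟙 :* (𝟙 :* (𝟙 :* 𝟙))))) , q))

mon-e : ∀ (a b c d e f : ℤ) → zpow E1 I1 a * (zpow E2 I2 b * (zpow E7 I7 c * (zpow E14 I14 d * (zpow E49 I49 e * zpow E98 I98 f)))) ≃ mon (ex +0 a b c d e f)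
mon-e a b c d e f = ≈-sym (mon-def _ _ _ _ _ _ _ ⨾ *-congʳ (reflexive q0≡1) ⨾ *-identityˡ _)

mon-cls : ∀ n a b c d → Cls n (mon (ex n +0 +0 a b c d))
mon-cls n a b c d = cls (mon (ex +0 a b c d +0 +0)) (≈-sym (*-cong (mon-q n) (mon-V7 +0 a b c d) ⨾ mon-* _ _
  ⨾ reflexive (cong mon (ex-cong (Z.+-identityʳ n) (Z.+-identityˡ a) (Z.+-identityˡ b) (Z.+-identityˡ c) (Z.+-identityˡ d)))))
  where
  ex-cong : ∀ {n n′ a a′ b b′ c c′ d d′} → n ≡ n′ → a ≡ a′ → b ≡ b′ → c ≡ c′ → d ≡ d′ → ex n +0 +0 a b c d ≡ ex n′ +0 +0 a′ b′ c′ d′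
  ex-cong refl refl refl refl refl = refl

cls-V2 : ∀ {r f} → Cls r f → Cls (+ 2 Z.* r) (V 2 f)
cls-V2 {r} (cls k e) = cls (V 2 k) (V-cong 2 e ⨾ V-* 2 _ _ ⨾ *-cong (V-q 2 r) (V-V 2 7 k ⨾ ≈-sym (V-V 7 2 k)))

cls-ι* : ∀ {r f} z → Cls r f → Cls r (ι z * f)
cls-ι* {r} z c = subst (λ s → Cls s _) (Z.+-identityˡ r) (cls-* (ι-cls z) c)

-- Dissection of the Euler product

-- The triple product in base q³ with a = 1 and b = 2, that is, Euler's pentagonal number series.
Π₁ Π₂ : Fam
Π₁ = fam +0 (+ 1) 3 1 0
Π₂ = fam +0 −1 3 3 1

euler-fam : E1 ≃ ⟪ Π₁ ⟫ + ⟪ Π₂ ⟫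
euler-fam = ℙ-regroup 3 1 1 ⨾ ring! 3 (ℙ 3 1) (ℙ 3 2) (ℙ 3 3) (λ x y z → ((𝟙 :* x) :* y) :* z , z :* (x :* y)) ⨾ ≈-sym (Theta.theta 0 1)

-- The parts of E1 with exponents congruent to 0, 1 and 5 modulo 7. The remaining generalised
-- pentagonal numbers are congruent to 2 and make up -q² E49.
Ea Eb Ec : Laurent
Ea = ⟪ sub 0 Π₁ ⟫ + ⟪ sub 2 Π₁ ⟫ + ⟪ sub 4 Π₂ ⟫ + ⟪ sub 6 Π₂ ⟫
Eb = ⟪ sub 3 Π₁ ⟫ + ⟪ sub 6 Π₁ ⟫ + ⟪ sub 0 Π₂ ⟫ + ⟪ sub 3 Π₂ ⟫
Ec = ⟪ sub 4 Π₁ ⟫ + ⟪ sub 5 Π₁ ⟫ + ⟪ sub 1 Π₂ ⟫ + ⟪ sub 2 Π₂ ⟫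

moved : ∀ z m F → ι z * (q^ m * ⟪ F ⟫) ≃ ⟪ scaleF z (raise m F) ⟫
moved z m F = *-congˡ (q^-fam m F) ⨾ ι-fam z (raise m F)

e₄₉-fam : E49 ≃ ⟪ dilate 48 Π₁ ⟫ + ⟪ dilate 48 Π₂ ⟫
e₄₉-fam = ≈-sym (V-ℙ 49 1 1) ⨾ V-cong 49 euler-fam ⨾ V-+ 49 _ _ ⨾ +-cong (V-fam 48 Π₁) (V-fam 48 Π₂)

euler-dissected : E1 ≃ Ea + Eb + Ec - q^ 2 * E49
euler-dissected = euler-fam ⨾ +-cong (fam-split Π₁) (fam-split Π₂)
  ⨾ mod! 18 (⟪ sub 0 Π₁ ⟫) (⟪ sub 1 Π₁ ⟫) (⟪ sub 2 Π₁ ⟫) (⟪ sub 3 Π₁ ⟫) (⟪ sub 4 Π₁ ⟫) (⟪ sub 5 Π₁ ⟫) (⟪ sub 6 Π₁ ⟫) (⟪ sub 0 Π₂ ⟫) (⟪ sub 1 Π₂ ⟫) (⟪ sub 2 Π₂ ⟫) (⟪ sub 3 Π₂ ⟫) (⟪ sub 4 Π₂ ⟫) (⟪ sub 5 Π₂ ⟫) (⟪ sub 6 Π₂ ⟫) (q^ 2) E49 (⟪ dilate 48 Π₁ ⟫) (⟪ dilate 48 Π₂ ⟫)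
    (λ a₀ a₁ a₂ a₃ a₄ a₅ a₆ b₀ b₁ b₂ b₃ b₄ b₅ b₆ q e d d′ →
      ( (𝟘 :+ a₀ :+ a₁ :+ a₂ :+ a₃ :+ a₄ :+ a₅ :+ a₆) :+ (𝟘 :+ b₀ :+ b₁ :+ b₂ :+ b₃ :+ b₄ :+ b₅ :+ b₆)
      , (a₀ :+ a₂ :+ b₄ :+ b₆) :+ (a₃ :+ a₆ :+ b₀ :+ b₃) :+ (a₄ :+ a₅ :+ b₁ :+ b₂) :- q :* e ) ,
      (:- 𝟙 , con −1 :* (q :* d) , a₁) ∷ (:- 𝟙 , con −1 :* (q :* d′) , b₅) ∷ (q , e , d :+ d′) ∷ [])
    (moved −1 2 (dilate 48 Π₁) , moved −1 2 (dilate 48 Π₂) , e₄₉-fam)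

pre z z⁻¹ y : Laurent
pre = mon (ex −2 +0 +0 +0 +0 −1 +0)
z = mon (ex −2 (+ 1) +0 +0 +0 −1 +0)
z⁻¹ = mon (ex (+ 2) −1 +0 +0 +0 (+ 1) +0)
y = mon (ex −4 +0 (+ 1) +0 +0 +0 −1)

opaque
  a b c a′ b′ c′ : Laurent
  a = pre * Ea
  b = pre * Eb
  c = pre * Ec
  a′ = V 2 a
  b′ = V 2 b
  c′ = V 2 c

  a-cls : Cls −2 a
  a-cls = cls-* (mon-cls −2 +0 +0 −1 +0) (cls-+ (cls-+ (cls-+ (sub-cls Π₁ 0 0 0 refl refl refl) (sub-cls Π₁ 2 0 1 refl refl refl)) (sub-cls Π₂ 4 0 5 refl refl refl)) (sub-cls Π₂ 6 0 10 refl refl refl))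

  b-cls : Cls −1 b
  b-cls = cls-* (mon-cls −2 +0 +0 −1 +0) (cls-+ (cls-+ (cls-+ (sub-cls Π₁ 3 1 2 refl refl refl) (sub-cls Π₁ 6 1 8 refl refl refl)) (sub-cls Π₂ 0 1 0 refl refl refl)) (sub-cls Π₂ 3 1 3 refl refl refl))

  c-cls : Cls (+ 3) c
  c-cls = cls-* (mon-cls −2 +0 +0 −1 +0) (cls-+ (cls-+ (cls-+ (sub-cls Π₁ 4 5 3 refl refl refl) (sub-cls Π₁ 5 5 5 refl refl refl)) (sub-cls Π₂ 1 5 0 refl refl refl)) (sub-cls Π₂ 2 5 1 refl refl refl))

  a′-cls : Cls −4 a′
  a′-cls = cls-V2 a-cls

  b′-cls : Cls −2 b′
  b′-cls = cls-V2 b-cls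

  c′-cls : Cls (+ 6) c′
  c′-cls = cls-V2 c-cls

  z≈ : z ≃ a + b + c - 1#
  z≈ = begin
    z ≈⟨ ≈-sym (*-congˡ (e₁-mon ⨾ ≈-refl) ⨾ mon-* _ _) ⟩
    pre * E1 ≈⟨ *-congˡ euler-dissected ⟩
    pre * (Ea + Eb + Ec - q^ 2 * E49) ≈⟨ mod! 6 pre Ea Eb Ec (q^ 2) E49 (λ p a b c q e → (p :* (a :+ b :+ c :- q :* e) , p :* a :+ p :* b :+ p :* c :- 𝟙) , (:- 𝟙 , p :* (q :* e) , 𝟙) ∷ []) unit-part ⟩
    a + b + c - 1# ∎
    where
    e₁-mon : E1 ≃ mon (ex +0 (+ 1) +0 +0 +0 +0 +0)
    e₁-mon = ring! 1 E1 (λ e → e , e :^ 1 :* (𝟙 :* (𝟙 :* (𝟙 :* (𝟙 :* 𝟙))))) ⨾ mon-e (+ 1) +0 +0 +0 +0 +0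
    e₄₉-mon : E49 ≃ mon (ex +0 +0 +0 +0 +0 (+ 1) +0)
    e₄₉-mon = ring! 1 E49 (λ e → e , 𝟙 :* (𝟙 :* (𝟙 :* (𝟙 :* (e :^ 1 :* 𝟙))))) ⨾ mon-e +0 +0 +0 +0 (+ 1) +0
    unit-part : pre * (q^ 2 * E49) ≃ 1#
    unit-part = *-congˡ (*-cong (mon-q (+ 2)) e₄₉-mon ⨾ mon-* _ _) ⨾ mon-* _ _ ⨾ mon-0

  y≈ : y ≃ a′ + b′ + c′ - 1#
  y≈ = ≈-sym (mon-V2 −2 (+ 1) +0 −1) ⨾ V-cong 2 z≈ ⨾ V-+ 2 _ _ ⨾ +-cong (V-+ 2 _ _ ⨾ +-congʳ (V-+ 2 a b)) (V-neg 2 1# ⨾ -‿cong (V-one 2))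


-- The cube of z and the relation abc = -1

module AbcJ where
  J : Fam
  J = Jacobi.F₀

  pre³ : Laurent
  pre³ = mon (ex −6 +0 +0 +0 +0 −3 +0)

  -- Triangular numbers are congruent to 0, 1, 3 or 6 modulo 7; after the shift by q⁻⁶ the first
  -- three give the classes 1, 2, 4. The indices congruent to 3 give class 0, where 2k + 1 is
  -- divisible by 7 and the sum is -7.
  K₁ K₂ K₄ : Laurent
  K₁ = pre³ * (⟪ sub 0 J ⟫ + ⟪ sub 6 J ⟫)
  K₂ = pre³ * (⟪ sub 1 J ⟫ + ⟪ sub 5 J ⟫)
  K₄ = pre³ * (⟪ sub 2 J ⟫ + ⟪ sub 4 J ⟫)

  K₁-cls : Cls (+ 1) K₁
  K₁-cls = cls-mod (+ 1) −1 refl (cls-* (mon-cls −6 +0 +0 −3 +0) (cls-+ (sub-cls J 0 0 0 refl refl refl) (sub-cls J 6 0 3 refl refl refl)))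
  K₂-cls : Cls (+ 2) K₂
  K₂-cls = cls-mod (+ 2) −1 refl (cls-* (mon-cls −6 +0 +0 −3 +0) (cls-+ (sub-cls J 1 1 0 refl refl refl) (sub-cls J 5 1 2 refl refl refl)))
  K₄-cls : Cls (+ 4) K₄
  K₄-cls = cls-mod (+ 4) −1 refl (cls-* (mon-cls −6 +0 +0 −3 +0) (cls-+ (sub-cls J 2 3 0 refl refl refl) (sub-cls J 4 3 1 refl refl refl)))

  cube-dissected : z * (z * z) ≃ K₁ + K₂ + K₄ - ι (+ 7)
  cube-dissected = begin
    z * (z * z) ≈⟨ *-congˡ (mon-* _ _) ⨾ mon-* _ _ ⟩
    mon (ex −6 (+ 3) +0 +0 +0 −3 +0) ≈⟨ ≈-sym (*-congˡ e₁³ ⨾ mon-* _ _) ⟩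
    pre³ * (E1 * (E1 * E1)) ≈⟨ *-congˡ (≈-sym Jacobi.cube ⨾ fam-split J) ⟩
    pre³ * ∑ᴸ (λ r → ⟪ sub r J ⟫) 7 ≈⟨ mod! 11 pre³ (⟪ sub 0 J ⟫) (⟪ sub 1 J ⟫) (⟪ sub 2 J ⟫) (⟪ sub 3 J ⟫) (⟪ sub 4 J ⟫) (⟪ sub 5 J ⟫) (⟪ sub 6 J ⟫) (q^ 6) E49 (⟪ dilate 48 J ⟫)
        (λ p j₀ j₁ j₂ j₃ j₄ j₅ j₆ q e d → (p :* (𝟘 :+ j₀ :+ j₁ :+ j₂ :+ j₃ :+ j₄ :+ j₅ :+ j₆) , p :* (j₀ :+ j₆) :+ p :* (j₁ :+ j₅) :+ p :* (j₂ :+ j₄) :- # 7) ,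
          (:- p , con −7 :* (q :* d) , j₃) ∷ (:- (# 7 :* p :* q) , d , e :* (e :* e)) ∷ (:- # 7 , p :* (q :* (e :* (e :* e))) , 𝟙) ∷ [])
        (moved −7 6 (dilate 48 J) , d≈ , unit-part) ⟩
    K₁ + K₂ + K₄ - ι (+ 7) ∎
    where
    e₁³ : E1 * (E1 * E1) ≃ mon (ex +0 (+ 3) +0 +0 +0 +0 +0)
    e₁³ = ring! 1 E1 (λ e → e :* (e :* e) , e :^ 3 :* (𝟙 :* (𝟙 :* (𝟙 :* (𝟙 :* 𝟙))))) ⨾ mon-e (+ 3) +0 +0 +0 +0 +0
    e₄₉³ : E49 * (E49 * E49) ≃ mon (ex +0 +0 +0 +0 +0 (+ 3) +0)
    e₄₉³ = ring! 1 E49 (λ e → e :* (e :* e) , 𝟙 :* (𝟙 :* (𝟙 :* (𝟙 :* (e :^ 3 :* 𝟙))))) ⨾ mon-e +0 +0 +0 +0 (+ 3) +0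
    d≈ : ⟪ dilate 48 J ⟫ ≃ E49 * (E49 * E49)
    d≈ = ≈-sym (V-fam 48 J) ⨾ V-cong 49 Jacobi.cube ⨾ V-* 49 _ _ ⨾ *-cong (V-ℙ 49 1 1) (V-* 49 _ _ ⨾ *-cong (V-ℙ 49 1 1) (V-ℙ 49 1 1))
    unit-part : pre³ * (q^ 6 * (E49 * (E49 * E49))) ≃ 1#
    unit-part = *-congˡ (*-cong (mon-q (+ 6)) e₄₉³ ⨾ mon-* _ _) ⨾ mon-* _ _ ⨾ mon-0

  infixl 6 _⟨+⟩_ _⟨-⟩_
  _⟨+⟩_ : ∀ {r f g} → Cls r f → Cls r g → Cls r (f + g)
  _⟨+⟩_ = cls-+
  _⟨-⟩_ : ∀ {r f g} → Cls r f → Cls r g → Cls r (f - g)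
  x ⟨-⟩ y = cls-+ x (cls-neg y)

  part : ℕ → Laurent
  part 0 = ι (+ 6) * (a * (b * c)) + ι (+ 6)
  part 1 = a * (a * a) + ι (+ 3) * (b * (b * c)) - ι (+ 6) * (c * a) - K₁
  part 2 = c * (c * c) + ι (+ 3) * (a * (a * b)) - ι (+ 6) * (b * c) - K₂
  part 3 = ι (+ 3) * (a * (b * b)) - ι (+ 3) * (a * a) + ι (+ 3) * c
  part 4 = b * (b * b) + ι (+ 3) * (a * (c * c)) - ι (+ 6) * (a * b) - K₄
  part 5 = ι (+ 3) * (b * (c * c)) - ι (+ 3) * (b * b) + ι (+ 3) * a
  part 6 = ι (+ 3) * (a * (a * c)) - ι (+ 3) * (c * c) + ι (+ 3) * b
  part _ = 0#

  part-cls : ∀ i → Cls (+ i) (part i)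
  part-cls 0 = cls-ι* (+ 6) (cls-* a-cls (cls-* b-cls c-cls)) ⟨+⟩ ι-cls (+ 6)
  part-cls 1 = cls-mod (+ 1) −1 refl (cls-* a-cls (cls-* a-cls a-cls)) ⟨+⟩ cls-ι* (+ 3) (cls-* b-cls (cls-* b-cls c-cls)) ⟨-⟩ cls-ι* (+ 6) (cls-* c-cls a-cls) ⟨-⟩ K₁-cls
  part-cls 2 = cls-mod (+ 2) (+ 1) refl (cls-* c-cls (cls-* c-cls c-cls)) ⟨+⟩ cls-ι* (+ 3) (cls-mod (+ 2) −1 refl (cls-* a-cls (cls-* a-cls b-cls))) ⟨-⟩ cls-ι* (+ 6) (cls-* b-cls c-cls) ⟨-⟩ K₂-cls
  part-cls 3 = cls-ι* (+ 3) (cls-mod (+ 3) −1 refl (cls-* a-cls (cls-* b-cls b-cls))) ⟨-⟩ cls-ι* (+ 3) (cls-mod (+ 3) −1 refl (cls-* a-cls a-cls)) ⟨+⟩ cls-ι* (+ 3) c-cls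
  part-cls 4 = cls-mod (+ 4) −1 refl (cls-* b-cls (cls-* b-cls b-cls)) ⟨+⟩ cls-ι* (+ 3) (cls-* a-cls (cls-* c-cls c-cls)) ⟨-⟩ cls-ι* (+ 6) (cls-mod (+ 4) −1 refl (cls-* a-cls b-cls)) ⟨-⟩ K₄-cls
  part-cls 5 = cls-ι* (+ 3) (cls-* b-cls (cls-* c-cls c-cls)) ⟨-⟩ cls-ι* (+ 3) (cls-mod (+ 5) −1 refl (cls-* b-cls b-cls)) ⟨+⟩ cls-ι* (+ 3) (cls-mod (+ 5) −1 refl a-cls)
  part-cls 6 = cls-ι* (+ 3) (cls-mod (+ 6) −1 refl (cls-* a-cls (cls-* a-cls c-cls))) ⟨-⟩ cls-ι* (+ 3) (cls-* c-cls c-cls) ⟨+⟩ cls-ι* (+ 3) (cls-mod (+ 6) −1 refl b-cls)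
  part-cls (suc (suc (suc (suc (suc (suc (suc i))))))) = cls 0# (≈-sym (*-congˡ (V-0 7) ⨾ zeroʳ _))

  total : part 0 + (part 1 + (part 2 + (part 3 + (part 4 + (part 5 + (part 6 + 0#)))))) ≃ 0#
  total = mod! 7 a b c z K₁ K₂ K₄ (λ a b c z k l m →
    ((# 6 :* (a :* (b :* c)) :+ # 6) :+ ((a :* (a :* a) :+ # 3 :* (b :* (b :* c)) :- # 6 :* (c :* a) :- k) :+ ((c :* (c :* c) :+ # 3 :* (a :* (a :* b)) :- # 6 :* (b :* c) :- l)
      :+ ((# 3 :* (a :* (b :* b)) :- # 3 :* (a :* a) :+ # 3 :* c) :+ ((b :* (b :* b) :+ # 3 :* (a :* (c :* c)) :- # 6 :* (a :* b) :- m)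
      :+ ((# 3 :* (b :* (c :* c)) :- # 3 :* (b :* b) :+ # 3 :* a) :+ ((# 3 :* (a :* (a :* c)) :- # 3 :* (c :* c) :+ # 3 :* b) :+ 𝟘)))))) , 𝟘) ,
    (𝟙 , z :* (z :* z) , k :+ l :+ m :- # 7) ∷ (:- (z :* z :+ z :* (a :+ b :+ c :- 𝟙) :+ (a :+ b :+ c :- 𝟙) :* (a :+ b :+ c :- 𝟙)) , z , a :+ b :+ c :- 𝟙) ∷ []) (cube-dissected , z≈)

  -- The class 0 part of (a + b + c - 1)³ is 6abc - 1, and that of z³ is -7.
  six-abc : ι (+ 6) * (a * b * c + 1#) ≃ 0#
  six-abc = ring! 3 a b c (λ a b c → # 6 :* (a :* b :* c :+ 𝟙) , # 6 :* (a :* (b :* c)) :+ # 6) ⨾ Separate.v₀ part part-cls total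

abc≈-1 : a * b * c ≃ - 1#
abc≈-1 = mod! 1 (a * b * c) (λ x → (x , :- 𝟙) , (𝟙 , x :+ 𝟙 , 𝟘) ∷ []) (ι-cancel (+ 6) _ (λ ()) AbcJ.six-abc)

opaque
  unfolding a

  a′b′c′≈-1 : a′ * b′ * c′ ≃ - 1#
  a′b′c′≈-1 = ≈-sym (V-* 2 (a * b) c ⨾ *-congʳ (V-* 2 a b)) ⨾ V-cong 2 abc≈-1 ⨾ V-neg 2 1# ⨾ -‿cong (V-one 2)

-- Dissection of φ(−q) = Σ (−1)ⁿ q^{n²}

f₁ f₂ : Fam
f₁ = fam +0 (+ 1) 2 0 0
f₂ = fam +0 −1 2 2 1

φ : Laurent
φ = ⟪ f₁ ⟫ + ⟪ f₂ ⟫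

φ≈ : φ ≃ mon (ex +0 (+ 2) −1 +0 +0 +0 +0)
φ≈ = begin
  φ ≈⟨ Theta.theta 0 0 ⟩
  E2 * (ℙ 2 1 * ℙ 2 1) ≈⟨ mod! 4 E1 E2 I2 (ℙ 2 1) (λ e f i p → (f :* (p :* p) , e :* (e :* i)) , (:- (i :* (e :+ p :* f)) , e , p :* f) ∷ (:- (f :* p :* p) , f :* i , 𝟙) ∷ []) (ℙ-regroup 2 1 1 ⨾ *-congʳ (*-identityˡ _) , EtaProduct.e-inv 1) ⟩
  E1 * (E1 * I2) ≈⟨ ring! 2 E1 I2 (λ e i → e :* (e :* i) , e :^ 2 :* (i :^ 1 :* (𝟙 :* (𝟙 :* (𝟙 :* 𝟙))))) ⟩
  zpow E1 I1 (+ 2) * (zpow E2 I2 −1 * (1# * (1# * (1# * 1#)))) ≈⟨ mon-e (+ 2) −1 +0 +0 +0 +0 ⟩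
  mon (ex +0 (+ 2) −1 +0 +0 +0 +0) ∎

φ₄₉ n₄₉ : Laurent
φ₄₉ = ⟪ dilate 48 f₁ ⟫ + ⟪ dilate 48 f₂ ⟫
n₄₉ = mon (ex +0 +0 +0 +0 +0 −2 (+ 1))

φ₄₉≈ : φ₄₉ ≃ mon (ex +0 +0 +0 +0 +0 (+ 2) −1)
φ₄₉≈ = ≈-sym (V-+ 49 _ _ ⨾ +-cong (V-fam 48 f₁) (V-fam 48 f₂)) ⨾ ≈-sym (V-V 7 7 φ)
  ⨾ V-cong 7 (V-cong 7 φ≈ ⨾ mon-V7 +0 (+ 2) −1 +0 +0) ⨾ mon-V7 +0 +0 +0 (+ 2) −1

n₄₉φ₄₉ : n₄₉ * φ₄₉ ≃ 1#
n₄₉φ₄₉ = *-congˡ φ₄₉≈ ⨾ mon-* _ _ ⨾ mon-0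

-- Indices n congruent to ±1, ±2, ±3 modulo 7 in the sum of (-1)ⁿ q^(n²) contribute q, q⁴, q⁹ times
-- triple products in base q⁹⁸ with the exponents 49 ∓ 14, 49 ∓ 28, 49 ∓ 42.
t₃₅ t₂₁ t₇ : Laurent
t₃₅ = ⟪ Theta.F₁ 34 62 ⟫ + ⟪ Theta.F₂ 34 62 ⟫
t₂₁ = ⟪ Theta.F₁ 20 76 ⟫ + ⟪ Theta.F₂ 20 76 ⟫
t₇ = ⟪ Theta.F₁ 6 90 ⟫ + ⟪ Theta.F₂ 6 90 ⟫

φ-dissected : φ ≃ φ₄₉ + ι −2 * (q^ 1 * t₃₅) + ι (+ 2) * (q^ 4 * t₂₁) + ι −2 * (q^ 9 * t₇)
φ-dissected = +-cong (fam-split f₁) (fam-split f₂)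
  ⨾ mod! 17 (⟪ sub 0 f₁ ⟫) (⟪ sub 1 f₁ ⟫) (⟪ sub 2 f₁ ⟫) (⟪ sub 3 f₁ ⟫) (⟪ sub 4 f₁ ⟫) (⟪ sub 5 f₁ ⟫) (⟪ sub 6 f₁ ⟫) (⟪ sub 6 f₂ ⟫) (q^ 1) (q^ 4) (q^ 9) (⟪ Theta.F₁ 34 62 ⟫) (⟪ Theta.F₂ 34 62 ⟫) (⟪ Theta.F₁ 20 76 ⟫) (⟪ Theta.F₂ 20 76 ⟫) (⟪ Theta.F₁ 6 90 ⟫) (⟪ Theta.F₂ 6 90 ⟫)
    (λ a₀ a₁ a₂ a₃ a₄ a₅ a₆ b₆ q q₄ q₉ x x′ y y′ w w′ →
      -- `f₂` is `f₁` with the index shifted by one, so `sub r f₂` coincides with `sub (suc r) f₁`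
      -- for r < 6; the same variables serve for both.
      ( (𝟘 :+ a₀ :+ a₁ :+ a₂ :+ a₃ :+ a₄ :+ a₅ :+ a₆) :+ (𝟘 :+ a₁ :+ a₂ :+ a₃ :+ a₄ :+ a₅ :+ a₆ :+ b₆)
      , (a₀ :+ b₆) :+ con −2 :* (q :* (x :+ x′)) :+ # 2 :* (q₄ :* (y :+ y′)) :+ con −2 :* (q₉ :* (w :+ w′)) ) ,
      (con −2 , con −1 :* (q :* x) , a₁) ∷ (con −2 , con −1 :* (q :* x′) , a₆) ∷
      (con −2 , # 1 :* (q₄ :* y) , a₂) ∷ (con −2 , # 1 :* (q₄ :* y′) , a₅) ∷
      (con −2 , con −1 :* (q₉ :* w) , a₃) ∷ (con −2 , con −1 :* (q₉ :* w′) , a₄) ∷ [])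
    (moved −1 1 (Theta.F₁ 34 62) , moved −1 1 (Theta.F₂ 34 62) , moved (+ 1) 4 (Theta.F₁ 20 76) , moved (+ 1) 4 (Theta.F₂ 20 76)
    , moved −1 9 (Theta.F₁ 6 90) , moved −1 9 (Theta.F₂ 6 90))

q-cls : ∀ n → Cls (+ n) (q^ n)
q-cls n = cls 1# (≈-sym (*-congˡ (V-one 7) ⨾ *-identityʳ _))

opaque
  X₁ X₂ X₄ : Laurent
  X₁ = n₄₉ * (ι −2 * (q^ 1 * t₃₅))
  X₂ = n₄₉ * (ι −2 * (q^ 9 * t₇))
  X₄ = n₄₉ * (ι (+ 2) * (q^ 4 * t₂₁))

  X₁-cls : Cls (+ 1) X₁
  X₁-cls = cls-* (mon-cls +0 +0 +0 −2 (+ 1)) (cls-ι* −2 (cls-* (q-cls 1) (cls-+ (fam-cls′ _ _ _ _ _ refl refl) (cls-mod +0 (+ 5) refl (fam-cls′ _ _ _ _ _ refl refl)))))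

  X₂-cls : Cls (+ 2) X₂
  X₂-cls = cls-mod (+ 2) (+ 1) refl (cls-* (mon-cls +0 +0 +0 −2 (+ 1)) (cls-ι* −2 (cls-* (q-cls 9) (cls-+ (fam-cls′ _ _ _ _ _ refl refl) (cls-mod +0 (+ 1) refl (fam-cls′ _ _ _ _ _ refl refl))))))

  X₄-cls : Cls (+ 4) X₄
  X₄-cls = cls-* (mon-cls +0 +0 +0 −2 (+ 1)) (cls-ι* (+ 2) (cls-* (q-cls 4) (cls-+ (fam-cls′ _ _ _ _ _ refl refl) (cls-mod +0 (+ 3) refl (fam-cls′ _ _ _ _ _ refl refl)))))

  -- The quotient z²/y is φ(-q)/φ(-q⁴⁹). Its exponents modulo 7 are squares, so beside the constant
  -- 1 only the classes 1, 2, 4 occur.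
  z²≈ : z * z ≃ y * (1# + X₁ + X₂ + X₄)
  z²≈ = begin
    z * z ≈⟨ mon-* _ _ ⟩
    mon (ex −4 (+ 2) +0 +0 +0 −2 +0) ≈⟨ ≈-sym (*-congˡ (*-congˡ φ≈ ⨾ mon-* _ _) ⨾ mon-* _ _) ⟩
    y * (n₄₉ * φ) ≈⟨ *-congˡ (*-congˡ φ-dissected ⨾ mod! 5 n₄₉ φ₄₉ (ι −2 * (q^ 1 * t₃₅)) (ι (+ 2) * (q^ 4 * t₂₁)) (ι −2 * (q^ 9 * t₇)) (λ n φ a b c → (n :* (φ :+ a :+ b :+ c) , 𝟙 :+ n :* a :+ n :* c :+ n :* b) , (𝟙 , n :* φ , 𝟙) ∷ []) n₄₉φ₄₉) ⟩
    y * (1# + X₁ + X₂ + X₄) ∎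

  -- The triple product evaluates the product of the three components.
  X-product : X₁ * X₂ * X₄ * mon (ex −14 +0 +0 −1 (+ 1) (+ 7) −7) ≃ ι (+ 8)
  X-product = begin
    X₁ * X₂ * X₄ * T
      ≈⟨ ring! 8 n₄₉ (q^ 1) (q^ 4) (q^ 9) t₃₅ t₂₁ t₇ T (λ n q q₄ q₉ x y w T →
           (n :* (con −2 :* (q :* x))) :* (n :* (con −2 :* (q₉ :* w))) :* (n :* (# 2 :* (q₄ :* y))) :* T , # 8 :* ((q :* (q₄ :* q₉)) :* ((n :* (n :* n)) :* ((x :* y :* w) :* T)))) ⟩
    ι (+ 8) * ((q^ 1 * (q^ 4 * q^ 9)) * ((n₄₉ * (n₄₉ * n₄₉)) * ((t₃₅ * t₂₁ * t₇) * T)))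
      ≈⟨ *-congˡ (*-cong (*-congˡ (q^-+ 4 9) ⨾ q^-+ 1 13 ⨾ mon-q (+ 14)) (*-cong (*-congˡ (mon-* _ _) ⨾ mon-* _ _) (*-congʳ t-product ⨾ mon-* _ _))
           ⨾ *-congˡ (mon-* _ _) ⨾ mon-* _ _ ⨾ mon-0) ⟩
    ι (+ 8) * 1# ≈⟨ *-identityʳ _ ⟩
    ι (+ 8) ∎
    where
    T : Laurent
    T = mon (ex −14 +0 +0 −1 (+ 1) (+ 7) −7)
    t-product : t₃₅ * t₂₁ * t₇ ≃ mon (ex +0 +0 +0 (+ 1) −1 −1 (+ 4))
    t-product = begin
      t₃₅ * t₂₁ * t₇
        ≈⟨ *-cong (*-cong (Theta.theta 34 62) (Theta.theta 20 76)) (Theta.theta 6 90) ⟩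
      (E98 * (ℙ 98 35 * ℙ 98 63)) * (E98 * (ℙ 98 21 * ℙ 98 77)) * (E98 * (ℙ 98 7 * ℙ 98 91))
        -- The six partial products are those of `ℙ 14 7` modulo 98 except for `ℙ 98 49`, which is
        -- E49/E98; and `ℙ 14 7` itself is E7/E14.
        ≈⟨ mod! 14 E98 E49 I49 E7 E14 I14 (ℙ 98 7) (ℙ 98 21) (ℙ 98 35) (ℙ 98 49) (ℙ 98 63) (ℙ 98 77) (ℙ 98 91) (ℙ 14 7)
             (λ E F f S G g a b c d e h k p →
               ((E :* (c :* e)) :* (E :* (b :* h)) :* (E :* (a :* k)) , S :* (g :* (f :* E :^ 4))) ,
               (:- (E :^ 3 :* (a :* b :* c :* e :* h :* k)) , F :* f , 𝟙) ∷ (E :^ 3 :* (a :* b :* c :* e :* h :* k) :* f , F , d :* E) ∷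
               (:- (E :^ 4 :* f) , p , a :* b :* c :* d :* e :* h :* k) ∷ (:- (E :^ 4 :* f :* p) , G :* g , 𝟙) ∷ (:- (E :^ 4 :* f :* g) , S , p :* G) ∷ [])
             ( EtaProduct.e-inv 48 , ℙ-regroup 2 49 49 ⨾ *-congʳ (*-identityˡ _) , ℙ-regroup 7 14 7 ⨾ *-congʳ (*-congʳ (*-congʳ (*-congʳ (*-congʳ (*-congʳ (*-identityˡ _))))))
             , EtaProduct.e-inv 13 , ℙ-regroup 2 7 7 ⨾ *-congʳ (*-identityˡ _)) ⟩
      E7 * (I14 * (I49 * E98 ^ 4))
        ≈⟨ ring! 4 E7 I14 I49 (E98 ^ 4) (λ a b c d → a :* (b :* (c :* d)) , 𝟙 :* (𝟙 :* (a :^ 1 :* (b :^ 1 :* (c :^ 1 :* d))))) ⟩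
      zpow E1 I1 +0 * (zpow E2 I2 +0 * (zpow E7 I7 (+ 1) * (zpow E14 I14 −1 * (zpow E49 I49 −1 * zpow E98 I98 (+ 4)))))
        ≈⟨ mon-e +0 +0 (+ 1) −1 −1 (+ 4) ⟩
      mon (ex +0 +0 +0 (+ 1) −1 −1 (+ 4)) ∎

-- Comparison of z² and y (1 + X₁ + X₂ + X₄) class by class

module Phi where
  infixl 6 _⟨+⟩_ _⟨-⟩_
  _⟨+⟩_ : ∀ {r f g} → Cls r f → Cls r g → Cls r (f + g)
  _⟨+⟩_ = cls-+
  _⟨-⟩_ : ∀ {r f g} → Cls r f → Cls r g → Cls r (f - g)
  x ⟨-⟩ y = cls-+ x (cls-neg y)

  part : ℕ → Laurent
  part 0 = ι (+ 2) - c′ * X₁ - b′ * X₂ - a′ * X₄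
  part 1 = ι (+ 2) * (c * a) - c′ * X₂ + X₁
  part 2 = ι (+ 2) * (b * c) - b′ * X₄ + X₂
  part 3 = a * a - ι (+ 2) * c - a′ - c′ * X₄
  part 4 = ι (+ 2) * (a * b) - a′ * X₁ + X₄
  part 5 = b * b - ι (+ 2) * a - b′ - a′ * X₂
  part 6 = c * c - ι (+ 2) * b - c′ - b′ * X₁
  part _ = 0#

  part-cls : ∀ i → Cls (+ i) (part i)
  part-cls 0 = ι-cls (+ 2) ⟨-⟩ cls-mod +0 (+ 1) refl (cls-* c′-cls X₁-cls) ⟨-⟩ cls-* b′-cls X₂-cls ⟨-⟩ cls-* a′-cls X₄-cls
  part-cls 1 = cls-ι* (+ 2) (cls-* c-cls a-cls) ⟨-⟩ cls-mod (+ 1) (+ 1) refl (cls-* c′-cls X₂-cls) ⟨+⟩ X₁-cls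
  part-cls 2 = cls-ι* (+ 2) (cls-* b-cls c-cls) ⟨-⟩ cls-* b′-cls X₄-cls ⟨+⟩ X₂-cls
  part-cls 3 = cls-mod (+ 3) −1 refl (cls-* a-cls a-cls) ⟨-⟩ cls-ι* (+ 2) c-cls ⟨-⟩ cls-mod (+ 3) −1 refl a′-cls ⟨-⟩ cls-mod (+ 3) (+ 1) refl (cls-* c′-cls X₄-cls)
  part-cls 4 = cls-ι* (+ 2) (cls-mod (+ 4) −1 refl (cls-* a-cls b-cls)) ⟨-⟩ cls-mod (+ 4) −1 refl (cls-* a′-cls X₁-cls) ⟨+⟩ X₄-cls
  part-cls 5 = cls-mod (+ 5) −1 refl (cls-* b-cls b-cls) ⟨-⟩ cls-ι* (+ 2) (cls-mod (+ 5) −1 refl a-cls) ⟨-⟩ cls-mod (+ 5) −1 refl b′-cls ⟨-⟩ cls-mod (+ 5) −1 refl (cls-* a′-cls X₂-cls)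
  part-cls 6 = cls-* c-cls c-cls ⟨-⟩ cls-ι* (+ 2) (cls-mod (+ 6) −1 refl b-cls) ⟨-⟩ c′-cls ⟨-⟩ cls-mod (+ 6) −1 refl (cls-* b′-cls X₁-cls)
  part-cls (suc (suc (suc (suc (suc (suc (suc i))))))) = cls 0# (≈-sym (*-congˡ (V-0 7) ⨾ zeroʳ _))

  total : part 0 + (part 1 + (part 2 + (part 3 + (part 4 + (part 5 + (part 6 + 0#)))))) ≃ 0#
  total = mod! 11 a b c a′ b′ c′ X₁ X₂ X₄ z y (λ a b c a′ b′ c′ x x₂ x₄ z y →
    ((# 2 :- c′ :* x :- b′ :* x₂ :- a′ :* x₄) :+ ((# 2 :* (c :* a) :- c′ :* x₂ :+ x) :+ ((# 2 :* (b :* c) :- b′ :* x₄ :+ x₂) :+ ((a :* a :- # 2 :* c :- a′ :- c′ :* x₄)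
      :+ ((# 2 :* (a :* b) :- a′ :* x :+ x₄) :+ ((b :* b :- # 2 :* a :- b′ :- a′ :* x₂) :+ ((c :* c :- # 2 :* b :- c′ :- b′ :* x) :+ 𝟘)))))) , 𝟘) ,
    (𝟙 , z :* z , y :* (𝟙 :+ x :+ x₂ :+ x₄)) ∷ (:- (z :+ (a :+ b :+ c :- 𝟙)) , z , a :+ b :+ c :- 𝟙) ∷ (𝟙 :+ x :+ x₂ :+ x₄ , y , a′ :+ b′ :+ c′ :- 𝟙) ∷ []) (z²≈ , z≈ , y≈)

  open Separate part part-cls

  halve : ∀ {x} → ι (+ 2) * x ≃ 0# → x ≃ 0#
  halve = ι-cancel (+ 2) _ (λ ())

  -- The classes 1, 2 and 4 are linear in X₁, X₂, X₄ and form a cycle; eliminating around it returns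
  -- X₁ multiplied by -a′b′c′ = 1, whence the division by 2.
  X₁≈ : X₁ ≃ - (a * c + b * c * c′ + a * b * b′ * c′)
  X₁≈ = sub≈0⇒≈ (halve (mod! 9 a b c a′ b′ c′ X₁ X₂ X₄ (λ a b c a′ b′ c′ x x₂ x₄ → (# 2 :* (x :- :- (a :* c :+ b :* c :* c′ :+ a :* b :* b′ :* c′)) , 𝟘) ,
    (𝟙 , # 2 :* (c :* a) :- c′ :* x₂ :+ x , 𝟘) ∷ (c′ , # 2 :* (b :* c) :- b′ :* x₄ :+ x₂ , 𝟘) ∷ (b′ :* c′ , # 2 :* (a :* b) :- a′ :* x :+ x₄ , 𝟘) ∷ (x , a′ :* b′ :* c′ , :- 𝟙) ∷ []) (v₁ total , v₂ total , v₄ total , a′b′c′≈-1)))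

  X₄≈ : X₄ ≃ - (b * a + c * a * a′ + b * c * c′ * a′)
  X₄≈ = sub≈0⇒≈ (halve (mod! 9 a b c a′ b′ c′ X₁ X₂ X₄ (λ a b c a′ b′ c′ x x₂ x₄ → (# 2 :* (x₄ :- :- (b :* a :+ c :* a :* a′ :+ b :* c :* c′ :* a′)) , 𝟘) ,
    (a′ , # 2 :* (c :* a) :- c′ :* x₂ :+ x , 𝟘) ∷ (a′ :* c′ , # 2 :* (b :* c) :- b′ :* x₄ :+ x₂ , 𝟘) ∷ (𝟙 , # 2 :* (a :* b) :- a′ :* x :+ x₄ , 𝟘) ∷ (x₄ , a′ :* b′ :* c′ , :- 𝟙) ∷ []) (v₁ total , v₂ total , v₄ total , a′b′c′≈-1)))

  X₂≈ : X₂ ≃ - (c * b + a * b * b′ + c * a * a′ * b′)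
  X₂≈ = sub≈0⇒≈ (halve (mod! 9 a b c a′ b′ c′ X₁ X₂ X₄ (λ a b c a′ b′ c′ x x₂ x₄ → (# 2 :* (x₂ :- :- (c :* b :+ a :* b :* b′ :+ c :* a :* a′ :* b′)) , 𝟘) ,
    (a′ :* b′ , # 2 :* (c :* a) :- c′ :* x₂ :+ x , 𝟘) ∷ (𝟙 , # 2 :* (b :* c) :- b′ :* x₄ :+ x₂ , 𝟘) ∷ (b′ , # 2 :* (a :* b) :- a′ :* x :+ x₄ , 𝟘) ∷ (x₂ , a′ :* b′ :* c′ , :- 𝟙) ∷ []) (v₁ total , v₂ total , v₄ total , a′b′c′≈-1)))

  -- Three expressions that will be shown to vanish. After elimination of the X, the classes 5, 6
  -- and 3 only say that each is a multiple of the next in cyclic order; leading terms then decide.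
  p₁ᴸ p₂ᴸ p₃ᴸ : Laurent
  p₁ᴸ = a + b′ + b * c′
  p₂ᴸ = b + c′ + c * a′
  p₃ᴸ = c + a′ + a * b′

  k₁ᴸ k₂ᴸ k₃ᴸ : Laurent
  k₁ᴸ = b + b′ * (a * a′)
  k₂ᴸ = c + c′ * (b * b′)
  k₃ᴸ = a + a′ * (c * c′)

  p₁-step : p₁ᴸ ≃ k₁ᴸ * p₂ᴸ
  p₁-step = mod! 7 a b c a′ b′ c′ X₂ (λ a b c a′ b′ c′ x → (a :+ b′ :+ b :* c′ , (b :+ b′ :* (a :* a′)) :* (b :+ c′ :+ c :* a′)) ,
    (:- 𝟙 , b :* b :- # 2 :* a :- b′ :- a′ :* x , 𝟘) ∷ (:- a′ , x , :- (c :* b :+ a :* b :* b′ :+ c :* a :* a′ :* b′)) ∷ (:- a , a′ :* b′ :* c′ , :- 𝟙) ∷ []) (v₅ total , X₂≈ , a′b′c′≈-1)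

  p₂-step : p₂ᴸ ≃ k₂ᴸ * p₃ᴸ
  p₂-step = mod! 7 a b c a′ b′ c′ X₁ (λ a b c a′ b′ c′ x → (b :+ c′ :+ c :* a′ , (c :+ c′ :* (b :* b′)) :* (c :+ a′ :+ a :* b′)) ,
    (:- 𝟙 , c :* c :- # 2 :* b :- c′ :- b′ :* x , 𝟘) ∷ (:- b′ , x , :- (a :* c :+ b :* c :* c′ :+ a :* b :* b′ :* c′)) ∷ (:- b , a′ :* b′ :* c′ , :- 𝟙) ∷ []) (v₆ total , X₁≈ , a′b′c′≈-1)

  p₃-step : p₃ᴸ ≃ k₃ᴸ * p₁ᴸ
  p₃-step = mod! 7 a b c a′ b′ c′ X₄ (λ a b c a′ b′ c′ x → (c :+ a′ :+ a :* b′ , (a :+ a′ :* (c :* c′)) :* (a :+ b′ :+ b :* c′)) ,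
    (:- 𝟙 , a :* a :- # 2 :* c :- a′ :- c′ :* x , 𝟘) ∷ (:- c′ , x , :- (b :* a :+ c :* a :* a′ :+ b :* c :* c′ :* a′)) ∷ (:- c , a′ :* b′ :* c′ , :- 𝟙) ∷ []) (v₃ total , X₄≈ , a′b′c′≈-1)

-- Leading terms of the components, and vanishing of the three relations

lead-ι : ∀ n → Lead (ι n) +0 n
lead-ι n = go (int-ι n)
  where
  go : Int (ι n) → Lead (ι n) +0 n
  go (d , l@(lead s eq h)) = lead s eq (sym (coeff-mkL +0 s 0) ⟫ sym (at-coeff eq +0) ⟫ sym (at-coeff (*-identityʳ (ι n)) +0) ⟫ coeff-ι n 1# +0 ⟫ cong (Z._*_ n) coeff-1-0 ⟫ Z.*-identityʳ n)

lead-agr : ∀ {f n} → Agr 1 f (ι n) → Lead f +0 n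
lead-agr {f} {n} (agr {h} (d , l) e) = lead-cong (≈-sym e) (subst (Lead _ +0) (Z.+-identityʳ n) (lead-+ (lead-ι n) (lead-lower 0 refl (lead-* (lead-q (+ 1)) l))))

fam-lead : ∀ μ ν α b γ → Lead ⟪ fam μ ν α b γ ⟫ (+ γ) ν
fam-lead μ ν α b γ = lead-cong (q^-fam γ (fam μ ν α b 0) ⨾ reflexive (cong (λ g → ⟪ fam μ ν α b g ⟫) (N.+-identityʳ γ)))
    (subst₂ (Lead _) (Z.+-identityʳ (+ γ)) (Z.*-identityˡ ν) (lead-* (lead-q (+ γ)) leading))
  where
  leading : Lead ⟪ fam μ ν α b 0 ⟫ +0 ν
  leading = lead-agr (agr-trans (fam-agr (fam μ ν α b 0) 1) (agr-≈ (+-identityˡ _ ⨾ *-identityˡ _ ⨾ *-cong (reflexive (cong ι weight0)) (reflexive (cong q^ expo0) ⨾ q^0) ⨾ *-identityʳ _)))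
    where
    weight0 : μ Z.* + 0 Z.+ ν ≡ ν
    weight0 = cong (Z._+ ν) (Z.*-zeroʳ μ) ⟫ Z.+-identityˡ ν
    expo0 : α N.* 0 N.+ suc b N.* 0 N.+ 0 ≡ 0
    expo0 = solveℕ 2 (λ α b → α *' con' 0 +' b *' con' 0 +' con' 0 =' con' 0) refl α (suc b)

i-lead : ∀ k₀ → Lead (EtaProduct.i k₀) +0 (+ 1)
i-lead k₀ = lead-agr (agr-trans (lim-agr (Poch.inv-stable (suc k₀)) 1) (agr-trans (agr-≈ (*-identityˡ _)) (agr-weaken 0<k (agr {k} (ginv-int k)
    (mod! 2 (ginv k) (q^ k) (λ g q → (g , # 1 :+ q :* g) , (𝟙 , g :* (𝟙 :- q) , 𝟙) ∷ []) (ginv-inv k 0<k))))))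
  where
  k : ℕ
  k = suc k₀ N.* 0 N.+ suc k₀
  0<k : 0 N.< k
  0<k = Poch.pos (suc k₀) 0

pre-lead : Lead pre −2 (+ 1)
pre-lead = lead-cong (≈-sym (mon-def _ _ _ _ _ _ _ ⨾ ring! 2 (qᵐ −2) I49 (λ q i → q :* (𝟙 :* (𝟙 :* (𝟙 :* (𝟙 :* (i :^ 1 :* 𝟙))))) , q :* i)))
  (lead-* (lead-q −2) (i-lead 48))

opaque
  unfolding a

  a-lead : Lead a −2 (+ 1)
  a-lead = lead-* pre-lead (lead-+ (lead-+ (lead-+ (fam-lead _ _ _ _ 0) (lead-lower 6 refl (fam-lead _ _ _ _ 7))) (lead-lower 34 refl (fam-lead _ _ _ _ 35))) (lead-lower 69 refl (fam-lead _ _ _ _ 70)))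

  b-lead : Lead b −1 −1
  b-lead = lead-* pre-lead (lead-+ (lead-+ (lead-+ (lead-lower 13 refl (fam-lead _ _ _ _ 15)) (lead-lower 55 refl (fam-lead _ _ _ _ 57))) (fam-lead _ _ _ _ 1)) (lead-lower 20 refl (fam-lead _ _ _ _ 22)))

  c-lead : Lead c (+ 3) (+ 1)
  c-lead = lead-* pre-lead (lead-+ (lead-+ (lead-+ (lead-lower 20 refl (fam-lead _ _ _ _ 26)) (lead-lower 34 refl (fam-lead _ _ _ _ 40))) (fam-lead _ _ _ _ 5)) (lead-lower 6 refl (fam-lead _ _ _ _ 12)))

  a′-lead : Lead a′ −4 (+ 1)
  a′-lead = lead-V 2 a-lead

  b′-lead : Lead b′ −2 −1
  b′-lead = lead-V 2 b-lead

  c′-lead : Lead c′ (+ 6) (+ 1)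
  c′-lead = lead-V 2 c-lead

open Phi using (p₁ᴸ; p₂ᴸ; p₃ᴸ; k₁ᴸ; k₂ᴸ; k₃ᴸ; p₁-step; p₂-step; p₃-step)

-- p₁ = k₁ k₂ k₃ p₁ with k₁ k₂ k₃ = −2 q⁻⁷ + ⋯
p₁≈0 : p₁ᴸ ≃ 0#
p₁≈0 = lead-cancel p₁ᴸ (lead-+ (lead-lower 6 refl (lead-cong q^0 (lead-q +0))) (lead-neg κ-lead)) (λ ())
    (mod! 6 p₁ᴸ p₂ᴸ p₃ᴸ k₁ᴸ k₂ᴸ k₃ᴸ (λ p q r k l m → ((𝟙 :- k :* (l :* m)) :* p , 𝟘) , (𝟙 , p , k :* q) ∷ (k , q , l :* r) ∷ (k :* l , r , m :* p) ∷ []) (p₁-step , p₂-step , p₃-step))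
  where
  κ-lead : Lead (k₁ᴸ * (k₂ᴸ * k₃ᴸ)) −7 −2
  κ-lead = lead-* (lead-+ (lead-lower 6 refl b-lead) (lead-* b′-lead (lead-* a-lead a′-lead)))
    (lead-* (lead-+ c-lead (lead-* c′-lead (lead-* b-lead b′-lead))) (lead-+ a-lead (lead-lower 6 refl (lead-* a′-lead (lead-* c-lead c′-lead)))))

p₃≈0 : p₃ᴸ ≃ 0#
p₃≈0 = p₃-step ⨾ *-congˡ p₁≈0 ⨾ zeroʳ _

p₂≈0 : p₂ᴸ ≃ 0#
p₂≈0 = p₂-step ⨾ *-congˡ p₃≈0 ⨾ zeroʳ _

-- The ratios r₁, r₂, r₃ and the construction of the tower

opaque
  -- These are a′/c, c′/b and b′/a, with the divisions carried out by means of abc = -1.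
  r₁ r₂ r₃ s T : Laurent
  r₁ = - (a′ * a * b)
  r₂ = - (c′ * c * a)
  r₃ = - (b′ * b * c)
  s = r₁ + r₂ + r₃
  T = s * (1# + s) + (1# + s * (1# + s)) * r₁ - s * (r₁ * r₁) + r₂ * (ι (+ 3) * (r₁ * r₁) - (1# + s * (1# + ι (+ 2) * r₁)))

  s≈ : s ≃ r₁ + r₂ + r₃
  s≈ = ≈-refl

  T≈ : T ≃ s * (1# + s) + (1# + s * (1# + s)) * r₁ - s * (r₁ * r₁) + r₂ * (ι (+ 3) * (r₁ * r₁) - (1# + s * (1# + ι (+ 2) * r₁)))
  T≈ = ≈-refl

  a′≈ : a′ ≃ r₁ * c
  a′≈ = mod! 4 a b c a′ (λ a b c a′ → (a′ , :- (a′ :* a :* b) :* c) , (a′ , a :* b :* c , :- 𝟙) ∷ []) abc≈-1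

  b′≈ : b′ ≃ r₃ * a
  b′≈ = mod! 4 a b c b′ (λ a b c a′ → (a′ , :- (a′ :* b :* c) :* a) , (a′ , a :* b :* c , :- 𝟙) ∷ []) abc≈-1

  c′≈ : c′ ≃ r₂ * b
  c′≈ = mod! 4 a b c c′ (λ a b c a′ → (a′ , :- (a′ :* c :* a) :* b) , (a′ , a :* b :* c , :- 𝟙) ∷ []) abc≈-1

  r-prod : r₁ * r₂ * r₃ ≃ 1#
  r-prod = mod! 6 a b c a′ b′ c′ (λ a b c a′ b′ c′ → (:- (a′ :* a :* b) :* :- (c′ :* c :* a) :* :- (b′ :* b :* c) , 𝟙) ,
    (:- ((a :* b :* c) :* (a :* b :* c)) , a′ :* b′ :* c′ , :- 𝟙) ∷ (a :* b :* c :- 𝟙 , a :* b :* c , :- 𝟙) ∷ []) (a′b′c′≈-1 , abc≈-1)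

  r₁-cls : Cls +0 r₁
  r₁-cls = cls-neg (cls-mod +0 −1 refl (cls-* (cls-* a′-cls a-cls) b-cls))

  r₂-cls : Cls +0 r₂
  r₂-cls = cls-neg (cls-mod +0 (+ 1) refl (cls-* (cls-* c′-cls c-cls) a-cls))

  r₃-cls : Cls +0 r₃
  r₃-cls = cls-neg (cls-* (cls-* b′-cls b-cls) c-cls)

  s-cls : Cls +0 s
  s-cls = cls-+ (cls-+ r₁-cls r₂-cls) r₃-cls

p₁-r : (1# + r₃) * a ≃ - (r₂ * (b * b))
p₁-r = mod! 6 a b b′ c′ r₂ r₃ (λ a b b′ c′ r r′ → ((𝟙 :+ r′) :* a , :- (r :* (b :* b))) ,
  (𝟙 , a :+ b′ :+ b :* c′ , 𝟘) ∷ (:- 𝟙 , b′ , r′ :* a) ∷ (:- b , c′ , r :* b) ∷ []) (p₁≈0 , b′≈ , c′≈)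

p₂-r : (1# + r₂) * b ≃ - (r₁ * (c * c))
p₂-r = mod! 6 b c c′ a′ r₁ r₂ (λ a b b′ c′ r r′ → ((𝟙 :+ r′) :* a , :- (r :* (b :* b))) ,
  (𝟙 , a :+ b′ :+ b :* c′ , 𝟘) ∷ (:- 𝟙 , b′ , r′ :* a) ∷ (:- b , c′ , r :* b) ∷ []) (p₂≈0 , c′≈ , a′≈)

p₃-r : (1# + r₁) * c ≃ - (r₃ * (a * a))
p₃-r = mod! 6 c a a′ b′ r₃ r₁ (λ a b b′ c′ r r′ → ((𝟙 :+ r′) :* a , :- (r :* (b :* b))) ,
  (𝟙 , a :+ b′ :+ b :* c′ , 𝟘) ∷ (:- 𝟙 , b′ , r′ :* a) ∷ (:- b , c′ , r :* b) ∷ []) (p₃≈0 , a′≈ , b′≈)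

-- The product of the three relations `p₁-r`, `p₂-r`, `p₃-r`: the left side is the product of the 1
-- + rᵢ times abc, the right side is -r₁r₂r₃ (abc)².
r-unit : (1# + r₁) * (1# + r₂) * (1# + r₃) ≃ 1#
r-unit = mod! 6 a b c r₁ r₂ r₃ (λ a b c x y w → ((𝟙 :+ x) :* (𝟙 :+ y) :* (𝟙 :+ w) , 𝟙) ,
  ((𝟙 :+ x) :* (𝟙 :+ y) :* (𝟙 :+ w) :+ (a :* b :* c :- 𝟙) , a :* b :* c , :- 𝟙) ∷
  (:- ((𝟙 :+ y) :* b :* ((𝟙 :+ w) :* a)) , (𝟙 :+ x) :* c , :- (w :* (a :* a))) ∷
  (w :* (a :* a) :* ((𝟙 :+ w) :* a) , (𝟙 :+ y) :* b , :- (x :* (c :* c))) ∷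
  (:- (w :* (a :* a) :* (x :* (c :* c))) , (𝟙 :+ w) :* a , :- (y :* (b :* b))) ∷
  ((a :* b :* c) :* (a :* b :* c) , x :* y :* w , 𝟙) ∷ []) (abc≈-1 , p₃-r , p₂-r , p₁-r , r-prod)

tower : TowerData 𝕃
tower = record
  { s = s ; r₁ = r₁ ; r₂ = r₂ ; r₃ = r₃ ; T = T ; a = a ; b = b ; c = c
  ; cubic = mod! 4 s r₁ r₂ r₃ (λ s x y w → (x :* (x :* x) , s :* (x :* x) :+ (𝟙 :+ s) :* x :+ 𝟙) ,
      (:- (x :* x :+ x) , s , x :+ y :+ w) ∷ (:- x , (𝟙 :+ x) :* (𝟙 :+ y) :* (𝟙 :+ w) , 𝟙) ∷ (x :+ 𝟙 , x :* y :* w , 𝟙) ∷ []) (s≈ , r-unit , r-prod)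
  ; quadratic = mod! 4 s r₁ r₂ r₃ (λ s x y w → (y :* y , (s :- x) :* y :- (x :* x :- s :* x :- (𝟙 :+ s))) ,
      (:- (y :+ x :+ 𝟙) , s , x :+ y :+ w) ∷ (:- 𝟙 , (𝟙 :+ x) :* (𝟙 :+ y) :* (𝟙 :+ w) , 𝟙) ∷ (𝟙 , x :* y :* w , 𝟙) ∷ []) (s≈ , r-unit , r-prod)
  ; r-sum = s≈
  ; r-prod = r-prod
  ; r-unit = r-unit
  ; T≈ = T≈
  ; a² = mod! 5 a c r₁ r₂ r₃ (λ a c x y w → (a :* a , :- (x :* (y :* (𝟙 :+ x))) :* c) ,
      (x :* y , (𝟙 :+ x) :* c , :- (w :* (a :* a))) ∷ (:- (a :* a) , x :* y :* w , 𝟙) ∷ []) (p₃-r , r-prod)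
  ; b² = mod! 5 a b r₁ r₂ r₃ (λ a b x y w → (b :* b , :- (x :* (w :* (𝟙 :+ w)) :* a)) ,
      (x :* w , (𝟙 :+ w) :* a , :- (y :* (b :* b))) ∷ (:- (b :* b) , x :* y :* w , 𝟙) ∷ []) (p₁-r , r-prod)
  ; c² = mod! 5 b c r₁ r₂ r₃ (λ b c x y w → (c :* c , (𝟙 :+ y :* ((𝟙 :+ x) :* (𝟙 :+ y))) :* b) ,
      (y :* w , (𝟙 :+ y) :* b , :- (x :* (c :* c))) ∷ (b :* (y :+ 𝟙) :- c :* c , x :* y :* w , 𝟙) ∷ (:- (b :* y) , (𝟙 :+ x) :* (𝟙 :+ y) :* (𝟙 :+ w) , 𝟙) ∷ []) (p₂-r , r-prod , r-unit)
  ; abc = abc≈-1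
  }

module K where
  open Tower 𝕃 tower public using (z; y; g; a²; b²; c²; abc; h; h⁻¹; λ⁻; h⁻¹h; λ-h⁻¹)
  open TowerIdentities 𝕃 tower public

off-zero : ∀ {i f} r x → r ≡ + 0 Z.+ (+ suc i Z.+ + 7 Z.* x) → suc i N.< 7 → Cls r f → U f ≃ 0#
off-zero {i} {f} r x e l k = U-cong (≈-sym (*-congʳ (reflexive q0≡1) ⨾ *-identityˡ f)) ⨾ off-cls +0 i x e l k

dissection : Dissection 𝕃
dissection = record
  { tower = tower ; W = W ; U = U
  ; W-cong = V-cong 7 ; W-+ = V-+ 7 ; W-* = W-* ; W-1 = V-one 7
  ; U-cong = U-cong ; U-+ = U-+ ; U-W = U-W ; U-1 = U-one
  ; s° = U s ; r₁° = U r₁ ; r₂° = U r₂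
  ; W-s = ≈-sym (W-U s-cls) ; W-r₁ = ≈-sym (W-U r₁-cls) ; W-r₂ = ≈-sym (W-U r₂-cls)
  ; U-a = off-zero −2 −1 refl (N.m≤m+n 6 _) a-cls
  ; U-b = off-zero −1 −1 refl (N.m≤m+n 7 _) b-cls
  ; U-c = off-zero (+ 3) +0 refl (N.m≤m+n 4 _) c-cls
  ; U-ab = off-zero −3 −1 refl (N.m≤m+n 5 _) (cls-* a-cls b-cls)
  ; U-bc = off-zero (+ 2) +0 refl (N.s≤s (N.s≤s (N.s≤s N.z≤n))) (cls-* b-cls c-cls)
  ; U-ca = off-zero (+ 1) +0 refl (N.s≤s (N.s≤s N.z≤n)) (cls-* c-cls a-cls)
  }

-- T as an eta quotient, and R in terms of a, b, c

X₁-ξ : X₁ ≃ - (K.ξ₁ * (a * c))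
X₁-ξ = mod! 10 a b c b′ c′ X₁ r₂ r₃ K.h K.λ⁻ (λ a b c b′ c′ x r₂ r₃ h l →
  (x , :- ((𝟙 :+ :- 𝟙 :* r₂ :* h :* (𝟙 :+ r₃ :* l)) :* (a :* c))) ,
  (𝟙 , x , :- (a :* c :+ b :* c :* c′ :+ a :* b :* b′ :* c′)) ∷ (:- (b :* c :+ a :* b :* b′) , c′ , r₂ :* b) ∷ (:- (a :* b :* r₂ :* b) , b′ , r₃ :* a) ∷
  (:- (r₂ :* c :+ r₂ :* r₃ :* a :* a) , b :* b , :- (h :* a)) ∷ (r₂ :* r₃ :* h :* a , a :* a , l :* c) ∷ []) (Phi.X₁≈ , c′≈ , b′≈ , K.b² , K.a²)

X₂-ξ : X₂ ≃ - (K.ξ₂ * (b * c))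
X₂-ξ = mod! 10 a b c a′ b′ X₂ r₁ r₃ K.h⁻¹ K.λ⁻ (λ a b c a′ b′ x r₁ r₃ i l →
  (x , :- ((𝟙 :+ r₃ :* l :* (𝟙 :+ r₁ :* (𝟙 :+ i))) :* (b :* c))) ,
  (𝟙 , x , :- (c :* b :+ a :* b :* b′ :+ c :* a :* a′ :* b′)) ∷ (:- (a :* b :+ c :* a :* a′) , b′ , r₃ :* a) ∷ (:- (c :* a :* r₃ :* a) , a′ , r₁ :* c) ∷
  (:- (r₃ :* b :+ r₁ :* r₃ :* c :* c) , a :* a , l :* c) ∷ (:- (r₁ :* r₃ :* l :* c) , c :* c , (𝟙 :+ i) :* b) ∷ []) (Phi.X₂≈ , b′≈ , a′≈ , K.a² , K.c²)

X₄-ξ : X₄ ≃ - (K.ξ₄ * (a * b))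
X₄-ξ = mod! 10 a b c a′ c′ X₄ r₁ r₂ K.h⁻¹ K.h (λ a b c a′ c′ x r₁ r₂ i h →
  (x , :- ((𝟙 :+ r₁ :* (𝟙 :+ i) :* (𝟙 :+ :- 𝟙 :* r₂ :* h)) :* (a :* b))) ,
  (𝟙 , x , :- (b :* a :+ c :* a :* a′ :+ b :* c :* c′ :* a′)) ∷ (:- (c :* a :+ b :* c :* c′) , a′ , r₁ :* c) ∷ (:- (b :* c :* r₁ :* c) , c′ , r₂ :* b) ∷
  (:- (r₁ :* a :+ r₁ :* r₂ :* b :* b) , c :* c , (𝟙 :+ i) :* b) ∷ (:- (r₁ :* r₂ :* (𝟙 :+ i) :* b) , b :* b , :- (h :* a)) ∷ []) (Phi.X₄≈ , a′≈ , c′≈ , K.c² , K.b²)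

Tᵐ : Laurent
Tᵐ = mon (ex −14 +0 +0 −1 (+ 1) (+ 7) −7)

-- Both T and the eta quotient complete X₁X₂X₄ to 8, the former by a computation in the tower, the
-- latter by the triple product.
T≈mon : T ≃ Tᵐ
T≈mon = sub≈0⇒≈ (ι-cancel (+ 8) (T - Tᵐ) (λ ()) (mod! 11 K.ξ₁ K.ξ₂ K.ξ₄ T Tᵐ X₁ X₂ X₄ a b c (λ x y w T T′ X₁ X₂ X₄ a b c →
  (# 8 :* (T :- T′) , 𝟘) , (:- T′ , x :* y :* w :* T , :- # 8) ∷
  (T :* T′ , X₁ :* X₂ :* X₄ , :- (x :* y :* w :* (a :* b :* c :* (a :* b :* c)))) ∷
  (:- T , X₁ :* X₂ :* X₄ :* T′ , # 8) ∷ (:- (x :* y :* w :* T :* T′ :* (a :* b :* c :- 𝟙)) , a :* b :* c , :- 𝟙) ∷ [])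
  (K.ξ-product , product , X-product , K.abc)))
  where
  product : X₁ * X₂ * X₄ ≃ - (K.ξ₁ * K.ξ₂ * K.ξ₄ * (a * b * c * (a * b * c)))
  product = *-cong (*-cong X₁-ξ X₂-ξ) X₄-ξ ⨾ ring! 6 K.ξ₁ K.ξ₂ K.ξ₄ a b c (λ x y w a b c →
    :- (x :* (a :* c)) :* :- (y :* (b :* c)) :* :- (w :* (a :* b)) , :- (x :* y :* w :* (a :* b :* c :* (a :* b :* c))))

-- Written in a, b, c instead of h, so that the substitution q ↦ q² replaces these by a′, b′, c′.
R : Laurent
R = - (a * a * a * b + b * b * b * c + c * c * c * a) - ι (+ 8)

R≈ : R ≃ K.Rᴷ
R≈ = mod! 6 a b c K.h K.h⁻¹ K.λ⁻ (λ a b c h i l → (:- (a :* a :* a :* b :+ b :* b :* b :* c :+ c :* c :* c :* a) :- # 8 , l :- h :+ i :- # 7) ,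
  (:- (a :* b) , a :* a , l :* c) ∷ (:- (b :* c) , b :* b , :- (h :* a)) ∷ (:- (c :* a) , c :* c , (𝟙 :+ i) :* b) ∷ (h :- l :- (𝟙 :+ i) , a :* b :* c , :- 𝟙) ∷ []) (K.a² , K.b² , K.c² , K.abc)

opaque
  unfolding a

  V2-R : V 2 R ≃ - (a′ * a′ * a′ * b′ + b′ * b′ * b′ * c′ + c′ * c′ * c′ * a′) - ι (+ 8)
  V2-R = V-+ 2 _ _ ⨾ +-cong (V-neg 2 _ ⨾ -‿cong (V-+ 2 _ _ ⨾ +-cong (V-+ 2 _ _ ⨾ +-cong (quartic a b) (quartic b c)) (quartic c a)))
      (V-neg 2 _ ⨾ -‿cong (V-ι 2 (+ 8)))
    where
    quartic : ∀ x y → V 2 (x * x * x * y) ≃ V 2 x * V 2 x * V 2 x * V 2 y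
    quartic x y = V-* 2 _ y ⨾ *-congʳ (V-* 2 _ x ⨾ *-congʳ (V-* 2 x x))

V2-R≈ : V 2 R ≃ T - ι (+ 5) - s
V2-R≈ = V2-R ⨾ mod! 13 a b c a′ b′ c′ K.h K.h⁻¹ K.λ⁻ (T - ι (+ 5) - s) r₁ r₂ r₃
  (λ a b c a′ b′ c′ h i l κ x y w → (:- (a′ :* a′ :* a′ :* b′ :+ b′ :* b′ :* b′ :* c′ :+ c′ :* c′ :* c′ :* a′) :- # 8 , κ) ,
    (:- 𝟙 , κ , x :* x :* x :* w :* (𝟙 :+ i) :+ w :* w :* w :* y :* l :- y :* y :* y :* x :* h :- # 8) ∷
    (:- 𝟙 , a′ :* a′ :* a′ :* b′ , (x :* c) :* (x :* c) :* (x :* c) :* (w :* a)) ∷ (:- 𝟙 , b′ :* b′ :* b′ :* c′ , (w :* a) :* (w :* a) :* (w :* a) :* (y :* b)) ∷ (:- 𝟙 , c′ :* c′ :* c′ :* a′ , (y :* b) :* (y :* b) :* (y :* b) :* (x :* c)) ∷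
    (:- (x :* x :* x :* w :* c :* a) , c :* c , (𝟙 :+ i) :* b) ∷ (:- (w :* w :* w :* y :* a :* b) , a :* a , l :* c) ∷ (:- (y :* y :* y :* x :* b :* c) , b :* b , :- (h :* a)) ∷
    (:- (x :* x :* x :* w :* (𝟙 :+ i)) :- w :* w :* w :* y :* l :+ y :* y :* y :* x :* h , a :* b :* c , :- 𝟙) ∷ [])
  (K.κ₂≈ , quartic a′≈ b′≈ , quartic b′≈ c′≈ , quartic c′≈ a′≈ , K.c² , K.a² , K.b² , K.abc)
  where
  quartic : ∀ {x x′ y y′} → x ≃ x′ → y ≃ y′ → x * x * x * y ≃ x′ * x′ * x′ * y′
  quartic e f = *-cong (*-cong (*-cong e e) e) f

-- Logarithmic derivatives

coeff-negative : ∀ s n → coeff (mkL +0 s) -[1+ n ] ≡ + 0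
coeff-negative s n = coeff≡at (mkL +0 s) -[1+ n ] ⟫ cong (at s) (Z.+-identityʳ -[1+ n ])

int-coeff : ∀ {f} → (∀ n → coeff f -[1+ n ] ≡ + 0) → Int f
int-coeff {f} p = int-cong (co go) (int-mkL (λ n → coeff f (+ n)))
  where
  go : ∀ m → coeff (mkL +0 (λ n → coeff f (+ n))) m ≡ coeff f m
  go (+ n) = coeff-0-mkL (λ n → coeff f (+ n)) n
  go -[1+ n ] = coeff-negative (λ n → coeff f (+ n)) n ⟫ sym (p n)

coeff-int : ∀ {f} → Int f → ∀ n → coeff f -[1+ n ] ≡ + 0
coeff-int {f} i n = at-coeff (int≈ i) -[1+ n ] ⟫ coeff-negative (λ n → coeff f (+ n)) n

int-θ : ∀ {f} → Int f → Int (θ f)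
int-θ {f} i = int-coeff (λ n → coeff-θ f -[1+ n ] ⟫ cong (Z._*_ -[1+ n ]) (coeff-int i n) ⟫ Z.*-zeroʳ -[1+ n ])

int-U : ∀ {f} → Int f → Int (U f)
int-U {f} i = int-coeff (λ n → coeff-U f -[1+ n ] ⟫ coeff-int i _)

θ-1 : θ 1# ≃ 0#
θ-1 = x+x≈x⇒x≈0 _ (≈-sym (θ-cong (≈-sym (*-identityˡ 1#)) ⨾ θ-* 1# 1# ⨾ +-cong (*-identityʳ _) (*-identityˡ _)))

θ-ι* : ∀ n f → θ (ι n * f) ≃ ι n * θ f
θ-ι* n f = co λ m → coeff-θ (ι n * f) m ⟫ cong (Z._*_ m) (coeff-ι n f m) ⟫ swap m n (coeff f m) ⟫ cong (Z._*_ n) (sym (coeff-θ f m)) ⟫ sym (coeff-ι n (θ f) m)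
  where
  swap : ∀ x y w → x Z.* (y Z.* w) ≡ y Z.* (x Z.* w)
  swap x y w = ℤR.ring! 3 x y w (λ x y w → x :* (y :* w) , y :* (x :* w))

θ-ι : ∀ n → θ (ι n) ≃ 0#
θ-ι n = θ-cong (≈-sym (*-identityʳ (ι n))) ⨾ θ-ι* n 1# ⨾ *-congˡ θ-1 ⨾ zeroʳ _

U-ι* : ∀ n f → U (ι n * f) ≃ ι n * U f
U-ι* n f = co λ m → coeff-U (ι n * f) m ⟫ coeff-ι n f (+ 7 Z.* m) ⟫ cong (Z._*_ n) (sym (coeff-U f m)) ⟫ sym (coeff-ι n (U f) m)

θ-V : ∀ k .{{_ : N.NonZero k}} f → θ (V k f) ≃ ι (+ k) * V k (θ f)
θ-V k f = co λ m → subst (λ m → coeff (θ (V k f)) m ≡ coeff (ι (+ k) * V k (θ f)) m) (sym (ℤ÷.a≡a%ℕn+[a/ℕn]*n m k ⟫ cong (Z._+_ (+ (m ℤ÷.%ℕ k))) (Z.*-comm (m ℤ÷./ℕ k) (+ k))))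
    (go (m ℤ÷.%ℕ k) (m ℤ÷./ℕ k) (ℤ÷.n%ℕd<d m k))
  where
  inner : ∀ r x → (+ r Z.+ + k Z.* x) Z.* δ₀ r (coeff f x) ≡ + k Z.* δ₀ r (x Z.* coeff f x)
  inner zero x = cong (Z._* coeff f x) (Z.+-identityˡ (+ k Z.* x)) ⟫ Z.*-assoc (+ k) x (coeff f x)
  inner (suc r) x = Z.*-zeroʳ (+ suc r Z.+ + k Z.* x) ⟫ sym (Z.*-zeroʳ (+ k))
  go : ∀ r x → r N.< k → coeff (θ (V k f)) (+ r Z.+ + k Z.* x) ≡ coeff (ι (+ k) * V k (θ f)) (+ r Z.+ + k Z.* x)
  go r x l = coeff-θ (V k f) (+ r Z.+ + k Z.* x) ⟫ cong (Z._*_ (+ r Z.+ + k Z.* x)) (coeff-V k f r x l) ⟫ inner r x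
    ⟫ cong (λ c → + k Z.* δ₀ r c) (sym (coeff-θ f x)) ⟫ cong (Z._*_ (+ k)) (sym (coeff-V k (θ f) r x l)) ⟫ sym (coeff-ι (+ k) (V k (θ f)) (+ r Z.+ + k Z.* x))

-- A logarithmic derivative stated as an equation, so that it can be transported before any division
-- is made.
record Dlog (f l : Laurent) : Set where
  constructor dlog
  field derivative : θ f ≃ l * f
open Dlog

dlog-cong : ∀ {f g l m} → f ≃ g → l ≃ m → Dlog f l → Dlog g m
dlog-cong e e′ (dlog p) = dlog (θ-cong (≈-sym e) ⨾ p ⨾ *-cong e′ e)

dlog-* : ∀ {f g l m} → Dlog f l → Dlog g m → Dlog (f * g) (l + m)
dlog-* {f} {g} {l} {m} (dlog p) (dlog q) = dlog (θ-* f g ⨾ +-cong (*-congʳ p) (*-congˡ q)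
  ⨾ ring! 4 f g l m (λ f g l m → (l :* f) :* g :+ f :* (m :* g) , (l :+ m) :* (f :* g)))

dlog-1 : Dlog 1# 0#
dlog-1 = dlog (θ-1 ⨾ ≈-sym (zeroˡ _))

dlog-inv : ∀ {f g l} → f * g ≃ 1# → Dlog f l → Dlog g (- l)
dlog-inv {f} {g} {l} e (dlog p) = dlog (mod! 5 f g l (θ f) (θ g) (λ f g l f′ g′ → (g′ , :- l :* g) ,
    (g , f′ :* g :+ f :* g′ , 𝟘) ∷ (:- (g :* g) , f′ , l :* f) ∷ (:- g′ :- l :* g , f :* g , 𝟙) ∷ [])
  (≈-sym (θ-* f g) ⨾ θ-cong e ⨾ θ-1 , p , e))

dlog-^ : ∀ {f l} n → Dlog f l → Dlog (f ^ n) (ι (+ n) * l)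
dlog-^ zero p = dlog-cong ≈-refl (≈-sym (*-congʳ ι-0 ⨾ zeroˡ _)) dlog-1
dlog-^ {f} {l} (suc n) p = dlog-cong ≈-refl (+-congʳ (≈-sym (*-congʳ ι-1 ⨾ *-identityˡ l)) ⨾ ≈-sym (distribʳ l _ _) ⨾ *-congʳ (≈-sym (ι-+ (+ 1) (+ n)))) (dlog-* p (dlog-^ n p))

dlog-V : ∀ k .{{_ : N.NonZero k}} {f l} → Dlog f l → Dlog (V k f) (ι (+ k) * V k l)
dlog-V k {f} {l} (dlog p) = dlog (θ-V k f ⨾ *-congˡ (V-cong k p ⨾ V-* k l f) ⨾ ≈-sym (*-assoc _ _ _))

dlog-q : ∀ n → Dlog (qᵐ n) (ι n)
dlog-q n = dlog (co λ m → coeff-θ (qᵐ n) m ⟫ go m (m Z.≟ n) ⟫ sym (coeff-ι n (qᵐ n) m))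
  where
  away : ∀ x → x ≢ + 0 → at oneS x ≡ + 0
  away (+ zero) ne = ⊥-elim (ne refl)
  away (+ suc _) _ = refl
  away -[1+ _ ] _ = refl
  vanish : ∀ m → m ≢ n → coeff (qᵐ n) m ≡ + 0
  vanish m ne = cong (λ f → coeff f m) (q≡mkL n) ⟫ coeff≡at (mkL n oneS) m ⟫ away (m Z.- n) (λ e → ne (Z.i-j≡0⇒i≡j m n e))
  go : ∀ m → Dec (m ≡ n) → m Z.* coeff (qᵐ n) m ≡ n Z.* coeff (qᵐ n) m
  go m (yes e) = cong (Z._* coeff (qᵐ n) m) e
  go m (no ne) = cong (Z._*_ m) (vanish m ne) ⟫ Z.*-zeroʳ m ⟫ sym (cong (Z._*_ n) (vanish m ne) ⟫ Z.*-zeroʳ n)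

dlog-unique : ∀ {f g l} → f * g ≃ 1# → ∀ {k} → Dlog k l → Dlog f l → θ (k * g) ≃ 0#
dlog-unique e p q = derivative (dlog-* p (dlog-inv e q)) ⨾ *-congʳ (-‿inverseʳ _) ⨾ zeroˡ _

agr-θ : ∀ {N f g} → Agr N f g → Agr N (θ f) (θ g)
agr-θ {N} {f} {g} (agr {h} i e) = agr (int-+ (int-* (int-ι (+ N)) i) (int-θ i)) (θ-cong e ⨾ θ-+ g _ ⨾ +-congˡ (θ-* (q^ N) h
  ⨾ +-congʳ (*-congʳ (derivative (dlog-q (+ N)))) ⨾ ring! 4 (ι (+ N)) (q^ N) h (θ h) (λ n q h h′ → n :* q :* h :+ q :* h′ , q :* (n :* h :+ h′))))

agr-U : ∀ N {f g} → Agr (7 N.* N) f g → Agr N (U f) (U g)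
agr-U N {f} {g} (agr {h} i e) = agr (int-U i) (U-cong e ⨾ U-+ g _ ⨾ +-congˡ (U-cong (*-congʳ (reflexive (cong qᵐ (Z.pos-* 7 N)) ⨾ ≈-sym (V-q 7 (+ N)))) ⨾ U-W (q^ N) h))

agr-neg : ∀ {N f g} → Agr N f g → Agr N (- f) (- g)
agr-neg {N} {f} {g} (agr {h} i e) = agr (int-neg i) (-‿cong e ⨾ ring! 3 g (q^ N) h (λ g q h → :- (g :+ q :* h) , :- g :+ q :* :- h))

-- The Lambert series of the divisor sums

lambert : ℕ → Laurent
lambert i = ι (+ suc i) * (ginv (suc i) - 1#)

-- The generating series of the sums of divisors; -σ is the logarithmic derivative of E1.
σ : Laurent
σ = lim (∑ᴸ lambert)

lambert-low : ∀ k → Low k (lambert k)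
lambert-low k = low-*ˡ (int-ι (+ suc k)) (low-cong (≈-sym shifted) (low-*ˡ (ginv-int (suc k)) (low-q (N.n≤1+n k))))
  where
  low-cong : ∀ {f g} → f ≃ g → Low k f → Low k g
  low-cong e (low i d) = low i (≈-sym e ⨾ d)
  shifted : ginv (suc k) - 1# ≃ ginv (suc k) * q^ (suc k)
  shifted = mod! 2 (ginv (suc k)) (q^ (suc k)) (λ g q → (g :- 𝟙 , g :* q) , (𝟙 , g :* (𝟙 :- q) , 𝟙) ∷ []) (ginv-inverse k)

σ-stable : Stable (∑ᴸ lambert)
σ-stable = stable-∑ lambert-low

dlog-fac : ∀ i → Dlog (fac 1 1 i) (- lambert i)
dlog-fac i = dlog-cong (reflexive (cong one-q (sym exponent))) ≈-refl (dlog (θ-+ 1# _ ⨾ +-cong θ-1 (θ-neg _ ⨾ -‿cong (derivative (dlog-q (+ suc i)))) ⨾ +-identityˡ _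
    ⨾ mod! 3 (ginv (suc i)) (q^ (suc i)) (ι (+ suc i)) (λ g q n → (:- (n :* q) , :- (n :* (g :- 𝟙)) :* (𝟙 :- q)) , (n , g :* (𝟙 :- q) , 𝟙) ∷ []) (ginv-inverse i)))
  where
  exponent : 1 N.* i N.+ 1 ≡ suc i
  exponent = solveℕ 1 (λ i → con' 1 *' i +' con' 1 =' con' 1 +' i) refl i

dlog-finite : ∀ n → Dlog (ℙₙ 1 1 n) (- ∑ᴸ lambert n)
dlog-finite zero = dlog-cong ≈-refl (ring! 0 (𝟘 , :- 𝟘)) dlog-1
dlog-finite (suc n) = dlog-cong ≈-refl (ring! 2 (∑ᴸ lambert n) (lambert n) (λ x y → :- x :+ :- y , :- (x :+ y))) (dlog-* (dlog-finite n) (dlog-fac n))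

dlog-e₁ : Dlog E1 (- σ)
dlog-e₁ = dlog (agr-all (λ N → agr-trans (agr-θ (lim-agr (ℙ-stable 1 1) N)) (agr-trans (agr-≈ (derivative (dlog-finite N)))
  (agr-sym (agr-* (int-neg (lim-int (∑ᴸ lambert))) (stable-int (ℙ-stable 1 1) N) (agr-neg (lim-agr σ-stable N)) (lim-agr (ℙ-stable 1 1) N))))))

U-geom : ∀ d → (∀ n → d ℕ∣.∣ 7 N.* n → d ℕ∣.∣ n) → U (ginv d) ≃ ginv d
U-geom d p = co λ m → coeff-U (ginv d) m ⟫ go m
  where
  same : ∀ n → Dec (d ℕ∣.∣ n) → geom d (7 N.* n) ≡ geom d n
  same n (yes e) = cong (λ b → if b then + 1 else + 0) (dec-true (d ℕ∣.∣? (7 N.* n)) (ℕ∣.∣n⇒∣m*n 7 e) ⟫ sym (dec-true (d ℕ∣.∣? n) e))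
  same n (no ¬e) = cong (λ b → if b then + 1 else + 0) (dec-false (d ℕ∣.∣? (7 N.* n)) (λ e → ¬e (p n e)) ⟫ sym (dec-false (d ℕ∣.∣? n) ¬e))
  go : ∀ m → coeff (ginv d) (+ 7 Z.* m) ≡ coeff (ginv d) m
  go (+ n) = cong (coeff (ginv d)) (sym (Z.pos-* 7 n)) ⟫ coeff-0-mkL (geom d) (7 N.* n) ⟫ same n (d ℕ∣.∣? n) ⟫ sym (coeff-0-mkL (geom d) n)
  go -[1+ n ] = coeff-negative (geom d) (n N.+ 6 N.* suc n) ⟫ sym (coeff-negative (geom d) n)

prime-7 : Prime 7
prime-7 = toWitness {a? = prime? 7} tt

U-ginv : ∀ d → ¬ 7 ℕ∣.∣ d → U (ginv d) ≃ ginv d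
U-ginv d ∤d = U-geom d λ { n (ℕ∣.divides k e) → [ (λ { (ℕ∣.divides j e′) → ℕ∣.divides j (N.*-cancelˡ-≡ n (j N.* d) 7 (e ⟫ cong (N._* d) e′ ⟫ shuffle j d)) }) , (λ d′ → ⊥-elim (∤d d′)) ]′ (euclidsLemma k d prime-7 (ℕ∣.divides n (sym e ⟫ N.*-comm 7 n))) }
  where
  shuffle : ∀ j d → j N.* 7 N.* d ≡ 7 N.* (j N.* d)
  shuffle = solveℕ 2 (λ j d → j *' con' 7 *' d =' con' 7 *' (j *' d)) refl

V-ginv : ∀ k → V 7 (ginv (suc k)) ≃ ginv (7 N.* suc k)
V-ginv k = mod! 3 (V 7 (ginv (suc k))) (ginv (7 N.* suc k)) (q^ (7 N.* suc k)) (λ v g q → (v , g) ,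
    (:- v , g :* (𝟙 :- q) , 𝟙) ∷ (g , v :* (𝟙 :- q) , 𝟙) ∷ [])
  (ginv-inverse (k N.+ 6 N.* suc k) , *-congˡ (≈-sym (V-one-q 7 (suc k))) ⨾ ≈-sym (V-* 7 _ _) ⨾ V-cong 7 (ginv-inverse k) ⨾ V-one 7)

U-lambert : ∀ i → ¬ 7 ℕ∣.∣ suc i → U (lambert i) ≃ lambert i
U-lambert i ∤ = U-ι* _ _ ⨾ *-congˡ (U-+ _ _ ⨾ +-cong (U-ginv (suc i) ∤) (U-neg-1))
  where
  U-neg-1 : U (- 1#) ≃ - 1#
  U-neg-1 = U-cong (≈-sym (V-neg 7 1# ⨾ -‿cong (V-one 7))) ⨾ U-cancel (- 1#)

W-lambert : ∀ N → lambert (6 N.+ N N.* 7) ≃ ι (+ 7) * W (lambert N)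
W-lambert N = *-cong (reflexive (cong (λ n → ι (+ n)) (N.*-comm (suc N) 7) ⟫ cong ι (Z.pos-* 7 (suc N))) ⨾ ι-* (+ 7) (+ suc N))
    (+-congʳ (reflexive (cong ginv (N.*-comm (suc N) 7)) ⨾ ≈-sym (V-ginv N)))
  ⨾ *-assoc _ _ _ ⨾ *-congˡ (≈-sym (W-* _ _ ⨾ *-cong (V-ι 7 (+ suc N)) (V-+ 7 _ _ ⨾ +-congˡ (V-neg 7 1# ⨾ -‿cong (V-one 7)))))

U-lambert-7 : ∀ N → U (lambert (6 N.+ N N.* 7)) ≃ ι (+ 7) * lambert N
U-lambert-7 N = U-cong (W-lambert N) ⨾ U-ι* (+ 7) (W (lambert N)) ⨾ *-congˡ (U-cancel (lambert N))

not-multiple : ∀ j N → suc j N.< 7 → ¬ 7 ℕ∣.∣ suc (j N.+ N N.* 7)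
not-multiple j N l d = ℕ∣.>⇒∤ l (ℕ∣.∣m+n∣m⇒∣n (subst (7 ℕ∣.∣_) (N.+-comm (suc j) (N N.* 7)) d) (ℕ∣.divides N refl))

-- Induction over blocks of seven. Six summands have index prime to 7 and are fixed by `U`; the
-- seventh equals 7 W(lambert N) and is sent to 7 times `lambert N`.
U-partial : ∀ N → U (∑ᴸ lambert (N N.* 7)) ≃ ∑ᴸ lambert (N N.* 7) + ι (+ 7) * ∑ᴸ lambert N - ι (+ 7) * W (∑ᴸ lambert N)
U-partial zero = U-0 ⨾ ≈-sym (+-congˡ (-‿cong (*-congˡ (V-0 7))) ⨾ ring! 0 (𝟘 :+ # 7 :* 𝟘 :- # 7 :* 𝟘 , 𝟘))
  where
  U-0 : U 0# ≃ 0#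
  U-0 = U-cong (≈-sym (V-0 7)) ⨾ U-cancel 0#
U-partial (suc N) = split _ _ ⨾ +-cong (split _ _ ⨾ +-cong (split _ _ ⨾ +-cong (split _ _ ⨾ +-cong (split _ _ ⨾ +-cong (split _ _ ⨾ +-cong (split _ _ ⨾ +-cong (U-partial N)
      (keep 0)) (keep 1)) (keep 2)) (keep 3)) (keep 4)) (keep 5)) (U-lambert-7 N)
    ⨾ mod! 12 (∑ᴸ lambert (N N.* 7)) (∑ᴸ lambert N) (W (∑ᴸ lambert N)) (l 0) (l 1) (l 2) (l 3) (l 4) (l 5) (l 6) (lambert N) (W (lambert N))
      (λ x y w a b c d e f g l l′ → (x :+ # 7 :* y :- # 7 :* w :+ a :+ b :+ c :+ d :+ e :+ f :+ # 7 :* l ,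
        (x :+ a :+ b :+ c :+ d :+ e :+ f :+ g) :+ # 7 :* (y :+ l) :- # 7 :* (w :+ l′)) , (:- 𝟙 , g , # 7 :* l′) ∷ []) (W-lambert N)
      ⨾ +-congˡ (-‿cong (*-congˡ (≈-sym (V-+ 7 _ _))))
  where
  l : ℕ → Laurent
  l j = lambert (j N.+ N N.* 7)
  split : ∀ x y → U (x + y) ≃ U x + U y
  split = U-+
  small : ∀ j → {_ : Data.Bool.T (suc j N.<ᵇ 7)} → suc j N.< 7
  small j {t} = N.<ᵇ⇒< (suc j) 7 t
  keep : ∀ j → {_ : Data.Bool.T (suc j N.<ᵇ 7)} → U (l j) ≃ l j
  keep j {t} = U-lambert (j N.+ N N.* 7) (not-multiple j N (small j {t}))

-- Multiplicativity of σ at the prime 7.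
U-σ : U σ ≃ ι (+ 8) * σ - ι (+ 7) * W σ
U-σ = agr-all λ N → agr-trans (agr-U N (lim-agr σ-stable (7 N.* N))) (agr-trans (agr-≈ (U-cong (reflexive (cong (∑ᴸ lambert) (N.*-comm 7 N))) ⨾ U-partial N))
    (agr-sym (agr-trans (agr-≈ (ring! 2 σ (W σ) (λ x y → # 8 :* x :- # 7 :* y , x :+ # 7 :* x :- # 7 :* y)))
      (agr-+ (agr-+ (agr-weaken (N.m≤m*n N 7) (lim-agr σ-stable (N N.* 7))) (times7 (lim-agr σ-stable N))) (agr-neg (times7 (agr-V 7 (lim-agr σ-stable N))))))))
  where
  times7 : ∀ {N f g} → Agr N f g → Agr N (ι (+ 7) * f) (ι (+ 7) * g)
  times7 {N} {f} {g} (agr {h} i e) = agr (int-* (int-ι (+ 7)) i) (*-congˡ e ⨾ ring! 4 (ι (+ 7)) g (q^ N) h (λ c g q h → c :* (g :+ q :* h) , c :* g :+ q :* (c :* h)))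

-- Derivatives in the tower and the logarithmic derivative of R

module Watson where
  open K using (h; h⁻¹; λ⁻; Rᴷ; ϱ; z~; z*)

  θ₃ : ∀ x y w → θ (x * y * w) ≃ (θ x * y + x * θ y) * w + x * y * θ w
  θ₃ x y w = θ-* (x * y) w ⨾ +-congʳ (*-congʳ (θ-* x y))

  λ[1+h] : λ⁻ * (1# + h) ≃ 1#
  λ[1+h] = mod! 3 h h⁻¹ λ⁻ (λ h i l → (l :* (𝟙 :+ h) , 𝟙) , (h , l :* (𝟙 :+ i) , i) ∷ (𝟙 :- l , i :* h , 𝟙) ∷ []) (K.λ-h⁻¹ , K.h⁻¹h)

  [1+h]a² : (1# + h) * (a * a) ≃ c
  [1+h]a² = mod! 4 a c h λ⁻ (λ a c h l → ((𝟙 :+ h) :* (a :* a) , c) , (𝟙 :+ h , a :* a , l :* c) ∷ (c , l :* (𝟙 :+ h) , 𝟙) ∷ []) (K.a² , λ[1+h])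

  θ-b² : θ b * b + b * θ b ≃ - (θ h * a + h * θ a)
  θ-b² = ≈-sym (θ-* b b) ⨾ θ-cong K.b² ⨾ θ-neg _ ⨾ -‿cong (θ-* h a)

  θ-c : θ h * (a * a) + (1# + h) * (θ a * a + a * θ a) ≃ θ c
  θ-c = ≈-sym (θ-* (1# + h) (a * a) ⨾ +-cong (*-congʳ (θ-+ 1# h ⨾ +-congʳ θ-1 ⨾ +-identityˡ _)) (*-congˡ (θ-* a a))) ⨾ θ-cong [1+h]a²

  θ-abc : (θ a * b + a * θ b) * c + a * b * θ c ≃ 0#
  θ-abc = ≈-sym (θ₃ a b c) ⨾ θ-cong abc≈-1 ⨾ θ-neg 1# ⨾ -‿cong θ-1 ⨾ ring! 0 (:- 𝟘 , 𝟘)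

  δᵃ δᵇ δᶜ : Laurent
  δᵃ = - (b * c * θ a)
  δᵇ = - (a * c * θ b)
  δᶜ = - (a * b * θ c)

  -- δᵃ, δᵇ, δᶜ are the logarithmic derivatives of a, b, c, and h = − b²/a, 1 + h = c/a².
  δᵃ+δᵇ+δᶜ : δᵃ + δᵇ + δᶜ ≃ 0#
  δᵃ+δᵇ+δᶜ = mod! 6 a b c (θ a) (θ b) (θ c) (λ a b c x y w → (:- (b :* c :* x) :+ :- (a :* c :* y) :+ :- (a :* b :* w) , 𝟘) ,
    (:- 𝟙 , (x :* b :+ a :* y) :* c :+ a :* b :* w , 𝟘) ∷ []) θ-abc

  2hδᵇ : ι (+ 2) * h * δᵇ ≃ θ h + h * δᵃ
  2hδᵇ = mod! 7 a b c (θ a) (θ b) h (θ h) (λ a b c x y h h′ → (# 2 :* h :* :- (a :* c :* y) , h′ :+ h :* :- (b :* c :* x)) ,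
    (b :* c , y :* b :+ b :* y , :- (h′ :* a :+ h :* x)) ∷ (:- (# 2 :* c :* y) , b :* b , :- (h :* a)) ∷ (:- h′ , a :* b :* c , :- 𝟙) ∷ []) (θ-b² , K.b² , abc≈-1)

  [1+h]δᶜ : θ h + ι (+ 2) * (1# + h) * δᵃ ≃ (1# + h) * δᶜ
  [1+h]δᶜ = mod! 7 a b c (θ a) (θ c) h (θ h) (λ a b c x w h h′ → (h′ :+ # 2 :* (𝟙 :+ h) :* :- (b :* c :* x) , (𝟙 :+ h) :* :- (a :* b :* w)) ,
    (:- ((𝟙 :+ h) :* a :* b) , h′ :* (a :* a) :+ (𝟙 :+ h) :* (x :* a :+ a :* x) , w) ∷ (a :* b :* h′ :+ # 2 :* (𝟙 :+ h) :* b :* x , (𝟙 :+ h) :* (a :* a) , c) ∷ (h′ , a :* b :* c , :- 𝟙) ∷ [])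
    (θ-c , [1+h]a² , abc≈-1)

  -- The three relations above are linear in δᵃ, δᵇ, δᶜ; eliminating the last two leaves the
  -- coefficient 7h(1 + h).
  7δᵃ : ι (+ 7) * h * (1# + h) * δᵃ ≃ - (1# + ι (+ 3) * h) * θ h
  7δᵃ = mod! 5 δᵃ δᵇ δᶜ h (θ h) (λ δᵃ δᵇ δᶜ h h′ → (# 7 :* h :* (𝟙 :+ h) :* δᵃ , :- (𝟙 :+ # 3 :* h) :* h′) ,
    (# 2 :* h , h′ :+ # 2 :* (𝟙 :+ h) :* δᵃ , (𝟙 :+ h) :* δᶜ) ∷ (# 2 :* h :* (𝟙 :+ h) , δᵃ :+ δᵇ :+ δᶜ , 𝟘) ∷ (:- (𝟙 :+ h) , # 2 :* h :* δᵇ , h′ :+ h :* δᵃ) ∷ [])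
    ([1+h]δᶜ , δᵃ+δᵇ+δᶜ , 2hδᵇ)

  7δᵇ : ι (+ 7) * h * (1# + h) * δᵇ ≃ (ι (+ 3) + ι (+ 2) * h) * θ h
  7δᵇ = mod! 5 δᵃ δᵇ δᶜ h (θ h) (λ δᵃ δᵇ δᶜ h h′ → (# 7 :* h :* (𝟙 :+ h) :* δᵇ , (# 3 :+ # 2 :* h) :* h′) ,
    (# 7 :* h , h′ :+ # 2 :* (𝟙 :+ h) :* δᵃ , (𝟙 :+ h) :* δᶜ) ∷ (# 7 :* h :* (𝟙 :+ h) , δᵃ :+ δᵇ :+ δᶜ , 𝟘) ∷ (:- # 3 , # 7 :* h :* (𝟙 :+ h) :* δᵃ , :- (𝟙 :+ # 3 :* h) :* h′) ∷ [])
    ([1+h]δᶜ , δᵃ+δᵇ+δᶜ , 7δᵃ)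

  θ-z : ι (+ 7) * h * (1# + h) * θ z ≃ θ h * z~
  θ-z = mod! 12 δᵃ δᵇ δᶜ h (θ h) a b c (θ a) (θ b) (θ c) (θ z) (λ δᵃ δᵇ δᶜ h h′ a b c x y w z′ →
      (# 7 :* h :* (𝟙 :+ h) :* z′ , h′ :* (:- (𝟙 :+ # 3 :* h) :* a :+ (# 3 :+ # 2 :* h) :* b :+ (h :- # 2) :* c)) ,
      (# 7 :* h :* (𝟙 :+ h) , z′ , x :+ y :+ w) ∷ (# 7 :* h :* (𝟙 :+ h) , x , a :* δᵃ) ∷ (# 7 :* h :* (𝟙 :+ h) , y , b :* δᵇ) ∷ (# 7 :* h :* (𝟙 :+ h) , w , c :* δᶜ) ∷
      (a :- c , # 7 :* h :* (𝟙 :+ h) :* δᵃ , :- (𝟙 :+ # 3 :* h) :* h′) ∷ (b :- c , # 7 :* h :* (𝟙 :+ h) :* δᵇ , (# 3 :+ # 2 :* h) :* h′) ∷ (c :* # 7 :* h :* (𝟙 :+ h) , δᵃ :+ δᵇ :+ δᶜ , 𝟘) ∷ [])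
    (θz≈ , a-dlog , b-dlog , c-dlog , 7δᵃ , 7δᵇ , δᵃ+δᵇ+δᶜ)
    where
    θz≈ : θ z ≃ θ a + θ b + θ c
    θz≈ = θ-cong z≈ ⨾ θ-+ _ _ ⨾ +-cong (θ-+ _ _ ⨾ +-congʳ (θ-+ a b)) (θ-neg 1# ⨾ -‿cong θ-1)
      ⨾ ring! 3 (θ a) (θ b) (θ c) (λ x y w → x :+ y :+ w :+ :- 𝟘 , x :+ y :+ w)
    a-dlog : θ a ≃ a * δᵃ
    a-dlog = mod! 4 a b c (θ a) (λ a b c x → (x , a :* :- (b :* c :* x)) , (x , a :* b :* c , :- 𝟙) ∷ []) abc≈-1
    b-dlog : θ b ≃ b * δᵇ
    b-dlog = mod! 4 a b c (θ b) (λ a b c x → (x , b :* :- (a :* c :* x)) , (x , a :* b :* c , :- 𝟙) ∷ []) abc≈-1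
    c-dlog : θ c ≃ c * δᶜ
    c-dlog = mod! 4 a b c (θ c) (λ a b c x → (x , c :* :- (a :* b :* x)) , (x , a :* b :* c , :- 𝟙) ∷ []) abc≈-1

  θ-R : h * (1# + h) * θ Rᴷ ≃ ϱ * θ h
  θ-R = mod! 7 h h⁻¹ λ⁻ (θ h) (θ h⁻¹) (θ λ⁻) (θ Rᴷ) (λ h i l h′ i′ l′ R′ → (h :* (𝟙 :+ h) :* R′ , (l :- # 2 :- h :- h :* h :- i) :* h′) ,
      (h :* (𝟙 :+ h) , R′ , l′ :- h′ :+ i′) ∷ (h , l′ :* (𝟙 :+ h) :+ l :* h′ , 𝟘) ∷ (𝟙 :+ h , i′ :* h :+ i :* h′ , 𝟘) ∷ (:- h′ , l :* (𝟙 :+ h) , 𝟙) ∷ (:- h′ , i :* h , 𝟙) ∷ [])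
    (θR≈ , λ-rule , h-rule , λ[1+h] , K.h⁻¹h)
    where
    λ-rule : θ λ⁻ * (1# + h) + λ⁻ * θ h ≃ 0#
    λ-rule = +-congˡ (*-congˡ (≈-sym (θ-+ 1# h ⨾ +-congʳ θ-1 ⨾ +-identityˡ _))) ⨾ ≈-sym (θ-* λ⁻ (1# + h)) ⨾ θ-cong λ[1+h] ⨾ θ-1
    h-rule : θ h⁻¹ * h + h⁻¹ * θ h ≃ 0#
    h-rule = ≈-sym (θ-* h⁻¹ h) ⨾ θ-cong K.h⁻¹h ⨾ θ-1
    θR≈ : θ Rᴷ ≃ θ λ⁻ - θ h + θ h⁻¹
    θR≈ = θ-+ _ _ ⨾ +-cong (θ-+ _ _ ⨾ +-congʳ (θ-+ _ _ ⨾ +-congˡ (θ-neg h))) (θ-neg _ ⨾ -‿cong (θ-ι (+ 7)))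
      ⨾ ring! 3 (θ λ⁻) (θ h) (θ h⁻¹) (λ x y w → x :- y :+ w :+ :- 𝟘 , x :- y :+ w)

  cls₀-* : ∀ {f g} → Cls +0 f → Cls +0 g → Cls +0 (f * g)
  cls₀-* = cls-*

  1+cls : ∀ {f} → Cls +0 f → Cls +0 (1# + f)
  1+cls = cls-+ (cls-cong ι-1 (ι-cls (+ 1)))

  h-cls : Cls +0 h
  h-cls = cls₀-* r₁-cls (cls₀-* r₃-cls (1+cls r₃-cls))

  h⁻¹-cls : Cls +0 h⁻¹
  h⁻¹-cls = cls₀-* r₂-cls (cls₀-* (1+cls r₁-cls) (1+cls r₂-cls))

  λ-cls : Cls +0 λ⁻
  λ-cls = cls-neg (cls₀-* r₁-cls (cls₀-* r₂-cls (1+cls r₁-cls)))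

  R-cls : Cls +0 Rᴷ
  R-cls = cls-+ (cls-+ (cls-+ λ-cls (cls-neg h-cls)) h⁻¹-cls) (cls-neg (ι-cls (+ 7)))

  ϱ-cls : Cls +0 ϱ
  ϱ-cls = cls-+ (cls-+ (cls-+ (cls-+ λ-cls (cls-neg (ι-cls (+ 2)))) (cls-neg h-cls)) (cls-neg (cls₀-* h-cls h-cls))) (cls-neg h⁻¹-cls)

  θ-cls : ∀ {f} → Cls +0 f → Cls +0 (θ f)
  θ-cls {f} k = cls-cong (≈-sym (θ-cong (W-U k) ⨾ θ-V 7 (U f))) (cls₀-* (ι-cls (+ 7)) (W-cls (θ (U f))))

  WU : Laurent → Laurent
  WU f = W (U f)

  WU-* : ∀ {f} → Cls +0 f → ∀ g → WU (f * g) ≃ f * WU g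
  WU-* {f} k g = V-cong 7 (U-cong (*-congʳ (W-U k)) ⨾ U-W (U f) g) ⨾ W-* (U f) (U g) ⨾ *-congʳ (≈-sym (W-U k))

  -- `WU` is the projection to class 0, so of z~ z* only the coordinate of 1 contributes, and
  -- `derivative-check` evaluates it.
  WU-trace : WU (z~ * z*) ≃ ι (+ 2) * (Rᴷ * ϱ)
  WU-trace = begin
    WU (z~ * z*) ≈⟨ V-cong 7 (U-cong K.z~z*) ⟩
    WU (⟦ twisted ⟧₇ + ⟦ watson ⟧₇) ≈⟨ V-cong 7 (U-+ _ _ ⨾ +-cong (trace₇ twisted) (trace₇ watson) ⨾ ≈-sym (U-+ _ _)) ⟩
    WU (⟦ eᵒ twisted ⟧₆ + ⟦ eᵒ watson ⟧₆) ≈⟨ V-cong 7 (U-cong K.heads≈) ⟩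
    WU (ι (+ 2) * (Rᴷ * ϱ)) ≈⟨ ≈-sym (W-U (cls₀-* (ι-cls (+ 2)) (cls₀-* R-cls ϱ-cls))) ⟩
    ι (+ 2) * (Rᴷ * ϱ) ∎
    where
    open Tower 𝕃 tower using (⟦_⟧₆; ⟦_⟧₇)
    open Trace 𝕃 dissection using (trace₇)

  R-lead : Lead Rᴷ −7 (+ 1)
  R-lead = lead-cong R≈ (lead-+ (lead-neg (lead-+ (lead-+ (lead-* (lead-* (lead-* a-lead a-lead) a-lead) b-lead) (lead-lower 6 refl (lead-* (lead-* (lead-* b-lead b-lead) b-lead) c-lead)))
    (lead-lower 13 refl (lead-* (lead-* (lead-* c-lead c-lead) c-lead) a-lead)))) (lead-lower 6 refl (lead-neg (lead-ι (+ 8)))))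

  -- Taking the part in class 0 of z′/z = z′ z* / R².
  2θR : ∀ {l} → Dlog z l → ι (+ 2) * θ Rᴷ ≃ ι (+ 7) * (Rᴷ * WU l)
  2θR {l} (dlog p) = ≈-sym (sub≈0⇒≈ (lead-cancel (ι (+ 7) * (Rᴷ * WU l) - ι (+ 2) * θ Rᴷ) R-lead (λ ()) (mod! 8 h h⁻¹ λ⁻ Rᴷ ϱ (θ h) (θ Rᴷ) (WU l)
      (λ h i m R r h′ R′ L → (R :* (# 7 :* (R :* L) :- # 2 :* R′) , 𝟘) ,
        (i :* m , # 7 :* h :* (𝟙 :+ h) :* (R :* R) :* L , h′ :* (# 2 :* (R :* r))) ∷ (:- (i :* m :* # 2 :* R) , h :* (𝟙 :+ h) :* R′ , r :* h′) ∷
        (:- (R :* (# 7 :* (R :* L) :- # 2 :* R′)) , m :* (𝟙 :+ h) , 𝟙) ∷ (:- (R :* (# 7 :* (R :* L) :- # 2 :* R′) :* m :* (𝟙 :+ h)) , i :* h , 𝟙) ∷ [])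
      (traced , θ-R , λ[1+h] , K.h⁻¹h))))
    where
    Γ : Laurent
    Γ = ι (+ 7) * h * (1# + h) * (Rᴷ * Rᴷ)
    traced : Γ * WU l ≃ θ h * (ι (+ 2) * (Rᴷ * ϱ))
    traced = begin
      Γ * WU l ≈⟨ ≈-sym (WU-* (cls₀-* (cls₀-* (cls₀-* (ι-cls (+ 7)) h-cls) (1+cls h-cls)) (cls₀-* R-cls R-cls)) l) ⟩
      WU (Γ * l) ≈⟨ V-cong 7 (U-cong (mod! 8 h Rᴷ l z z* (θ z) z~ (θ h) (λ h R l z z* z′ z~ h′ →
                                           (# 7 :* h :* (𝟙 :+ h) :* (R :* R) :* l , h′ :* (z~ :* z*)) , (:- (# 7 :* h :* (𝟙 :+ h) :* l) , z :* z* , R :* R) ∷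
                                           (:- (# 7 :* h :* (𝟙 :+ h) :* z*) , z′ , l :* z) ∷ (z* , # 7 :* h :* (𝟙 :+ h) :* z′ , h′ :* z~) ∷ [])
                                           (*-congʳ z≈ ⨾ K.zz* , p , θ-z))) ⟩
      WU (θ h * (z~ * z*)) ≈⟨ WU-* (θ-cls h-cls) (z~ * z*) ⟩
      θ h * WU (z~ * z*) ≈⟨ *-congˡ WU-trace ⟩
      θ h * (ι (+ 2) * (Rᴷ * ϱ)) ∎

-- R as an eta quotient

k₁ k₁⁻¹ : Laurent
k₁ = mon (ex −7 +0 +0 (+ 4) +0 −4 +0)
k₁⁻¹ = mon (ex (+ 7) +0 +0 −4 +0 (+ 4) +0)

dlog-e₇ : Dlog E7 (ι (+ 7) * W (- σ))
dlog-e₇ = dlog-cong (V-ℙ 7 1 1) ≈-refl (dlog-V 7 dlog-e₁)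

dlog-i₄₉ : Dlog I49 (- (ι (+ 49) * V 49 (- σ)))
dlog-i₄₉ = dlog-inv (EtaProduct.e-inv 48) (dlog-cong (V-ℙ 49 1 1) ≈-refl (dlog-V 49 dlog-e₁))

dlog-z : Dlog z (ι −2 - σ + ι (+ 49) * W (W σ))
dlog-z = dlog-cong (≈-sym (mon-def _ _ _ _ _ _ _ ⨾ ring! 3 (qᵐ −2) E1 I49 (λ q e i → q :* (e :^ 1 :* (𝟙 :* (𝟙 :* (𝟙 :* (i :^ 1 :* 𝟙))))) , q :* (e :* i))))
  (mod! 4 (ι −2) σ (V 49 (- σ)) (W (W σ)) (λ n s v w → (n :+ (:- s :+ :- (# 49 :* v)) , n :- s :+ # 49 :* w) , (:- # 49 , v , :- w) ∷ []) V49)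
  (dlog-* (dlog-q −2) (dlog-* dlog-e₁ dlog-i₄₉))
  where
  V49 : V 49 (- σ) ≃ - W (W σ)
  V49 = V-neg 49 σ ⨾ -‿cong (≈-sym (V-V 7 7 σ))

dlog-k₁ : Dlog k₁ (ι −7 - ι (+ 28) * W σ + ι (+ 196) * W (W σ))
dlog-k₁ = dlog-cong (≈-sym (mon-def _ _ _ _ _ _ _ ⨾ ring! 3 (qᵐ −7) (E7 ^ 4) (I49 ^ 4) (λ q e i → q :* (𝟙 :* (𝟙 :* (e :* (𝟙 :* (i :* 𝟙))))) , q :* (e :* i))))
  (mod! 5 (ι −7) (W (- σ)) (W σ) (V 49 (- σ)) (W (W σ)) (λ n x y v w → (n :+ (# 4 :* (# 7 :* x) :+ # 4 :* :- (# 49 :* v)) , n :- # 28 :* y :+ # 196 :* w) ,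
    (# 28 , x , :- y) ∷ (:- # 196 , v , :- w) ∷ []) (V-neg 7 σ , V-neg 49 σ ⨾ -‿cong (≈-sym (V-V 7 7 σ))))
  (dlog-* (dlog-q −7) (dlog-* (dlog-^ 4 dlog-e₇) (dlog-^ 4 dlog-i₄₉)))

-- In 2 θR = 7 R W(U l) with l = -2 - σ + 49 W(W σ), the relation `U-σ` gives U l = -2 - 8σ + 56 Wσ.
-- Multiplying its image under W by 7/2 gives the claim; the division by 2 is done at the end.
dlog-R : Dlog K.Rᴷ (ι −7 - ι (+ 28) * W σ + ι (+ 196) * W (W σ))
dlog-R = dlog (sub≈0⇒≈ (ι-cancel (+ 2) (θ K.Rᴷ - (ι −7 - ι (+ 28) * W σ + ι (+ 196) * W (W σ)) * K.Rᴷ) (λ ())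
  (mod! 5 (θ K.Rᴷ) K.Rᴷ (W σ) (W (W σ)) (W (U Λ)) (λ R′ R x y L → (# 2 :* (R′ :- (con −7 :- # 28 :* x :+ # 196 :* y) :* R) , 𝟘) ,
    (𝟙 , # 2 :* R′ , # 7 :* (R :* L)) ∷ (# 7 :* R , L , con −2 :- # 8 :* x :+ # 56 :* y) ∷ []) (Watson.2θR dlog-z , WUΛ))))
  where
  Λ : Laurent
  Λ = ι −2 - σ + ι (+ 49) * W (W σ)
  U-neg : ∀ f → U (- f) ≃ - U f
  U-neg f = U-cong (≈-sym (neg-one* f)) ⨾ U-ι* −1 f ⨾ neg-one* (U f)
  UΛ : U Λ ≃ ι −2 - ι (+ 8) * σ + ι (+ 56) * W σ
  UΛ = U-+ _ _ ⨾ +-cong (U-+ _ _ ⨾ +-cong (U-cong (≈-sym (V-ι 7 −2)) ⨾ U-cancel _) (U-neg σ ⨾ -‿cong U-σ)) (U-ι* (+ 49) _ ⨾ *-congˡ (U-cancel (W σ)))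
    ⨾ ring! 3 (ι −2) σ (W σ) (λ n x y → n :+ :- (# 8 :* x :- # 7 :* y) :+ # 49 :* y , n :- # 8 :* x :+ # 56 :* y)
  WUΛ : W (U Λ) ≃ ι −2 - ι (+ 8) * W σ + ι (+ 56) * W (W σ)
  WUΛ = V-cong 7 UΛ ⨾ V-+ 7 _ _ ⨾ +-cong (V-+ 7 _ _ ⨾ +-cong (V-ι 7 −2) (V-neg 7 _ ⨾ -‿cong (W-* _ _ ⨾ *-congʳ (V-ι 7 (+ 8))))) (W-* _ _ ⨾ *-congʳ (V-ι 7 (+ 56)))

k₁k₁⁻¹ : k₁ * k₁⁻¹ ≃ 1#
k₁k₁⁻¹ = mon-* _ _ ⨾ mon-0

e-lead : ∀ k₀ → Lead (EtaProduct.e k₀) +0 (+ 1)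
e-lead k₀ = lead-agr (agr-trans (lim-agr (ℙ-stable (suc k₀) (suc k₀)) 1) (agr-trans (agr-≈ (*-identityˡ _)) (agr-trans (one-q-agr 1 _ (Poch.pos (suc k₀) 0)) (agr-≈ (≈-sym ι-1)))))

lead-^ : ∀ {f} n → Lead f +0 (+ 1) → Lead (f ^ n) +0 (+ 1)
lead-^ zero l = lead-cong ι-1 (lead-ι (+ 1))
lead-^ (suc n) l = lead-* l (lead-^ n l)

-- Both sides have the same logarithmic derivative and leading term q⁻⁷.
R≈k₁ : R ≃ k₁
R≈k₁ = R≈ ⨾ mod! 3 K.Rᴷ k₁ k₁⁻¹ (λ R k i → (R , k) , (:- R , k :* i , 𝟙) ∷ (k , R :* i , 𝟙) ∷ [])
    (k₁k₁⁻¹ , θ-constant (K.Rᴷ * k₁⁻¹) (dlog-unique k₁k₁⁻¹ dlog-R dlog-k₁) (coeff-lead (lead-* Watson.R-lead k₁⁻¹-lead)))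
  where
  coeff-lead : ∀ {f c} → Lead f +0 c → coeff f +0 ≡ c
  coeff-lead (lead s e eq) = at-coeff e +0 ⟫ coeff-mkL +0 s 0 ⟫ eq
  k₁⁻¹-lead : Lead k₁⁻¹ (+ 7) (+ 1)
  k₁⁻¹-lead = lead-cong (≈-sym (mon-def _ _ _ _ _ _ _ ⨾ ring! 3 (qᵐ (+ 7)) (I7 ^ 4) (E49 ^ 4) (λ q e i → q :* (𝟙 :* (𝟙 :* (e :* (𝟙 :* (i :* 𝟙))))) , q :* (e :* i))))
    (lead-* (lead-q (+ 7)) (lead-* (lead-^ 4 (i-lead 6)) (lead-^ 4 (e-lead 48))))

-- The series t, u and A satisfy the relations assumed for the computation

tᵐ uᵐ wᵐ Aᵐ k₂ k₂⁻¹ : Laurent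
tᵐ = mon (ex −2 −1 (+ 1) (+ 7) −7 +0 +0)
uᵐ = mon (ex (+ 3) −3 −1 −3 (+ 7) +0 +0)
wᵐ = mon (ex −3 (+ 3) (+ 1) (+ 3) −7 +0 +0)
Aᵐ = mon (ex (+ 2) −5 (+ 2) +0 +0 (+ 5) −2)
k₂ = mon (ex −14 +0 +0 +0 (+ 4) +0 −4)
k₂⁻¹ = mon (ex (+ 14) +0 +0 +0 −4 +0 (+ 4))

W-tᵐ : W tᵐ ≃ T
W-tᵐ = mon-V7 _ _ _ _ _ ⨾ ≈-sym T≈mon

W-s : W (U s) ≃ s
W-s = ≈-sym (W-U s-cls)

W-sum : ∀ {f g x y} → W f ≃ x → W g ≃ y → W (f + g) ≃ x + y
W-sum p q = V-+ 7 _ _ ⨾ +-cong p q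

W-prod : ∀ {f g x y} → W f ≃ x → W g ≃ y → W (f * g) ≃ x * y
W-prod p q = W-* _ _ ⨾ *-cong p q

W-diff : ∀ {f g x y} → W f ≃ x → W g ≃ y → W (f - g) ≃ x - y
W-diff p q = W-sum p (V-neg 7 _ ⨾ -‿cong q)

W-κ₁ : W (U s * U s + ι (+ 2) * U s - ι (+ 7) - tᵐ) ≃ k₁
W-κ₁ = W-diff (W-diff (W-sum (W-prod W-s W-s) (W-prod (V-ι 7 (+ 2)) W-s)) (V-ι 7 (+ 7))) W-tᵐ ⨾ K.κ₁≈ ⨾ ≈-sym R≈ ⨾ R≈k₁

W-κ₂ : W (tᵐ - ι (+ 5) - U s) ≃ k₂
W-κ₂ = W-diff (W-diff W-tᵐ (V-ι 7 (+ 5))) W-s ⨾ ≈-sym V2-R≈ ⨾ V-cong 2 R≈k₁ ⨾ mon-V2 _ _ _ _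

y≈K : y ≃ K.y
y≈K = y≈ ⨾ +-congʳ (+-cong (+-cong a′≈ b′≈) c′≈) ⨾ ring! 3 (r₁ * c) (r₃ * a) (r₂ * b) (λ x y w → x :+ y :+ w :- 𝟙 , y :+ w :+ x :- 𝟙)

W-w : W wᵐ ≃ T * k₁
W-w = mon-V7 _ _ _ _ _ ⨾ ≈-sym (*-congʳ T≈mon ⨾ mon-* _ _)

setup : Setup 𝕃
setup = record
  { dissection = dissection
  ; t = tᵐ ; u = uᵐ ; w = wᵐ ; A = Aᵐ ; z⁻¹ = z⁻¹ ; κ⁻¹ = k₂⁻¹
  ; W-t = W-tᵐ
  ; uw = mon-* _ _ ⨾ mon-0
  ; t² = W-injective (W-prod W-tᵐ W-tᵐ ⨾ K.T² ⨾ ≈-sym (W-diff (W-prod (W-diff (W-sum (W-prod W-s W-s) W-s) (V-ι 7 (+ 3))) W-tᵐ) (V-ι 7 (+ 8))))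
  ; w≈ = W-injective (W-w ⨾ mod! 3 s T k₁ (λ s T k → (T :* k , (s :- # 4) :* T :+ # 8) ,
      (:- T , s :* s :+ # 2 :* s :- # 7 :- T , k) ∷ (:- 𝟙 , T :* T , (s :* s :+ s :- # 3) :* T :- # 8) ∷ [])
      (K.κ₁≈ ⨾ ≈-sym R≈ ⨾ R≈k₁ , K.T²) ⨾ ≈-sym (W-sum (W-prod (W-diff W-s (V-ι 7 (+ 4))) W-tᵐ) (V-ι 7 (+ 8))))
  ; z-inv = *-congʳ (≈-sym z≈) ⨾ mon-* _ _ ⨾ mon-0
  ; κ-inv = *-congʳ W-κ₂ ⨾ mon-* _ _ ⨾ mon-0
  ; w-eq = *-congˡ (*-cong W-κ₂ W-κ₂ ⨾ mon-* _ _) ⨾ mon-* _ _ ⨾ ≈-sym (*-cong g≈ (mon-V7 _ _ _ _ _) ⨾ mon-* _ _)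
  ; t-eq = *-cong (*-congˡ (≈-sym z≈) ⨾ mon-* _ _) (*-cong W-κ₂ W-κ₂ ⨾ mon-* _ _) ⨾ mon-* _ _
      ⨾ ≈-sym (*-cong (*-cong (≈-sym y≈K) (mon-V7 _ _ _ _ _) ⨾ mon-* _ _) W-κ₁ ⨾ mon-* _ _)
  ; A≈ = ≈-sym (*-cong (*-cong (≈-sym y≈K) (≈-sym y≈K) ⨾ mon-* _ _) z⁻⁵ ⨾ mon-* _ _)
  }
  where
  g≈ : K.g ≃ mon (ex -[1+ 9 ] (+ 3) (+ 1) +0 +0 −3 −1)
  g≈ = *-cong (≈-sym z≈) (*-cong (≈-sym z≈) (*-cong (≈-sym z≈) (≈-sym y≈K) ⨾ mon-* _ _) ⨾ mon-* _ _) ⨾ mon-* _ _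
  z⁻⁵ : z⁻¹ ^ 5 ≃ mon (ex (+ 10) −5 +0 +0 +0 (+ 5) +0)
  z⁻⁵ = *-congˡ (*-congˡ (*-congˡ (*-congˡ (*-identityʳ _) ⨾ mon-* _ _) ⨾ mon-* _ _) ⨾ mon-* _ _) ⨾ mon-* _ _

open PAdic 𝕃 setup

-- From spans to the coefficients of the statement

sumBelow : ℕ → (ℕ → Laurent) → Laurent
sumBelow zero F = 0#
sumBelow (suc n) F = F 0 + sumBelow n (λ k → F (suc k))

sumBelow-cong : ∀ n {F G} → (∀ k → F k ≃ G k) → sumBelow n F ≃ sumBelow n G
sumBelow-cong zero e = ≈-refl
sumBelow-cong (suc n) e = +-cong (e 0) (sumBelow-cong n (λ k → e (suc k)))

sumBelow-+ : ∀ n F G → sumBelow n (λ k → F k + G k) ≃ sumBelow n F + sumBelow n G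
sumBelow-+ zero F G = ≈-sym (+-identityˡ 0#)
sumBelow-+ (suc n) F G = +-congˡ (sumBelow-+ n _ _) ⨾ ring! 4 (F 0) (G 0) (sumBelow n (λ k → F (suc k))) (sumBelow n (λ k → G (suc k))) (λ a b c d → (a :+ b) :+ (c :+ d) , (a :+ c) :+ (b :+ d))

sumBelow-0 : ∀ n {F} → (∀ k → F k ≃ 0#) → sumBelow n F ≃ 0#
sumBelow-0 zero e = ≈-refl
sumBelow-0 (suc n) e = +-cong (e 0) (sumBelow-0 n (λ k → e (suc k))) ⨾ +-identityˡ 0#

sum3≈ : ∀ N F {G} → (∀ k → F (3 N.+ k) ≃ G k) → sum3 N F ≃ sumBelow (N N.∸ 2) G
sum3≈ N F {G} e = go (N N.∸ 2) (λ k → k) ⨾ sumBelow-cong (N N.∸ 2) e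
  where
  go : ∀ n g → foldr _+L_ zeroL (map (λ k → F (3 N.+ k)) (applyUpTo g n)) ≃ sumBelow n (λ k → F (3 N.+ g k))
  go zero g = reflexive 0≡zeroL
  go (suc n) g = reflexive (⊕≡+L (F (3 N.+ g 0)) (foldr _+L_ zeroL (map (λ k → F (3 N.+ k)) (applyUpTo (λ k → g (suc k)) n)))) ⨾ +-congˡ (go n (λ k → g (suc k)))

single : ℕ → ℤ → ℕ → ℤ
single zero v zero = v
single zero v (suc k) = + 0
single (suc l) v zero = + 0
single (suc l) v (suc k) = single l v k

ι0* : ∀ x (f : Laurent) → ι (x Z.* + 0) * f ≃ 0#
ι0* x f = *-congʳ (reflexive (cong ι (Z.*-zeroʳ x)) ⨾ ι-0) ⨾ zeroˡ f

ι-+* : ∀ x a b f → ι (x Z.* (a Z.+ b)) * f ≃ ι (x Z.* a) * f + ι (x Z.* b) * f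
ι-+* x a b f = *-congʳ (reflexive (cong ι (Z.*-distribˡ-+ x a b)) ⨾ ι-+ _ _) ⨾ distribʳ f _ _

sumBelow-single : ∀ n l v (x : ℕ → ℤ) (f : ℕ → Laurent) → l N.< n → sumBelow n (λ k → ι (x k Z.* single l v k) * f k) ≃ ι (x l Z.* v) * f l
sumBelow-single (suc n) zero v x f _ = +-congˡ (sumBelow-0 n (λ k → ι0* (x (suc k)) (f (suc k)))) ⨾ +-identityʳ _
sumBelow-single (suc n) (suc l) v x f (N.s≤s l<n) = +-cong (ι0* (x 0) (f 0)) (sumBelow-single n l v (λ k → x (suc k)) (λ k → f (suc k)) l<n) ⨾ +-identityˡ _

sum₈ : (x y w x′ y′ w′ y″ w″ : Laurent) → Laurent
sum₈ x y w x′ y′ w′ y″ w″ = x +L y +L w +L x′ +L y′ +L w′ +L y″ +L w″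

sum₈≈ : ∀ {x y w x′ y′ w′ y″ w″ X Y Z X′ Y′ Z′ Y″ Z″} → x ≃ X → y ≃ Y → w ≃ Z → x′ ≃ X′ → y′ ≃ Y′ → w′ ≃ Z′ → y″ ≃ Y″ → w″ ≃ Z″ →
        sum₈ x y w x′ y′ w′ y″ w″ ≃ X + Y + Z + (X′ + Y′ + Z′) + (Y″ + Z″)
sum₈≈ {x} {y} {w} {x′} {y′} {w′} {y″} {w″} {X} {Y} {Z} {X′} {Y′} {Z′} {Y″} {Z″} p₁ p₂ p₃ p₄ p₅ p₆ p₇ p₈ =
  add p₁₋₇ p₈ ⨾ ring! 8 X Y Z X′ Y′ Z′ Y″ Z″ (λ x y w x′ y′ w′ y″ w″ →
      x :+ y :+ w :+ x′ :+ y′ :+ w′ :+ y″ :+ w″ , x :+ y :+ w :+ (x′ :+ y′ :+ w′) :+ (y″ :+ w″))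
  where
  add : ∀ {f g x y} → f ≃ x → g ≃ y → f +L g ≃ x + y
  add {f} {g} p q = reflexive (⊕≡+L f g) ⨾ +-cong p q
  p₁₋₃ : x +L y +L w ≃ X + Y + Z
  p₁₋₃ = add {x +L y} (add p₁ p₂) p₃
  p₁₋₅ : x +L y +L w +L x′ +L y′ ≃ X + Y + Z + X′ + Y′
  p₁₋₅ = add {x +L y +L w +L x′} (add {x +L y +L w} p₁₋₃ p₄) p₅
  p₁₋₇ : x +L y +L w +L x′ +L y′ +L w′ +L y″ ≃ X + Y + Z + X′ + Y′ + Z′ + Y″
  p₁₋₇ = add {x +L y +L w +L x′ +L y′ +L w′} (add {x +L y +L w +L x′ +L y′} p₁₋₅ p₆) p₇

powL≈ : ∀ i → powL Defs.u i ≃ uᵐ ^ i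
powL≈ zero = reflexive 1≡oneL
powL≈ (suc i) = reflexive (⊗≡*L Defs.u (powL Defs.u i)) ⨾ *-cong u≈mon (powL≈ i)

mono : ℕ → ℕ → Laurent
mono j l = uᵐ ^ l * tᵐ ^ j

mono₀ : ∀ i → powL Defs.u i ≃ mono 0 i
mono₀ i = powL≈ i ⨾ ≈-sym (*-identityʳ _)

t¹ : Defs.t ≃ tᵐ ^ 1
t¹ = t≈mon ⨾ ≈-sym (*-identityʳ tᵐ)

mono₁ : ∀ i → powL Defs.u i *L Defs.t ≃ mono 1 i
mono₁ i = reflexive (⊗≡*L (powL Defs.u i) Defs.t) ⨾ *-cong (powL≈ i) t¹

mono₂ : ∀ i → powL Defs.u i *L Defs.t² ≃ mono 2 i
mono₂ i = reflexive (⊗≡*L (powL Defs.u i) Defs.t²) ⨾ *-cong (powL≈ i) (reflexive (⊗≡*L Defs.t Defs.t) ⨾ *-cong t≈mon t¹)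

u¹ : Defs.u ≃ mono 0 1
u¹ = u≈mon ⨾ ≈-sym (*-identityʳ _ ⨾ *-identityʳ _)

ut : Defs.u *L Defs.t ≃ mono 1 1
ut = reflexive (⊗≡*L Defs.u Defs.t) ⨾ *-cong (u≈mon ⨾ ≈-sym (*-identityʳ _)) t¹

-- wt j is the power of 7 guaranteed in the coefficients of u tʲ and u² tʲ; there is no term u t².
module Represent (k p : ℕ) (wt : ℕ → ℕ) (e : ℕ → ℕ) (N : ℕ) where

  head₁ : ℕ → ℤ
  head₁ 0 = p7 (wt 0)
  head₁ 1 = p7 (wt 1)
  head₁ _ = + 0

  part : ℕ → (ℕ → ℤ) → Laurent
  part j a = ι (head₁ j Z.* a 1) * mono j 1 + ι (p7 (wt j) Z.* a 2) * mono j 2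
    + ι (p7 p) * sumBelow (N N.∸ 2) (λ i → ι (p7 (e (3 N.+ i)) Z.* a (3 N.+ i)) * mono j (3 N.+ i))

  value : (a b c : ℕ → ℤ) → Laurent
  value a b c = part 0 a + part 1 b + part 2 c

  none : ℕ → ℤ
  none _ = + 0

  part-none : ∀ j → part j none ≃ 0#
  part-none j = +-cong (+-cong (ι0* (head₁ j) (mono j 1)) (ι0* (p7 (wt j)) (mono j 2))) (*-congˡ (sumBelow-0 (N N.∸ 2) (λ i → ι0* (p7 (e (3 N.+ i))) (mono j (3 N.+ i)))) ⨾ zeroʳ _) ⨾ ring! 0 (𝟘 :+ 𝟘 :+ 𝟘 , 𝟘)

  part-+ : ∀ j a b → part j (λ i → a i Z.+ b i) ≃ part j a + part j b
  part-+ j a b = +-cong (+-cong (ι-+* (head₁ j) (a 1) (b 1) (mono j 1)) (ι-+* (p7 (wt j)) (a 2) (b 2) (mono j 2))) (*-congˡ (sumBelow-cong (N N.∸ 2) (λ i → ι-+* (p7 (e (3 N.+ i))) (a (3 N.+ i)) (b (3 N.+ i)) (mono j (3 N.+ i))) ⨾ sumBelow-+ (N N.∸ 2) _ _))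
    ⨾ regroup _ _ _ _ (ι (p7 p)) _ _
    where
    regroup : ∀ x x′ y y′ s w w′ → x + x′ + (y + y′) + s * (w + w′) ≃ x + y + s * w + (x′ + y′ + s * w′)
    regroup x x′ y y′ s w w′ = ring! 7 x x′ y y′ s w w′ (λ x x′ y y′ s w w′ → x :+ x′ :+ (y :+ y′) :+ s :* (w :+ w′) , x :+ y :+ s :* w :+ (x′ :+ y′ :+ s :* w′))

  data Fits (n : ℕ) : ℕ → ℕ → Set where
    one : ∀ {j} → j N.≤ 1 → wt j N.≤ k N.+ n → Fits n 1 j
    two : ∀ {j} → j N.≤ 2 → wt j N.≤ k N.+ n → Fits n 2 j
    more : ∀ {i j} → j N.≤ 2 → p N.+ e (3 N.+ i) N.≤ k N.+ n → 3 N.+ i N.≤ N → Fits n (3 N.+ i) j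

  needed : ℕ → ℕ → ℕ
  needed j 1 = wt j
  needed j 2 = wt j
  needed j l = p N.+ e l

  fits-j : ∀ {n l j} → Fits n l j → j N.≤ 2
  fits-j (one q _) = N.≤-trans q (N.s≤s N.z≤n)
  fits-j (two q _) = q
  fits-j (more q _ _) = q

  fits-needed : ∀ {n l j} → Fits n l j → needed j l N.≤ k N.+ n
  fits-needed (one _ q) = q
  fits-needed (two _ q) = q
  fits-needed (more _ q _) = q

  part-single : ∀ {n l j} → Fits n l j → ∀ v → part j (single l v) ≃ ι (p7 (needed j l)) * (ι v * mono j l)
  part-single {j = j} (one q _) v = +-cong (+-cong (*-congʳ (reflexive (cong (λ h → ι (h Z.* v)) (head q)) ⨾ ι-* _ _) ⨾ *-assoc _ _ _) (ι0* (p7 (wt j)) (mono j 2)))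
      (*-congˡ (sumBelow-0 (N N.∸ 2) (λ i → ι0* (p7 (e (3 N.+ i))) (mono j (3 N.+ i)))) ⨾ zeroʳ _) ⨾ +-identityʳ _ ⨾ +-identityʳ _
    where
    head : ∀ {j} → j N.≤ 1 → head₁ j ≡ p7 (wt j)
    head N.z≤n = refl
    head (N.s≤s N.z≤n) = refl
  part-single {j = j} (two _ _) v = +-cong (+-congʳ (ι0* (head₁ j) (mono j 1)) ⨾ +-identityˡ _) (*-congˡ (sumBelow-0 (N N.∸ 2) (λ i → ι0* (p7 (e (3 N.+ i))) (mono j (3 N.+ i)))) ⨾ zeroʳ _)
    ⨾ +-identityʳ _ ⨾ *-congʳ (ι-* _ _) ⨾ *-assoc _ _ _
  part-single {j = j} (more {i} _ _ l≤N) v = +-cong (+-cong (ι0* (head₁ j) (mono j 1)) (ι0* (p7 (wt j)) (mono j 2)) ⨾ +-identityˡ _)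
      (*-congˡ (sumBelow-single (N N.∸ 2) i v (λ i → p7 (e (3 N.+ i))) (λ i → mono j (3 N.+ i)) (N.∸-monoˡ-≤ 2 l≤N) ⨾ *-congʳ (ι-* _ _)))
    ⨾ +-identityˡ _ ⨾ regroup _ _ _ _ ⨾ *-congʳ (≈-sym (7^-+ p (e (3 N.+ i))))
    where
    regroup : ∀ x y v m → x * (y * v * m) ≃ x * y * (v * m)
    regroup x y v m = ring! 4 x y v m (λ x y v m → x :* (y :* v :* m) , x :* y :* (v :* m))

  Representable : Laurent → Set
  Representable x = ∃ λ a → ∃ λ b → ∃ λ c → x ≃ value a b c

  generator : ∀ {n l j} c → Fits n l j → Representable (ι (p7 k) * (ι c * term n l j))
  generator {n} {l} {j} c fit = place (fits-j fit) (single l v) (scaled ⨾ ≈-sym (part-single fit v))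
    where
    -- The powers of 7 beyond those prescribed are absorbed into the integer coefficient.
    d : ℕ
    d = k N.+ n N.∸ needed j l
    v : ℤ
    v = p7 d Z.* c
    scaled : ι (p7 k) * (ι c * term n l j) ≃ ι (p7 (needed j l)) * (ι v * mono j l)
    scaled = begin
      ι (p7 k) * (ι c * (ι (p7 n) * mono j l)) ≈⟨ ring! 4 (ι (p7 k)) (ι c) (ι (p7 n)) (mono j l) (λ x c y m → x :* (c :* (y :* m)) , x :* y :* (c :* m)) ⟩
      ι (p7 k) * ι (p7 n) * (ι c * mono j l) ≈⟨ *-congʳ (≈-sym (7^-+ k n) ⨾ reflexive (cong (λ m → ι (p7 m)) (sym (N.m+[n∸m]≡n (fits-needed fit)))) ⨾ 7^-+ (needed j l) d) ⟩
      ι (p7 (needed j l)) * ι (p7 d) * (ι c * mono j l) ≈⟨ ring! 4 (ι (p7 (needed j l))) (ι (p7 d)) (ι c) (mono j l) (λ x y c m → x :* y :* (c :* m) , x :* (y :* c :* m)) ⟩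
      ι (p7 (needed j l)) * (ι (p7 d) * ι c * mono j l) ≈⟨ *-congˡ (*-congʳ (≈-sym (ι-* (p7 d) c))) ⟩
      ι (p7 (needed j l)) * (ι v * mono j l) ∎
    place : ∀ {j x} → j N.≤ 2 → (a : ℕ → ℤ) → x ≃ part j a → Representable x
    place N.z≤n a q = a , none , none , q ⨾ ≈-sym (+-cong (+-congˡ (part-none 1)) (part-none 2) ⨾ +-identityʳ _ ⨾ +-identityʳ _)
    place (N.s≤s N.z≤n) a q = none , a , none , q ⨾ ≈-sym (+-cong (+-congʳ (part-none 0) ⨾ +-identityˡ _) (part-none 2) ⨾ +-identityʳ _)
    place (N.s≤s (N.s≤s N.z≤n)) a q = none , none , a , q ⨾ ≈-sym (+-congʳ (+-cong (part-none 0) (part-none 1) ⨾ +-identityˡ _) ⨾ +-identityˡ _)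

  represent : ∀ {P : Shape} → (∀ {n l j} → P n l j → Fits n l j) → ∀ {x} → Span P x → Representable (ι (p7 k) * x)
  represent f (sp-0 q) = none , none , none , *-congˡ q ⨾ zeroʳ _ ⨾ ≈-sym (+-cong (+-cong (part-none 0) (part-none 1) ⨾ +-identityˡ _) (part-none 2) ⨾ +-identityˡ _)
  represent f (sp-+ X Y q) = add (represent f X) (represent f Y) (*-congˡ q ⨾ distribˡ _ _ _)
    where
    regroup : ∀ x y w x′ y′ w′ → x + x′ + (y + y′) + (w + w′) ≃ x + y + w + (x′ + y′ + w′)
    regroup x y w x′ y′ w′ = ring! 6 x y w x′ y′ w′ (λ x y w x′ y′ w′ → x :+ x′ :+ (y :+ y′) :+ (w :+ w′) , x :+ y :+ w :+ (x′ :+ y′ :+ w′))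
    add : ∀ {x y z} → Representable x → Representable y → z ≃ x + y → Representable z
    add (a , b , c , q) (a′ , b′ , c′ , q′) e = (λ i → a i Z.+ a′ i) , (λ i → b i Z.+ b′ i) , (λ i → c i Z.+ c′ i) ,
      e ⨾ +-cong q q′ ⨾ ≈-sym (+-cong (+-cong (part-+ 0 a a′) (part-+ 1 b b′)) (part-+ 2 c c′) ⨾ regroup _ _ _ _ _ _)
  represent f (sp-gen c g q) = cong-rep (*-congˡ q) (generator c (f g))
    where
    cong-rep : ∀ {x y} → x ≃ y → Representable y → Representable x
    cong-rep e (a , b , c , q) = a , b , c , e ⨾ q

  RHS : (a b c : ℕ → ℤ) → Laurent
  RHS a b c = sum₈
    (scale (p7 (wt 0) Z.* a 1) Defs.u)
    (scale (p7 (wt 0) Z.* a 2) (powL Defs.u 2))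
    (scale (p7 p) (sum3 N (λ i → scale (p7 (e i) Z.* a i) (powL Defs.u i))))
    (scale (p7 (wt 1) Z.* b 1) (Defs.u *L Defs.t))
    (scale (p7 (wt 1) Z.* b 2) (powL Defs.u 2 *L Defs.t))
    (scale (p7 p) (sum3 N (λ i → scale (p7 (e i) Z.* b i) (powL Defs.u i *L Defs.t))))
    (scale (p7 (wt 2) Z.* c 2) (powL Defs.u 2 *L Defs.t²))
    (scale (p7 p) (sum3 N (λ i → scale (p7 (e i) Z.* c i) (powL Defs.u i *L Defs.t²))))

  scale≈ : ∀ x f {g} → f ≃ g → scale x f ≃ ι x * g
  scale≈ x f q = scale≃ι x f ⨾ *-congˡ q

  tail≈ : ∀ (a : ℕ → ℤ) j (f : ℕ → Laurent) → (∀ i → f i ≃ mono j i) →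
          scale (p7 p) (sum3 N (λ i → scale (p7 (e i) Z.* a i) (f i))) ≃ ι (p7 p) * sumBelow (N N.∸ 2) (λ i → ι (p7 (e (3 N.+ i)) Z.* a (3 N.+ i)) * mono j (3 N.+ i))
  tail≈ a j f q = scale≈ (p7 p) (sum3 N (λ i → scale (p7 (e i) Z.* a i) (f i))) (sum3≈ N (λ i → scale (p7 (e i) Z.* a i) (f i)) (λ i → scale≈ (p7 (e (3 N.+ i)) Z.* a (3 N.+ i)) (f (3 N.+ i)) (q (3 N.+ i))))

  RHS≈ : ∀ a b c → RHS a b c ≃ value a b c
  RHS≈ a b c = sum₈≈ (scale≈ (p7 (wt 0) Z.* a 1) Defs.u u¹) (scale≈ (p7 (wt 0) Z.* a 2) (powL Defs.u 2) (mono₀ 2)) (tail≈ a 0 (powL Defs.u) mono₀)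
        (scale≈ (p7 (wt 1) Z.* b 1) (Defs.u *L Defs.t) ut) (scale≈ (p7 (wt 1) Z.* b 2) (powL Defs.u 2 *L Defs.t) (mono₁ 2)) (tail≈ b 1 (λ i → powL Defs.u i *L Defs.t) mono₁)
        (scale≈ (p7 (wt 2) Z.* c 2) (powL Defs.u 2 *L Defs.t²) (mono₂ 2)) (tail≈ c 2 (λ i → powL Defs.u i *L Defs.t²) mono₂)
      -- Inserts the zero term at ut², which `value` lists and the statement omits.
      ⨾ +-congˡ (+-congʳ (≈-sym (+-identityˡ _) ⨾ +-congʳ (≈-sym (*-congʳ ι-0 ⨾ zeroˡ _))))

order⇒positive : ∀ {D s n j} → F 3 D s n 0 j → ⊥
order⇒positive {j = j} f = absurd (N.≤-trans (N.m≤n+m 3 (2 N.* j)) (ord f))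
  where
  absurd : 3 N.≤ 2 → ⊥
  absurd (N.s≤s (N.s≤s ()))

-- The function ut² has order -1 at infinity, which the shape excludes.
order⇒j≤1 : ∀ {D s n j} → F 3 D s n 1 j → j N.≤ 1
order⇒j≤1 {j = j} f = N.*-cancelˡ-≤ 2 (N.+-cancelʳ-≤ 3 (2 N.* j) 2 (ord f))

pow⇒< : ∀ {D n i j} → G D n (3 N.+ i) j → suc i N.≤ n
pow⇒< {n = n} {i} f = N.+-cancelʳ-≤ 2 (suc i) n (subst (N._≤ n N.+ 2) (N.+-comm 2 (suc i)) (pow f))

/26-≤ : ∀ m n → m N.< suc n N.* 26 → m N./ 26 N.≤ n
/26-≤ m n l = N.≤-pred (ℕ÷.m<n*o⇒m/o<n l)

-- The shape gives 7 the exponent l - 2 at uˡ; one factor 7 belongs to the prefactor 7^(α+1), so l -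
-- 3 remains, and the slope 7/26 is below 1.
e1-bound : ∀ i → Defs.e1 (3 N.+ i) N.≤ i
e1-bound i = /26-≤ _ i (N.≤-trans (N.s≤s (N.+-monoˡ-≤ 25 numerator)) (N.≤-trans (N.≤-reflexive (rearrange i)) (N.+-monoʳ-≤ 26 (N.*-monoʳ-≤ i (N.m≤m+n 7 19)))))
  where
  numerator : 7 N.* (3 N.+ i) N.∸ 24 N.≤ 7 N.* i
  numerator = N.≤-trans (N.∸-monoˡ-≤ 24 (N.≤-trans (N.≤-reflexive (N.*-distribˡ-+ 7 3 i)) (N.+-monoˡ-≤ (7 N.* i) (N.m≤m+n 21 3)))) (N.≤-reflexive (N.m+n∸m≡n 24 (7 N.* i)))
  rearrange : ∀ i → suc (7 N.* i N.+ 25) ≡ 26 N.+ i N.* 7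
  rearrange = solveℕ 1 (λ i → con' 1 +' (con' 7 *' i +' con' 25) =' con' 26 +' i *' con' 7) refl

-- At even index the prefactor 7^(α+1) is already split off, so the full exponent l - 2 is
-- available; for l = 3 both sides equal 1.
e2-bound : ∀ i → Defs.e2 (3 N.+ i) N.≤ suc i
e2-bound i = /26-≤ _ (suc i) (N.≤-trans (N.≤-reflexive (rearrange i)) (N.+-mono-≤ (N.m≤m+n 50 2) (N.*-monoʳ-≤ i (N.m≤m+n 7 19))))
  where
  rearrange : ∀ i → suc (7 N.* (3 N.+ i) N.+ 3 N.+ 25) ≡ 50 N.+ i N.* 7
  rearrange = solveℕ 1 (λ i → con' 1 +' (con' 7 *' (con' 3 +' i) +' con' 3 +' con' 25) =' con' 50 +' i *' con' 7) refl

oddWeight : ℕ → ℕ → ℕ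
oddWeight α zero = suc α
oddWeight α (suc _) = α

module Odd (α : ℕ) where
  open Represent α (suc α) (oddWeight α) Defs.e1 (Defs.N1 α) public

  fits : ∀ {n l j} → O (Defs.N1 α) n l j → Fits n l j
  fits {l = 0} (f , _) = ⊥-elim (order⇒positive f)
  fits {n} {l = 1} {j} (f , small) = one (order⇒j≤1 f) (head j (λ e → small e (N.s≤s N.z≤n)))
    where
    head : ∀ j → (j ≡ 0 → 1 N.≤ n) → oddWeight α j N.≤ α N.+ n
    head zero q = subst (N._≤ α N.+ n) (N.+-comm α 1) (N.+-monoʳ-≤ α (q refl))
    head (suc j) q = N.m≤m+n α n
  fits {n} {l = 2} {j} (f , small) = two (j≤2 f) (head j (λ e → small e N.≤-refl))
    where
    head : ∀ j → (j ≡ 0 → 1 N.≤ n) → oddWeight α j N.≤ α N.+ n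
    head zero q = subst (N._≤ α N.+ n) (N.+-comm α 1) (N.+-monoʳ-≤ α (q refl))
    head (suc j) q = N.m≤m+n α n
  fits {n} {l = suc (suc (suc i))} (f , _) = more (j≤2 f) (subst (N._≤ α N.+ n) (N.+-suc α (Defs.e1 (3 N.+ i))) (N.+-monoʳ-≤ α (N.≤-trans (N.s≤s (e1-bound i)) (pow⇒< f)))) (deg f)

module Even (α : ℕ) where
  open Represent (suc α) (suc α) (λ _ → suc α) Defs.e2 (Defs.N2 α) public

  fits : ∀ {n l j} → G (Defs.N2 α) n l j → Fits n l j
  fits {l = 0} f = ⊥-elim (order⇒positive f)
  fits {n} {l = 1} f = one (order⇒j≤1 f) (N.m≤m+n (suc α) n)
  fits {n} {l = 2} f = two (j≤2 f) (N.m≤m+n (suc α) n)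
  fits {n} {l = suc (suc (suc i))} f = more (j≤2 f) (N.+-monoʳ-≤ (suc α) (N.≤-trans (e2-bound i) (pow⇒< f))) (deg f)

-- d m is the degree (7²ᵐ⁺² − 1)/6 in u of L₂ₘ₊₁.
d : ℕ → ℕ
d zero = 8
d (suc m) = 7 N.* (7 N.* d m) N.+ 8

d-pow : ∀ m → 7 N.^ (2 N.* suc m) ≡ suc (d m N.* 6)
d-pow zero = refl
d-pow (suc m) = cong (7 N.^_) (N.*-suc 2 (suc m)) ⟫ cong (λ x → 7 N.* (7 N.* x)) (d-pow m)
  ⟫ solveℕ 1 (λ d → con' 7 *' (con' 7 *' (con' 1 +' d *' con' 6)) =' con' 1 +' (con' 7 *' (con' 7 *' d) +' con' 8) *' con' 6) refl (d m)

N1≡d : ∀ m → Defs.N1 (suc m) ≡ d m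
N1≡d m = cong (λ x → (x N.∸ 1) N./ 6) (d-pow m) ⟫ ℕ÷.m*n/n≡m (d m) 6

N2≡7d : ∀ m → Defs.N2 (suc m) ≡ 7 N.* d m
N2≡7d m = cong (λ x → (x N.∸ 7) N./ 6) exponent ⟫ cong (N._/ 6) (N.m+n∸m≡n 7 (7 N.* d m N.* 6)) ⟫ ℕ÷.m*n/n≡m (7 N.* d m) 6
  where
  exponent : 7 N.^ (2 N.* suc m N.+ 1) ≡ 7 N.+ 7 N.* d m N.* 6
  exponent = cong (7 N.^_) (N.+-comm (2 N.* suc m) 1) ⟫ cong (7 N.*_) (d-pow m)
    ⟫ solveℕ 1 (λ d → con' 7 *' (con' 1 +' d *' con' 6) =' con' 7 +' con' 7 *' d *' con' 6) refl (d m)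

8≤d : ∀ m → 8 N.≤ d m
8≤d zero = N.≤-refl
8≤d (suc m) = N.m≤n+m 8 _

even-double : ∀ m → isEven (2 N.* m) ≡ true
even-double zero = refl
even-double (suc m) = cong isEven (N.*-suc 2 m) ⟫ cong (λ b → not (not b)) (even-double m)

U≈U7 : ∀ f {g} → f ≃ g → U7 f ≃ U g
U≈U7 f e = reflexive (U≡U7 f) ⨾ U-cong e

L-odd : ∀ m → Defs.L (suc (2 N.* m)) ≃ U (Aᵐ * Defs.L (2 N.* m))
L-odd m = reflexive (cong (λ b → if b then U7 (Defs.A *L Defs.L (2 N.* m)) else U7 (Defs.L (2 N.* m))) (even-double m))
  ⨾ U≈U7 (Defs.A *L Defs.L (2 N.* m)) (reflexive (⊗≡*L Defs.A (Defs.L (2 N.* m))) ⨾ *-congʳ A≈mon)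

L-even : ∀ m → Defs.L (2 N.* suc m) ≃ U (Defs.L (suc (2 N.* m)))
L-even m = reflexive (cong Defs.L (N.*-suc 2 m) ⟫ cong (λ b → if not b then U7 (Defs.A *L Defs.L (suc (2 N.* m))) else U7 (Defs.L (suc (2 N.* m)))) (even-double m))
  ⨾ U≈U7 (Defs.L (suc (2 N.* m))) ≈-refl

-- Induction on the index

-- Here α = m + 1. A factor 7 is gained only in passing from odd to even index; the step x ↦ U(A x)
-- instead restores the shape `O` on which that gain depends.
OddSpan EvenSpan : ℕ → Set
OddSpan m = ∃ λ x → (Defs.L (suc (2 N.* m)) ≃ 7^ (suc m) * x) × Span (O (d m)) x
EvenSpan m = ∃ λ x → (Defs.L (2 N.* suc m) ≃ 7^ (suc (suc m)) * x) × Span (G (7 N.* d m)) x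

7^-suc : ∀ m x → 7^ (suc m) * x ≃ 7^ m * (ι (+ 7) * x)
7^-suc m x = *-congʳ (reflexive (cong 7^ (N.+-comm 1 m)) ⨾ 7^-+ m 1) ⨾ *-assoc _ _ _

odd⇒even : ∀ m → OddSpan m → EvenSpan m
odd⇒even m (x , e , X) = go (stepT (d m) (N.≤-trans (N.m≤m+n 3 5) (8≤d m)) X)
  where
  go : (∃ λ y → (U x ≃ ι (+ 7) * y) × Span (G (7 N.* d m)) y) → EvenSpan m
  go (y , e′ , Y) = y , L-even m ⨾ U-cong e ⨾ U-ι* _ x ⨾ *-congˡ e′ ⨾ ≈-sym (7^-suc (suc m) y) , Y

even⇒odd : ∀ m → EvenSpan m → OddSpan (suc m)
even⇒odd m (x , e , X) = U (Aᵐ * x) , L-odd (suc m) ⨾ U-cong (*-congˡ e ⨾ swap Aᵐ (7^ (suc (suc m))) x) ⨾ U-ι* _ (Aᵐ * x)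
    , stepA (7 N.* d m) (N.≤-trans (N.m≤m+n 2 6) (N.≤-trans (8≤d m) (N.m≤m+n (d m) _))) X
  where
  swap : ∀ x y w → x * (y * w) ≃ y * (x * w)
  swap x y w = ring! 3 x y w (λ x y w → x :* (y :* w) , y :* (x :* w))

first : OddSpan 0
first = go (Up-extract UA-1)
  where
  go : (∃ λ y → (U Aᵐ ≃ ι (+ 7) * y) × Span (O 8) y) → OddSpan 0
  go (y , e , Y) = y , L-odd 0 ⨾ U-cong (*-congˡ (reflexive 1≡oneL) ⨾ *-identityʳ Aᵐ) ⨾ e , Y

odd-span : ∀ m → OddSpan m
odd-span zero = first
odd-span (suc m) = even⇒odd m (odd⇒even m (odd-span m))

odd-RHS : ∀ m → ∃ λ a → ∃ λ b → ∃ λ c → Defs.L (suc (2 N.* m)) ≃ Odd.RHS (suc m) a b c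
odd-RHS m = go (odd-span m)
  where
  open Odd (suc m)
  go : OddSpan m → ∃ λ a → ∃ λ b → ∃ λ c → Defs.L (suc (2 N.* m)) ≃ RHS a b c
  go (x , e , X) = conclude (represent fits (subst (λ D → Span (O D) x) (sym (N1≡d m)) X))
    where
    conclude : Representable (7^ (suc m) * x) → ∃ λ a → ∃ λ b → ∃ λ c → Defs.L (suc (2 N.* m)) ≃ RHS a b c
    conclude (a , b , c , q) = a , b , c , e ⨾ q ⨾ ≈-sym (RHS≈ a b c)

even-RHS : ∀ m → ∃ λ a → ∃ λ b → ∃ λ c → Defs.L (2 N.* suc m) ≃ Even.RHS (suc m) a b c
even-RHS m = go (odd⇒even m (odd-span m))
  where
  open Even (suc m)
  go : EvenSpan m → ∃ λ a → ∃ λ b → ∃ λ c → Defs.L (2 N.* suc m) ≃ RHS a b c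
  go (x , e , X) = conclude (represent fits (subst (λ D → Span (G D) x) (sym (N2≡7d m)) X))
    where
    conclude : Representable (7^ (suc (suc m)) * x) → ∃ λ a → ∃ λ b → ∃ λ c → Defs.L (2 N.* suc m) ≃ RHS a b c
    conclude (a , b , c , q) = a , b , c , e ⨾ q ⨾ ≈-sym (RHS≈ a b c)

theorem4p1 : (α : ℕ) → 1 N.≤ α →
  (∃ λ (a : ℕ → ℤ) → ∃ λ (b : ℕ → ℤ) → ∃ λ (c : ℕ → ℤ) →
     Defs.L (2 N.* α N.∸ 1) ≈ Defs.RHSodd α a b c)
  × (∃ λ (a : ℕ → ℤ) → ∃ λ (b : ℕ → ℤ) → ∃ λ (c : ℕ → ℤ) →
     Defs.L (2 N.* α) ≈ Defs.RHSeven α a b c)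
theorem4p1 (suc m) _ = odd (odd-RHS m) , even (even-RHS m)
  where
  odd : (∃ λ a → ∃ λ b → ∃ λ c → Defs.L (suc (2 N.* m)) ≃ Odd.RHS (suc m) a b c) → _
  odd (a , b , c , q) = a , b , c , subst (λ n → Defs.L n ≈ Defs.RHSodd (suc m) a b c) (sym (cong N.pred (N.*-suc 2 m))) (at-coeff q)
  even : (∃ λ a → ∃ λ b → ∃ λ c → Defs.L (2 N.* suc m) ≃ Even.RHS (suc m) a b c) → _
  even (a , b , c , q) = a , b , c , at-coeff q
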